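{- There exists $C>0$ such that, for every $n$, if $c$ is a $\widehat c$-free $2$-colouring of the points of $M\cong\mathrm{PG}(n-1,2)$, then $M$ has a monochromatic flat (subspace) of rank (dimension) at least $Cn^{1/7}$.
   Context: Points of $\mathrm{PG}(n-1,2)$ are identified with nonzero vectors of $\mathbb F_2^n$; flats/subspaces are the nonzero vectors of linear subspaces, with rank equal to the linear dimension. $\widehat c$ is a $2$-colouring (colours $1,2$) of the seven points of $\mathrm{PG}(2,2)$ in which the set of points of colour $1$ is a three-element linearly independent set (a basis of $\mathbb F_2^3$). A colouring $c$ of $\mathrm{PG}(n-1,2)$ contains $\widehat c$ if there is an injective linear map $\psi:\mathbb F_2^3\to\mathbb F_2^n$ with $c(\psi(x))=\widehat c(x)$ for all nonzero $x\in\mathbb F_2^3$; $c$ is $\widehat c$-free otherwise. -}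

module Defs where

open import Data.Bool using (Bool; true; false; _xor_; if_then_else_)
open import Data.Nat using (ℕ; zero; suc; _*_; _^_; _≤_)
open import Data.Fin using (Fin; zero; suc)
open import Data.Vec using (Vec; []; _∷_; zipWith; replicate)
open import Data.Product using (Σ; ∃; _×_)
open import Relation.Binary.PropositionalEquality using (_≡_; _≢_)
open import Relation.Nullary using (¬_)
open import Function using (_∘_; _⇔_)
open import Function.Definitions using (Injective)

𝔽₂^ : ℕ → Set
𝔽₂^ n = Vec Bool n

0v : ∀ {n} → 𝔽₂^ n
0v = replicate _ false

_⊕_ : ∀ {n} → 𝔽₂^ n → 𝔽₂^ n → 𝔽₂^ n
_⊕_ = zipWith _xor_

-- A point of PG(n-1,2): a nonzero vector.
NonZeroV : ∀ {n} → 𝔽₂^ n → Set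
NonZeroV x = x ≢ 0v

-- The linear map F_2^k → F_2^n with columns v 0, …, v (k-1):
-- lin v x = Σ_i x_i v_i.  Every linear map F_2^k → F_2^n is of this form.
lin : ∀ {k n} → (Fin k → 𝔽₂^ n) → 𝔽₂^ k → 𝔽₂^ n
lin {zero}  v []      = 0v
lin {suc k} v (b ∷ x) = (if b then v zero else 0v) ⊕ lin (v ∘ suc) x

InjLin : ∀ {k n} → (Fin k → 𝔽₂^ n) → Set
InjLin v = Injective _≡_ _≡_ (lin v)

-- 2-colourings; colours 1,2 are represented by Fin 2 (zero = colour 1,
-- suc zero = colour 2).  The value at the zero vector is irrelevant
-- (never consulted).
Colouring : ℕ → Set
Colouring n = 𝔽₂^ n → Fin 2

IsBasisColouring : Colouring 3 → Set
IsBasisColouring ĉ =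
  Σ (Fin 3 → 𝔽₂^ 3) λ b → InjLin b ×
    (∀ x → NonZeroV x → (ĉ x ≡ zero ⇔ ∃ λ i → x ≡ b i))

Contains : ∀ {n} → Colouring n → Colouring 3 → Set
Contains {n} c ĉ =
  Σ (Fin 3 → 𝔽₂^ n) λ ψ → InjLin ψ × (∀ x → NonZeroV x → c (lin ψ x) ≡ ĉ x)

HasMonoFlat : ∀ {n} → Colouring n → ℕ → Set
HasMonoFlat {n} c k =
  Σ (Fin k → 𝔽₂^ n) λ v → InjLin v × ∃ λ col → ∀ x → NonZeroV x → c (lin v x) ≡ col

module Submission where

{-
Let A be the set of points of colour 1; it is claw-free, and B is its complement.

Triangle-free case (after Hunter and Pohoata).  If B contains no line and every
subspace of dimension t meets B, then B has density at least 2^-t in every large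
subspace.  For a dense slice A' of B on a coset of a subspace V, the sums A' + A'
miss the dense set B ∩ V.  Positive definiteness of the autocorrelation turns this
into a large moment of the number of representations (Kelley–Meka), sifting gives
a set C of density 2^-O(t²) whose sums are mostly popular, almost periodicity of
popularity under C together with Chang's theorem gives a subspace of codimension
O(t⁶) on a coset of which A' is denser by a factor 9/8.  This can happen only O(t)
times, so the dimension is O(t⁷).

General case.  Let U be a maximal flat in B.  For x outside U the fibre of A over
the coset x + U is a coset of a subspace stab x of U, and claw-freeness together
with maximality of U strongly restricts the three stabilisers on a line.  Filtering
the space by the size of stab x gives layers; each layer contains, up to O(t²)
dimensions, a lift on which B is triangle-free, hence a flat of A.  The flats of
layers two apart can be added, and the seventh powers of their dimensions then sum
up without loss.
-}

open import Defs
open import Data.Bool using (Bool; true; false; _∧_; not; _xor_; if_then_else_)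
import Data.Bool.Properties as 𝔹ₚ
open import Data.Empty using (⊥; ⊥-elim)
open import Data.Fin using (Fin; zero; suc)
open import Data.Integer using (ℤ; 0ℤ; 1ℤ; -1ℤ) renaming (+_ to pos; _+_ to _+ᶻ_; _*_ to _*ᶻ_; _-_ to _-ᶻ_; -_ to -ᶻ_; _≤_ to _≤ᶻ_; ∣_∣ to absᶻ)
import Data.Integer as ℤ
import Data.Integer.Properties as ℤₚ
import Data.Integer.Tactic.RingSolver as ℤ-Solver
open import Data.List using (List; []; _∷_; _++_; concat)
import Data.List as List
open import Data.Nat using (ℕ; zero; suc; _+_; _*_; _∸_; _^_; _≤_; _<_; _≤ᵇ_; z≤n; s≤s; >-nonZero; _⊔_)
open import Data.Nat.Properties hiding (_≟_)
open import Data.Nat.Tactic.RingSolver using (solve-∀)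
open import Data.Product using (Σ; ∃; _×_; _,_; proj₁; proj₂)
open import Data.Sum using (_⊎_; inj₁; inj₂)
open import Data.Vec using (Vec; []; _∷_; map; lookup; head; tail)
import Data.Vec as Vec
import Data.Vec.Properties as Vecₚ
open import Function using (_∘_; id; Equivalence)
open import Relation.Binary.PropositionalEquality using (_≡_; _≢_; refl; sym; trans; cong; cong₂; subst; subst₂; module ≡-Reasoning)
open import Relation.Nullary using (¬_; Dec; yes; no; contradiction)
open import Relation.Nullary.Decidable using (¬?; decidable-stable; map′; _×-dec_; _→-dec_; _⊎-dec_; ⌊_⌋)
open import Algebra.Properties.CommutativeSemigroup *-commutativeSemigroup using () renaming (x∙yz≈y∙xz to *-swap)
open import Algebra.Structures using (IsCommutativeSemiring)

-- Vectors over 𝔽₂ and finite sums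

-- Why the seventh power. The sifted set has density 2^-8T². Its popularity must survive about T
-- smoothing steps, so sample frequencies need accuracy of order 1/T, hence blocks of order T²
-- samples; making exceptional points rarer than the sifted set takes about T² blocks. Each of these
-- T⁴ samples costs a factor 2^-8T², so the periods have density 2^-O(T⁶), and Chang's theorem turns
-- the exponent into a codimension.
--
-- The obstacle in the general case is that the points with small stabiliser do not form a subspace.
-- A sum, however, can at most double the stabiliser, so subspaces fit between consecutive dyadic
-- levels of size. There are a + 1 levels, with a the dimension of U, and each loses O(a²)
-- dimensions because U has only 2^O(a²) subspaces. The total loss O(a³) is harmless, as U is itself
-- monochromatic.
--
-- Densities appear throughout as inequalities between integers with all denominators multiplied
-- out.

private
  variable
    m n k e : ℕ

⊕-assoc : (x y z : 𝔽₂^ n) → (x ⊕ y) ⊕ z ≡ x ⊕ (y ⊕ z)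
⊕-assoc = Vecₚ.zipWith-assoc 𝔹ₚ.xor-assoc

⊕-comm : (x y : 𝔽₂^ n) → x ⊕ y ≡ y ⊕ x
⊕-comm = Vecₚ.zipWith-comm 𝔹ₚ.xor-comm

⊕-identityˡ : (x : 𝔽₂^ n) → 0v ⊕ x ≡ x
⊕-identityˡ = Vecₚ.zipWith-identityˡ 𝔹ₚ.xor-identityˡ

⊕-identityʳ : (x : 𝔽₂^ n) → x ⊕ 0v ≡ x
⊕-identityʳ x = trans (⊕-comm x 0v) (⊕-identityˡ x)

⊕-self : (x : 𝔽₂^ n) → x ⊕ x ≡ 0v
⊕-self []      = refl
⊕-self (b ∷ x) = cong₂ _∷_ (𝔹ₚ.xor-same b) (⊕-self x)

⊕-interchange : (a b c d : 𝔽₂^ n) → (a ⊕ b) ⊕ (c ⊕ d) ≡ (a ⊕ c) ⊕ (b ⊕ d)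
⊕-interchange a b c d = begin
  (a ⊕ b) ⊕ (c ⊕ d)  ≡⟨ ⊕-assoc a b (c ⊕ d) ⟩
  a ⊕ (b ⊕ (c ⊕ d))  ≡⟨ cong (a ⊕_) (⊕-assoc b c d) ⟨
  a ⊕ ((b ⊕ c) ⊕ d)  ≡⟨ cong (λ t → a ⊕ (t ⊕ d)) (⊕-comm b c) ⟩
  a ⊕ ((c ⊕ b) ⊕ d)  ≡⟨ cong (a ⊕_) (⊕-assoc c b d) ⟩
  a ⊕ (c ⊕ (b ⊕ d))  ≡⟨ ⊕-assoc a c (b ⊕ d) ⟨
  (a ⊕ c) ⊕ (b ⊕ d)  ∎
  where open ≡-Reasoning

_·ᵥ_ : Bool → 𝔽₂^ n → 𝔽₂^ n
b ·ᵥ x = if b then x else 0v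

·ᵥ-xor : ∀ b c (x : 𝔽₂^ n) → (b xor c) ·ᵥ x ≡ (b ·ᵥ x) ⊕ (c ·ᵥ x)
·ᵥ-xor true  true  x = sym (⊕-self x)
·ᵥ-xor true  false x = sym (⊕-identityʳ x)
·ᵥ-xor false c     x = sym (⊕-identityˡ _)

lin-⊕ : (v : Fin k → 𝔽₂^ n) (x y : 𝔽₂^ k) → lin v (x ⊕ y) ≡ lin v x ⊕ lin v y
lin-⊕ v []      []      = sym (⊕-identityˡ 0v)
lin-⊕ v (b ∷ x) (c ∷ y) =
  trans (cong₂ _⊕_ (·ᵥ-xor b c (v zero)) (lin-⊕ (v ∘ suc) x y))
        (⊕-interchange (b ·ᵥ v zero) (c ·ᵥ v zero) (lin (v ∘ suc) x) (lin (v ∘ suc) y))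

lin-0v : (v : Fin k → 𝔽₂^ n) → lin v 0v ≡ 0v
lin-0v {zero}  v = refl
lin-0v {suc k} v = trans (⊕-identityˡ _) (lin-0v (v ∘ suc))

unit : Fin k → 𝔽₂^ k
unit zero    = true ∷ 0v
unit (suc i) = false ∷ unit i

lin-unit : (v : Fin k → 𝔽₂^ n) (i : Fin k) → lin v (unit i) ≡ v i
lin-unit v zero    = trans (cong (v zero ⊕_) (lin-0v (v ∘ suc))) (⊕-identityʳ (v zero))
lin-unit v (suc i) = trans (⊕-identityˡ _) (lin-unit (v ∘ suc) i)

-- A solver for identities in elementary abelian 2-groups: an expression is
-- normalised to the vector of parities of its variables.
infixl 6 _⊹_
data Expr (k : ℕ) : Set where
  ‵_  : Fin k → Expr k
  ‵0  : Expr k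
  _⊹_ : Expr k → Expr k → Expr k

⟦_⟧ₑ : Expr k → Vec (𝔽₂^ n) k → 𝔽₂^ n
⟦ ‵ i ⟧ₑ   ρ = lookup ρ i
⟦ ‵0 ⟧ₑ    ρ = 0v
⟦ e ⊹ f ⟧ₑ ρ = ⟦ e ⟧ₑ ρ ⊕ ⟦ f ⟧ₑ ρ

parities : Expr k → 𝔽₂^ k
parities (‵ i)   = unit i
parities ‵0      = 0v
parities (e ⊹ f) = parities e ⊕ parities f

parities-sound : (e : Expr k) (ρ : Vec (𝔽₂^ n) k) → ⟦ e ⟧ₑ ρ ≡ lin (lookup ρ) (parities e)
parities-sound (‵ i)   ρ = sym (lin-unit (lookup ρ) i)
parities-sound ‵0      ρ = sym (lin-0v (lookup ρ))
parities-sound (e ⊹ f) ρ =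
  trans (cong₂ _⊕_ (parities-sound e ρ) (parities-sound f ρ))
        (sym (lin-⊕ (lookup ρ) (parities e) (parities f)))

⊕-solve : (ρ : Vec (𝔽₂^ n) k) (e f : Expr k) → parities e ≡ parities f → ⟦ e ⟧ₑ ρ ≡ ⟦ f ⟧ₑ ρ
⊕-solve ρ e f eq =
  trans (parities-sound e ρ) (trans (cong (lin (lookup ρ)) eq) (sym (parities-sound f ρ)))

pattern 𝕩₀ = ‵ zero
pattern 𝕩₁ = ‵ suc zero
pattern 𝕩₂ = ‵ suc (suc zero)
pattern 𝕩₃ = ‵ suc (suc (suc zero))
pattern 𝕩₄ = ‵ suc (suc (suc (suc zero)))
pattern 𝕩₅ = ‵ suc (suc (suc (suc (suc zero))))

⊕-cancelˡ : (x y : 𝔽₂^ n) → x ⊕ (x ⊕ y) ≡ y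
⊕-cancelˡ x y = ⊕-solve (x ∷ y ∷ []) (𝕩₀ ⊹ (𝕩₀ ⊹ 𝕩₁)) 𝕩₁ refl

⊕-cancelʳ : (x y : 𝔽₂^ n) → (x ⊕ y) ⊕ y ≡ x
⊕-cancelʳ x y = ⊕-solve (x ∷ y ∷ []) (𝕩₀ ⊹ 𝕩₁ ⊹ 𝕩₁) 𝕩₀ refl

⊕≡0⇒≡ : {x y : 𝔽₂^ n} → x ⊕ y ≡ 0v → x ≡ y
⊕≡0⇒≡ {x = x} {y} eq =
  trans (sym (⊕-cancelʳ x y)) (trans (cong (_⊕ y) eq) (⊕-identityˡ y))

_≟ᵥ_ : (x y : 𝔽₂^ n) → Dec (x ≡ y)
_≟ᵥ_ = Vecₚ.≡-dec 𝔹ₚ._≟_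

-- Stated over a commutative semiring because counts live in ℕ, where inequalities are simplest,
-- while characters need the signs of ℤ.
module Summation {R : Set} (_+ᴿ_ _*ᴿ_ : R → R → R) (0ᴿ 1ᴿ : R)
  (isCS : IsCommutativeSemiring _≡_ _+ᴿ_ _*ᴿ_ 0ᴿ 1ᴿ) where

  private
    module R = IsCommutativeSemiring isCS
    variable
      X Y : Set
    +-interchange : ∀ a b c d → (a +ᴿ b) +ᴿ (c +ᴿ d) ≡ (a +ᴿ c) +ᴿ (b +ᴿ d)
    +-interchange a b c d =
      trans (R.+-assoc a b (c +ᴿ d))
        (trans (cong (a +ᴿ_) (trans (sym (R.+-assoc b c d))
          (trans (cong (_+ᴿ d) (R.+-comm b c)) (R.+-assoc c b d))))
          (sym (R.+-assoc a c (b +ᴿ d))))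

  sum : List X → (X → R) → R
  sum []       f = 0ᴿ
  sum (x ∷ xs) f = f x +ᴿ sum xs f

  sum-cong : (xs : List X) {f g : X → R} → (∀ x → f x ≡ g x) → sum xs f ≡ sum xs g
  sum-cong []       eq = refl
  sum-cong (x ∷ xs) eq = cong₂ _+ᴿ_ (eq x) (sum-cong xs eq)

  sum-zero : (xs : List X) → sum xs (λ _ → 0ᴿ) ≡ 0ᴿ
  sum-zero []       = refl
  sum-zero (x ∷ xs) = trans (R.+-identityˡ _) (sum-zero xs)

  sum-+ : (xs : List X) (f g : X → R) → sum xs (λ x → f x +ᴿ g x) ≡ sum xs f +ᴿ sum xs g
  sum-+ []       f g = sym (R.+-identityˡ 0ᴿ)
  sum-+ (x ∷ xs) f g =
    trans (cong ((f x +ᴿ g x) +ᴿ_) (sum-+ xs f g)) (+-interchange (f x) (g x) _ _)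

  sum-*ˡ : (xs : List X) (c : R) (f : X → R) → sum xs (λ x → c *ᴿ f x) ≡ c *ᴿ sum xs f
  sum-*ˡ []       c f = sym (R.zeroʳ c)
  sum-*ˡ (x ∷ xs) c f = trans (cong ((c *ᴿ f x) +ᴿ_) (sum-*ˡ xs c f)) (sym (R.distribˡ c (f x) _))

  sum-*ʳ : (xs : List X) (c : R) (f : X → R) → sum xs (λ x → f x *ᴿ c) ≡ sum xs f *ᴿ c
  sum-*ʳ xs c f =
    trans (sum-cong xs (λ x → R.*-comm (f x) c)) (trans (sum-*ˡ xs c f) (R.*-comm c _))

  sum-swap : (xs : List X) (ys : List Y) (f : X → Y → R) →
    sum xs (λ x → sum ys (f x)) ≡ sum ys (λ y → sum xs (λ x → f x y))
  sum-swap []       ys f = sym (sum-zero ys)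
  sum-swap (x ∷ xs) ys f =
    trans (cong (sum ys (f x) +ᴿ_) (sum-swap xs ys f))
          (sym (sum-+ ys (f x) (λ y → sum xs (λ x′ → f x′ y))))

  sum-++ : (xs ys : List X) (f : X → R) → sum (xs ++ ys) f ≡ sum xs f +ᴿ sum ys f
  sum-++ []       ys f = sym (R.+-identityˡ _)
  sum-++ (x ∷ xs) ys f = trans (cong (f x +ᴿ_) (sum-++ xs ys f)) (sym (R.+-assoc (f x) _ _))

  sum-map : (h : X → Y) (xs : List X) (f : Y → R) → sum (List.map h xs) f ≡ sum xs (f ∘ h)
  sum-map h []       f = refl
  sum-map h (x ∷ xs) f = cong (f (h x) +ᴿ_) (sum-map h xs f)

  sum-concat : (h : X → List Y) (xs : List X) (f : Y → R) →
    sum (concat (List.map h xs)) f ≡ sum xs (λ x → sum (h x) f)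
  sum-concat h []       f = refl
  sum-concat h (x ∷ xs) f = trans (sum-++ (h x) _ f) (cong (sum (h x) f +ᴿ_) (sum-concat h xs f))

  pow : R → ℕ → R
  pow a zero    = 1ᴿ
  pow a (suc n) = a *ᴿ pow a n

  prod : (X → R) → Vec X n → R
  prod f []       = 1ᴿ
  prod f (x ∷ xs) = f x *ᴿ prod f xs

-- Tuples over bits are the vector space itself; tuples of vectors, and tuples of such tuples, are
-- the probability spaces of the sampling arguments.
vecs : {X : Set} → List X → (n : ℕ) → List (Vec X n)
vecs xs zero    = [] ∷ []
vecs xs (suc n) = concat (List.map (λ x → List.map (x ∷_) (vecs xs n)) xs)

𝔾 : (n : ℕ) → List (𝔽₂^ n)
𝔾 n = vecs (false ∷ true ∷ []) n

module VecSummation {R : Set} (_+ᴿ_ _*ᴿ_ : R → R → R) (0ᴿ 1ᴿ : R)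
  (isCS : IsCommutativeSemiring _≡_ _+ᴿ_ _*ᴿ_ 0ᴿ 1ᴿ) where

  open Summation _+ᴿ_ _*ᴿ_ 0ᴿ 1ᴿ isCS public
  private
    module R = IsCommutativeSemiring isCS
    variable
      X Y : Set

  sum-vecs : (xs : List X) (n : ℕ) (f : Vec X (suc n) → R) →
    sum (vecs xs (suc n)) f ≡ sum xs (λ x → sum (vecs xs n) (λ v → f (x ∷ v)))
  sum-vecs xs n f =
    trans (sum-concat (λ x → List.map (x ∷_) (vecs xs n)) xs f)
          (sum-cong xs (λ x → sum-map (x ∷_) (vecs xs n) f))

  sum-prod : (xs : List X) (f : X → R) (n : ℕ) → sum (vecs xs n) (prod f) ≡ pow (sum xs f) n
  sum-prod xs f zero    = R.+-identityʳ 1ᴿ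
  sum-prod xs f (suc n) = begin
    sum (vecs xs (suc n)) (prod f)  ≡⟨ sum-vecs xs n (prod f) ⟩
    sum xs (λ x → sum (vecs xs n) (λ v → f x *ᴿ prod f v)) ≡⟨ sum-cong xs (λ x → sum-*ˡ (vecs xs n) (f x) (prod f)) ⟩
    sum xs (λ x → f x *ᴿ sum (vecs xs n) (prod f))  ≡⟨ sum-*ʳ xs _ f ⟩
    sum xs f *ᴿ sum (vecs xs n) (prod f)  ≡⟨ cong (sum xs f *ᴿ_) (sum-prod xs f n) ⟩
    sum xs f *ᴿ pow (sum xs f) n  ∎
    where open ≡-Reasoning

  -- Invariance of the counting measure passes from single entries to tuples, so translating all
  -- samples at once is harmless.
  sum-map-vecs : (xs : List X) (h : X → X) → (∀ f → sum xs (f ∘ h) ≡ sum xs f) →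
    (n : ℕ) (f : Vec X n → R) → sum (vecs xs n) (f ∘ map h) ≡ sum (vecs xs n) f
  sum-map-vecs xs h inv zero    f = refl
  sum-map-vecs xs h inv (suc n) f = begin
    sum (vecs xs (suc n)) (f ∘ map h)  ≡⟨ sum-vecs xs n (f ∘ map h) ⟩
    sum xs (λ x → sum (vecs xs n) (λ v → f (h x ∷ map h v)))
      ≡⟨ sum-cong xs (λ x → sum-map-vecs xs h inv n (λ v → f (h x ∷ v))) ⟩
    sum xs (λ x → sum (vecs xs n) (λ v → f (h x ∷ v)))  ≡⟨ inv (λ x → sum (vecs xs n) (λ v → f (x ∷ v))) ⟩
    sum xs (λ x → sum (vecs xs n) (λ v → f (x ∷ v)))  ≡⟨ sum-vecs xs n f ⟨
    sum (vecs xs (suc n)) f  ∎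
    where open ≡-Reasoning

  sum-𝔾 : (n : ℕ) (f : 𝔽₂^ (suc n) → R) →
    sum (𝔾 (suc n)) f ≡ sum (𝔾 n) (λ x → f (false ∷ x)) +ᴿ sum (𝔾 n) (λ x → f (true ∷ x))
  sum-𝔾 n f = trans (sum-vecs (false ∷ true ∷ []) n f)
                    (cong (sum (𝔾 n) (λ x → f (false ∷ x)) +ᴿ_) (R.+-identityʳ _))

  sum-shift : (c : 𝔽₂^ n) (f : 𝔽₂^ n → R) → sum (𝔾 n) (λ x → f (c ⊕ x)) ≡ sum (𝔾 n) f
  sum-shift []          f = refl
  sum-shift {suc n} (false ∷ c) f = begin
    sum (𝔾 (suc n)) (λ x → f ((false ∷ c) ⊕ x))  ≡⟨ sum-𝔾 n _ ⟩
    _  ≡⟨ cong₂ _+ᴿ_ (sum-shift c (λ x → f (false ∷ x))) (sum-shift c (λ x → f (true ∷ x))) ⟩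
    _  ≡⟨ sum-𝔾 n f ⟨
    sum (𝔾 (suc n)) f  ∎
    where open ≡-Reasoning
  sum-shift {suc n} (true ∷ c) f = begin
    sum (𝔾 (suc n)) (λ x → f ((true ∷ c) ⊕ x))  ≡⟨ sum-𝔾 n _ ⟩
    _  ≡⟨ cong₂ _+ᴿ_ (sum-shift c (λ x → f (true ∷ x))) (sum-shift c (λ x → f (false ∷ x))) ⟩
    _  ≡⟨ R.+-comm _ _ ⟩
    _  ≡⟨ sum-𝔾 n f ⟨
    sum (𝔾 (suc n)) f  ∎
    where open ≡-Reasoning

  sum-shiftʳ : (c : 𝔽₂^ n) (f : 𝔽₂^ n → R) → sum (𝔾 n) (λ x → f (x ⊕ c)) ≡ sum (𝔾 n) f
  sum-shiftʳ {n} c f = trans (sum-cong (𝔾 n) (λ x → cong f (⊕-comm x c))) (sum-shift c f)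

open VecSummation _+_ _*_ 0 1 +-*-isCommutativeSemiring public
module ℤΣ = VecSummation _+ᶻ_ _*ᶻ_ 0ℤ 1ℤ ℤₚ.+-*-isCommutativeSemiring
open ℤΣ using () renaming (sum to sumᶻ; pow to powᶻ; prod to prodᶻ) public

private
  variable
    Ix : Set

pow≡^ : ∀ a k → pow a k ≡ a ^ k
pow≡^ a zero    = refl
pow≡^ a (suc k) = cong (a *_) (pow≡^ a k)

sum-mono : (xs : List Ix) {f g : Ix → ℕ} → (∀ x → f x ≤ g x) → sum xs f ≤ sum xs g
sum-mono []       le = z≤n
sum-mono (x ∷ xs) le = +-mono-≤ (le x) (sum-mono xs le)

sumᶻ-mono : (xs : List Ix) {f g : Ix → ℤ} → (∀ x → f x ≤ᶻ g x) → sumᶻ xs f ≤ᶻ sumᶻ xs g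
sumᶻ-mono []       le = ℤₚ.≤-refl
sumᶻ-mono (x ∷ xs) le = ℤₚ.+-mono-≤ (le x) (sumᶻ-mono xs le)

pos-sum : (xs : List Ix) (f : Ix → ℕ) → pos (sum xs f) ≡ sumᶻ xs (pos ∘ f)
pos-sum []       f = refl
pos-sum (x ∷ xs) f = trans (ℤₚ.pos-+ (f x) (sum xs f)) (cong (pos (f x) +ᶻ_) (pos-sum xs f))

sum-const-𝔾 : (n c : ℕ) → sum (𝔾 n) (λ _ → c) ≡ 2 ^ n * c
sum-const-𝔾 zero    c = refl
sum-const-𝔾 (suc n) c =
  trans (sum-𝔾 n (λ _ → c)) (trans (cong₂ _+_ (sum-const-𝔾 n c) (sum-const-𝔾 n c)) (lem (2 ^ n) c))
  where
  lem : ∀ q c → q * c + q * c ≡ 2 * q * c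
  lem = solve-∀

sum-const-vecs : (xs : List Ix) (q n c : ℕ) → (∀ d → sum xs (λ _ → d) ≡ q * d) → sum (vecs xs n) (λ _ → c) ≡ q ^ n * c
sum-const-vecs xs q zero    c h = refl
sum-const-vecs xs q (suc n) c h = begin
  sum (vecs xs (suc n)) (λ _ → c)  ≡⟨ sum-vecs xs n _ ⟩
  sum xs (λ _ → sum (vecs xs n) (λ _ → c)) ≡⟨ sum-cong xs (λ _ → sum-const-vecs xs q n c h) ⟩
  sum xs (λ _ → q ^ n * c)  ≡⟨ h (q ^ n * c) ⟩
  q * (q ^ n * c)  ≡⟨ *-assoc q (q ^ n) c ⟨
  q ^ suc n * c  ∎
  where open ≡-Reasoning

-- The first moment method: a random choice of a tuple, a base point or a coset becomes one
-- comparison of two sums.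
sum<⇒∃ : (xs : List Ix) {f g : Ix → ℕ} → sum xs f < sum xs g → ∃ λ x → f x < g x
sum<⇒∃ []       ()
sum<⇒∃ (x ∷ xs) {f} {g} lt with f x <? g x
... | yes fx<gx = x , fx<gx
... | no  fx≮gx with sum xs f <? sum xs g
...   | yes lt′ = sum<⇒∃ xs lt′
...   | no  ≮′  = ⊥-elim (<⇒≱ lt (+-mono-≤ (≮⇒≥ fx≮gx) (≮⇒≥ ≮′)))

-- Exhaustive search makes case distinctions and existence proofs by contradiction constructive.
∃? : {P : 𝔽₂^ n → Set} → (∀ x → Dec (P x)) → Dec (∃ P)
∃? {zero}  P? = map′ (λ p → [] , p) (λ { ([] , p) → p }) (P? [])
∃? {suc n} P? with ∃? (λ x → P? (false ∷ x)) | ∃? (λ x → P? (true ∷ x))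
... | yes (x , p) | _           = yes (false ∷ x , p)
... | no _        | yes (x , p) = yes (true ∷ x , p)
... | no ¬f       | no ¬t       = no λ { (false ∷ x , p) → ¬f (x , p) ; (true ∷ x , p) → ¬t (x , p) }

∀? : {P : 𝔽₂^ n → Set} → (∀ x → Dec (P x)) → Dec (∀ x → P x)
∀? P? with ∃? (λ x → ¬? (P? x))
... | yes (x , ¬p) = no λ f → ¬p (f x)
... | no ¬∃        = yes λ x → decidable-stable (P? x) (λ ¬p → ¬∃ (x , ¬p))

∀⊎∃¬ : {P : 𝔽₂^ n → Set} → (∀ x → Dec (P x)) → (∀ x → P x) ⊎ ∃ λ x → ¬ P x
∀⊎∃¬ P? with ∃? (λ x → ¬? (P? x))
... | yes w = inj₂ w
... | no ¬∃ = inj₁ λ x → decidable-stable (P? x) (λ ¬p → ¬∃ (x , ¬p))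

ι : Bool → ℕ
ι true  = 1
ι false = 0

ι≤1 : ∀ b → ι b ≤ 1
ι≤1 true  = ≤-refl
ι≤1 false = z≤n

ι-*-ι : ∀ b → ι b * ι b ≡ ι b
ι-*-ι true  = refl
ι-*-ι false = refl

ι-∧ : ∀ b c → ι (b ∧ c) ≡ ι b * ι c
ι-∧ true  c = sym (+-identityʳ (ι c))
ι-∧ false c = refl

count : (𝔽₂^ n → Bool) → ℕ
count {n} P = sum (𝔾 n) (ι ∘ P)

count≤ : (P : 𝔽₂^ n → Bool) → count P ≤ 2 ^ n
count≤ {n} P = ≤-trans (sum-mono (𝔾 n) (ι≤1 ∘ P)) (≤-reflexive (trans (sum-const-𝔾 n 1) (*-identityʳ _)))

sum-ge-term : (x : 𝔽₂^ n) (f : 𝔽₂^ n → ℕ) → f x ≤ sum (𝔾 n) f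
sum-ge-term []              f = m≤m+n (f []) 0
sum-ge-term {suc n} (false ∷ x) f = ≤-trans (sum-ge-term x (λ y → f (false ∷ y)))
  (≤-trans (m≤m+n _ _) (≤-reflexive (sym (sum-𝔾 n f))))
sum-ge-term {suc n} (true ∷ x) f = ≤-trans (sum-ge-term x (λ y → f (true ∷ y)))
  (≤-trans (m≤n+m _ _) (≤-reflexive (sym (sum-𝔾 n f))))

-- Linear algebra over 𝔽₂

δ₀ : 𝔽₂^ n → ℕ
δ₀ []          = 1
δ₀ (true ∷ x)  = 0
δ₀ (false ∷ x) = δ₀ x

δ₀-0v : ∀ n → δ₀ (0v {n}) ≡ 1
δ₀-0v zero    = refl
δ₀-0v (suc n) = δ₀-0v n

δ₀-≤ : (x : 𝔽₂^ n) (b : ℕ) → (x ≡ 0v → 1 ≤ b) → δ₀ x ≤ b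
δ₀-≤ []          b h = h refl
δ₀-≤ (true ∷ x)  b h = z≤n
δ₀-≤ (false ∷ x) b h = δ₀-≤ x b (λ eq → h (cong (false ∷_) eq))

δ₀-self : (x : 𝔽₂^ n) → δ₀ (x ⊕ x) ≡ 1
δ₀-self {n} x = trans (cong δ₀ (⊕-self x)) (δ₀-0v n)

sum-δ₀ : (f : 𝔽₂^ n → ℕ) → sum (𝔾 n) (λ x → f x * δ₀ x) ≡ f 0v
sum-δ₀ {zero}  f = trans (+-identityʳ _) (*-identityʳ _)
sum-δ₀ {suc n} f = begin
  sum (𝔾 (suc n)) (λ x → f x * δ₀ x)  ≡⟨ sum-𝔾 n _ ⟩
  sum (𝔾 n) (λ x → f (false ∷ x) * δ₀ x) + sum (𝔾 n) (λ x → f (true ∷ x) * 0)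
    ≡⟨ cong₂ _+_ (sum-δ₀ (λ x → f (false ∷ x)))
                 (trans (sum-cong (𝔾 n) (λ x → *-zeroʳ (f (true ∷ x)))) (sum-zero (𝔾 n))) ⟩
  f 0v + 0  ≡⟨ +-identityʳ _ ⟩
  f 0v  ∎
  where open ≡-Reasoning

sum-δ : (y : 𝔽₂^ n) → sum (𝔾 n) (λ x → δ₀ (x ⊕ y)) ≡ 1
sum-δ {n} y = trans (sum-shiftʳ y δ₀)
  (trans (sum-cong (𝔾 n) (λ x → sym (+-identityʳ (δ₀ x)))) (sum-δ₀ {n} (λ _ → 1)))

-- Double counting of the pairs in which `x` equals `h y`: each `y` has exactly one partner, and
-- injectivity leaves at most one `y` for each `x`.
count-inj : {P : 𝔽₂^ m → Bool} {R : 𝔽₂^ n → Bool} (h : 𝔽₂^ m → 𝔽₂^ n) →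
  (∀ y → P y ≡ true → R (h y) ≡ true) →
  (∀ y y′ → P y ≡ true → P y′ ≡ true → h y ≡ h y′ → y ≡ y′) →
  count P ≤ count R
count-inj {m} {n} {P} {R} h maps inj = begin
  count P  ≡⟨ sum-cong (𝔾 m) (λ y → sym (trans (cong (ι (P y) *_) (sum-δ (h y))) (*-identityʳ _))) ⟩
  sum (𝔾 m) (λ y → ι (P y) * sum (𝔾 n) (λ x → δ₀ (x ⊕ h y)))  ≡⟨ sum-cong (𝔾 m) (λ y → sym (sum-*ˡ (𝔾 n) (ι (P y)) _)) ⟩
  sum (𝔾 m) (λ y → sum (𝔾 n) (λ x → ι (P y) * δ₀ (x ⊕ h y)))  ≡⟨ sum-swap (𝔾 m) (𝔾 n) _ ⟩
  sum (𝔾 n) (λ x → sum (𝔾 m) (λ y → ι (P y) * δ₀ (x ⊕ h y)))  ≤⟨ sum-mono (𝔾 n) fibre ⟩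
  count R  ∎
  where
  open ≤-Reasoning
  fibre : ∀ x → sum (𝔾 m) (λ y → ι (P y) * δ₀ (x ⊕ h y)) ≤ ι (R x)
  fibre x with ∃? (λ y → (P y 𝔹ₚ.≟ true) ×-dec (h y ≟ᵥ x))
  ... | yes (y₀ , Py₀ , refl) = ≤-trans (sum-mono (𝔾 m) term) (≤-reflexive (trans (sum-δ y₀) (sym (cong ι (maps y₀ Py₀)))))
    where
    term : ∀ y → ι (P y) * δ₀ (h y₀ ⊕ h y) ≤ δ₀ (y ⊕ y₀)
    term y with P y in Py
    ... | false = z≤n
    ... | true  = ≤-trans (≤-reflexive (+-identityʳ _)) (δ₀-≤ (h y₀ ⊕ h y) _ λ eq →
      ≤-reflexive (sym (trans (cong (λ t → δ₀ (t ⊕ y₀)) (inj y y₀ Py Py₀ (sym (⊕≡0⇒≡ eq)))) (δ₀-self y₀))))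
  ... | no ¬∃ = ≤-trans (sum-mono (𝔾 m) term) (≤-trans (≤-reflexive (sum-zero (𝔾 m))) z≤n)
    where
    term : ∀ y → ι (P y) * δ₀ (x ⊕ h y) ≤ 0
    term y with P y in Py
    ... | false = z≤n
    ... | true  = ≤-trans (≤-reflexive (+-identityʳ _)) (δ₀-≤ (x ⊕ h y) _ λ eq →
      ⊥-elim (¬∃ (y , Py , sym (⊕≡0⇒≡ eq))))

count-all : (n : ℕ) → count {n} (λ _ → true) ≡ 2 ^ n
count-all n = trans (sum-const-𝔾 n 1) (*-identityʳ _)

2^-cancel-≤ : ∀ m n → 2 ^ m ≤ 2 ^ n → m ≤ n
2^-cancel-≤ m n le with m ≤? n
... | yes p = p
... | no ¬p = ⊥-elim (<⇒≱ (^-monoʳ-< 2 (s≤s (s≤s z≤n)) (≰⇒> ¬p)) le)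

injective⇒≤ : (h : 𝔽₂^ m → 𝔽₂^ n) → (∀ y y′ → h y ≡ h y′ → y ≡ y′) → m ≤ n
injective⇒≤ {m} {n} h inj = 2^-cancel-≤ m n
  (subst₂ _≤_ (count-all m) (count-all n)
    (count-inj {P = λ _ → true} {R = λ _ → true} h (λ _ _ → refl) (λ y y′ _ _ → inj y y′)))

collision : n < m → (h : 𝔽₂^ m → 𝔽₂^ n) → ∃ λ y → ∃ λ y′ → y ≢ y′ × h y ≡ h y′
collision n<m h with ∃? (λ y → ∃? (λ y′ → ¬? (y ≟ᵥ y′) ×-dec (h y ≟ᵥ h y′)))
... | yes w = w
... | no ¬w = ⊥-elim (<⇒≱ n<m (injective⇒≤ h
  (λ y y′ eq → decidable-stable (y ≟ᵥ y′) (λ y≢y′ → ¬w (y , y′ , y≢y′ , eq)))))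

Additive : (𝔽₂^ m → 𝔽₂^ n) → Set
Additive f = ∀ x y → f (x ⊕ y) ≡ f x ⊕ f y

additive-0v : {f : 𝔽₂^ m → 𝔽₂^ n} → Additive f → f 0v ≡ 0v
additive-0v {f = f} add = begin
  f 0v  ≡⟨ ⊕-cancelʳ (f 0v) (f 0v) ⟨
  (f 0v ⊕ f 0v) ⊕ f 0v ≡⟨ cong (_⊕ f 0v) (add 0v 0v) ⟨
  f (0v ⊕ 0v) ⊕ f 0v  ≡⟨ cong (λ t → f t ⊕ f 0v) (⊕-self 0v) ⟩
  f 0v ⊕ f 0v  ≡⟨ ⊕-self (f 0v) ⟩
  0v  ∎
  where open ≡-Reasoning

additive-·ᵥ : {f : 𝔽₂^ m → 𝔽₂^ n} → Additive f → ∀ b x → f (b ·ᵥ x) ≡ b ·ᵥ f x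
additive-·ᵥ add true  x = refl
additive-·ᵥ add false x = additive-0v add

-- Additive maps over 𝔽₂ are linear, hence determined by the unit vectors; this is the way back from
-- abstract embeddings to the form `lin` used in the theorem.
additive-≡lin : {f : 𝔽₂^ m → 𝔽₂^ n} → Additive f → ∀ x → lin (f ∘ unit) x ≡ f x
additive-≡lin {f = f} add []      = sym (additive-0v add)
additive-≡lin {f = f} add (b ∷ x) = begin
  (b ·ᵥ f (true ∷ 0v)) ⊕ lin (λ i → f (false ∷ unit i)) x
    ≡⟨ cong₂ _⊕_ (sym (additive-·ᵥ add b (true ∷ 0v))) (additive-≡lin (λ y z → add (false ∷ y) (false ∷ z)) x) ⟩
  f (b ·ᵥ (true ∷ 0v)) ⊕ f (false ∷ x)  ≡⟨ add _ _ ⟨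
  f ((b ·ᵥ (true ∷ 0v)) ⊕ (false ∷ x))  ≡⟨ cong f (split b) ⟩
  f (b ∷ x)  ∎
  where
  open ≡-Reasoning
  split : ∀ b → (b ·ᵥ (true ∷ 0v)) ⊕ (false ∷ x) ≡ b ∷ x
  split true  = cong (true ∷_) (⊕-identityˡ x)
  split false = cong (false ∷_) (⊕-identityˡ x)

-- Subspaces are handled as injective additive maps instead of lists of columns, so that passing to
-- a subspace is composition.
record Emb (m n : ℕ) : Set where
  field
    fun : 𝔽₂^ m → 𝔽₂^ n
    add : Additive fun
    ker : ∀ x → fun x ≡ 0v → x ≡ 0v

  0v-fun : fun 0v ≡ 0v
  0v-fun = additive-0v add

  inj : ∀ x y → fun x ≡ fun y → x ≡ y
  inj x y eq = ⊕≡0⇒≡ (ker (x ⊕ y) (trans (add x y) (trans (cong (_⊕ fun y) eq) (⊕-self (fun y)))))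

open Emb public

dim≤ : Emb m n → m ≤ n
dim≤ ψ = injective⇒≤ (fun ψ) (inj ψ)

idₑ : Emb n n
idₑ = record { fun = id ; add = λ _ _ → refl ; ker = λ _ eq → eq }

_∘ₑ_ : Emb m n → Emb k m → Emb k n
ψ ∘ₑ χ = record
  { fun = fun ψ ∘ fun χ
  ; add = λ x y → trans (cong (fun ψ) (add χ x y)) (add ψ _ _)
  ; ker = λ x eq → ker χ x (ker ψ _ eq)
  }

[]ₑ : Emb 0 n
[]ₑ {n} = record { fun = λ _ → 0v ; add = λ _ _ → sym (⊕-self 0v) ; ker = λ { [] _ → refl } }

snoc : (ψ : Emb k n) (x : 𝔽₂^ n) → (∀ y → fun ψ y ≢ x) → Emb (suc k) n
snoc ψ x x∉ = record
  { fun = f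
  ; add = λ { (b ∷ y) (c ∷ z) → trans (cong₂ _⊕_ (·ᵥ-xor b c x) (add ψ y z))
                                      (⊕-interchange (b ·ᵥ x) (c ·ᵥ x) (fun ψ y) (fun ψ z)) }
  ; ker = kerf
  }
  where
  f : 𝔽₂^ (suc _) → 𝔽₂^ _
  f (b ∷ y) = (b ·ᵥ x) ⊕ fun ψ y
  kerf : ∀ y → f y ≡ 0v → y ≡ 0v
  kerf (true ∷ y)  eq = ⊥-elim (x∉ y (sym (⊕≡0⇒≡ eq)))
  kerf (false ∷ y) eq = cong (false ∷_) (ker ψ y (trans (sym (⊕-identityˡ _)) eq))

_∈im_ : 𝔽₂^ n → Emb k n → Set
x ∈im ψ = ∃ λ y → fun ψ y ≡ x

_∈im?_ : (x : 𝔽₂^ n) (ψ : Emb k n) → Dec (x ∈im ψ)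
x ∈im? ψ = ∃? (λ y → fun ψ y ≟ᵥ x)

∈im-⊕ : (ψ : Emb k n) {x y : 𝔽₂^ n} → x ∈im ψ → y ∈im ψ → (x ⊕ y) ∈im ψ
∈im-⊕ ψ (u , refl) (v , refl) = u ⊕ v , add ψ u v

surjective⇒≤ : (ψ : Emb k n) → (∀ x → x ∈im ψ) → n ≤ k
surjective⇒≤ ψ surj = injective⇒≤ (λ x → proj₁ (surj x))
  (λ x x′ eq → trans (sym (proj₂ (surj x))) (trans (cong (fun ψ) eq) (proj₂ (surj x′))))

outside : (ψ : Emb k n) → k < n → ∃ λ x → ¬ x ∈im ψ
outside ψ k<n with ∀⊎∃¬ (λ x → x ∈im? ψ)
... | inj₁ surj = ⊥-elim (<⇒≱ k<n (surjective⇒≤ ψ surj))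
... | inj₂ w    = w

-- A missed vector could be adjoined, embedding a space of dimension n + 1 into one of dimension n.
square-surjective : (ψ : Emb n n) → ∀ x → x ∈im ψ
square-surjective ψ x with x ∈im? ψ
... | yes p = p
... | no ¬p = ⊥-elim (1+n≰n (dim≤ (snoc ψ x (λ y eq → ¬p (y , eq)))))

_⧺_ : 𝔽₂^ e → 𝔽₂^ k → 𝔽₂^ (e + k)
_⧺_ = Vec._++_

⧺-⊕ : (z z′ : 𝔽₂^ e) (y y′ : 𝔽₂^ k) → (z ⧺ y) ⊕ (z′ ⧺ y′) ≡ (z ⊕ z′) ⧺ (y ⊕ y′)
⧺-⊕ []      []        y y′ = refl
⧺-⊕ (b ∷ z) (c ∷ z′) y y′ = cong ((b xor c) ∷_) (⧺-⊕ z z′ y y′)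

⧺≡0v : (z : 𝔽₂^ e) (y : 𝔽₂^ k) → z ⧺ y ≡ 0v → z ≡ 0v × y ≡ 0v
⧺≡0v []      y eq = refl , eq
⧺≡0v (b ∷ z) y eq with cong head eq | ⧺≡0v z y (cong tail eq)
... | refl | p , q = cong (false ∷_) p , q

0v⧺0v : ∀ e → 0v {e} ⧺ 0v {k} ≡ 0v
0v⧺0v zero    = refl
0v⧺0v (suc e) = cong (false ∷_) (0v⧺0v e)

⧺-surj : ∀ {k} e (v : 𝔽₂^ (e + k)) → Σ (𝔽₂^ e) λ z → Σ (𝔽₂^ k) λ y → v ≡ z ⧺ y
⧺-surj zero    v       = [] , v , refl
⧺-surj (suc e) (b ∷ v) with ⧺-surj e v
... | z , y , refl = b ∷ z , y , refl

⧺-inj : (z z′ : 𝔽₂^ e) {y y′ : 𝔽₂^ k} → z ⧺ y ≡ z′ ⧺ y′ → z ≡ z′ × y ≡ y′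
⧺-inj []      []        eq = refl , eq
⧺-inj (b ∷ z) (c ∷ z′) eq with ⧺-inj z z′ (cong tail eq)
... | p , q = cong₂ _∷_ (cong head eq) p , q

-- The `e` new coordinates precede the old ones because `snoc` prepends; `new` spans a complement of
-- the image of `ψ` in that of `whole`.
record Extension {k n : ℕ} (e : ℕ) (ψ : Emb k n) : Set where
  field
    whole    : Emb (e + k) n
    restrict : ∀ y → fun whole (0v {e} ⧺ y) ≡ fun ψ y

  new : 𝔽₂^ e → 𝔽₂^ n
  new z = fun whole (z ⧺ 0v)

  whole-⧺ : ∀ z y → fun whole (z ⧺ y) ≡ new z ⊕ fun ψ y
  whole-⧺ z y = begin
    fun whole (z ⧺ y)  ≡⟨ cong (fun whole) (cong₂ _⧺_ (⊕-identityʳ z) (⊕-identityˡ y)) ⟨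
    fun whole ((z ⊕ 0v) ⧺ (0v ⊕ y))  ≡⟨ cong (fun whole) (⧺-⊕ z 0v 0v y) ⟨
    fun whole ((z ⧺ 0v) ⊕ (0v ⧺ y))  ≡⟨ add whole (z ⧺ 0v) (0v ⧺ y) ⟩
    new z ⊕ fun whole (0v ⧺ y)  ≡⟨ cong (new z ⊕_) (restrict y) ⟩
    new z ⊕ fun ψ y  ∎
    where open ≡-Reasoning

  new-add : Additive new
  new-add z z′ = trans (cong (fun whole) (trans (cong ((z ⊕ z′) ⧺_) (sym (⊕-self 0v))) (sym (⧺-⊕ z z′ 0v 0v)))) (add whole _ _)

  newₑ : Emb e n
  newₑ = record { fun = new ; add = new-add ; ker = λ z eq → proj₁ (⧺≡0v z 0v (ker whole _ eq)) }

  new∉im : ∀ z → z ≢ 0v → ¬ new z ∈im ψ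
  new∉im z z≢0 (y , eq) = z≢0 (proj₁ (⧺≡0v z y (ker whole _
    (trans (whole-⧺ z y) (trans (cong (new z ⊕_) eq) (⊕-self (new z)))))))

open Extension public

trivialExt : (ψ : Emb k n) → Extension 0 ψ
trivialExt ψ = record { whole = ψ ; restrict = λ y → refl }

snocExt : {ψ : Emb k n} (E : Extension e ψ) (x : 𝔽₂^ n) → ¬ x ∈im whole E → Extension (suc e) ψ
snocExt E x x∉ = record
  { whole    = snoc (whole E) x (λ y eq → x∉ (y , eq))
  ; restrict = λ y → trans (⊕-identityˡ _) (restrict E y)
  }

complement : (ψ : Emb k n) (e : ℕ) → e + k ≤ n → Extension e ψ
complement ψ zero    le = trivialExt ψ
complement ψ (suc e) le with complement ψ e (≤-trans (n≤1+n _) le)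
... | E with outside (whole E) le
...   | x , x∉ = snocExt E x x∉

AdditiveB : (𝔽₂^ n → Bool) → Set
AdditiveB φ = ∀ x y → φ (x ⊕ y) ≡ φ x xor φ y

additiveB-0v : (φ : 𝔽₂^ n → Bool) → AdditiveB φ → φ 0v ≡ false
additiveB-0v φ add = trans (cong φ (sym (⊕-self 0v))) (trans (add 0v 0v) (𝔹ₚ.xor-same (φ 0v)))

record KernelChart {e : ℕ} (κ : 𝔽₂^ (suc e) → Bool) : Set where
  field
    chart   : Emb e (suc e)
    offset  : 𝔽₂^ (suc e)
    κ-chart : ∀ y → κ (fun chart y) ≡ false
    κ-off   : κ offset ≡ true
    split   : ∀ (f : 𝔽₂^ (suc e) → ℕ) →
      sum (𝔾 (suc e)) f ≡ sum (𝔾 e) (f ∘ fun chart) + sum (𝔾 e) (λ y → f (offset ⊕ fun chart y))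

open KernelChart public

-- Elimination of one equation. If `κ` is true at the first unit vector, the equation is solved for
-- the first coordinate and the hyperplane is a graph over the others; otherwise `κ` ignores that
-- coordinate and the search moves to the next.
kernelChart : (κ : 𝔽₂^ (suc e) → Bool) → AdditiveB κ → (∃ λ x → κ x ≡ true) → KernelChart κ
kernelChart {e} κ add (x , κx) with κ (true ∷ 0v) in κ₁
... | true = record
  { chart   = record
    { fun = λ y → κ (false ∷ y) ∷ y
    ; add = λ y z → cong (_∷ (y ⊕ z)) (add (false ∷ y) (false ∷ z))
    ; ker = λ y eq → cong tail eq
    }
  ; offset  = true ∷ 0v
  ; κ-chart = λ y → trans (κ∷ (κ (false ∷ y)) y) (𝔹ₚ.xor-same (κ (false ∷ y)))
  ; κ-off   = κ₁
  ; split   = λ f → trans (sum-𝔾 e f) (trans (sym (sum-+ (𝔾 e) _ _))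
      (trans (sum-cong (𝔾 e) (λ y → rearrange f (κ (false ∷ y)) y)) (sum-+ (𝔾 e) _ _)))
  }
  where
  κ∷ : ∀ b y → κ (b ∷ y) ≡ b xor κ (false ∷ y)
  κ∷ false y = refl
  κ∷ true  y = trans (cong (κ ∘ (true ∷_)) (sym (⊕-identityˡ y)))
                     (trans (add (true ∷ 0v) (false ∷ y)) (cong (_xor κ (false ∷ y)) κ₁))
  rearrange : ∀ (f : 𝔽₂^ (suc e) → ℕ) b y → f (false ∷ y) + f (true ∷ y) ≡ f (b ∷ y) + f ((not b) ∷ (0v ⊕ y))
  rearrange f false y = cong (λ t → f (false ∷ y) + f (true ∷ t)) (sym (⊕-identityˡ y))
  rearrange f true  y = trans (+-comm (f (false ∷ y)) _) (cong (λ t → f (true ∷ y) + f (false ∷ t)) (sym (⊕-identityˡ y)))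
kernelChart {zero} κ add (true ∷ [] , κx)  | false = contradiction (trans (sym κx) κ₁) λ ()
kernelChart {zero} κ add (false ∷ [] , κx) | false = contradiction (trans (sym κx) (additiveB-0v κ add)) λ ()
kernelChart {suc e} κ add (b ∷ x , κx) | false = record
  { chart   = record
    { fun = lift
    ; add = λ { (c ∷ y) (d ∷ z) → cong ((c xor d) ∷_) (Emb.add (chart K) y z) }
    ; ker = λ { (c ∷ y) eq → cong₂ _∷_ (cong head eq) (ker (chart K) y (cong tail eq)) }
    }
  ; offset  = false ∷ offset K
  ; κ-chart = λ { (c ∷ y) → trans (κ∷ c _) (κ-chart K y) }
  ; κ-off   = κ-off K
  ; split   = λ f → begin
      sum (𝔾 (suc (suc e))) f  ≡⟨ sum-𝔾 (suc e) f ⟩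
      _  ≡⟨ cong₂ _+_ (split K (λ y → f (false ∷ y))) (split K (λ y → f (true ∷ y))) ⟩
      _  ≡⟨ +-interchange (sum (𝔾 e) (λ y → f (false ∷ fun (chart K) y)))
                                                (sum (𝔾 e) (λ y → f (false ∷ (offset K ⊕ fun (chart K) y))))
                                                (sum (𝔾 e) (λ y → f (true ∷ fun (chart K) y)))
                                                (sum (𝔾 e) (λ y → f (true ∷ (offset K ⊕ fun (chart K) y)))) ⟩
      _  ≡⟨ cong₂ _+_ (sum-𝔾 e (λ y → f (lift y)))
                                            (sum-𝔾 e (λ y → f ((false ∷ offset K) ⊕ lift y))) ⟨
      _  ∎
  }
  where
  open ≡-Reasoning
  +-interchange : ∀ a b c d → (a + b) + (c + d) ≡ (a + c) + (b + d)
  +-interchange = solve-∀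
  κ∷ : ∀ b y → κ (b ∷ y) ≡ κ (false ∷ y)
  κ∷ false y = refl
  κ∷ true  y = trans (cong (κ ∘ (true ∷_)) (sym (⊕-identityˡ y)))
                     (trans (add (true ∷ 0v) (false ∷ y)) (cong (_xor κ (false ∷ y)) κ₁))
  K : KernelChart (λ y → κ (false ∷ y))
  K = kernelChart (λ y → κ (false ∷ y)) (λ y z → add (false ∷ y) (false ∷ z)) (x , trans (sym (κ∷ b x)) κx)
  lift : 𝔽₂^ (suc e) → 𝔽₂^ (suc (suc e))
  lift (c ∷ y) = c ∷ fun (chart K) y

record IsSubspace (P : 𝔽₂^ n → Bool) : Set where
  field
    has-0  : P 0v ≡ true
    closed : ∀ x y → P x ≡ true → P y ≡ true → P (x ⊕ y) ≡ true

  closed-∉ : ∀ x y → P x ≡ false → P y ≡ true → P (x ⊕ y) ≡ false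
  closed-∉ x y px py with P (x ⊕ y) in pxy
  ... | false = refl
  ... | true  = trans (sym (trans (sym (cong P (⊕-cancelʳ x y))) (closed (x ⊕ y) y pxy py))) px

open IsSubspace public

sectionSubspace : {P : 𝔽₂^ (suc n) → Bool} → IsSubspace P → IsSubspace (λ y → P (false ∷ y))
sectionSubspace sub = record { has-0 = has-0 sub ; closed = λ x y → closed sub (false ∷ x) (false ∷ y) }

-- Induction on coordinates. A vector of `P` with leading bit true eliminates that coordinate. If
-- there is none, the leading bit vanishes on `P`; it separates `x` when `x` has leading bit true,
-- and otherwise the problem lives in the remaining coordinates.
separate : {P : 𝔽₂^ n → Bool} → IsSubspace P → (x : 𝔽₂^ n) → P x ≡ false →
  ∃ λ φ → AdditiveB φ × (∀ y → P y ≡ true → φ y ≡ false) × φ x ≡ true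
separate {zero}  {P} sub [] x∉ with () ← trans (sym x∉) (has-0 sub)
separate {suc n} {P} sub (b ∷ x) x∉ with ∃? (λ y → P (true ∷ y) 𝔹ₚ.≟ true)
... | yes (z , z∈) = φ , φ-add , φ-P , φx₀
  where
  reduce : ∀ c y → P (c ∷ y) ≡ P (false ∷ (y ⊕ (c ·ᵥ z)))
  reduce false y = cong (λ t → P (false ∷ t)) (sym (⊕-identityʳ y))
  reduce true  y with P (true ∷ y) in py
  ... | true  = sym (closed sub (true ∷ y) (true ∷ z) py z∈)
  ... | false = sym (closed-∉ sub (true ∷ y) (true ∷ z) py z∈)
  ih = separate (sectionSubspace sub) (x ⊕ (b ·ᵥ z)) (trans (sym (reduce b x)) x∉)
  φ₀ = proj₁ ih
  φ₀-add = proj₁ (proj₂ ih)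
  φ : 𝔽₂^ (suc n) → Bool
  φ (c ∷ y) = φ₀ (y ⊕ (c ·ᵥ z))
  φ-add : AdditiveB φ
  φ-add (c ∷ y) (d ∷ w) =
    trans (cong φ₀ (trans (cong ((y ⊕ w) ⊕_) (·ᵥ-xor c d z)) (⊕-interchange y w (c ·ᵥ z) (d ·ᵥ z)))) (φ₀-add _ _)
  φ-P : ∀ y → P y ≡ true → φ y ≡ false
  φ-P (c ∷ y) py = proj₁ (proj₂ (proj₂ ih)) _ (trans (sym (reduce c y)) py)
  φx₀ : φ (b ∷ x) ≡ true
  φx₀ = proj₂ (proj₂ (proj₂ ih))
separate {suc n} {P} sub (true ∷ x) x∉ | no none =
  head , (λ { (c ∷ y) (d ∷ w) → refl }) , (λ { (false ∷ y) py → refl ; (true ∷ y) py → ⊥-elim (none (y , py)) }) , refl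
separate {suc n} {P} sub (false ∷ x) x∉ | no none with separate (sectionSubspace sub) x x∉
... | φ₀ , φ₀-add , φ₀-P , φ₀x =
  φ₀ ∘ tail , (λ { (c ∷ y) (d ∷ w) → φ₀-add y w })
  , (λ { (false ∷ y) py → φ₀-P y py ; (true ∷ y) py → ⊥-elim (none (y , py)) }) , φ₀x

-- The triangular number 1 + ... + a, one echelon row per coordinate. It bounds the logarithm of the
-- number of subspaces and is the source of the quadratic loss per layer.
codeLength : ℕ → ℕ
codeLength zero    = 0
codeLength (suc a) = suc a + codeLength a

-- A reduced echelon form: a subspace is determined by its section and one
-- vector outside it.
code : (𝔽₂^ n → Bool) → 𝔽₂^ (codeLength n)
code {zero}  P = []
code {suc n} P with ∃? (λ y → P (true ∷ y) 𝔹ₚ.≟ true)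
... | yes (z , _) = (true ∷ z) ⧺ code (λ y → P (false ∷ y))
... | no  _       = 0v ⧺ code (λ y → P (false ∷ y))

code-injective : {P Q : 𝔽₂^ n → Bool} → IsSubspace P → IsSubspace Q → code P ≡ code Q → ∀ x → P x ≡ Q x
code-injective {zero}  subP subQ eq [] = trans (has-0 subP) (sym (has-0 subQ))
code-injective {suc n} {P} {Q} subP subQ eq (b ∷ x)
  with ∃? (λ y → P (true ∷ y) 𝔹ₚ.≟ true) | ∃? (λ y → Q (true ∷ y) 𝔹ₚ.≟ true)
... | yes (z , z∈) | yes (w , w∈) = go b
  where
  eqs = ⧺-inj (true ∷ z) (true ∷ w) eq
  ih  = code-injective (sectionSubspace subP) (sectionSubspace subQ) (proj₂ eqs)
  z≡w : z ≡ w
  z≡w = cong tail (proj₁ eqs)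
  go : ∀ b → P (b ∷ x) ≡ Q (b ∷ x)
  go false = ih x
  go true with P (true ∷ x) in px | Q (true ∷ x) in qx
  ... | true  | true  = refl
  ... | false | false = refl
  ... | true  | false = trans (sym (closed subP _ _ px z∈)) (trans (ih _) (closed-∉ subQ _ _ qx (subst (λ t → Q (true ∷ t) ≡ true) (sym z≡w) w∈)))
  ... | false | true  = trans (sym (closed-∉ subP _ _ px z∈)) (trans (ih _) (closed subQ _ _ qx (subst (λ t → Q (true ∷ t) ≡ true) (sym z≡w) w∈)))
... | no ¬p | no ¬q = go b
  where
  ih = code-injective (sectionSubspace subP) (sectionSubspace subQ) (proj₂ (⧺-inj (0v {suc n}) 0v eq))
  go : ∀ b → P (b ∷ x) ≡ Q (b ∷ x)
  go false = ih x
  go true  = trans (𝔹ₚ.¬-not (λ p → ¬p (x , p))) (sym (𝔹ₚ.¬-not (λ q → ¬q (x , q))))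
... | yes (z , _) | no _ with () ← cong head (proj₁ (⧺-inj (true ∷ z) 0v eq))
... | no _ | yes (w , _) with () ← cong head (proj₁ (⧺-inj 0v (true ∷ w) eq))

-- Fourier analysis

dot : 𝔽₂^ n → 𝔽₂^ n → Bool
dot []      []      = false
dot (b ∷ ξ) (c ∷ x) = (b ∧ c) xor dot ξ x

xor-interchange : ∀ a b c d → (a xor b) xor (c xor d) ≡ (a xor c) xor (b xor d)
xor-interchange false b c d = begin
  b xor (c xor d)  ≡⟨ 𝔹ₚ.xor-assoc b c d ⟨
  (b xor c) xor d  ≡⟨ cong (_xor d) (𝔹ₚ.xor-comm b c) ⟩
  (c xor b) xor d  ≡⟨ 𝔹ₚ.xor-assoc c b d ⟩
  c xor (b xor d)  ∎
  where open ≡-Reasoning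
xor-interchange true b c d = begin
  not b xor (c xor d)  ≡⟨ 𝔹ₚ.not-distribˡ-xor b (c xor d) ⟨
  not (b xor (c xor d))  ≡⟨ cong not (xor-interchange false b c d) ⟩
  not (c xor (b xor d))  ≡⟨ 𝔹ₚ.not-distribˡ-xor c (b xor d) ⟩
  not c xor (b xor d)  ∎
  where open ≡-Reasoning

dot-⊕ : (ξ : 𝔽₂^ n) → AdditiveB (dot ξ)
dot-⊕ []      []      []      = refl
dot-⊕ (b ∷ ξ) (c ∷ x) (d ∷ y) =
  trans (cong₂ _xor_ (𝔹ₚ.∧-distribˡ-xor b c d) (dot-⊕ ξ x y)) (xor-interchange (b ∧ c) (b ∧ d) _ _)

sgn : Bool → ℤ
sgn true  = -1ℤ
sgn false = 1ℤ

sgn-xor : ∀ b c → sgn (b xor c) ≡ sgn b *ᶻ sgn c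
sgn-xor true  true  = refl
sgn-xor true  false = refl
sgn-xor false c     = sym (ℤₚ.*-identityˡ (sgn c))

χ : 𝔽₂^ n → 𝔽₂^ n → ℤ
χ ξ x = sgn (dot ξ x)

χ-⊕ : (ξ x y : 𝔽₂^ n) → χ ξ (x ⊕ y) ≡ χ ξ x *ᶻ χ ξ y
χ-⊕ ξ x y = trans (cong sgn (dot-⊕ ξ x y)) (sgn-xor (dot ξ x) (dot ξ y))

χ-0v : (ξ : 𝔽₂^ n) → χ ξ 0v ≡ 1ℤ
χ-0v ξ = cong sgn (additiveB-0v (dot ξ) (dot-⊕ ξ))

sumᶻ-neg : {X : Set} (xs : List X) (f : X → ℤ) → sumᶻ xs (λ x → -ᶻ f x) ≡ -ᶻ sumᶻ xs f
sumᶻ-neg xs f = trans (ℤΣ.sum-cong xs (λ x → sym (ℤₚ.-1*i≡-i (f x))))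
  (trans (ℤΣ.sum-*ˡ xs -1ℤ f) (ℤₚ.-1*i≡-i _))

orthogonality : (x : 𝔽₂^ n) → sumᶻ (𝔾 n) (λ ξ → χ ξ x) ≡ pos (2 ^ n) *ᶻ pos (δ₀ x)
orthogonality [] = refl
orthogonality {suc n} (false ∷ x) = begin
  sumᶻ (𝔾 (suc n)) (λ ξ → χ ξ (false ∷ x))  ≡⟨ ℤΣ.sum-𝔾 n _ ⟩
  S +ᶻ S  ≡⟨ cong₂ _+ᶻ_ (orthogonality x) (orthogonality x) ⟩
  D +ᶻ D  ≡⟨ lem (pos (2 ^ n)) (pos (δ₀ x)) ⟩
  (pos (2 ^ n) +ᶻ pos (2 ^ n)) *ᶻ pos (δ₀ x)
    ≡⟨ cong (_*ᶻ pos (δ₀ x)) (trans (sym (ℤₚ.pos-+ (2 ^ n) (2 ^ n))) (cong (λ t → pos (2 ^ n + t)) (sym (+-identityʳ (2 ^ n))))) ⟩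
  pos (2 ^ suc n) *ᶻ pos (δ₀ x)  ∎
  where
  open ≡-Reasoning
  S = sumᶻ (𝔾 n) (λ ξ → χ ξ x)
  D = pos (2 ^ n) *ᶻ pos (δ₀ x)
  lem : ∀ a b → a *ᶻ b +ᶻ a *ᶻ b ≡ (a +ᶻ a) *ᶻ b
  lem = ℤ-Solver.solve-∀
orthogonality {suc n} (true ∷ x) = begin
  sumᶻ (𝔾 (suc n)) (λ ξ → χ ξ (true ∷ x))  ≡⟨ ℤΣ.sum-𝔾 n _ ⟩
  S +ᶻ sumᶻ (𝔾 n) (λ ξ → sgn (true xor dot ξ x))  ≡⟨ cong (S +ᶻ_) (trans (ℤΣ.sum-cong (𝔾 n) (λ ξ → trans (sgn-xor true (dot ξ x)) (ℤₚ.-1*i≡-i _))) (sumᶻ-neg (𝔾 n) _)) ⟩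
  S +ᶻ -ᶻ S  ≡⟨ ℤₚ.+-inverseʳ S ⟩
  0ℤ  ≡⟨ ℤₚ.*-zeroʳ (pos (2 ^ suc n)) ⟨
  pos (2 ^ suc n) *ᶻ 0ℤ  ∎
  where
  open ≡-Reasoning
  S = sumᶻ (𝔾 n) (λ ξ → χ ξ x)

sumᶻ-δ₀ : (f : 𝔽₂^ n → ℤ) → sumᶻ (𝔾 n) (λ x → f x *ᶻ pos (δ₀ x)) ≡ f 0v
sumᶻ-δ₀ {zero}  f = trans (ℤₚ.+-identityʳ _) (ℤₚ.*-identityʳ _)
sumᶻ-δ₀ {suc n} f = begin
  sumᶻ (𝔾 (suc n)) (λ x → f x *ᶻ pos (δ₀ x))  ≡⟨ ℤΣ.sum-𝔾 n _ ⟩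
  sumᶻ (𝔾 n) (λ x → f (false ∷ x) *ᶻ pos (δ₀ x)) +ᶻ sumᶻ (𝔾 n) (λ x → f (true ∷ x) *ᶻ 0ℤ)
    ≡⟨ cong₂ _+ᶻ_ (sumᶻ-δ₀ (λ x → f (false ∷ x)))
                 (trans (ℤΣ.sum-cong (𝔾 n) (λ x → ℤₚ.*-zeroʳ (f (true ∷ x)))) (ℤΣ.sum-zero (𝔾 n))) ⟩
  f 0v +ᶻ 0ℤ  ≡⟨ ℤₚ.+-identityʳ _ ⟩
  f 0v  ∎
  where open ≡-Reasoning

sumᶻ-δ : (c : 𝔽₂^ n) (f : 𝔽₂^ n → ℤ) → sumᶻ (𝔾 n) (λ x → f x *ᶻ pos (δ₀ (c ⊕ x))) ≡ f c
sumᶻ-δ {n} c f = begin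
  sumᶻ (𝔾 n) (λ x → f x *ᶻ pos (δ₀ (c ⊕ x)))  ≡⟨ ℤΣ.sum-cong (𝔾 n) (λ x → cong (λ t → f t *ᶻ pos (δ₀ (c ⊕ x))) (sym (⊕-cancelˡ c x))) ⟩
  sumᶻ (𝔾 n) (λ x → f (c ⊕ (c ⊕ x)) *ᶻ pos (δ₀ (c ⊕ x)))  ≡⟨ ℤΣ.sum-shift c (λ x → f (c ⊕ x) *ᶻ pos (δ₀ x)) ⟩
  sumᶻ (𝔾 n) (λ x → f (c ⊕ x) *ᶻ pos (δ₀ x))  ≡⟨ sumᶻ-δ₀ (λ x → f (c ⊕ x)) ⟩
  f (c ⊕ 0v)  ≡⟨ cong f (⊕-identityʳ c) ⟩
  f c  ∎
  where open ≡-Reasoning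

-- Without normalisation all transforms stay integral, at the price of factors `2 ^ n` in inversion
-- and in Parseval's identity.
hat : (𝔽₂^ n → ℤ) → 𝔽₂^ n → ℤ
hat {n} f ξ = sumᶻ (𝔾 n) (λ x → f x *ᶻ χ ξ x)

conv : (𝔽₂^ n → ℤ) → (𝔽₂^ n → ℤ) → 𝔽₂^ n → ℤ
conv {n} f h z = sumᶻ (𝔾 n) (λ x → f x *ᶻ h (x ⊕ z))

sumᶻ-*-sumᶻ : {X Y : Set} (xs : List X) (ys : List Y) (f : X → ℤ) (h : Y → ℤ) →
  sumᶻ xs f *ᶻ sumᶻ ys h ≡ sumᶻ xs (λ x → sumᶻ ys (λ y → f x *ᶻ h y))
sumᶻ-*-sumᶻ xs ys f h =
  trans (sym (ℤΣ.sum-*ʳ xs (sumᶻ ys h) f)) (ℤΣ.sum-cong xs (λ x → sym (ℤΣ.sum-*ˡ ys (f x) h)))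

hat-*-hat : (f h : 𝔽₂^ n → ℤ) (ξ : 𝔽₂^ n) →
  hat f ξ *ᶻ hat h ξ ≡ sumᶻ (𝔾 n) (λ x → sumᶻ (𝔾 n) (λ y → (f x *ᶻ h y) *ᶻ χ ξ (x ⊕ y)))
hat-*-hat {n} f h ξ = trans (sumᶻ-*-sumᶻ (𝔾 n) (𝔾 n) _ _)
  (ℤΣ.sum-cong (𝔾 n) λ x → ℤΣ.sum-cong (𝔾 n) λ y →
    trans (lem (f x) (χ ξ x) (h y) (χ ξ y)) (cong ((f x *ᶻ h y) *ᶻ_) (sym (χ-⊕ ξ x y))))
  where
  lem : ∀ a b c d → (a *ᶻ b) *ᶻ (c *ᶻ d) ≡ (a *ᶻ c) *ᶻ (b *ᶻ d)
  lem = ℤ-Solver.solve-∀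

hat-conv : (f h : 𝔽₂^ n → ℤ) (ξ : 𝔽₂^ n) → hat (conv f h) ξ ≡ hat f ξ *ᶻ hat h ξ
hat-conv {n} f h ξ = begin
  sumᶻ (𝔾 n) (λ z → conv f h z *ᶻ χ ξ z)  ≡⟨ ℤΣ.sum-cong (𝔾 n) (λ z → sym (ℤΣ.sum-*ʳ (𝔾 n) (χ ξ z) _)) ⟩
  sumᶻ (𝔾 n) (λ z → sumᶻ (𝔾 n) (λ x → (f x *ᶻ h (x ⊕ z)) *ᶻ χ ξ z)) ≡⟨ ℤΣ.sum-swap (𝔾 n) (𝔾 n) _ ⟩
  sumᶻ (𝔾 n) (λ x → sumᶻ (𝔾 n) (λ z → (f x *ᶻ h (x ⊕ z)) *ᶻ χ ξ z))
    ≡⟨ ℤΣ.sum-cong (𝔾 n) (λ x → ℤΣ.sum-cong (𝔾 n) (λ z → cong (λ t → (f x *ᶻ h (x ⊕ z)) *ᶻ χ ξ t) (sym (⊕-cancelˡ x z)))) ⟩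
  sumᶻ (𝔾 n) (λ x → sumᶻ (𝔾 n) (λ z → (f x *ᶻ h (x ⊕ z)) *ᶻ χ ξ (x ⊕ (x ⊕ z))))
    ≡⟨ ℤΣ.sum-cong (𝔾 n) (λ x → ℤΣ.sum-shift x (λ y → (f x *ᶻ h y) *ᶻ χ ξ (x ⊕ y))) ⟩
  sumᶻ (𝔾 n) (λ x → sumᶻ (𝔾 n) (λ y → (f x *ᶻ h y) *ᶻ χ ξ (x ⊕ y))) ≡⟨ hat-*-hat f h ξ ⟨
  hat f ξ *ᶻ hat h ξ  ∎
  where open ≡-Reasoning

-- Stated for a product of two transforms, the form in which autocorrelations arise; Parseval's
-- identity is its value at zero.
inversion : (f h : 𝔽₂^ n → ℤ) (z : 𝔽₂^ n) →
  sumᶻ (𝔾 n) (λ ξ → (hat f ξ *ᶻ hat h ξ) *ᶻ χ ξ z) ≡ pos (2 ^ n) *ᶻ conv f h z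
inversion {n} f h z = begin
  sumᶻ G (λ ξ → (hat f ξ *ᶻ hat h ξ) *ᶻ χ ξ z)
    ≡⟨ ℤΣ.sum-cong G (λ ξ → trans (cong (_*ᶻ χ ξ z) (hat-*-hat f h ξ))
         (trans (sym (ℤΣ.sum-*ʳ G (χ ξ z) _)) (ℤΣ.sum-cong G λ x → trans (sym (ℤΣ.sum-*ʳ G (χ ξ z) _))
           (ℤΣ.sum-cong G λ y → trans (ℤₚ.*-assoc (f x *ᶻ h y) _ _) (cong ((f x *ᶻ h y) *ᶻ_)
             (trans (sym (χ-⊕ ξ (x ⊕ y) z)) (cong (χ ξ) (⊕-solve (x ∷ y ∷ z ∷ []) (𝕩₀ ⊹ 𝕩₁ ⊹ 𝕩₂) ((𝕩₀ ⊹ 𝕩₂) ⊹ 𝕩₁) refl)))))))) ⟩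
  sumᶻ G (λ ξ → sumᶻ G (λ x → sumᶻ G (λ y → (f x *ᶻ h y) *ᶻ χ ξ ((x ⊕ z) ⊕ y))))
    ≡⟨ ℤΣ.sum-swap G G _ ⟩
  sumᶻ G (λ x → sumᶻ G (λ ξ → sumᶻ G (λ y → (f x *ᶻ h y) *ᶻ χ ξ ((x ⊕ z) ⊕ y))))
    ≡⟨ ℤΣ.sum-cong G (λ x → ℤΣ.sum-swap G G _) ⟩
  sumᶻ G (λ x → sumᶻ G (λ y → sumᶻ G (λ ξ → (f x *ᶻ h y) *ᶻ χ ξ ((x ⊕ z) ⊕ y))))
    ≡⟨ ℤΣ.sum-cong G (λ x → ℤΣ.sum-cong G (λ y → trans (ℤΣ.sum-*ˡ G (f x *ᶻ h y) _)
         (trans (cong ((f x *ᶻ h y) *ᶻ_) (orthogonality ((x ⊕ z) ⊕ y))) (lem (f x) (h y) (pos (2 ^ n)) _)))) ⟩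
  sumᶻ G (λ x → sumᶻ G (λ y → pos (2 ^ n) *ᶻ (f x *ᶻ (h y *ᶻ pos (δ₀ ((x ⊕ z) ⊕ y))))))
    ≡⟨ ℤΣ.sum-cong G (λ x → trans (ℤΣ.sum-*ˡ G (pos (2 ^ n)) _) (cong (pos (2 ^ n) *ᶻ_)
         (trans (ℤΣ.sum-*ˡ G (f x) _) (cong (f x *ᶻ_) (sumᶻ-δ (x ⊕ z) h))))) ⟩
  sumᶻ G (λ x → pos (2 ^ n) *ᶻ (f x *ᶻ h (x ⊕ z)))
    ≡⟨ ℤΣ.sum-*ˡ G (pos (2 ^ n)) _ ⟩
  pos (2 ^ n) *ᶻ conv f h z ∎
  where
  open ≡-Reasoning
  G = 𝔾 n
  lem : ∀ a b c d → (a *ᶻ b) *ᶻ (c *ᶻ d) ≡ c *ᶻ (a *ᶻ (b *ᶻ d))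
  lem = ℤ-Solver.solve-∀

parseval : (f h : 𝔽₂^ n → ℤ) →
  sumᶻ (𝔾 n) (λ ξ → hat f ξ *ᶻ hat h ξ) ≡ pos (2 ^ n) *ᶻ sumᶻ (𝔾 n) (λ x → f x *ᶻ h x)
parseval {n} f h = begin
  sumᶻ (𝔾 n) (λ ξ → hat f ξ *ᶻ hat h ξ)  ≡⟨ ℤΣ.sum-cong (𝔾 n) (λ ξ → sym (trans (cong ((hat f ξ *ᶻ hat h ξ) *ᶻ_) (χ-0v ξ)) (ℤₚ.*-identityʳ _))) ⟩
  sumᶻ (𝔾 n) (λ ξ → (hat f ξ *ᶻ hat h ξ) *ᶻ χ ξ 0v)  ≡⟨ inversion f h 0v ⟩
  pos (2 ^ n) *ᶻ conv f h 0v  ≡⟨ cong (pos (2 ^ n) *ᶻ_) (ℤΣ.sum-cong (𝔾 n) (λ x → cong (λ t → f x *ᶻ h t) (⊕-identityʳ x))) ⟩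
  pos (2 ^ n) *ᶻ sumᶻ (𝔾 n) (λ x → f x *ᶻ h x)  ∎
  where open ≡-Reasoning

-- Positive definite functions and unbalancing

*ᶻ-nonneg : ∀ {i j} → 0ℤ ≤ᶻ i → 0ℤ ≤ᶻ j → 0ℤ ≤ᶻ i *ᶻ j
*ᶻ-nonneg {pos a} {pos b} _ _ = subst (0ℤ ≤ᶻ_) (ℤₚ.pos-* a b) (ℤ.+≤+ z≤n)

square-nonneg : ∀ i → 0ℤ ≤ᶻ i *ᶻ i
square-nonneg (pos a)        = *ᶻ-nonneg {pos a} {pos a} (ℤ.+≤+ z≤n) (ℤ.+≤+ z≤n)
square-nonneg (ℤ.-[1+ a ]) = ℤ.+≤+ z≤n

pos-nonneg : ∀ a → 0ℤ ≤ᶻ pos a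
pos-nonneg a = ℤ.+≤+ z≤n

sumᶻ-nonneg : {X : Set} (xs : List X) {f : X → ℤ} → (∀ x → 0ℤ ≤ᶻ f x) → 0ℤ ≤ᶻ sumᶻ xs f
sumᶻ-nonneg xs {f} h = subst (_≤ᶻ sumᶻ xs f) (ℤΣ.sum-zero xs) (sumᶻ-mono xs h)

-- The coefficients are integers, which is why the autocorrelation below carries a factor `2 ^ n`.
record PosDef {n : ℕ} (f : 𝔽₂^ n → ℤ) : Set where
  field
    coeff   : 𝔽₂^ n → ℤ
    coeff≥0 : ∀ ξ → 0ℤ ≤ᶻ coeff ξ
    expansion  : ∀ x → f x ≡ sumᶻ (𝔾 n) (λ ξ → coeff ξ *ᶻ χ ξ x)

open PosDef

dot-comm : (x y : 𝔽₂^ n) → dot x y ≡ dot y x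
dot-comm []      []      = refl
dot-comm (b ∷ x) (c ∷ y) = cong₂ _xor_ (𝔹ₚ.∧-comm b c) (dot-comm x y)

χ-comm : (x y : 𝔽₂^ n) → χ x y ≡ χ y x
χ-comm x y = cong sgn (dot-comm x y)

PosDef-+ : {f h : 𝔽₂^ n → ℤ} → PosDef f → PosDef h → PosDef (λ x → f x +ᶻ h x)
PosDef-+ {n} F H = record
  { coeff   = λ ξ → coeff F ξ +ᶻ coeff H ξ
  ; coeff≥0 = λ ξ → ℤₚ.+-mono-≤ (coeff≥0 F ξ) (coeff≥0 H ξ)
  ; expansion  = λ x → trans (cong₂ _+ᶻ_ (expansion F x) (expansion H x))
      (trans (sym (ℤΣ.sum-+ (𝔾 n) _ _)) (ℤΣ.sum-cong (𝔾 n) (λ ξ → sym (ℤₚ.*-distribʳ-+ (χ ξ x) (coeff F ξ) (coeff H ξ)))))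
  }

-- Pointwise products correspond to convolutions of coefficients. As χ is symmetric, `hat-conv`
-- applies with points and characters exchanged.
PosDef-* : {f h : 𝔽₂^ n → ℤ} → PosDef f → PosDef h → PosDef (λ x → f x *ᶻ h x)
PosDef-* {n} {f} {h} F H = record
  { coeff   = conv (coeff F) (coeff H)
  ; coeff≥0 = λ ξ → sumᶻ-nonneg (𝔾 n) (λ η → *ᶻ-nonneg (coeff≥0 F η) (coeff≥0 H _))
  ; expansion  = λ x → begin
      f x *ᶻ h x  ≡⟨ cong₂ _*ᶻ_ (trans (expansion F x) (flip F x)) (trans (expansion H x) (flip H x)) ⟩
      hat (coeff F) x *ᶻ hat (coeff H) x  ≡⟨ hat-conv (coeff F) (coeff H) x ⟨
      hat (conv (coeff F) (coeff H)) x  ≡⟨ ℤΣ.sum-cong (𝔾 n) (λ ξ → cong (conv (coeff F) (coeff H) ξ *ᶻ_) (χ-comm x ξ)) ⟩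
      sumᶻ (𝔾 n) (λ ξ → conv (coeff F) (coeff H) ξ *ᶻ χ ξ x) ∎
  }
  where
  open ≡-Reasoning
  flip : ∀ {f} (F : PosDef f) x → sumᶻ (𝔾 n) (λ ξ → coeff F ξ *ᶻ χ ξ x) ≡ hat (coeff F) x
  flip F x = ℤΣ.sum-cong (𝔾 n) (λ ξ → cong (coeff F ξ *ᶻ_) (χ-comm ξ x))

χ-0vˡ : (x : 𝔽₂^ n) → χ 0v x ≡ 1ℤ
χ-0vˡ x = trans (χ-comm 0v x) (χ-0v x)

PosDef-const : (c : ℤ) → 0ℤ ≤ᶻ c → PosDef {n} (λ _ → c)
PosDef-const {n} c c≥0 = record
  { coeff   = λ ξ → c *ᶻ pos (δ₀ ξ)
  ; coeff≥0 = λ ξ → *ᶻ-nonneg c≥0 (pos-nonneg (δ₀ ξ))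
  ; expansion  = λ x → sym (trans (ℤΣ.sum-cong (𝔾 n) (λ ξ → lem c (pos (δ₀ ξ)) (χ ξ x)))
      (trans (sumᶻ-δ₀ (λ ξ → c *ᶻ χ ξ x)) (trans (cong (c *ᶻ_) (χ-0vˡ x)) (ℤₚ.*-identityʳ c))))
  }
  where
  lem : ∀ a b c → (a *ᶻ b) *ᶻ c ≡ (a *ᶻ c) *ᶻ b
  lem = ℤ-Solver.solve-∀

PosDef-autocorrelation : (φ : 𝔽₂^ n → ℤ) → PosDef (λ x → pos (2 ^ n) *ᶻ conv φ φ x)
PosDef-autocorrelation φ = record
  { coeff   = λ ξ → hat φ ξ *ᶻ hat φ ξ
  ; coeff≥0 = λ ξ → square-nonneg (hat φ ξ)
  ; expansion  = λ x → sym (inversion φ φ x)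
  }

PosDef-sum≥0 : {f : 𝔽₂^ n → ℤ} → PosDef f → 0ℤ ≤ᶻ sumᶻ (𝔾 n) f
PosDef-sum≥0 {n} {f} F = subst (0ℤ ≤ᶻ_) (sym eq)
  (sumᶻ-nonneg (𝔾 n) (λ ξ → *ᶻ-nonneg (coeff≥0 F ξ) (*ᶻ-nonneg (pos-nonneg (2 ^ n)) (pos-nonneg (δ₀ ξ)))))
  where
  open ≡-Reasoning
  eq : sumᶻ (𝔾 n) f ≡ sumᶻ (𝔾 n) (λ ξ → coeff F ξ *ᶻ (pos (2 ^ n) *ᶻ pos (δ₀ ξ)))
  eq = begin
    sumᶻ (𝔾 n) f  ≡⟨ ℤΣ.sum-cong (𝔾 n) (expansion F) ⟩
    sumᶻ (𝔾 n) (λ x → sumᶻ (𝔾 n) (λ ξ → coeff F ξ *ᶻ χ ξ x))  ≡⟨ ℤΣ.sum-swap (𝔾 n) (𝔾 n) _ ⟩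
    sumᶻ (𝔾 n) (λ ξ → sumᶻ (𝔾 n) (λ x → coeff F ξ *ᶻ χ ξ x))  ≡⟨ ℤΣ.sum-cong (𝔾 n) (λ ξ → trans (ℤΣ.sum-*ˡ (𝔾 n) (coeff F ξ) _)
                                                                        (cong (coeff F ξ *ᶻ_) (trans (ℤΣ.sum-cong (𝔾 n) (λ x → χ-comm ξ x)) (orthogonality ξ)))) ⟩
    sumᶻ (𝔾 n) (λ ξ → coeff F ξ *ᶻ (pos (2 ^ n) *ᶻ pos (δ₀ ξ)))  ∎

-- Unbalancing: all moments of a positive definite g are nonnegative, so in the
-- expansion of (g + α)² = 2αg + (α² + g²) every term may be dropped but the powers of 2αg.
unbalance : {g h : 𝔽₂^ n → ℤ} → PosDef g → (α : ℤ) → 0ℤ ≤ᶻ α → (p : ℕ) → PosDef h →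
  sumᶻ (𝔾 n) (λ x → powᶻ ((α +ᶻ α) *ᶻ g x) p *ᶻ h x) ≤ᶻ
  sumᶻ (𝔾 n) (λ x → powᶻ ((g x +ᶻ α) *ᶻ (g x +ᶻ α)) p *ᶻ h x)
unbalance G α α≥0 zero H = ℤₚ.≤-refl
unbalance {n} {g} {h} G α α≥0 (suc p) H = begin
  sumᶻ (𝔾 n) (λ x → powᶻ (u x) (suc p) *ᶻ h x)  ≡⟨ ℤΣ.sum-cong (𝔾 n) (λ x → rot (u x) (powᶻ (u x) p) (h x)) ⟩
  -- The peeled factor joins the weight, which stays positive definite; the induction therefore
  -- needs a general `h`.
  sumᶻ (𝔾 n) (λ x → powᶻ (u x) p *ᶻ (u x *ᶻ h x))  ≤⟨ unbalance G α α≥0 p (PosDef-* U H) ⟩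
  sumᶻ (𝔾 n) (λ x → powᶻ (w x) p *ᶻ (u x *ᶻ h x))  ≡⟨ ℤₚ.+-identityʳ _ ⟨
  sumᶻ (𝔾 n) (λ x → powᶻ (w x) p *ᶻ (u x *ᶻ h x)) +ᶻ 0ℤ
    ≤⟨ ℤₚ.+-monoʳ-≤ (sumᶻ (𝔾 n) (λ x → powᶻ (w x) p *ᶻ (u x *ᶻ h x))) (PosDef-sum≥0 (PosDef-* (PosDef-pow W p) (PosDef-* V H))) ⟩
  sumᶻ (𝔾 n) (λ x → powᶻ (w x) p *ᶻ (u x *ᶻ h x)) +ᶻ sumᶻ (𝔾 n) (λ x → powᶻ (w x) p *ᶻ (v x *ᶻ h x))
                                                   ≡⟨ ℤΣ.sum-+ (𝔾 n) _ _ ⟨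
  sumᶻ (𝔾 n) (λ x → powᶻ (w x) p *ᶻ (u x *ᶻ h x) +ᶻ powᶻ (w x) p *ᶻ (v x *ᶻ h x))
                                                   ≡⟨ ℤΣ.sum-cong (𝔾 n) (λ x → collect α (g x) (powᶻ (w x) p) (h x)) ⟩
  sumᶻ (𝔾 n) (λ x → powᶻ (w x) (suc p) *ᶻ h x)  ∎
  where
  open ℤₚ.≤-Reasoning
  u v w : 𝔽₂^ n → ℤ
  u x = (α +ᶻ α) *ᶻ g x
  v x = α *ᶻ α +ᶻ g x *ᶻ g x
  w x = (g x +ᶻ α) *ᶻ (g x +ᶻ α)
  U : PosDef u
  U = PosDef-* (PosDef-const (α +ᶻ α) (ℤₚ.+-mono-≤ α≥0 α≥0)) G
  V : PosDef v
  V = PosDef-+ (PosDef-const (α *ᶻ α) (*ᶻ-nonneg α≥0 α≥0)) (PosDef-* G G)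
  W : PosDef w
  W = PosDef-* (PosDef-+ G (PosDef-const α α≥0)) (PosDef-+ G (PosDef-const α α≥0))
  PosDef-pow : {f : 𝔽₂^ n → ℤ} → PosDef f → ∀ p → PosDef (λ x → powᶻ (f x) p)
  PosDef-pow F zero    = PosDef-const 1ℤ (pos-nonneg 1)
  PosDef-pow F (suc p) = PosDef-* F (PosDef-pow F p)
  rot : ∀ a b c → (a *ᶻ b) *ᶻ c ≡ b *ᶻ (a *ᶻ c)
  rot = ℤ-Solver.solve-∀
  collect : ∀ α g P h → P *ᶻ (((α +ᶻ α) *ᶻ g) *ᶻ h) +ᶻ P *ᶻ ((α *ᶻ α +ᶻ g *ᶻ g) *ᶻ h)
    ≡ (((g +ᶻ α) *ᶻ (g +ᶻ α)) *ᶻ P) *ᶻ h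
  collect = ℤ-Solver.solve-∀

-- Sifting

^-2≡* : ∀ a → a ^ 2 ≡ a * a
^-2≡* a = cong (a *_) (*-identityʳ a)

*-^ : ∀ a b k → (a * b) ^ k ≡ a ^ k * b ^ k
*-^ a b zero    = refl
*-^ a b (suc k) = trans (cong (a * b *_) (*-^ a b k)) (lem a b (a ^ k) (b ^ k))
  where
  lem : ∀ a b c d → a * b * (c * d) ≡ a * c * (b * d)
  lem = solve-∀

^-pos : ∀ {a} k → 0 < a → 0 < a ^ k
^-pos {suc a} k _ = m^n>0 (suc a) k

*-cancelˡ-≤′ : ∀ {a b c} → 0 < a → a * b ≤ a * c → b ≤ c
*-cancelˡ-≤′ {suc a} _ = *-cancelˡ-≤ (suc a)

*-cancelˡ-<′ : ∀ {b c} a → a * b < a * c → b < c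
*-cancelˡ-<′ {b} {c} a = *-cancelˡ-< a b c

square-cancel-≤ : ∀ {a b} → a * a ≤ b * b → a ≤ b
square-cancel-≤ {a} {b} le with a ≤? b
... | yes p = p
... | no ¬p = ⊥-elim (<⇒≱ (*-mono-< (≰⇒> ¬p) (≰⇒> ¬p)) le)

powᶻ-+ : ∀ a k l → powᶻ a (k + l) ≡ powᶻ a k *ᶻ powᶻ a l
powᶻ-+ a zero    l = sym (ℤₚ.*-identityˡ _)
powᶻ-+ a (suc k) l = trans (cong (a *ᶻ_) (powᶻ-+ a k l)) (sym (ℤₚ.*-assoc a _ _))

powᶻ-* : ∀ a b k → powᶻ a k *ᶻ powᶻ b k ≡ powᶻ (a *ᶻ b) k
powᶻ-* a b zero    = refl
powᶻ-* a b (suc k) = trans (lem a b (powᶻ a k) (powᶻ b k)) (cong ((a *ᶻ b) *ᶻ_) (powᶻ-* a b k))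
  where
  lem : ∀ a b c d → (a *ᶻ c) *ᶻ (b *ᶻ d) ≡ (a *ᶻ b) *ᶻ (c *ᶻ d)
  lem = ℤ-Solver.solve-∀

powᶻ-pos : ∀ a k → powᶻ (pos a) k ≡ pos (a ^ k)
powᶻ-pos a zero    = refl
powᶻ-pos a (suc k) = trans (cong (pos a *ᶻ_) (powᶻ-pos a k)) (sym (ℤₚ.pos-* a (a ^ k)))

-- Reduces a comparison of exponentials to one computation at the threshold `T₀`.
ratio-^ : ∀ a b c T₀ T → T₀ ≤ T → c * a ^ T₀ ≤ b ^ T₀ → a ≤ b → c * a ^ T ≤ b ^ T
ratio-^ a b c T₀ T T₀≤T base a≤b = begin
  c * a ^ T  ≡⟨ cong (λ t → c * a ^ t) (m+[n∸m]≡n T₀≤T) ⟨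
  c * a ^ (T₀ + u)  ≡⟨ trans (cong (c *_) (^-distribˡ-+-* a T₀ u)) (sym (*-assoc c (a ^ T₀) _)) ⟩
  c * a ^ T₀ * a ^ u  ≤⟨ *-mono-≤ base (^-monoˡ-≤ u a≤b) ⟩
  b ^ T₀ * b ^ u  ≡⟨ ^-distribˡ-+-* b T₀ u ⟨
  b ^ (T₀ + u)  ≡⟨ cong (b ^_) (m+[n∸m]≡n T₀≤T) ⟩
  b ^ T  ∎
  where
  open ≤-Reasoning
  u = T ∸ T₀

module Representation {n : ℕ} (A : 𝔽₂^ n → Bool) where

  private
    G = 𝔾 n

  q a : ℕ
  q = 2 ^ n
  a = count A

  r : 𝔽₂^ n → ℕ
  r x = sum G (λ y → ι (A y) * ι (A (y ⊕ x)))

  q>0 : 0 < q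
  q>0 = m^n>0 2 n

  balanced : 𝔽₂^ n → ℤ
  balanced y = pos q *ᶻ pos (ι (A y)) -ᶻ pos a

  -- The balanced function qA − a has autocorrelation q(qr − a²).
  autocorrelation-balanced : ∀ x → pos q *ᶻ conv balanced balanced x +ᶻ pos (q * q * (a * a)) ≡ pos (q * q * (q * r x))
  autocorrelation-balanced x = begin
    pos q *ᶻ conv balanced balanced x +ᶻ pos (q * q * (a * a))
      ≡⟨ cong (λ t → pos q *ᶻ t +ᶻ pos (q * q * (a * a))) (ℤΣ.sum-cong G λ y → expand-balanced (pos q) (pos a) (pos (ι (A y))) (pos (ι (A (y ⊕ x))))) ⟩
    pos q *ᶻ sumᶻ G (λ y → (pos q *ᶻ pos q) *ᶻ (I y *ᶻ J y) +ᶻ ((-ᶻ (pos q *ᶻ pos a)) *ᶻ I y +ᶻ ((-ᶻ (pos q *ᶻ pos a)) *ᶻ J y +ᶻ pos a *ᶻ pos a))) +ᶻ pos (q * q * (a * a))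
      ≡⟨ cong (λ t → pos q *ᶻ t +ᶻ pos (q * q * (a * a)))
          (trans (ℤΣ.sum-+ G _ _) (cong₂ _+ᶻ_ (ℤΣ.sum-*ˡ G (pos q *ᶻ pos q) (λ y → I y *ᶻ J y)) (trans (ℤΣ.sum-+ G _ _) (cong₂ _+ᶻ_ (ℤΣ.sum-*ˡ G (-ᶻ (pos q *ᶻ pos a)) I)
            (trans (ℤΣ.sum-+ G _ _) (cong₂ _+ᶻ_ (ℤΣ.sum-*ˡ G (-ᶻ (pos q *ᶻ pos a)) J) refl)))))) ⟩
    pos q *ᶻ ((pos q *ᶻ pos q) *ᶻ sumᶻ G (λ y → I y *ᶻ J y) +ᶻ ((-ᶻ (pos q *ᶻ pos a)) *ᶻ sumᶻ G I +ᶻ ((-ᶻ (pos q *ᶻ pos a)) *ᶻ sumᶻ G J +ᶻ sumᶻ G (λ _ → pos a *ᶻ pos a)))) +ᶻ pos (q * q * (a * a))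
      ≡⟨ cong (λ t → pos q *ᶻ t +ᶻ pos (q * q * (a * a)))
          (cong₂ _+ᶻ_ (cong ((pos q *ᶻ pos q) *ᶻ_) ΣIJ) (cong₂ _+ᶻ_ (cong ((-ᶻ (pos q *ᶻ pos a)) *ᶻ_) ΣI)
            (cong₂ _+ᶻ_ (cong ((-ᶻ (pos q *ᶻ pos a)) *ᶻ_) (trans (ℤΣ.sum-shiftʳ x I) ΣI)) Σa))) ⟩
    pos q *ᶻ ((pos q *ᶻ pos q) *ᶻ pos (r x) +ᶻ ((-ᶻ (pos q *ᶻ pos a)) *ᶻ pos a +ᶻ ((-ᶻ (pos q *ᶻ pos a)) *ᶻ pos a +ᶻ pos q *ᶻ (pos a *ᶻ pos a)))) +ᶻ pos (q * q * (a * a))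
      ≡⟨ cong (pos q *ᶻ ((pos q *ᶻ pos q) *ᶻ pos (r x) +ᶻ ((-ᶻ (pos q *ᶻ pos a)) *ᶻ pos a +ᶻ ((-ᶻ (pos q *ᶻ pos a)) *ᶻ pos a +ᶻ pos q *ᶻ (pos a *ᶻ pos a)))) +ᶻ_)
           (trans (ℤₚ.pos-* (q * q) (a * a)) (cong₂ _*ᶻ_ (ℤₚ.pos-* q q) (ℤₚ.pos-* a a))) ⟩
    pos q *ᶻ ((pos q *ᶻ pos q) *ᶻ pos (r x) +ᶻ ((-ᶻ (pos q *ᶻ pos a)) *ᶻ pos a +ᶻ ((-ᶻ (pos q *ᶻ pos a)) *ᶻ pos a +ᶻ pos q *ᶻ (pos a *ᶻ pos a)))) +ᶻ (pos q *ᶻ pos q) *ᶻ (pos a *ᶻ pos a)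
      ≡⟨ finish (pos q) (pos a) (pos (r x)) ⟩
    (pos q *ᶻ pos q) *ᶻ (pos q *ᶻ pos (r x))
      ≡⟨ trans (ℤₚ.pos-* (q * q) (q * r x)) (cong₂ _*ᶻ_ (ℤₚ.pos-* q q) (ℤₚ.pos-* q (r x))) ⟨
    pos (q * q * (q * r x)) ∎
    where
    open ≡-Reasoning
    I J : 𝔽₂^ n → ℤ
    I y = pos (ι (A y))
    J y = pos (ι (A (y ⊕ x)))
    expand-balanced : ∀ q a i j → (q *ᶻ i -ᶻ a) *ᶻ (q *ᶻ j -ᶻ a) ≡
      (q *ᶻ q) *ᶻ (i *ᶻ j) +ᶻ ((-ᶻ (q *ᶻ a)) *ᶻ i +ᶻ ((-ᶻ (q *ᶻ a)) *ᶻ j +ᶻ a *ᶻ a))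
    expand-balanced = ℤ-Solver.solve-∀
    ΣIJ : sumᶻ G (λ y → I y *ᶻ J y) ≡ pos (r x)
    ΣIJ = trans (ℤΣ.sum-cong G (λ y → sym (ℤₚ.pos-* (ι (A y)) _))) (sym (pos-sum G _))
    ΣI : sumᶻ G I ≡ pos a
    ΣI = sym (pos-sum G _)
    Σa : sumᶻ G (λ _ → pos a *ᶻ pos a) ≡ pos q *ᶻ (pos a *ᶻ pos a)
    Σa = trans (ℤΣ.sum-cong G (λ _ → sym (ℤₚ.pos-* a a))) (trans (sym (pos-sum G _))
      (trans (cong pos (sum-const-𝔾 n (a * a))) (trans (ℤₚ.pos-* q (a * a)) (cong (pos q *ᶻ_) (ℤₚ.pos-* a a)))))
    finish : ∀ q a r → q *ᶻ ((q *ᶻ q) *ᶻ r +ᶻ ((-ᶻ (q *ᶻ a)) *ᶻ a +ᶻ ((-ᶻ (q *ᶻ a)) *ᶻ a +ᶻ q *ᶻ (a *ᶻ a)))) +ᶻ (q *ᶻ q) *ᶻ (a *ᶻ a)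
      ≡ (q *ᶻ q) *ᶻ (q *ᶻ r)
    finish = ℤ-Solver.solve-∀

  moment-raw : (S : 𝔽₂^ n → Bool) → (∀ x → S x ≡ true → r x ≡ 0) → (p : ℕ) →
    let α = q * q * (a * a) in
    count S * (((α + α) * α) * ((α + α) * α)) ^ p ≤ sum G (λ x → ((q * q * (q * r x)) * (q * q * (q * r x))) ^ (p + p))
  moment-raw S r0 p = ℤ.drop‿+≤+ (begin
    pos (count S * M)  ≡⟨ cong pos (sym (sum-*ʳ G M (ι ∘ S))) ⟩
    pos (sum G (λ x → ι (S x) * M))  ≡⟨ pos-sum G _ ⟩
    sumᶻ G (λ x → pos (ι (S x) * M))  ≤⟨ sumᶻ-mono G term ⟩
    sumᶻ G (λ x → powᶻ ((pos α +ᶻ pos α) *ᶻ g x) (p + p) *ᶻ 1ℤ)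
      ≤⟨ unbalance (PosDef-autocorrelation balanced) (pos α) (pos-nonneg α) (p + p) (PosDef-const 1ℤ (pos-nonneg 1)) ⟩
    sumᶻ G (λ x → powᶻ ((g x +ᶻ pos α) *ᶻ (g x +ᶻ pos α)) (p + p) *ᶻ 1ℤ)
      ≡⟨ ℤΣ.sum-cong G (λ x → trans (ℤₚ.*-identityʳ _) (trans (cong (λ t → powᶻ (t *ᶻ t) (p + p)) (autocorrelation-balanced x))
           (trans (cong (λ t → powᶻ t (p + p)) (sym (ℤₚ.pos-* (R x) (R x)))) (powᶻ-pos (R x * R x) (p + p))))) ⟩
    sumᶻ G (λ x → pos ((R x * R x) ^ (p + p)))  ≡⟨ pos-sum G _ ⟨
    pos (sum G (λ x → (R x * R x) ^ (p + p)))  ∎)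
    where
    open ℤₚ.≤-Reasoning
    α = q * q * (a * a)
    β = (α + α) * α
    M = (β * β) ^ p
    R : 𝔽₂^ n → ℕ
    R x = q * q * (q * r x)
    g : 𝔽₂^ n → ℤ
    g x = pos q *ᶻ conv balanced balanced x
    sq : ∀ i → powᶻ i (p + p) ≡ powᶻ i p *ᶻ powᶻ i p
    sq i = powᶻ-+ i p p
    solveg : ∀ g α → g +ᶻ α ≡ 0ℤ → g ≡ -ᶻ α
    solveg g α eq = trans (lem g α) (trans (cong (_+ᶻ (-ᶻ α)) eq) (ℤₚ.+-identityˡ _))
      where
      lem : ∀ g α → g ≡ (g +ᶻ α) +ᶻ (-ᶻ α)
      lem = ℤ-Solver.solve-∀
    neg² : ∀ α → ((α +ᶻ α) *ᶻ (-ᶻ α)) *ᶻ ((α +ᶻ α) *ᶻ (-ᶻ α)) ≡ ((α +ᶻ α) *ᶻ α) *ᶻ ((α +ᶻ α) *ᶻ α)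
    neg² = ℤ-Solver.solve-∀
    term : ∀ x → pos (ι (S x) * M) ≤ᶻ powᶻ ((pos α +ᶻ pos α) *ᶻ g x) (p + p) *ᶻ 1ℤ
    term x with S x in Sx
    ... | false = subst (0ℤ ≤ᶻ_) (sym (trans (ℤₚ.*-identityʳ _) (sq ((pos α +ᶻ pos α) *ᶻ g x)))) (square-nonneg (powᶻ ((pos α +ᶻ pos α) *ᶻ g x) p))
    ... | true  = ℤₚ.≤-reflexive (sym (begin-equality
      powᶻ ((pos α +ᶻ pos α) *ᶻ g x) (p + p) *ᶻ 1ℤ  ≡⟨ trans (ℤₚ.*-identityʳ _) (sq ((pos α +ᶻ pos α) *ᶻ g x)) ⟩
      powᶻ ((pos α +ᶻ pos α) *ᶻ g x) p *ᶻ powᶻ ((pos α +ᶻ pos α) *ᶻ g x) p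
        ≡⟨ trans (powᶻ-* ((pos α +ᶻ pos α) *ᶻ g x) ((pos α +ᶻ pos α) *ᶻ g x) p) (cong (λ t → powᶻ (((pos α +ᶻ pos α) *ᶻ t) *ᶻ ((pos α +ᶻ pos α) *ᶻ t)) p) gx) ⟩
      powᶻ (((pos α +ᶻ pos α) *ᶻ (-ᶻ pos α)) *ᶻ ((pos α +ᶻ pos α) *ᶻ (-ᶻ pos α))) p
        ≡⟨ cong (λ t → powᶻ t p) (trans (neg² (pos α)) (sym (trans (ℤₚ.pos-* β β) (cong₂ _*ᶻ_ β≡ β≡)))) ⟩
      powᶻ (pos (β * β)) p  ≡⟨ powᶻ-pos (β * β) p ⟩
      pos M  ≡⟨ cong pos (sym (+-identityʳ M)) ⟩
      pos (M + 0)  ∎))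
      where
      β≡ : pos β ≡ (pos α +ᶻ pos α) *ᶻ pos α
      β≡ = trans (ℤₚ.pos-* (α + α) α) (cong (_*ᶻ pos α) (ℤₚ.pos-+ α α))
      gx : g x ≡ -ᶻ pos α
      gx = solveg (g x) (pos α) (trans (autocorrelation-balanced x)
        (cong pos (trans (cong (λ t → q * q * (q * t)) (r0 x Sx)) (trans (cong (q * q *_) (*-zeroʳ q)) (*-zeroʳ (q * q))))))

  -- With `p` equal to `2 * T`, the gain 16^T over the mean exceeds the loss 2^T from the density of
  -- `S`, leaving 8^T. In other words, the norm of order `8 * T` of the representation count is at
  -- least 8^(1/8) times its mean, and 8^(1/8) exceeds the popularity threshold 5/4.
  moment : (S : 𝔽₂^ n → Bool) → (∀ x → S x ≡ true → r x ≡ 0) → (T : ℕ) → q ≤ count S * 2 ^ T →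
    q * (8 ^ T * (a * a) ^ (8 * T)) ≤ sum G (λ x → (q * r x) ^ (8 * T))
  moment S r0 T dens = *-cancelˡ-≤′ (^-pos (8 * T) (*-mono-< q>0 q>0)) (*-cancelˡ-≤′ (m^n>0 2 T) (begin
    2 ^ T * (Q * (q * (8 ^ T * (a * a) ^ (8 * T))))  ≡⟨ rearr (2 ^ T) Q q (8 ^ T) _ ⟩
    q * ((2 ^ T * 8 ^ T) * (Q * (a * a) ^ (8 * T)))  ≡⟨ cong₂ (λ u v → q * (u * v)) (sym (*-^ 2 8 T)) (sym (*-^ (q * q) (a * a) (8 * T))) ⟩
    q * (16 ^ T * α ^ (8 * T))  ≤⟨ *-monoˡ-≤ _ dens ⟩
    count S * 2 ^ T * (16 ^ T * α ^ (8 * T))  ≡⟨ rot (count S) (2 ^ T) _ ⟩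
    2 ^ T * (count S * (16 ^ T * α ^ (8 * T)))  ≡⟨ cong (λ t → 2 ^ T * (count S * t)) (sym Mp) ⟩
    2 ^ T * (count S * (β * β) ^ (T + T))  ≤⟨ *-monoʳ-≤ (2 ^ T) (moment-raw S r0 (T + T)) ⟩
    2 ^ T * sum G (λ x → (R x * R x) ^ ((T + T) + (T + T)))
      ≡⟨ cong (2 ^ T *_) (trans (sum-cong G Rp) (sum-*ˡ G Q _)) ⟩
    2 ^ T * (Q * sum G (λ x → (q * r x) ^ (8 * T)))  ∎))
    where
    open ≤-Reasoning
    α = q * q * (a * a)
    β = (α + α) * α
    Q = (q * q) ^ (8 * T)
    R : 𝔽₂^ n → ℕ
    R x = q * q * (q * r x)
    rearr : ∀ t Q q e w → t * (Q * (q * (e * w))) ≡ q * ((t * e) * (Q * w))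
    rearr = solve-∀
    rot : ∀ a b c → a * b * c ≡ b * (a * c)
    rot = solve-∀
    expo : ∀ T → 2 * (T + T + (T + T)) ≡ 8 * T
    expo = solve-∀
    Rp : ∀ x → (R x * R x) ^ ((T + T) + (T + T)) ≡ Q * (q * r x) ^ (8 * T)
    Rp x = trans (cong (_^ ((T + T) + (T + T))) (sym (^-2≡* (R x))))
      (trans (^-*-assoc (R x) 2 ((T + T) + (T + T))) (trans (cong (R x ^_) (expo T)) (*-^ (q * q) (q * r x) (8 * T))))
    β² : ∀ α → ((α + α) * α) * ((α + α) * α) ≡ 4 * (α * α * (α * α))
    β² = solve-∀
    four : ∀ α → α * α * (α * α) ≡ α * (α * (α * (α * 1)))
    four = solve-∀
    e4 : ∀ T → 4 * (T + T) ≡ 8 * T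
    e4 = solve-∀
    e2 : ∀ T → T + T ≡ 2 * T
    e2 = solve-∀
    Mp : (β * β) ^ (T + T) ≡ 16 ^ T * α ^ (8 * T)
    Mp = begin-equality
      (β * β) ^ (T + T)  ≡⟨ cong (_^ (T + T)) (trans (β² α) (cong (4 *_) (four α))) ⟩
      (4 * α ^ 4) ^ (T + T)  ≡⟨ *-^ 4 (α ^ 4) (T + T) ⟩
      4 ^ (T + T) * (α ^ 4) ^ (T + T)  ≡⟨ cong₂ _*_ (trans (cong (4 ^_) (e2 T)) (sym (^-*-assoc 4 2 T))) (trans (^-*-assoc α 4 (T + T)) (cong (α ^_) (e4 T))) ⟩
      16 ^ T * α ^ (8 * T)  ∎

  -- x is popular if it has at least 5/4 of the average number of representations.
  popular : 𝔽₂^ n → Bool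
  popular x = 5 * (a * a) ≤ᵇ 4 * (q * r x)

  unpopular-< : ∀ x → popular x ≡ false → 4 * (q * r x) < 5 * (a * a)
  unpopular-< x eq with 5 * (a * a) ≤? 4 * (q * r x)
  ... | yes p with () ← trans (sym eq) (Equivalence.to 𝔹ₚ.T-≡ (≤⇒≤ᵇ p))
  ... | no ¬p = ≰⇒> ¬p

  popular-≥ : ∀ x → popular x ≡ true → 5 * (a * a) ≤ 4 * (q * r x)
  popular-≥ x eq = ≤ᵇ⇒≤ _ _ (Equivalence.from 𝔹ₚ.T-≡ eq)

  -- The intersection of the translates of `A` by the entries of the tuple; sifting looks for its
  -- set `C` among these.
  translates : Vec (𝔽₂^ n) k → 𝔽₂^ n → Bool
  translates []      z = true
  translates (w ∷ s) z = A (w ⊕ z) ∧ translates s z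

  sum-translates : ∀ k (z z′ : 𝔽₂^ n) →
    sum (vecs G k) (λ s → ι (translates s z) * ι (translates s z′)) ≡ r (z ⊕ z′) ^ k
  sum-translates k z z′ = begin
    sum (vecs G k) (λ s → ι (translates s z) * ι (translates s z′))  ≡⟨ sum-cong (vecs G k) as-prod ⟩
    sum (vecs G k) (prod f)  ≡⟨ sum-prod G f k ⟩
    pow (sum G f) k  ≡⟨ pow≡^ (sum G f) k ⟩
    sum G f ^ k  ≡⟨ cong (_^ k) Σf ⟩
    r (z ⊕ z′) ^ k  ∎
    where
    open ≡-Reasoning
    f : 𝔽₂^ n → ℕ
    f w = ι (A (w ⊕ z)) * ι (A (w ⊕ z′))
    lem : ∀ a b c d → (a * b) * (c * d) ≡ (a * c) * (b * d)
    lem = solve-∀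
    as-prod : ∀ {k} (s : Vec (𝔽₂^ n) k) → ι (translates s z) * ι (translates s z′) ≡ prod f s
    as-prod []      = refl
    as-prod (w ∷ s) = begin
      ι (A (w ⊕ z) ∧ translates s z) * ι (A (w ⊕ z′) ∧ translates s z′)
        ≡⟨ cong₂ _*_ (ι-∧ (A (w ⊕ z)) _) (ι-∧ (A (w ⊕ z′)) _) ⟩
      (ι (A (w ⊕ z)) * ι (translates s z)) * (ι (A (w ⊕ z′)) * ι (translates s z′))
        ≡⟨ lem (ι (A (w ⊕ z))) (ι (translates s z)) (ι (A (w ⊕ z′))) _ ⟩
      f w * (ι (translates s z) * ι (translates s z′))  ≡⟨ cong (f w *_) (as-prod s) ⟩
      f w * prod f s  ∎
    Σf : sum G f ≡ r (z ⊕ z′)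
    Σf = begin
      sum G f  ≡⟨ sum-shiftʳ z f ⟨
      sum G (λ y → ι (A ((y ⊕ z) ⊕ z)) * ι (A ((y ⊕ z) ⊕ z′)))
        ≡⟨ sum-cong G (λ y → cong₂ (λ u v → ι (A u) * ι (A v)) (⊕-cancelʳ y z) (⊕-assoc y z z′)) ⟩
      r (z ⊕ z′)  ∎

  pairs : (𝔽₂^ n → Bool) → (𝔽₂^ n → ℕ) → ℕ
  pairs C h = sum G (λ z → sum G (λ z′ → h (z ⊕ z′) * (ι (C z) * ι (C z′))))

  sum-pairs-translates : ∀ k (h : 𝔽₂^ n → ℕ) →
    sum (vecs G k) (λ s → pairs (translates s) h) ≡ q * sum G (λ x → h x * r x ^ k)
  sum-pairs-translates k h = begin
    sum V (λ s → sum G (λ z → sum G (λ z′ → h (z ⊕ z′) * (t s z * t s z′))))  ≡⟨ sum-swap V G _ ⟩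
    sum G (λ z → sum V (λ s → sum G (λ z′ → h (z ⊕ z′) * (t s z * t s z′))))  ≡⟨ sum-cong G (λ z → sum-swap V G _) ⟩
    sum G (λ z → sum G (λ z′ → sum V (λ s → h (z ⊕ z′) * (t s z * t s z′))))
      ≡⟨ sum-cong G (λ z → sum-cong G (λ z′ → trans (sum-*ˡ V (h (z ⊕ z′)) _) (cong (h (z ⊕ z′) *_) (sum-translates k z z′)))) ⟩
    sum G (λ z → sum G (λ z′ → h (z ⊕ z′) * r (z ⊕ z′) ^ k))  ≡⟨ sum-cong G (λ z → sum-shift z (λ x → h x * r x ^ k)) ⟩
    sum G (λ z → sum G (λ x → h x * r x ^ k))  ≡⟨ sum-const-𝔾 n _ ⟩
    q * sum G (λ x → h x * r x ^ k)  ∎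
    where
    open ≡-Reasoning
    V = vecs G k
    t : Vec (𝔽₂^ n) k → 𝔽₂^ n → ℕ
    t s z = ι (translates s z)

  pairs-1 : (C : 𝔽₂^ n → Bool) → pairs C (λ _ → 1) ≡ count C * count C
  pairs-1 C = begin
    sum G (λ z → sum G (λ z′ → 1 * (ι (C z) * ι (C z′))))  ≡⟨ sum-cong G (λ z → trans (sum-cong G (λ z′ → *-identityˡ (ι (C z) * ι (C z′)))) (sum-*ˡ G (ι (C z)) _)) ⟩
    sum G (λ z → ι (C z) * count C)  ≡⟨ sum-*ʳ G (count C) _ ⟩
    count C * count C  ∎
    where open ≡-Reasoning

  unpopularity : 𝔽₂^ n → ℕ
  unpopularity x = ι (not (popular x))

  record Sifted (T : ℕ) : Set where
    field
      C      : 𝔽₂^ n → Bool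
      large  : q ≤ count C * 2 ^ (T * (8 * T))
      mostly : 64 * pairs C unpopularity ≤ count C * count C

  -- Averaging over tuples weights a difference `x` by `r x ^ P`. By `moment` the total weight is
  -- far larger than the share of the unpopular differences, so an intersection of random translates
  -- has few unpopular sums.
  sift : (S : 𝔽₂^ n → Bool) → (∀ x → S x ≡ true → r x ≡ 0) → (T : ℕ) → 20 ≤ T →
    q ≤ count S * 2 ^ T → q ≤ a * 2 ^ T → Sifted T
  sift S r0 T T≥20 densS densA = record { C = translates s ; large = large ; mostly = mostly }
    where
    open ≤-Reasoning
    P = 8 * T
    V = vecs G P
    Q = q ^ P * q ^ P
    W : (𝔽₂^ n → ℕ) → ℕ
    W h = sum G (λ x → h x * (q * r x) ^ P)
    -- One inequality `f s < g s` serves two purposes: the first summand bounds the unpopular pairs,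
    -- and the second forces the intersection to be as large as expected of `P` random translates of
    -- `A`.
    f g : Vec (𝔽₂^ n) P → ℕ
    f s = 64 * (Q * pairs (translates s) unpopularity) + (a * a) ^ P * (q * q)
    g s = Q * pairs (translates s) (λ _ → 1)

    sum-q : ∀ (h : 𝔽₂^ n → ℕ) → sum V (λ s → Q * pairs (translates s) h) ≡ (q ^ P * q) * W h
    sum-q h = begin-equality
      sum V (λ s → Q * pairs (translates s) h)  ≡⟨ sum-*ˡ V Q _ ⟩
      Q * sum V (λ s → pairs (translates s) h)  ≡⟨ cong (Q *_) (sum-pairs-translates P h) ⟩
      Q * (q * sum G (λ x → h x * r x ^ P))  ≡⟨ rearr (q ^ P) q _ ⟩
      (q ^ P * q) * (q ^ P * sum G (λ x → h x * r x ^ P))  ≡⟨ cong ((q ^ P * q) *_) (trans (sym (sum-*ˡ G (q ^ P) _)) (sum-cong G (λ x → trans (swap3 (q ^ P) (h x) _) (cong (h x *_) (sym (*-^ q (r x) P)))))) ⟩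
      (q ^ P * q) * W h  ∎
      where
      rearr : ∀ u q s → u * u * (q * s) ≡ (u * q) * (u * s)
      rearr = solve-∀
      swap3 : ∀ u h r → u * (h * r) ≡ h * (u * r)
      swap3 = solve-∀

    -- (5/4)^8 is just below 6, so unpopular differences carry at most 6^T where the total is at
    -- least 8^T.
    fiveP : 5 ^ P ≤ 4 ^ P * 6 ^ T
    fiveP = begin
      5 ^ (8 * T)  ≡⟨ ^-*-assoc 5 8 T ⟨
      390625 ^ T  ≤⟨ ^-monoˡ-≤ T (≤ᵇ⇒≤ 390625 393216 _) ⟩
      393216 ^ T  ≡⟨ *-^ 65536 6 T ⟩
      65536 ^ T * 6 ^ T  ≡⟨ cong (_* 6 ^ T) (^-*-assoc 4 8 T) ⟩
      4 ^ (8 * T) * 6 ^ T  ∎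

    W-bad : W unpopularity ≤ q * (6 ^ T * (a * a) ^ P)
    W-bad = *-cancelˡ-≤′ (m^n>0 4 P) (begin
      4 ^ P * W unpopularity  ≡⟨ sum-*ˡ G (4 ^ P) _ ⟨
      sum G (λ x → 4 ^ P * (unpopularity x * (q * r x) ^ P))  ≤⟨ sum-mono G term ⟩
      sum G (λ _ → 5 ^ P * (a * a) ^ P)  ≡⟨ sum-const-𝔾 n _ ⟩
      q * (5 ^ P * (a * a) ^ P)  ≤⟨ *-monoʳ-≤ q (*-monoˡ-≤ ((a * a) ^ P) fiveP) ⟩
      q * (4 ^ P * 6 ^ T * (a * a) ^ P)  ≡⟨ rearr q (4 ^ P) (6 ^ T) _ ⟩
      4 ^ P * (q * (6 ^ T * (a * a) ^ P))  ∎)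
      where
      rearr : ∀ q u v w → q * (u * v * w) ≡ u * (q * (v * w))
      rearr = solve-∀
      term : ∀ x → 4 ^ P * (unpopularity x * (q * r x) ^ P) ≤ 5 ^ P * (a * a) ^ P
      term x with popular x in eq
      ... | true  = ≤-trans (≤-reflexive (*-zeroʳ (4 ^ P))) z≤n
      ... | false = begin
        4 ^ P * (1 * (q * r x) ^ P)  ≡⟨ cong (4 ^ P *_) (*-identityˡ _) ⟩
        4 ^ P * (q * r x) ^ P  ≡⟨ *-^ 4 (q * r x) P ⟨
        (4 * (q * r x)) ^ P  ≤⟨ ^-monoˡ-≤ P (<⇒≤ (unpopular-< x eq)) ⟩
        (5 * (a * a)) ^ P  ≡⟨ *-^ 5 (a * a) P ⟩
        5 ^ P * (a * a) ^ P  ∎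

    a>0 : 0 < a
    a>0 with a in eq
    ... | suc _ = s≤s z≤n
    ... | zero  = ⊥-elim (<⇒≱ q>0 densA)

    eight : 64 * 6 ^ T + 1 < 8 ^ T
    eight = begin-strict
      64 * 6 ^ T + 1  <⟨ +-monoʳ-< (64 * 6 ^ T) (≤-trans (≤ᵇ⇒≤ 2 64 _) (m≤m*n 64 (6 ^ T) {{>-nonZero (m^n>0 6 T)}})) ⟩
      64 * 6 ^ T + 64 * 6 ^ T  ≡⟨ *-distribʳ-+ (6 ^ T) 64 64 ⟨
      -- From exponent 20 on, (8/6)^T exceeds 128; this fixes the lower bound on `T`.
      128 * 6 ^ T  ≤⟨ ratio-^ 6 8 128 20 T T≥20 (≤ᵇ⇒≤ (128 * 6 ^ 20) (8 ^ 20) _) (≤ᵇ⇒≤ 6 8 _) ⟩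
      8 ^ T  ∎

    W< : 64 * W unpopularity + (a * a) ^ P * q < W (λ _ → 1)
    W< = begin-strict
      64 * W unpopularity + (a * a) ^ P * q  ≤⟨ +-monoˡ-≤ _ (*-monoʳ-≤ 64 W-bad) ⟩
      64 * (q * (6 ^ T * (a * a) ^ P)) + (a * a) ^ P * q  ≡⟨ rearr 64 q (6 ^ T) ((a * a) ^ P) ⟩
      q * ((64 * 6 ^ T + 1) * (a * a) ^ P)  <⟨ *-monoʳ-< q {{>-nonZero q>0}} (*-monoˡ-< ((a * a) ^ P) {{>-nonZero (^-pos P (*-mono-< a>0 a>0))}} eight) ⟩
      q * (8 ^ T * (a * a) ^ P)  ≤⟨ moment S r0 T densS ⟩
      sum G (λ x → (q * r x) ^ P)  ≡⟨ sum-cong G (λ x → sym (*-identityˡ _)) ⟩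
      W (λ _ → 1)  ∎
      where
      rearr : ∀ c q u v → c * (q * (u * v)) + v * q ≡ q * ((c * u + 1) * v)
      rearr = solve-∀

    Σf<Σg : sum V f < sum V g
    Σf<Σg = begin-strict
      sum V f
        ≡⟨ trans (sum-+ V _ _) (cong₂ _+_ (trans (sum-*ˡ V 64 _) (cong (64 *_) (sum-q unpopularity)))
             (sum-const-vecs G q P _ (sum-const-𝔾 n))) ⟩
      64 * ((q ^ P * q) * W unpopularity) + q ^ P * ((a * a) ^ P * (q * q))
        ≡⟨ rearr 64 (q ^ P) q (W unpopularity) ((a * a) ^ P) ⟩
      (q ^ P * q) * (64 * W unpopularity + (a * a) ^ P * q)
        <⟨ *-monoʳ-< (q ^ P * q) {{>-nonZero (*-mono-< (^-pos P q>0) q>0)}} W< ⟩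
      (q ^ P * q) * W (λ _ → 1)  ≡⟨ sum-q (λ _ → 1) ⟨
      sum V g  ∎
      where
      rearr : ∀ c u q w z → c * ((u * q) * w) + u * (z * (q * q)) ≡ (u * q) * (c * w + z * q)
      rearr = solve-∀

    found = sum<⇒∃ V Σf<Σg
    s = proj₁ found
    μ = count (translates s)

    fs<gs : 64 * (Q * pairs (translates s) unpopularity) + (a * a) ^ P * (q * q) < Q * (μ * μ)
    fs<gs = <-≤-trans (proj₂ found) (≤-reflexive (cong (Q *_) (pairs-1 (translates s))))

    mostly : 64 * pairs (translates s) unpopularity ≤ μ * μ
    mostly = *-cancelˡ-≤′ (*-mono-< (^-pos P q>0) (^-pos P q>0)) (begin
      Q * (64 * pairs (translates s) unpopularity)  ≡⟨ rot Q 64 _ ⟩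
      64 * (Q * pairs (translates s) unpopularity)  ≤⟨ m≤m+n _ _ ⟩
      _  ≤⟨ <⇒≤ fs<gs ⟩
      Q * (μ * μ)  ∎)
      where
      rot : ∀ a b c → a * (b * c) ≡ b * (a * c)
      rot = solve-∀

    large : q ≤ μ * 2 ^ (T * P)
    large = *-cancelˡ-≤′ (^-pos P q>0) (begin
      q ^ P * q  ≤⟨ *-monoˡ-≤ q (^-monoˡ-≤ P densA) ⟩
      (a * 2 ^ T) ^ P * q  ≡⟨ cong (_* q) (trans (*-^ a (2 ^ T) P) (cong (a ^ P *_) (^-*-assoc 2 T P))) ⟩
      a ^ P * 2 ^ (T * P) * q  ≡⟨ rot (a ^ P) (2 ^ (T * P)) q ⟩
      (a ^ P * q) * 2 ^ (T * P)  ≤⟨ *-monoˡ-≤ (2 ^ (T * P)) (square-cancel-≤ {a ^ P * q} {q ^ P * μ} (begin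
        (a ^ P * q) * (a ^ P * q)  ≡⟨ sq (a ^ P) q ⟩
        (a ^ P * a ^ P) * (q * q)  ≡⟨ cong (_* (q * q)) (*-^ a a P) ⟨
        (a * a) ^ P * (q * q)  ≤⟨ m≤n+m _ _ ⟩
        _  ≤⟨ <⇒≤ fs<gs ⟩
        Q * (μ * μ)  ≡⟨ sq (q ^ P) μ ⟨
        (q ^ P * μ) * (q ^ P * μ)  ∎)) ⟩
      (q ^ P * μ) * 2 ^ (T * P)  ≡⟨ *-assoc (q ^ P) μ _ ⟩
      q ^ P * (μ * 2 ^ (T * P))  ∎)
      where
      rot : ∀ a b c → a * b * c ≡ (a * c) * b
      rot = solve-∀
      sq : ∀ a b → (a * b) * (a * b) ≡ (a * a) * (b * b)
      sq = solve-∀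

-- Almost periodicity

module Variance {X : Set} (xs : List X) (w Y : X → ℤ) (centred : sumᶻ xs (λ x → w x *ᶻ Y x) ≡ 0ℤ) where

  dev : Vec X k → ℤ
  dev []      = 0ℤ
  dev (x ∷ v) = Y x +ᶻ dev v

  W V : ℤ
  W = sumᶻ xs w
  V = sumᶻ xs (λ x → w x *ᶻ (Y x *ᶻ Y x))

  first second : ℕ → ℤ
  first k  = sumᶻ (vecs xs k) (λ v → prodᶻ w v *ᶻ dev v)
  second k = sumᶻ (vecs xs k) (λ v → prodᶻ w v *ᶻ (dev v *ᶻ dev v))

  first≡0 : ∀ k → first k ≡ 0ℤ
  first≡0 zero    = refl
  first≡0 (suc k) = begin
    first (suc k)  ≡⟨ ℤΣ.sum-vecs xs k _ ⟩
    sumᶻ xs (λ x → sumᶻ (vecs xs k) (λ v → (w x *ᶻ prodᶻ w v) *ᶻ (Y x +ᶻ dev v)))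
      ≡⟨ ℤΣ.sum-cong xs (λ x → trans (ℤΣ.sum-cong (vecs xs k) (λ v → expand (w x) (Y x) (prodᶻ w v) (dev v)))
           (trans (ℤΣ.sum-+ (vecs xs k) _ _) (cong₂ _+ᶻ_ (ℤΣ.sum-*ˡ (vecs xs k) (w x *ᶻ Y x) (prodᶻ w)) (ℤΣ.sum-*ˡ (vecs xs k) (w x) (λ v → prodᶻ w v *ᶻ dev v))))) ⟩
    sumᶻ xs (λ x → (w x *ᶻ Y x) *ᶻ sumᶻ (vecs xs k) (prodᶻ w) +ᶻ w x *ᶻ first k)
      ≡⟨ trans (ℤΣ.sum-+ xs _ _) (cong₂ _+ᶻ_ (ℤΣ.sum-*ʳ xs _ (λ x → w x *ᶻ Y x)) (ℤΣ.sum-*ʳ xs (first k) w)) ⟩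
    sumᶻ xs (λ x → w x *ᶻ Y x) *ᶻ sumᶻ (vecs xs k) (prodᶻ w) +ᶻ W *ᶻ first k
      ≡⟨ cong₂ (λ s t → s *ᶻ sumᶻ (vecs xs k) (prodᶻ w) +ᶻ W *ᶻ t) centred (first≡0 k) ⟩
    0ℤ *ᶻ sumᶻ (vecs xs k) (prodᶻ w) +ᶻ W *ᶻ 0ℤ  ≡⟨ zeros (sumᶻ (vecs xs k) (prodᶻ w)) W ⟩
    0ℤ  ∎
    where
    open ≡-Reasoning
    expand : ∀ w y p d → (w *ᶻ p) *ᶻ (y +ᶻ d) ≡ (w *ᶻ y) *ᶻ p +ᶻ w *ᶻ (p *ᶻ d)
    expand = ℤ-Solver.solve-∀
    zeros : ∀ s w → 0ℤ *ᶻ s +ᶻ w *ᶻ 0ℤ ≡ 0ℤ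
    zeros = ℤ-Solver.solve-∀

  second-suc : ∀ k → second (suc k) ≡ V *ᶻ powᶻ W k +ᶻ W *ᶻ second k
  second-suc k = begin
    second (suc k)  ≡⟨ ℤΣ.sum-vecs xs k _ ⟩
    sumᶻ xs (λ x → sumᶻ (vecs xs k) (λ v → (w x *ᶻ prodᶻ w v) *ᶻ ((Y x +ᶻ dev v) *ᶻ (Y x +ᶻ dev v))))
      ≡⟨ ℤΣ.sum-cong xs (λ x → trans (ℤΣ.sum-cong (vecs xs k) (λ v → expand (w x) (Y x) (prodᶻ w v) (dev v)))
           (trans (ℤΣ.sum-+ (vecs xs k) _ _) (cong₂ _+ᶻ_ (ℤΣ.sum-*ˡ (vecs xs k) (w x *ᶻ (Y x *ᶻ Y x)) (prodᶻ w))
             (trans (ℤΣ.sum-+ (vecs xs k) _ _) (cong₂ _+ᶻ_ (ℤΣ.sum-*ˡ (vecs xs k) (w x *ᶻ Y x +ᶻ w x *ᶻ Y x) (λ v → prodᶻ w v *ᶻ dev v))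
               (ℤΣ.sum-*ˡ (vecs xs k) (w x) (λ v → prodᶻ w v *ᶻ (dev v *ᶻ dev v)))))))) ⟩
    sumᶻ xs (λ x → (w x *ᶻ (Y x *ᶻ Y x)) *ᶻ Π +ᶻ ((w x *ᶻ Y x +ᶻ w x *ᶻ Y x) *ᶻ first k +ᶻ w x *ᶻ second k))
      ≡⟨ ℤΣ.sum-cong xs (λ x → cong (λ t → (w x *ᶻ (Y x *ᶻ Y x)) *ᶻ Π +ᶻ ((w x *ᶻ Y x +ᶻ w x *ᶻ Y x) *ᶻ t +ᶻ w x *ᶻ second k)) (first≡0 k)) ⟩
    sumᶻ xs (λ x → (w x *ᶻ (Y x *ᶻ Y x)) *ᶻ Π +ᶻ ((w x *ᶻ Y x +ᶻ w x *ᶻ Y x) *ᶻ 0ℤ +ᶻ w x *ᶻ second k))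
      ≡⟨ ℤΣ.sum-cong xs (λ x → drop0 (w x *ᶻ (Y x *ᶻ Y x)) Π (w x *ᶻ Y x +ᶻ w x *ᶻ Y x) (w x *ᶻ second k)) ⟩
    sumᶻ xs (λ x → (w x *ᶻ (Y x *ᶻ Y x)) *ᶻ Π +ᶻ w x *ᶻ second k)
      ≡⟨ trans (ℤΣ.sum-+ xs _ _) (cong₂ _+ᶻ_ (ℤΣ.sum-*ʳ xs Π _) (ℤΣ.sum-*ʳ xs (second k) w)) ⟩
    V *ᶻ Π +ᶻ W *ᶻ second k  ≡⟨ cong (λ t → V *ᶻ t +ᶻ W *ᶻ second k) (ℤΣ.sum-prod xs w k) ⟩
    V *ᶻ powᶻ W k +ᶻ W *ᶻ second k  ∎
    where
    open ≡-Reasoning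
    Π = sumᶻ (vecs xs k) (prodᶻ w)
    expand : ∀ w y p d → (w *ᶻ p) *ᶻ ((y +ᶻ d) *ᶻ (y +ᶻ d)) ≡
      (w *ᶻ (y *ᶻ y)) *ᶻ p +ᶻ ((w *ᶻ y +ᶻ w *ᶻ y) *ᶻ (p *ᶻ d) +ᶻ w *ᶻ (p *ᶻ (d *ᶻ d)))
    expand = ℤ-Solver.solve-∀
    drop0 : ∀ a p b c → a *ᶻ p +ᶻ (b *ᶻ 0ℤ +ᶻ c) ≡ a *ᶻ p +ᶻ c
    drop0 = ℤ-Solver.solve-∀

  -- Cross terms vanish because `Y` is centred, so each sample contributes one `V` and the others
  -- contribute `W`. The factor `W` on the left avoids the exponent k - 1.
  variance : ∀ k → second k *ᶻ W ≡ (pos k *ᶻ V) *ᶻ powᶻ W k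
  variance zero    = zeros W V
    where
    zeros : ∀ w v → (1ℤ *ᶻ (0ℤ *ᶻ 0ℤ) +ᶻ 0ℤ) *ᶻ w ≡ (0ℤ *ᶻ v) *ᶻ 1ℤ
    zeros = ℤ-Solver.solve-∀
  variance (suc k) = begin
    second (suc k) *ᶻ W  ≡⟨ cong (_*ᶻ W) (second-suc k) ⟩
    (V *ᶻ powᶻ W k +ᶻ W *ᶻ second k) *ᶻ W  ≡⟨ rearr V (powᶻ W k) W (second k) ⟩
    V *ᶻ (W *ᶻ powᶻ W k) +ᶻ W *ᶻ (second k *ᶻ W)  ≡⟨ cong (λ t → V *ᶻ (W *ᶻ powᶻ W k) +ᶻ W *ᶻ t) (variance k) ⟩
    V *ᶻ (W *ᶻ powᶻ W k) +ᶻ W *ᶻ ((pos k *ᶻ V) *ᶻ powᶻ W k)  ≡⟨ collect V (powᶻ W k) W (pos k) ⟩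
    ((1ℤ +ᶻ pos k) *ᶻ V) *ᶻ (W *ᶻ powᶻ W k)  ∎
    where
    open ≡-Reasoning
    rearr : ∀ v p w s → (v *ᶻ p +ᶻ w *ᶻ s) *ᶻ w ≡ v *ᶻ (w *ᶻ p) +ᶻ w *ᶻ (s *ᶻ w)
    rearr = ℤ-Solver.solve-∀
    collect : ∀ v p w k → v *ᶻ (w *ᶻ p) +ᶻ w *ᶻ ((k *ᶻ v) *ᶻ p) ≡ ((1ℤ +ᶻ k) *ᶻ v) *ᶻ (w *ᶻ p)
    collect = ℤ-Solver.solve-∀

∧-≤ᵇ : ∀ p q r s → (p ≤ᵇ q) ∧ (r ≤ᵇ s) ≡ true → p ≤ q × r ≤ s
∧-≤ᵇ p q r s eq = ≤ᵇ⇒≤ p q (Equivalence.from 𝔹ₚ.T-≡ (𝔹ₚ.∧-conicalˡ (p ≤ᵇ q) _ eq))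
  , ≤ᵇ⇒≤ r s (Equivalence.from 𝔹ₚ.T-≡ (𝔹ₚ.∧-conicalʳ (p ≤ᵇ q) _ eq))

square-gap : ∀ {p q s} → q + s ≤ p → pos (s * s) ≤ᶻ (pos p -ᶻ pos q) *ᶻ (pos p -ᶻ pos q)
square-gap {p} {q} {s} le = subst (λ t → pos (s * s) ≤ᶻ (pos t -ᶻ pos q) *ᶻ (pos t -ᶻ pos q)) (m+[n∸m]≡n le)
  (subst (pos (s * s) ≤ᶻ_) (sym eq) (ℤ.+≤+ (*-mono-≤ (m≤m+n s d) (m≤m+n s d))))
  where
  d = p ∸ (q + s)
  cancel : ∀ q s d → (q +ᶻ s +ᶻ d) -ᶻ q ≡ s +ᶻ d
  cancel = ℤ-Solver.solve-∀
  diff : pos (q + s + d) -ᶻ pos q ≡ pos (s + d)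
  diff = trans (cong (_-ᶻ pos q) (trans (ℤₚ.pos-+ (q + s) d) (cong (_+ᶻ pos d) (ℤₚ.pos-+ q s))))
    (trans (cancel (pos q) (pos s) (pos d)) (sym (ℤₚ.pos-+ s d)))
  eq : (pos (q + s + d) -ᶻ pos q) *ᶻ (pos (q + s + d) -ᶻ pos q) ≡ pos ((s + d) * (s + d))
  eq = trans (cong₂ _*ᶻ_ diff diff) (sym (ℤₚ.pos-* (s + d) (s + d)))

square-≥-of-far : ∀ h p s t → (h * p ≤ᵇ h * s + t) ∧ (h * s ≤ᵇ h * p + t) ≡ false →
  pos (t * t) ≤ᶻ pos (h * h) *ᶻ ((pos p -ᶻ pos s) *ᶻ (pos p -ᶻ pos s))
square-≥-of-far h p s t far = subst (pos (t * t) ≤ᶻ_) scale gap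
  where
  factor : ∀ h p s → (h *ᶻ p -ᶻ h *ᶻ s) *ᶻ (h *ᶻ p -ᶻ h *ᶻ s) ≡ (h *ᶻ h) *ᶻ ((p -ᶻ s) *ᶻ (p -ᶻ s))
  factor = ℤ-Solver.solve-∀
  scale : (pos (h * p) -ᶻ pos (h * s)) *ᶻ (pos (h * p) -ᶻ pos (h * s)) ≡ pos (h * h) *ᶻ ((pos p -ᶻ pos s) *ᶻ (pos p -ᶻ pos s))
  scale = trans (cong₂ (λ u v → (u -ᶻ v) *ᶻ (u -ᶻ v)) (ℤₚ.pos-* h p) (ℤₚ.pos-* h s))
    (trans (factor (pos h) (pos p) (pos s)) (cong (_*ᶻ ((pos p -ᶻ pos s) *ᶻ (pos p -ᶻ pos s))) (sym (ℤₚ.pos-* h h))))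
  flip : ∀ p q → (q -ᶻ p) *ᶻ (q -ᶻ p) ≡ (p -ᶻ q) *ᶻ (p -ᶻ q)
  flip = ℤ-Solver.solve-∀
  gap : pos (t * t) ≤ᶻ (pos (h * p) -ᶻ pos (h * s)) *ᶻ (pos (h * p) -ᶻ pos (h * s))
  gap with h * p ≤? h * s + t | h * s ≤? h * p + t
  ... | no ¬p  | _      = square-gap {h * p} {h * s} (<⇒≤ (≰⇒> ¬p))
  ... | yes _  | no ¬p  = subst (pos (t * t) ≤ᶻ_) (flip (pos (h * p)) (pos (h * s))) (square-gap {h * s} {h * p} (<⇒≤ (≰⇒> ¬p)))
  ... | yes le | yes le′ = contradiction (trans (sym far) (cong₂ _∧_ (Equivalence.to 𝔹ₚ.T-≡ (≤⇒≤ᵇ le)) (Equivalence.to 𝔹ₚ.T-≡ (≤⇒≤ᵇ le′)))) λ ()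

square-difference-≤ : ∀ {p q s} → p ≤ s → q ≤ s → (pos p -ᶻ pos q) *ᶻ (pos p -ᶻ pos q) ≤ᶻ pos (s * s)
square-difference-≤ {p} {q} {s} p≤s q≤s with ≤-total q p
... | inj₁ q≤p = subst (λ t → t *ᶻ t ≤ᶻ pos (s * s)) (sym (trans (ℤₚ.m-n≡m⊖n p q) (ℤₚ.⊖-≥ q≤p)))
  (subst (_≤ᶻ pos (s * s)) (ℤₚ.pos-* (p ∸ q) (p ∸ q)) (ℤ.+≤+ (*-mono-≤ p∸q≤s p∸q≤s)))
  where
  p∸q≤s : p ∸ q ≤ s
  p∸q≤s = ≤-trans (m∸n≤m p q) p≤s
... | inj₂ p≤q = subst (_≤ᶻ pos (s * s)) (flip (pos p) (pos q))
  (subst (λ t → t *ᶻ t ≤ᶻ pos (s * s)) (sym (trans (ℤₚ.m-n≡m⊖n q p) (ℤₚ.⊖-≥ p≤q)))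
    (subst (_≤ᶻ pos (s * s)) (ℤₚ.pos-* (q ∸ p) (q ∸ p)) (ℤ.+≤+ (*-mono-≤ q∸p≤s q∸p≤s))))
  where
  q∸p≤s : q ∸ p ≤ s
  q∸p≤s = ≤-trans (m∸n≤m q p) q≤s
  flip : ∀ p q → (q -ᶻ p) *ᶻ (q -ᶻ p) ≡ (p -ᶻ q) *ᶻ (p -ᶻ q)
  flip = ℤ-Solver.solve-∀

sum-const-tuples : (n b K c : ℕ) → sum (vecs (vecs (𝔾 n) b) K) (λ _ → c) ≡ ((2 ^ n) ^ b) ^ K * c
sum-const-tuples n b K c = sum-const-vecs (vecs (𝔾 n) b) ((2 ^ n) ^ b) K c (λ d → sum-const-vecs (𝔾 n) (2 ^ n) b d (sum-const-𝔾 n))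

-- Croot–Sisask almost periodicity with a median of means: b samples per block
-- make a block accurate with probability 63/64 by Chebyshev, and the majority
-- of K blocks is then accurate except with probability 4^-K.
module Sampling {n : ℕ} (C D : 𝔽₂^ n → Bool) (h b K : ℕ) (h>0 : 0 < h) (b≥ : 64 * (h * h) ≤ b)
  (C>0 : 0 < count C) where

  private
    G = 𝔾 n
    q = 2 ^ n
    Block = Vec (𝔽₂^ n) b
    blocks = vecs G b
    tuples = vecs blocks K

  μ : ℕ
  μ = count C

  g : 𝔽₂^ n → ℕ
  g x = sum G (λ c → ι (C c) * ι (D (x ⊕ c)))

  g≤μ : ∀ x → g x ≤ μ
  g≤μ x = sum-mono G (λ c → ≤-trans (*-monoʳ-≤ (ι (C c)) (ι≤1 (D (x ⊕ c)))) (≤-reflexive (*-identityʳ _)))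

  hits : Vec (𝔽₂^ n) k → ℕ
  hits []      = 0
  hits (z ∷ v) = ι (D z) + hits v

  -- After division by `h * b * μ`: the frequency of `D` in the block differs from `val / μ` by at
  -- most `1 / h`.
  close : ℕ → Block → Bool
  close val v = (h * (μ * hits v) ≤ᵇ h * (b * val) + b * μ) ∧ (h * (b * val) ≤ᵇ h * (μ * hits v) + b * μ)

  wt : Vec (𝔽₂^ n) k → ℕ
  wt = prod (ι ∘ C)

  module _ (x : 𝔽₂^ n) where

    Y : 𝔽₂^ n → ℤ
    Y c = pos (μ * ι (D (x ⊕ c))) -ᶻ pos (g x)

    centred : sumᶻ G (λ c → pos (ι (C c)) *ᶻ Y c) ≡ 0ℤ
    centred = begin
      sumᶻ G (λ c → pos (ι (C c)) *ᶻ Y c)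
        ≡⟨ ℤΣ.sum-cong G (λ c → trans (cong (λ t → pos (ι (C c)) *ᶻ (t -ᶻ pos (g x))) (ℤₚ.pos-* μ _))
             (trans (expand (pos (ι (C c))) (pos μ) (pos (ι (D (x ⊕ c)))) (pos (g x)))
               (cong (λ t → pos μ *ᶻ t +ᶻ (-ᶻ pos (g x)) *ᶻ pos (ι (C c))) (sym (ℤₚ.pos-* (ι (C c)) _))))) ⟩
      sumᶻ G (λ c → pos μ *ᶻ pos (ι (C c) * ι (D (x ⊕ c))) +ᶻ (-ᶻ pos (g x)) *ᶻ pos (ι (C c)))
        ≡⟨ trans (ℤΣ.sum-+ G _ _) (cong₂ _+ᶻ_ (trans (ℤΣ.sum-*ˡ G (pos μ) (λ c → pos (ι (C c) * ι (D (x ⊕ c))))) (cong (pos μ *ᶻ_) (sym (pos-sum G _))))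
             (trans (ℤΣ.sum-*ˡ G (-ᶻ pos (g x)) (λ c → pos (ι (C c)))) (cong ((-ᶻ pos (g x)) *ᶻ_) (sym (pos-sum G _))))) ⟩
      pos μ *ᶻ pos (g x) +ᶻ (-ᶻ pos (g x)) *ᶻ pos μ  ≡⟨ vanish (pos μ) (pos (g x)) ⟩
      0ℤ  ∎
      where
      open ≡-Reasoning
      expand : ∀ c m d g → c *ᶻ (m *ᶻ d -ᶻ g) ≡ m *ᶻ (c *ᶻ d) +ᶻ (-ᶻ g) *ᶻ c
      expand = ℤ-Solver.solve-∀
      vanish : ∀ m g → m *ᶻ g +ᶻ (-ᶻ g) *ᶻ m ≡ 0ℤ
      vanish = ℤ-Solver.solve-∀

    open Variance G (λ c → pos (ι (C c))) Y centred

    dev≡ : ∀ {k} (v : Vec (𝔽₂^ n) k) → dev v ≡ pos (μ * hits (map (x ⊕_) v)) -ᶻ pos (k * g x)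
    dev≡ []      = sym (cong (λ t → pos t -ᶻ 0ℤ) (*-zeroʳ μ))
    dev≡ {suc k} (z ∷ v) = begin
      Y z +ᶻ dev v
        ≡⟨ cong (Y z +ᶻ_) (dev≡ v) ⟩
      (pos (μ * d) -ᶻ pos (g x)) +ᶻ (pos (μ * H) -ᶻ pos (k * g x))
        ≡⟨ regroup (pos (μ * d)) (pos (g x)) (pos (μ * H)) (pos (k * g x)) ⟩
      (pos (μ * d) +ᶻ pos (μ * H)) -ᶻ (pos (g x) +ᶻ pos (k * g x))
        ≡⟨ cong₂ _-ᶻ_ (trans (sym (ℤₚ.pos-+ (μ * d) (μ * H))) (cong pos (sym (*-distribˡ-+ μ d H)))) (sym (ℤₚ.pos-+ (g x) (k * g x))) ⟩
      pos (μ * (d + H)) -ᶻ pos (suc k * g x)  ∎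
      where
      open ≡-Reasoning
      d = ι (D (x ⊕ z))
      H = hits (map (x ⊕_) v)
      regroup : ∀ a b c d → (a -ᶻ b) +ᶻ (c -ᶻ d) ≡ (a +ᶻ c) -ᶻ (b +ᶻ d)
      regroup = ℤ-Solver.solve-∀

    wtᶻ : ∀ {k} (v : Vec (𝔽₂^ n) k) → prodᶻ (λ c → pos (ι (C c))) v ≡ pos (wt v)
    wtᶻ []      = refl
    wtᶻ (c ∷ v) = trans (cong (pos (ι (C c)) *ᶻ_) (wtᶻ v)) (sym (ℤₚ.pos-* (ι (C c)) (wt v)))

    far : Block → ℕ
    far v = ι (not (close (g x) (map (x ⊕_) v)))

    far-bound : ∀ v → pos (far v * ((b * μ) * (b * μ))) ≤ᶻ pos (h * h) *ᶻ (dev v *ᶻ dev v)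
    far-bound v = by-cases (close (g x) (map (x ⊕_) v)) refl
      where
      by-cases : ∀ c → close (g x) (map (x ⊕_) v) ≡ c → pos (ι (not c) * ((b * μ) * (b * μ))) ≤ᶻ pos (h * h) *ᶻ (dev v *ᶻ dev v)
      by-cases true  cl = *ᶻ-nonneg (pos-nonneg (h * h)) (square-nonneg (dev v))
      by-cases false cl = subst₂ (λ t u → pos t ≤ᶻ pos (h * h) *ᶻ (u *ᶻ u)) (sym (+-identityʳ ((b * μ) * (b * μ)))) (sym (dev≡ v))
        (square-≥-of-far h (μ * hits (map (x ⊕_) v)) (b * g x) (b * μ) cl)

    V≤ : V ≤ᶻ pos (μ * (μ * μ))
    V≤ = begin
      sumᶻ G (λ c → pos (ι (C c)) *ᶻ (Y c *ᶻ Y c))  ≤⟨ sumᶻ-mono G (λ c → ℤₚ.*-monoˡ-≤-nonNeg (pos (ι (C c)))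
                                                          (square-difference-≤ {μ * ι (D (x ⊕ c))} {g x} (≤-trans (*-monoʳ-≤ μ (ι≤1 _)) (≤-reflexive (*-identityʳ μ))) (g≤μ x))) ⟩
      sumᶻ G (λ c → pos (ι (C c)) *ᶻ pos (μ * μ))  ≡⟨ ℤΣ.sum-*ʳ G (pos (μ * μ)) _ ⟩
      sumᶻ G (λ c → pos (ι (C c))) *ᶻ pos (μ * μ)  ≡⟨ cong (_*ᶻ pos (μ * μ)) (sym (pos-sum G _)) ⟩
      pos μ *ᶻ pos (μ * μ)  ≡⟨ ℤₚ.pos-* μ (μ * μ) ⟨
      pos (μ * (μ * μ))  ∎
      where open ℤₚ.≤-Reasoning

    Wμ : W ≡ pos μ
    Wμ = sym (pos-sum G _)
    far-total : ℕ
    far-total = sum blocks (λ v → wt v * far v)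

    chebyshev-raw : far-total * ((b * μ) * (b * μ)) * μ ≤ h * h * (b * (μ * (μ * μ)) * μ ^ b)
    chebyshev-raw = ℤ.drop‿+≤+ (begin
      pos (far-total * ((b * μ) * (b * μ)) * μ)
        ≡⟨ trans (ℤₚ.pos-* (far-total * ((b * μ) * (b * μ))) μ) (cong (_*ᶻ pos μ) (trans (cong pos (sym (sum-*ʳ blocks ((b * μ) * (b * μ)) _))) (pos-sum blocks _))) ⟩
      sumᶻ blocks (λ v → pos (wt v * far v * ((b * μ) * (b * μ)))) *ᶻ pos μ
        ≤⟨ ℤₚ.*-monoʳ-≤-nonNeg (pos μ) (sumᶻ-mono blocks (λ v → ℤₚ.≤-trans (ℤₚ.≤-reflexive (trans (cong pos (*-assoc (wt v) (far v) _)) (ℤₚ.pos-* (wt v) _)))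
              (ℤₚ.≤-trans (ℤₚ.*-monoˡ-≤-nonNeg (pos (wt v)) (far-bound v)) (ℤₚ.≤-reflexive (swapᶻ (pos (wt v)) (pos (h * h)) _))))) ⟩
      sumᶻ blocks (λ v → pos (h * h) *ᶻ (pos (wt v) *ᶻ (dev v *ᶻ dev v))) *ᶻ pos μ
        ≡⟨ cong₂ _*ᶻ_ (trans (ℤΣ.sum-*ˡ blocks (pos (h * h)) _) (cong (pos (h * h) *ᶻ_) (ℤΣ.sum-cong blocks (λ v → cong (_*ᶻ (dev v *ᶻ dev v)) (sym (wtᶻ v)))))) (sym Wμ) ⟩
      (pos (h * h) *ᶻ second b) *ᶻ W
        ≡⟨ trans (ℤₚ.*-assoc (pos (h * h)) _ _) (cong (pos (h * h) *ᶻ_) (trans (variance b) (cong (λ t → (pos b *ᶻ V) *ᶻ t) (trans (cong (λ t → powᶻ t b) Wμ) (powᶻ-pos μ b))))) ⟩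
      pos (h * h) *ᶻ ((pos b *ᶻ V) *ᶻ pos (μ ^ b))
        ≤⟨ ℤₚ.*-monoˡ-≤-nonNeg (pos (h * h)) (ℤₚ.*-monoʳ-≤-nonNeg (pos (μ ^ b)) (ℤₚ.*-monoˡ-≤-nonNeg (pos b) V≤)) ⟩
      pos (h * h) *ᶻ ((pos b *ᶻ pos (μ * (μ * μ))) *ᶻ pos (μ ^ b))
        ≡⟨ sym (trans (ℤₚ.pos-* (h * h) _) (cong (pos (h * h) *ᶻ_) (trans (ℤₚ.pos-* (b * (μ * (μ * μ))) (μ ^ b)) (cong (_*ᶻ pos (μ ^ b)) (ℤₚ.pos-* b _))))) ⟩
      pos (h * h * (b * (μ * (μ * μ)) * μ ^ b)) ∎)
      where
      open ℤₚ.≤-Reasoning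
      swapᶻ : ∀ a b c → a *ᶻ (b *ᶻ c) ≡ b *ᶻ (a *ᶻ c)
      swapᶻ = ℤ-Solver.solve-∀

    -- Relative to `μ`, a block mean has variance at most `1 / b`, so a deviation above `1 / h` has
    -- probability at most `h * h / b`, which `b≥` makes at most 1/64.
    chebyshev : 64 * far-total ≤ μ ^ b
    chebyshev = *-cancelˡ-≤′ (*-mono-< h>0 h>0) (begin
      h * h * (64 * F)  ≡⟨ rot (h * h) 64 F ⟩
      64 * (h * h) * F  ≤⟨ *-monoˡ-≤ F b≥ ⟩
      b * F  ≤⟨ *-cancelˡ-≤′ (*-mono-< (*-mono-< b>0 C>0) (*-mono-< C>0 C>0)) (begin
        (b * μ) * (μ * μ) * (b * F)  ≡⟨ rearr₁ b μ F ⟩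
        F * ((b * μ) * (b * μ)) * μ  ≤⟨ chebyshev-raw ⟩
        h * h * (b * (μ * (μ * μ)) * μ ^ b)  ≡⟨ rearr₂ (h * h) b μ (μ ^ b) ⟩
        (b * μ) * (μ * μ) * (h * h * μ ^ b)  ∎) ⟩
      h * h * μ ^ b  ∎)
      where
      open ≤-Reasoning
      b>0 : 0 < b
      b>0 = ≤-trans (*-mono-≤ (s≤s {n = 63} z≤n) (*-mono-< h>0 h>0)) b≥
      F = far-total
      rot : ∀ a c f → a * (c * f) ≡ c * a * f
      rot = solve-∀
      rearr₁ : ∀ b m f → (b * m) * (m * m) * (b * f) ≡ f * ((b * m) * (b * m)) * m
      rearr₁ = solve-∀
      rearr₂ : ∀ h b m p → h * (b * (m * (m * m)) * p) ≡ (b * m) * (m * m) * (h * p)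
      rearr₂ = solve-∀

    failures : ∀ {k} → Vec Block k → ℕ
    failures []       = 0
    failures (v ∷ vs) = far v + failures vs

    -- This is `64 ^ far v`, written linearly so that its mean, at most 1 + 63/64, can be read off.
    penalty : Block → ℕ
    penalty v = 1 + 63 * far v

    penalty-prod : ∀ {k} (vs : Vec Block k) → prod wt vs * 64 ^ failures vs ≤ prod (λ v → wt v * penalty v) vs
    penalty-prod []       = ≤-refl
    penalty-prod (v ∷ vs) = begin
      wt v * prod wt vs * 64 ^ (far v + failures vs)
        ≡⟨ cong (wt v * prod wt vs *_) (^-distribˡ-+-* 64 (far v) (failures vs)) ⟩
      wt v * prod wt vs * (64 ^ far v * 64 ^ failures vs)
        ≡⟨ lem (wt v) (prod wt vs) (64 ^ far v) (64 ^ failures vs) ⟩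
      wt v * 64 ^ far v * (prod wt vs * 64 ^ failures vs)
        ≤⟨ *-mono-≤ (*-monoʳ-≤ (wt v) (pen (not (close (g x) (map (x ⊕_) v))))) (penalty-prod vs) ⟩
      wt v * penalty v * prod (λ v → wt v * penalty v) vs  ∎
      where
      open ≤-Reasoning
      lem : ∀ a b c d → a * b * (c * d) ≡ a * c * (b * d)
      lem = solve-∀
      pen : ∀ b → 64 ^ ι b ≤ 1 + 63 * ι b
      pen true  = ≤-refl
      pen false = ≤-refl

    penalty-sum : sum blocks (λ v → wt v * penalty v) ≤ 2 * μ ^ b
    penalty-sum = begin
      sum blocks (λ v → wt v * penalty v)  ≡⟨ trans (sum-cong blocks (λ v → lem (wt v) 63 (far v))) (trans (sum-+ blocks _ _) (cong (sum blocks wt +_) (sum-*ˡ blocks 63 _))) ⟩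
      sum blocks wt + 63 * sum blocks (λ v → wt v * far v) ≡⟨ cong (_+ 63 * sum blocks (λ v → wt v * far v)) (trans (sum-prod G (ι ∘ C) b) (pow≡^ μ b)) ⟩
      μ ^ b + 63 * sum blocks (λ v → wt v * far v)  ≤⟨ +-monoʳ-≤ (μ ^ b) (≤-trans (*-monoˡ-≤ far-total (n≤1+n 63)) chebyshev) ⟩
      μ ^ b + μ ^ b  ≡⟨ cong (μ ^ b +_) (+-identityʳ _) ⟨
      2 * μ ^ b  ∎
      where
      open ≤-Reasoning
      lem : ∀ w c f → w * (1 + c * f) ≡ w + c * (w * f)
      lem = solve-∀

    bad : Vec Block K → Bool
    bad vs = K ≤ᵇ 2 * failures vs

    bad-cost : ∀ vs → ι (bad vs) * 8 ^ K ≤ 64 ^ failures vs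
    bad-cost vs with bad vs in eq
    ... | false = z≤n
    ... | true  = begin
      8 ^ K + 0  ≡⟨ +-identityʳ _ ⟩
      8 ^ K  ≤⟨ ^-monoʳ-≤ 8 (≤ᵇ⇒≤ K _ (Equivalence.from 𝔹ₚ.T-≡ eq)) ⟩
      8 ^ (2 * failures vs)  ≡⟨ ^-*-assoc 8 2 (failures vs) ⟨
      64 ^ failures vs  ∎
      where open ≤-Reasoning

    -- An exponential moment bound: `64 ^ failures` has mean at most `2 ^ K` but is at least `8 ^ K`
    -- on a bad tuple.
    tail-bound : sum tuples (λ vs → prod wt vs * ι (bad vs)) * 4 ^ K ≤ (μ ^ b) ^ K
    tail-bound = *-cancelˡ-≤′ (m^n>0 2 K) (begin
      2 ^ K * (Bd * 4 ^ K)  ≡⟨ lem (2 ^ K) Bd (4 ^ K) ⟩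
      Bd * (2 ^ K * 4 ^ K)  ≡⟨ cong (Bd *_) (*-^ 2 4 K) ⟨
      Bd * 8 ^ K  ≡⟨ sum-*ʳ tuples (8 ^ K) _ ⟨
      sum tuples (λ vs → prod wt vs * ι (bad vs) * 8 ^ K)
        ≤⟨ sum-mono tuples (λ vs → ≤-trans (≤-reflexive (*-assoc (prod wt vs) _ _)) (≤-trans (*-monoʳ-≤ (prod wt vs) (bad-cost vs)) (penalty-prod vs))) ⟩
      sum tuples (prod (λ v → wt v * penalty v))  ≡⟨ trans (sum-prod blocks _ K) (pow≡^ _ K) ⟩
      sum blocks (λ v → wt v * penalty v) ^ K  ≤⟨ ^-monoˡ-≤ K penalty-sum ⟩
      (2 * μ ^ b) ^ K  ≡⟨ *-^ 2 (μ ^ b) K ⟩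
      2 ^ K * (μ ^ b) ^ K  ∎)
      where
      open ≤-Reasoning
      Bd = sum tuples (λ vs → prod wt vs * ι (bad vs))
      lem : ∀ a b c → a * (b * c) ≡ b * (a * c)
      lem = solve-∀

  shift : 𝔽₂^ n → Vec Block k → Vec Block k
  shift t = map (map (t ⊕_))

  badness : Vec Block K → ℕ
  badness vs = sum G (λ x → ι (bad x vs))

  -- Twice the expected bound on the share of bad points, so by Markov's inequality at least half of
  -- the tuples drawn from `C` qualify.
  good : Vec Block K → Bool
  good vs = badness vs * 4 ^ K ≤ᵇ 2 * q

  private
    M = (μ ^ b) ^ K
    good-sum = sum tuples (λ vs → prod wt vs * ι (good vs))
    q>0 : 0 < q
    q>0 = m^n>0 2 n

  half-good : M ≤ 2 * good-sum
  half-good = +-cancelˡ-≤ M M (2 * good-sum) (*-cancelˡ-≤′ q>0 (begin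
    q * (M + M)  ≡⟨ lem₁ q M ⟩
    2 * q * M  ≡⟨ cong (2 * q *_) total ⟩
    2 * q * (good-sum + bad-sum)  ≡⟨ *-distribˡ-+ (2 * q) good-sum bad-sum ⟩
    2 * q * good-sum + 2 * q * bad-sum  ≤⟨ +-monoʳ-≤ (2 * q * good-sum) bad≤ ⟩
    2 * q * good-sum + q * M  ≡⟨ lem₂ q good-sum M ⟩
    q * (M + 2 * good-sum)  ∎))
    where
    open ≤-Reasoning
    bad-sum = sum tuples (λ vs → prod wt vs * ι (not (good vs)))
    lem₁ : ∀ q m → q * (m + m) ≡ 2 * q * m
    lem₁ = solve-∀
    lem₂ : ∀ q g m → 2 * q * g + q * m ≡ q * (m + 2 * g)
    lem₂ = solve-∀
    ι-split : ∀ p b → p ≡ p * ι b + p * ι (not b)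
    ι-split p true  = sym (trans (cong₂ _+_ (*-identityʳ p) (*-zeroʳ p)) (+-identityʳ p))
    ι-split p false = sym (cong₂ _+_ (*-zeroʳ p) (*-identityʳ p))
    total : M ≡ good-sum + bad-sum
    total = begin-equality
      (μ ^ b) ^ K  ≡⟨ cong (_^ K) (trans (sum-prod G (ι ∘ C) b) (pow≡^ μ b)) ⟨
      sum blocks wt ^ K  ≡⟨ trans (sum-prod blocks wt K) (pow≡^ _ K) ⟨
      sum tuples (prod wt)  ≡⟨ trans (sum-cong tuples (λ vs → ι-split (prod wt vs) (good vs))) (sum-+ tuples _ _) ⟩
      good-sum + bad-sum  ∎
    cost : ∀ vs → 2 * q * ι (not (good vs)) ≤ badness vs * 4 ^ K
    cost vs with badness vs * 4 ^ K ≤? 2 * q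
    ... | no ¬p with good vs in eq
    ...   | true  = ⊥-elim (¬p (≤ᵇ⇒≤ _ _ (Equivalence.from 𝔹ₚ.T-≡ eq)))
    ...   | false = ≤-trans (≤-reflexive (*-identityʳ _)) (<⇒≤ (≰⇒> ¬p))
    cost vs | yes p with good vs in eq
    ... | true  = ≤-trans (≤-reflexive (*-zeroʳ (2 * q))) z≤n
    ... | false with () ← trans (sym eq) (Equivalence.to 𝔹ₚ.T-≡ (≤⇒≤ᵇ p))
    bad≤ : 2 * q * bad-sum ≤ q * M
    bad≤ = begin
      2 * q * bad-sum  ≡⟨ sum-*ˡ tuples (2 * q) _ ⟨
      sum tuples (λ vs → 2 * q * (prod wt vs * ι (not (good vs))))  ≤⟨ sum-mono tuples (λ vs → ≤-trans (≤-reflexive (*-swap (2 * q) (prod wt vs) _)) (*-monoʳ-≤ (prod wt vs) (cost vs))) ⟩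
      sum tuples (λ vs → prod wt vs * (badness vs * 4 ^ K))
        ≡⟨ sum-cong tuples (λ vs → trans (sym (*-assoc (prod wt vs) _ _)) (cong (_* 4 ^ K) (sym (sum-*ˡ G (prod wt vs) _)))) ⟩
      sum tuples (λ vs → sum G (λ x → prod wt vs * ι (bad x vs)) * 4 ^ K)
        ≡⟨ trans (sum-*ʳ tuples (4 ^ K) _) (cong (_* 4 ^ K) (sum-swap tuples G _)) ⟩
      sum G (λ x → sum tuples (λ vs → prod wt vs * ι (bad x vs))) * 4 ^ K
        ≡⟨ sum-*ʳ G (4 ^ K) _ ⟨
      sum G (λ x → sum tuples (λ vs → prod wt vs * ι (bad x vs)) * 4 ^ K)
        ≤⟨ sum-mono G tail-bound ⟩
      sum G (λ _ → M)  ≡⟨ sum-const-𝔾 n M ⟩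
      q * M  ∎

  wt≤1 : ∀ {k} (v : Vec (𝔽₂^ n) k) → wt v ≤ 1
  wt≤1 []      = ≤-refl
  wt≤1 (c ∷ v) = *-mono-≤ (ι≤1 (C c)) (wt≤1 v)

  prod-wt≤1 : ∀ {k} (vs : Vec Block k) → prod wt vs ≤ 1
  prod-wt≤1 []       = ≤-refl
  prod-wt≤1 (v ∷ vs) = *-mono-≤ (wt≤1 v) (prod-wt≤1 vs)

  -- The translated tuple has to be accurate at most points; it may leave `C`.
  periods : Vec Block K → 𝔽₂^ n → Bool
  periods vs t = good (shift t vs)

  sum-shift-tuples : (t : 𝔽₂^ n) (f : Vec Block K → ℕ) → sum tuples (λ vs → f (shift t vs)) ≡ sum tuples f
  sum-shift-tuples t f = sum-map-vecs blocks (map (t ⊕_)) (λ f′ → sum-map-vecs G (t ⊕_) (sum-shift t) b f′) K f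

  -- For each `t`, every good tuple from `C` is the translate of exactly one tuple. Averaging over
  -- all tuples of the space produces one with many such `t`.
  many-periods : ∃ λ vs → q * M ≤ 2 * ((q ^ b) ^ K * count (periods vs))
  many-periods = proj₁ found , ≤-pred (proj₂ found)
    where
    open ≤-Reasoning
    N = (q ^ b) ^ K
    average : sum tuples (λ _ → q * M) ≤ sum tuples (λ vs → 2 * (N * count (periods vs)))
    average = begin
      sum tuples (λ _ → q * M)  ≡⟨ sum-const-tuples n b K (q * M) ⟩
      N * (q * M)  ≤⟨ *-monoʳ-≤ N (*-monoʳ-≤ q half-good) ⟩
      N * (q * (2 * good-sum))  ≡⟨ trans (cong (N *_) (*-swap q 2 good-sum)) (*-swap N 2 (q * good-sum)) ⟩
      2 * (N * (q * good-sum))  ≡⟨ cong (λ t → 2 * (N * t)) (sum-const-𝔾 n good-sum) ⟨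
      2 * (N * sum G (λ _ → good-sum))
        ≡⟨ cong (λ t → 2 * (N * t)) (sum-cong G (λ t → sym (sum-shift-tuples t (λ vs → prod wt vs * ι (good vs))))) ⟩
      2 * (N * sum G (λ t → sum tuples (λ vs → prod wt (shift t vs) * ι (periods vs t))))
        ≤⟨ *-monoʳ-≤ 2 (*-monoʳ-≤ N (sum-mono G (λ t → sum-mono tuples (λ vs → ≤-trans (*-monoˡ-≤ _ (prod-wt≤1 (shift t vs))) (≤-reflexive (*-identityˡ _)))))) ⟩
      2 * (N * sum G (λ t → sum tuples (λ vs → ι (periods vs t))))
        ≡⟨ cong (λ t → 2 * (N * t)) (sum-swap G tuples _) ⟩
      2 * (N * sum tuples (λ vs → count (periods vs)))
        ≡⟨ trans (sum-*ˡ tuples 2 _) (cong (2 *_) (sum-*ˡ tuples N _)) ⟨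
      sum tuples (λ vs → 2 * (N * count (periods vs)))  ∎
    found : ∃ λ vs → q * M < suc (2 * (N * count (periods vs)))
    found = sum<⇒∃ tuples (begin-strict
      sum tuples (λ _ → q * M)  ≤⟨ average ⟩
      X  <⟨ m<n+m X (^-pos K (^-pos b q>0)) ⟩
      N + X  ≡⟨ cong (_+ X) (trans (sum-const-tuples n b K 1) (*-identityʳ N)) ⟨
      sum tuples (λ _ → 1) + X  ≡⟨ sum-+ tuples _ _ ⟨
      sum tuples (λ vs → suc (2 * (N * count (periods vs))))  ∎)
      where X = sum tuples (λ vs → 2 * (N * count (periods vs)))

  common-block : ∀ (x y : 𝔽₂^ n) {k} (us vs : Vec Block k) → map (map (x ⊕_)) us ≡ map (map (y ⊕_)) vs →
    failures x us + failures y vs < k → ∃ λ v → close (g x) v ≡ true × close (g y) v ≡ true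
  common-block x y {suc k} (u ∷ us) (v ∷ vs) eq lt with close (g x) (map (x ⊕_) u) in cx | close (g y) (map (y ⊕_) v) in cy
  ... | true  | true  = map (x ⊕_) u , cx , trans (cong (close (g y)) (cong head eq)) cy
  ... | true  | false = common-block x y us vs (cong tail eq) (≤-pred (subst (_< suc k) (+-suc (failures x us) (failures y vs)) lt))
  ... | false | true  = common-block x y us vs (cong tail eq) (≤-pred lt)
  ... | false | false = common-block x y us vs (cong tail eq) (≤-pred (≤-trans (s≤s (+-monoʳ-≤ (suc (failures x us)) (n≤1+n _))) lt))

  -- The point `x` with samples translated by `t`, and the point `(x ⊕ t) ⊕ t′` with samples
  -- translated by `t′`, evaluate the very same blocks. Two majorities share a block, and its
  -- frequency pins both values of `g`.
  transfer : ∀ vs (t t′ x : 𝔽₂^ n) → bad x (shift t vs) ≡ false → bad ((x ⊕ t) ⊕ t′) (shift t′ vs) ≡ false →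
    h * g x ≤ h * g ((x ⊕ t) ⊕ t′) + 2 * μ
  transfer vs t t′ x ok ok′ = *-cancelˡ-≤′ b>0 (begin
    b * (h * g x)  ≡⟨ *-swap b h (g x) ⟩
    h * (b * g x)  ≤⟨ proj₂ (unpack (proj₁ (proj₂ common))) ⟩
    h * (μ * hits v) + b * μ  ≤⟨ +-monoˡ-≤ (b * μ) (proj₁ (unpack (proj₂ (proj₂ common)))) ⟩
    h * (b * g y) + b * μ + b * μ  ≡⟨ lem h b (g y) μ ⟩
    b * (h * g y + 2 * μ)  ∎)
    where
    open ≤-Reasoning
    y = (x ⊕ t) ⊕ t′
    b>0 : 0 < b
    b>0 = ≤-trans (*-mono-≤ (s≤s {n = 63} z≤n) (*-mono-< h>0 h>0)) b≥
    lem : ∀ h b g m → h * (b * g) + b * m + b * m ≡ b * (h * g + 2 * m)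
    lem = solve-∀
    few : ∀ x us → bad x us ≡ false → 2 * failures x us < K
    few x us eq with K ≤? 2 * failures x us
    ... | no ¬p = ≰⇒> ¬p
    ... | yes p with () ← trans (sym eq) (Equivalence.to 𝔹ₚ.T-≡ (≤⇒≤ᵇ p))
    halves : ∀ {a c K} → 2 * a < K → 2 * c < K → a + c < K
    halves {a} {c} {K} p p′ = *-cancelˡ-<′ 2 (begin-strict
      2 * (a + c)  ≡⟨ *-distribˡ-+ 2 a c ⟩
      2 * a + 2 * c  <⟨ +-mono-< p p′ ⟩
      K + K  ≡⟨ cong (K +_) (+-identityʳ K) ⟨
      2 * K  ∎)
    shift-shift : ∀ x t {k} (us : Vec Block k) → map (map (x ⊕_)) (shift t us) ≡ map (map ((x ⊕ t) ⊕_)) us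
    shift-shift x t us = trans (sym (Vecₚ.map-∘ _ _ us)) (Vecₚ.map-cong (λ v → trans (sym (Vecₚ.map-∘ _ _ v)) (Vecₚ.map-cong (λ z → sym (⊕-assoc x t z)) v)) us)
    same : map (map (x ⊕_)) (shift t vs) ≡ map (map (y ⊕_)) (shift t′ vs)
    same = trans (shift-shift x t vs) (trans (cong (λ s → map (map (s ⊕_)) vs) (sym (⊕-cancelʳ (x ⊕ t) t′))) (sym (shift-shift y t′ vs)))
    common = common-block x y (shift t vs) (shift t′ vs) same
      (halves {failures x (shift t vs)} (few x (shift t vs) ok) (few y (shift t′ vs) ok′))
    v = proj₁ common
    unpack : ∀ {val} → close val v ≡ true → h * (μ * hits v) ≤ h * (b * val) + b * μ × h * (b * val) ≤ h * (μ * hits v) + b * μ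
    unpack {val} eq = ∧-≤ᵇ (h * (μ * hits v)) (h * (b * val) + b * μ) (h * (b * val)) (h * (μ * hits v) + b * μ) eq

-- Averaging over sums of two elements of `T` is repeated so that the transform of `T` enters with a
-- high power. Each round loses a share 3/h: 2/h by `transfer` and 1/h from the exceptional points,
-- which `size` keeps rare.
module Smoothing {n : ℕ} (T C : 𝔽₂^ n → Bool) (Bad : 𝔽₂^ n → 𝔽₂^ n → Bool) (g : 𝔽₂^ n → ℕ) (h K : ℕ)
  (g≤ : ∀ x → g x ≤ count C)
  (small : ∀ t → T t ≡ true → sum (𝔾 n) (λ x → ι (Bad t x)) * 4 ^ K ≤ 2 * 2 ^ n)
  (transfer : ∀ t t′ x → T t ≡ true → T t′ ≡ true → Bad t x ≡ false → Bad t′ ((x ⊕ t) ⊕ t′) ≡ false →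
    h * g x ≤ h * g ((x ⊕ t) ⊕ t′) + 2 * count C)
  (size : 4 * (h * 2 ^ n) ≤ 4 ^ K * count C) where

  private
    G = 𝔾 n
    q = 2 ^ n
    μ = count C

  τ : ℕ
  τ = count T * count T

  smoothen : (𝔽₂^ n → ℕ) → 𝔽₂^ n → ℕ
  smoothen φ x = sum G (λ t → ι (T t) * sum G (λ t′ → ι (T t′) * φ (t′ ⊕ (t ⊕ x))))

  smooth : ℕ → 𝔽₂^ n → ℕ
  smooth zero    = ι ∘ C
  smooth (suc i) = smoothen (smooth i)

  smoothen-≤ : ∀ {φ c} → (∀ x → φ x ≤ c) → ∀ x → smoothen φ x ≤ τ * c
  smoothen-≤ {φ} {c} φ≤ x = begin
    smoothen φ x  ≤⟨ sum-mono G (λ t → *-monoʳ-≤ (ι (T t)) (sum-mono G (λ t′ → *-monoʳ-≤ (ι (T t′)) (φ≤ _)))) ⟩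
    sum G (λ t → ι (T t) * sum G (λ t′ → ι (T t′) * c))  ≡⟨ trans (sum-*ʳ G _ _) (cong (count T *_) (sum-*ʳ G c _)) ⟩
    count T * (count T * c)  ≡⟨ *-assoc (count T) (count T) c ⟨
    τ * c  ∎
    where open ≤-Reasoning

  smoothen-pair : (φ f : 𝔽₂^ n → ℕ) →
    sum G (λ x → smoothen φ x * f x) ≡
    sum G (λ t → ι (T t) * sum G (λ t′ → ι (T t′) * sum G (λ x → φ x * f ((x ⊕ t) ⊕ t′))))
  smoothen-pair φ f = begin
    sum G (λ x → smoothen φ x * f x)
      ≡⟨ sum-cong G (λ x → trans (sym (sum-*ʳ G (f x) _)) (sum-cong G (λ t → trans (*-assoc (ι (T t)) _ (f x)) (cong (ι (T t) *_)
           (trans (sym (sum-*ʳ G (f x) _)) (sum-cong G (λ t′ → *-assoc (ι (T t′)) _ (f x)))))))) ⟩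
    sum G (λ x → sum G (λ t → ι (T t) * sum G (λ t′ → ι (T t′) * (φ (t′ ⊕ (t ⊕ x)) * f x))))
      ≡⟨ trans (sum-swap G G _) (sum-cong G (λ t → trans (sum-*ˡ G (ι (T t)) _) (cong (ι (T t) *_)
           (trans (sum-swap G G _) (sum-cong G (λ t′ → sum-*ˡ G (ι (T t′)) _)))))) ⟩
    sum G (λ t → ι (T t) * sum G (λ t′ → ι (T t′) * sum G (λ x → φ (t′ ⊕ (t ⊕ x)) * f x)))
      ≡⟨ sum-cong G (λ t → cong (ι (T t) *_) (sum-cong G (λ t′ → cong (ι (T t′) *_) (translate t t′)))) ⟩
    sum G (λ t → ι (T t) * sum G (λ t′ → ι (T t′) * sum G (λ x → φ x * f ((x ⊕ t) ⊕ t′)))) ∎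
    where
    open ≡-Reasoning
    translate : ∀ t t′ → sum G (λ x → φ (t′ ⊕ (t ⊕ x)) * f x) ≡ sum G (λ x → φ x * f ((x ⊕ t) ⊕ t′))
    translate t t′ = begin
      sum G (λ x → φ (t′ ⊕ (t ⊕ x)) * f x)  ≡⟨ sum-cong G (λ x → cong (λ z → φ (t′ ⊕ (t ⊕ x)) * f z) (⊕-solve (x ∷ t ∷ t′ ∷ []) 𝕩₀ (((𝕩₂ ⊹ (𝕩₁ ⊹ 𝕩₀)) ⊹ 𝕩₁) ⊹ 𝕩₂) refl)) ⟩
      sum G (λ x → φ (t′ ⊕ (t ⊕ x)) * f (((t′ ⊕ (t ⊕ x)) ⊕ t) ⊕ t′))
        ≡⟨ sum-shift t (λ z → φ (t′ ⊕ z) * f (((t′ ⊕ z) ⊕ t) ⊕ t′)) ⟩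
      sum G (λ z → φ (t′ ⊕ z) * f (((t′ ⊕ z) ⊕ t) ⊕ t′))
        ≡⟨ sum-shift t′ (λ x → φ x * f ((x ⊕ t) ⊕ t′)) ⟩
      sum G (λ x → φ x * f ((x ⊕ t) ⊕ t′))  ∎

  smoothen-mass : (φ : 𝔽₂^ n → ℕ) → sum G (smoothen φ) ≡ τ * sum G φ
  smoothen-mass φ = begin
    sum G (smoothen φ)  ≡⟨ sum-cong G (λ x → *-identityʳ _) ⟨
    sum G (λ x → smoothen φ x * 1)  ≡⟨ smoothen-pair φ (λ _ → 1) ⟩
    sum G (λ t → ι (T t) * sum G (λ t′ → ι (T t′) * sum G (λ x → φ x * 1)))
      ≡⟨ trans (sum-*ʳ G _ _) (cong (count T *_) (sum-*ʳ G _ _)) ⟩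
    count T * (count T * sum G (λ x → φ x * 1))  ≡⟨ cong (λ t → count T * (count T * t)) (sum-cong G (λ x → *-identityʳ _)) ⟩
    count T * (count T * sum G φ)  ≡⟨ *-assoc (count T) (count T) _ ⟨
    τ * sum G φ  ∎
    where open ≡-Reasoning

  -- The pointwise bound and the mass agree with those of `c` times the indicator of `C`; they are
  -- the invariant of the repeated smoothing.
  module _ (φ : 𝔽₂^ n → ℕ) (c : ℕ) (φ≤ : ∀ x → φ x ≤ c) (mass : sum G φ ≡ c * μ) where

    shift-loss : ∀ t t′ → T t ≡ true → T t′ ≡ true →
      sum G (λ x → φ x * (h * g x)) ≤ sum G (λ x → φ x * (h * g ((x ⊕ t) ⊕ t′))) + 3 * (c * (μ * μ))
    shift-loss t t′ Tt Tt′ = begin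
      sum G (λ x → φ x * (h * g x))
        ≤⟨ sum-mono G term ⟩
      sum G (λ x → φ x * (h * g (y x)) + (φ x * (2 * μ) + c * (h * μ) * (ι (Bad t x) + ι (Bad t′ (y x)))))
        ≡⟨ trans (sum-+ G _ _) (cong (S +_) (trans (sum-+ G _ _) (cong₂ _+_ (trans (sum-*ʳ G (2 * μ) φ) (cong (_* (2 * μ)) mass))
             (trans (sum-*ˡ G (c * (h * μ)) _) (cong (c * (h * μ) *_) (trans (sum-+ G _ _) (cong (B t +_) (trans (sum-shiftʳ t (λ x → ι (Bad t′ (x ⊕ t′)))) (sum-shiftʳ t′ (ι ∘ Bad t′)))))))))) ⟩
      S + (c * μ * (2 * μ) + c * (h * μ) * (B t + B t′))
        ≤⟨ +-monoʳ-≤ S (+-monoʳ-≤ (c * μ * (2 * μ)) rare) ⟩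
      S + (c * μ * (2 * μ) + c * (μ * μ))
        ≡⟨ lem S c μ ⟩
      S + 3 * (c * (μ * μ))  ∎
      where
      open ≤-Reasoning
      y : 𝔽₂^ n → 𝔽₂^ n
      y x = (x ⊕ t) ⊕ t′
      S = sum G (λ x → φ x * (h * g (y x)))
      B : 𝔽₂^ n → ℕ
      B t = sum G (λ x → ι (Bad t x))
      lem : ∀ s c m → s + (c * m * (2 * m) + c * (m * m)) ≡ s + 3 * (c * (m * m))
      lem = solve-∀
      crude : ∀ x → φ x * (h * g x) ≤ c * (h * μ)
      crude x = *-mono-≤ (φ≤ x) (*-monoʳ-≤ h (g≤ x))
      by-cases : ∀ x b b′ → Bad t x ≡ b → Bad t′ (y x) ≡ b′ →
        φ x * (h * g x) ≤ φ x * (h * g (y x)) + (φ x * (2 * μ) + c * (h * μ) * (ι b + ι b′))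
      by-cases x true  b′    _  _  = ≤-trans (crude x) (≤-trans (≤-trans (m≤m*n _ (1 + ι b′)) (m≤n+m _ (φ x * (2 * μ)))) (m≤n+m _ (φ x * (h * g (y x)))))
      by-cases x false true  _  _  = ≤-trans (crude x) (≤-trans (≤-trans (≤-reflexive (sym (*-identityʳ _))) (m≤n+m _ (φ x * (2 * μ)))) (m≤n+m _ (φ x * (h * g (y x)))))
      by-cases x false false e₁ e₂ = ≤-trans (*-monoʳ-≤ (φ x) (transfer t t′ x Tt Tt′ e₁ e₂))
        (≤-trans (≤-reflexive (*-distribˡ-+ (φ x) (h * g (y x)) (2 * μ))) (+-monoʳ-≤ (φ x * (h * g (y x))) (m≤m+n (φ x * (2 * μ)) (c * (h * μ) * 0))))
      term : ∀ x → φ x * (h * g x) ≤ φ x * (h * g (y x)) + (φ x * (2 * μ) + c * (h * μ) * (ι (Bad t x) + ι (Bad t′ (y x))))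
      term x = by-cases x (Bad t x) (Bad t′ (y x)) refl refl
      rare : c * (h * μ) * (B t + B t′) ≤ c * (μ * μ)
      rare = *-cancelˡ-≤′ (m^n>0 4 K) (begin
        4 ^ K * (c * (h * μ) * (B t + B t′))  ≡⟨ lem₁ (4 ^ K) c h μ (B t) (B t′) ⟩
        c * (h * μ) * (B t * 4 ^ K + B t′ * 4 ^ K)  ≤⟨ *-monoʳ-≤ (c * (h * μ)) (+-mono-≤ (small t Tt) (small t′ Tt′)) ⟩
        c * (h * μ) * (2 * q + 2 * q)  ≡⟨ lem₂ c h μ q ⟩
        c * μ * (4 * (h * q))  ≤⟨ *-monoʳ-≤ (c * μ) size ⟩
        c * μ * (4 ^ K * μ)  ≡⟨ lem₃ c μ (4 ^ K) ⟩
        4 ^ K * (c * (μ * μ))  ∎)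
        where
        lem₁ : ∀ k c h m u v → k * (c * (h * m) * (u + v)) ≡ c * (h * m) * (u * k + v * k)
        lem₁ = solve-∀
        lem₂ : ∀ c h m q → c * (h * m) * (2 * q + 2 * q) ≡ c * m * (4 * (h * q))
        lem₂ = solve-∀
        lem₃ : ∀ c m k → c * m * (k * m) ≡ k * (c * (m * m))
        lem₃ = solve-∀

    smoothen-loss : τ * sum G (λ x → φ x * (h * g x)) ≤ sum G (λ x → smoothen φ x * (h * g x)) + τ * (3 * (c * (μ * μ)))
    smoothen-loss = begin
      τ * X  ≡⟨ weights X ⟨
      sum G (λ t → ι (T t) * sum G (λ t′ → ι (T t′) * X))  ≤⟨ sum-mono G (λ t → restrict-ι (T t) λ Tt → sum-mono G (λ t′ → restrict-ι (T t′) λ Tt′ → shift-loss t t′ Tt Tt′)) ⟩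
      sum G (λ t → ι (T t) * sum G (λ t′ → ι (T t′) * (X′ t t′ + L)))
        ≡⟨ sum-cong G (λ t → trans (cong (ι (T t) *_) (trans (sum-cong G (λ t′ → *-distribˡ-+ (ι (T t′)) _ L)) (sum-+ G _ _))) (*-distribˡ-+ (ι (T t)) _ _)) ⟩
      sum G (λ t → ι (T t) * sum G (λ t′ → ι (T t′) * X′ t t′) + ι (T t) * sum G (λ t′ → ι (T t′) * L))
        ≡⟨ trans (sum-+ G _ _) (cong₂ _+_ (sym (smoothen-pair φ (λ x → h * g x))) (weights L)) ⟩
      sum G (λ x → smoothen φ x * (h * g x)) + τ * L  ∎
      where
      open ≤-Reasoning
      X = sum G (λ x → φ x * (h * g x))
      X′ : 𝔽₂^ n → 𝔽₂^ n → ℕ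
      X′ t t′ = sum G (λ x → φ x * (h * g ((x ⊕ t) ⊕ t′)))
      L = 3 * (c * (μ * μ))
      weights : ∀ X → sum G (λ t → ι (T t) * sum G (λ t′ → ι (T t′) * X)) ≡ τ * X
      weights X = trans (sum-*ʳ G _ _) (trans (cong (count T *_) (sum-*ʳ G X _)) (sym (*-assoc (count T) (count T) X)))
      restrict-ι : ∀ b {u v} → (b ≡ true → u ≤ v) → ι b * u ≤ ι b * v
      restrict-ι true  f = *-monoʳ-≤ 1 (f refl)
      restrict-ι false f = z≤n

  smooth-≤ : ∀ i x → smooth i x ≤ τ ^ i
  smooth-≤ zero    x = ι≤1 (C x)
  smooth-≤ (suc i) x = smoothen-≤ (smooth-≤ i) x

  smooth-mass : ∀ i → sum G (smooth i) ≡ τ ^ i * μ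
  smooth-mass zero    = sym (*-identityˡ μ)
  smooth-mass (suc i) = trans (smoothen-mass (smooth i)) (trans (cong (τ *_) (smooth-mass i)) (sym (*-assoc τ (τ ^ i) μ)))

  smooth-loss : ∀ i → τ ^ i * sum G (λ x → ι (C x) * (h * g x)) ≤
    sum G (λ x → smooth i x * (h * g x)) + i * (3 * (τ ^ i * (μ * μ)))
  smooth-loss zero    = ≤-trans (≤-reflexive (*-identityˡ _)) (m≤m+n _ _)
  smooth-loss (suc i) = begin
    τ * τ ^ i * X₀  ≡⟨ *-assoc τ (τ ^ i) X₀ ⟩
    τ * (τ ^ i * X₀)  ≤⟨ *-monoʳ-≤ τ (smooth-loss i) ⟩
    τ * (X i + i * L)  ≡⟨ *-distribˡ-+ τ (X i) (i * L) ⟩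
    τ * X i + τ * (i * L)  ≤⟨ +-monoˡ-≤ (τ * (i * L)) (smoothen-loss (smooth i) (τ ^ i) (smooth-≤ i) (smooth-mass i)) ⟩
    X (suc i) + τ * L + τ * (i * L)  ≡⟨ lem (X (suc i)) τ i (τ ^ i) (μ * μ) ⟩
    X (suc i) + suc i * (3 * (τ ^ suc i * (μ * μ))) ∎
    where
    open ≤-Reasoning
    X₀ = sum G (λ x → ι (C x) * (h * g x))
    X : ℕ → ℕ
    X i = sum G (λ x → smooth i x * (h * g x))
    L = 3 * (τ ^ i * (μ * μ))
    lem : ∀ x t i p m → x + t * (3 * (p * m)) + t * (i * (3 * (p * m))) ≡ x + suc i * (3 * (t * p * m))
    lem = solve-∀

-- Fourier energy of a set

indicator : (𝔽₂^ n → Bool) → 𝔽₂^ n → ℤ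
indicator P x = pos (ι (P x))

energy : (𝔽₂^ n → Bool) → 𝔽₂^ n → ℕ
energy P ξ = absᶻ (hat (indicator P) ξ) * absᶻ (hat (indicator P) ξ)

abs-square : ∀ i → pos (absᶻ i * absᶻ i) ≡ i *ᶻ i
abs-square i = trans (ℤₚ.pos-* (absᶻ i) (absᶻ i)) (lem i)
  where
  lem : ∀ i → pos (absᶻ i) *ᶻ pos (absᶻ i) ≡ i *ᶻ i
  lem (pos _)       = refl
  lem (ℤ.-[1+ _ ]) = refl

agree disagree : (𝔽₂^ n → Bool) → 𝔽₂^ n → ℕ
agree    {n} P ξ = sum (𝔾 n) (λ x → ι (P x) * ι (not (dot ξ x)))
disagree {n} P ξ = sum (𝔾 n) (λ x → ι (P x) * ι (dot ξ x))

agree+disagree : (P : 𝔽₂^ n → Bool) (ξ : 𝔽₂^ n) → agree P ξ + disagree P ξ ≡ count P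
agree+disagree {n} P ξ = trans (sym (sum-+ (𝔾 n) _ _)) (sum-cong (𝔾 n) (λ x → lem (ι (P x)) (dot ξ x)))
  where
  lem : ∀ p b → p * ι (not b) + p * ι b ≡ p
  lem p true  = trans (cong₂ _+_ (*-zeroʳ p) (*-identityʳ p)) refl
  lem p false = trans (cong₂ _+_ (*-identityʳ p) (*-zeroʳ p)) (+-identityʳ p)

hat-indicator : (P : 𝔽₂^ n → Bool) (ξ : 𝔽₂^ n) → hat (indicator P) ξ ≡ pos (agree P ξ) -ᶻ pos (disagree P ξ)
hat-indicator {n} P ξ = begin
  sumᶻ (𝔾 n) (λ x → pos (ι (P x)) *ᶻ χ ξ x)
    ≡⟨ ℤΣ.sum-cong (𝔾 n) (λ x → lem (P x) (dot ξ x)) ⟩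
  sumᶻ (𝔾 n) (λ x → pos (ι (P x) * ι (not (dot ξ x))) +ᶻ -ᶻ pos (ι (P x) * ι (dot ξ x)))
    ≡⟨ trans (ℤΣ.sum-+ (𝔾 n) _ _) (cong₂ _+ᶻ_ (sym (pos-sum (𝔾 n) _)) (trans (sumᶻ-neg (𝔾 n) _) (cong -ᶻ_ (sym (pos-sum (𝔾 n) _))))) ⟩
  pos (agree P ξ) -ᶻ pos (disagree P ξ)  ∎
  where
  open ≡-Reasoning
  lem : ∀ p b → pos (ι p) *ᶻ sgn b ≡ pos (ι p * ι (not b)) +ᶻ -ᶻ pos (ι p * ι b)
  lem true  true  = refl
  lem true  false = refl
  lem false true  = refl
  lem false false = refl

-- The transform is `agree` minus `disagree`, so a large energy means that few pairs of points of
-- `P` are told apart by ξ.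
energy-agree : (P : 𝔽₂^ n → Bool) (ξ : 𝔽₂^ n) → energy P ξ + 4 * (agree P ξ * disagree P ξ) ≡ count P * count P
energy-agree P ξ = ℤₚ.+-injective (begin
  pos (energy P ξ + 4 * (u * v))  ≡⟨ ℤₚ.pos-+ (energy P ξ) _ ⟩
  pos (energy P ξ) +ᶻ pos (4 * (u * v))  ≡⟨ cong₂ _+ᶻ_ (trans (abs-square (hat (indicator P) ξ)) (cong (λ t → t *ᶻ t) (hat-indicator P ξ)))
                                                               (trans (ℤₚ.pos-* 4 (u * v)) (cong (pos 4 *ᶻ_) (ℤₚ.pos-* u v))) ⟩
  (pos u -ᶻ pos v) *ᶻ (pos u -ᶻ pos v) +ᶻ pos 4 *ᶻ (pos u *ᶻ pos v)  ≡⟨ lem (pos u) (pos v) ⟩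
  (pos u +ᶻ pos v) *ᶻ (pos u +ᶻ pos v)  ≡⟨ cong₂ _*ᶻ_ sum≡ sum≡ ⟩
  pos (count P) *ᶻ pos (count P)  ≡⟨ ℤₚ.pos-* (count P) (count P) ⟨
  pos (count P * count P)  ∎)
  where
  open ≡-Reasoning
  u = agree P ξ
  v = disagree P ξ
  sum≡ : pos u +ᶻ pos v ≡ pos (count P)
  sum≡ = trans (sym (ℤₚ.pos-+ u v)) (cong pos (agree+disagree P ξ))
  lem : ∀ u v → (u -ᶻ v) *ᶻ (u -ᶻ v) +ᶻ pos 4 *ᶻ (u *ᶻ v) ≡ (u +ᶻ v) *ᶻ (u +ᶻ v)
  lem = ℤ-Solver.solve-∀

energy-≤ : (P : 𝔽₂^ n → Bool) (ξ : 𝔽₂^ n) → energy P ξ ≤ count P * count P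
energy-≤ P ξ = ≤-trans (m≤m+n _ _) (≤-reflexive (energy-agree P ξ))

sum-energy : (P : 𝔽₂^ n → Bool) → sum (𝔾 n) (energy P) ≡ 2 ^ n * count P
sum-energy {n} P = ℤₚ.+-injective (begin
  pos (sum (𝔾 n) (energy P))  ≡⟨ pos-sum (𝔾 n) _ ⟩
  sumᶻ (𝔾 n) (λ ξ → pos (energy P ξ))  ≡⟨ ℤΣ.sum-cong (𝔾 n) (λ ξ → abs-square (hat (indicator P) ξ)) ⟩
  sumᶻ (𝔾 n) (λ ξ → hat (indicator P) ξ *ᶻ hat (indicator P) ξ)  ≡⟨ parseval (indicator P) (indicator P) ⟩
  pos (2 ^ n) *ᶻ sumᶻ (𝔾 n) (λ x → indicator P x *ᶻ indicator P x)  ≡⟨ cong (pos (2 ^ n) *ᶻ_) (trans (ℤΣ.sum-cong (𝔾 n) (λ x → trans (sym (ℤₚ.pos-* (ι (P x)) _)) (cong pos (ι-*-ι (P x))))) (sym (pos-sum (𝔾 n) _))) ⟩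
  pos (2 ^ n) *ᶻ pos (count P)  ≡⟨ ℤₚ.pos-* (2 ^ n) (count P) ⟨
  pos (2 ^ n * count P)  ∎)
  where open ≡-Reasoning

-- Density increments

-- The Riesz weight 2 + χ of a character, which is 3 on its kernel and 1 off it.
rieszBit : Bool → ℕ
rieszBit true  = 1
rieszBit false = 3

riesz : Vec (𝔽₂^ n) k → 𝔽₂^ n → ℕ
riesz Ξ z = prod (λ ξ → rieszBit (dot ξ z)) Ξ

data AllTrue (P : 𝔽₂^ n → Bool) : Vec (𝔽₂^ n) k → Set where
  []  : AllTrue P []
  _∷_ : {ξ : 𝔽₂^ n} {Ξ : Vec (𝔽₂^ n) k} → P ξ ≡ true → AllTrue P Ξ → AllTrue P (ξ ∷ Ξ)

-- `cuts` are big characters chosen greedily, each nontrivial on what the earlier ones left, hence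
-- independent. Independence is recorded as the total of the Riesz product, the form needed for
-- Chang's theorem.
record Annihilator {n : ℕ} (big : 𝔽₂^ n → Bool) (e : ℕ) (ψ : Emb e n) : Set where
  field
    codim dimension : ℕ
    dims        : e ≡ codim + dimension
    sub         : Emb dimension n
    annihilated : ∀ ξ → big ξ ≡ true → ∀ y → dot ξ (fun sub y) ≡ false
    cuts        : Vec (𝔽₂^ n) codim
    cuts-big    : AllTrue big cuts
    riesz-sum   : ∀ x → sum (𝔾 e) (λ y → riesz cuts (x ⊕ fun ψ y)) ≡ 2 ^ e * 2 ^ codim

annihilator : (big : 𝔽₂^ n → Bool) (e : ℕ) (ψ : Emb e n) → Annihilator big e ψ
annihilator {n} big e ψ with ∃? (λ ξ → (big ξ 𝔹ₚ.≟ true) ×-dec ∃? (λ y → dot ξ (fun ψ y) 𝔹ₚ.≟ true))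
... | no none = record
  { codim = 0 ; dimension = e ; dims = refl ; sub = ψ
  ; annihilated = λ ξ bξ y → 𝔹ₚ.¬-not (λ dt → none (ξ , bξ , y , dt))
  ; cuts = [] ; cuts-big = []
  ; riesz-sum = λ x → sum-const-𝔾 e 1
  }
annihilator {n} big zero ψ | yes (ξ , bξ , [] , dt) =
  contradiction (trans (sym dt) (trans (cong (dot ξ) (0v-fun ψ)) (additiveB-0v (dot ξ) (dot-⊕ ξ)))) λ ()
annihilator {n} big (suc e) ψ | yes (ξ , bξ , y₀ , dt) = record
  { codim = suc (codim R) ; dimension = dimension R ; dims = cong suc (dims R) ; sub = sub R
  ; annihilated = annihilated R
  ; cuts = ξ ∷ cuts R ; cuts-big = bξ ∷ cuts-big R
  ; riesz-sum = total
  }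
  where
  open Annihilator
  κ : 𝔽₂^ (suc e) → Bool
  κ y = dot ξ (fun ψ y)
  κ-add : AdditiveB κ
  κ-add y z = trans (cong (dot ξ) (add ψ y z)) (dot-⊕ ξ _ _)
  L : KernelChart κ
  L = kernelChart κ κ-add (y₀ , dt)
  ψ′ : Emb e n
  ψ′ = ψ ∘ₑ chart L
  R : Annihilator big e ψ′
  R = annihilator big e ψ′
  N = 2 ^ e * 2 ^ codim R
  total : ∀ x → sum (𝔾 (suc e)) (λ y → riesz (ξ ∷ cuts R) (x ⊕ fun ψ y)) ≡ 2 ^ suc e * 2 ^ suc (codim R)
  total x = begin
    sum (𝔾 (suc e)) (λ y → riesz (ξ ∷ cuts R) (x ⊕ fun ψ y))
      ≡⟨ split L _ ⟩
    sum (𝔾 e) (λ y → rieszBit (dot ξ (x ⊕ fun ψ′ y)) * riesz (cuts R) (x ⊕ fun ψ′ y)) +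
    sum (𝔾 e) (λ y → rieszBit (dot ξ (x ⊕ fun ψ (offset L ⊕ fun (chart L) y))) * riesz (cuts R) (x ⊕ fun ψ (offset L ⊕ fun (chart L) y)))
      ≡⟨ cong₂ _+_
           (trans (sum-cong (𝔾 e) (λ y → cong (λ b → rieszBit b * riesz (cuts R) (x ⊕ fun ψ′ y)) (on y)))
             (trans (sum-*ˡ (𝔾 e) (rieszBit (dot ξ x)) _) (cong (rieszBit (dot ξ x) *_) (riesz-sum R x))))
           (trans (sum-cong (𝔾 e) (λ y → cong₂ (λ b z → rieszBit b * riesz (cuts R) z) (off y) (regroup y)))
             (trans (sum-*ˡ (𝔾 e) (rieszBit (not (dot ξ x))) _) (cong (rieszBit (not (dot ξ x)) *_) (riesz-sum R (x ⊕ fun ψ (offset L)))))) ⟩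
    -- The new character takes one sign on each half, so the two weights are 3 and 1 in some order.
    rieszBit (dot ξ x) * N + rieszBit (not (dot ξ x)) * N
      ≡⟨ four (dot ξ x) ⟩
    4 * N
      ≡⟨ lem (2 ^ e) (2 ^ codim R) ⟩
    2 ^ suc e * 2 ^ suc (codim R)  ∎
    where
    open ≡-Reasoning
    lem : ∀ a b → 4 * (a * b) ≡ 2 * a * (2 * b)
    lem = solve-∀
    four : ∀ b → rieszBit b * N + rieszBit (not b) * N ≡ 4 * N
    four true  = sym (*-distribʳ-+ N 1 3)
    four false = sym (*-distribʳ-+ N 3 1)
    regroup : ∀ y → x ⊕ fun ψ (offset L ⊕ fun (chart L) y) ≡ (x ⊕ fun ψ (offset L)) ⊕ fun ψ′ y
    regroup y = trans (cong (x ⊕_) (add ψ _ _)) (sym (⊕-assoc x _ _))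
    on : ∀ y → dot ξ (x ⊕ fun ψ′ y) ≡ dot ξ x
    on y = trans (dot-⊕ ξ x _) (trans (cong (dot ξ x xor_) (κ-chart L y)) (𝔹ₚ.xor-identityʳ _))
    off : ∀ y → dot ξ (x ⊕ fun ψ (offset L ⊕ fun (chart L) y)) ≡ not (dot ξ x)
    off y = trans (cong (dot ξ) (regroup y)) (trans (dot-⊕ ξ _ _)
      (trans (cong₂ _xor_ (trans (dot-⊕ ξ x _) (cong (dot ξ x xor_) (κ-off L))) (κ-chart L y))
        (trans (𝔹ₚ.xor-identityʳ _) (𝔹ₚ.xor-comm (dot ξ x) true))))

ι*-true : ∀ b {u v} → ι b * u < ι b * v → b ≡ true × u < v
ι*-true true {u} {v} lt = refl , subst₂ _<_ (*-identityˡ u) (*-identityˡ v) lt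
ι*-true false ()

-- Chang's theorem: independent characters with large Fourier coefficients on T
-- agree on most differences of T, where the Riesz product is exponentially large.
module Chang {n : ℕ} (T : 𝔽₂^ n → Bool) (T>0 : 0 < count T) {d : ℕ} (Ξ : Vec (𝔽₂^ n) d)
  (big : AllTrue (λ ξ → 3 * (count T * count T) ≤ᵇ 4 * energy T ξ) Ξ)
  (riesz-sum : sum (𝔾 n) (riesz Ξ) ≡ 2 ^ n * 2 ^ d) where

  private
    G = 𝔾 n
    q = 2 ^ n
    c = count T

  defects : Vec (𝔽₂^ n) k → 𝔽₂^ n → ℕ
  defects []      z = 0
  defects (ξ ∷ Ξ) z = ι (dot ξ z) + defects Ξ z

  disagreement : ∀ ξ → sum G (λ t′ → ι (T t′) * sum G (λ t → ι (T t) * ι (dot ξ (t ⊕ t′)))) ≡ 2 * (agree T ξ * disagree T ξ)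
  disagreement ξ = begin
    sum G (λ t′ → ι (T t′) * sum G (λ t → ι (T t) * ι (dot ξ (t ⊕ t′))))
      ≡⟨ sum-cong G (λ t′ → cong (ι (T t′) *_) (trans (sum-cong G (λ t → trans (cong (λ b → ι (T t) * ι b) (dot-⊕ ξ t t′)) (bits (ι (T t)) (dot ξ t) (dot ξ t′))))
           (trans (sum-+ G _ _) (cong₂ _+_ (sum-*ʳ G (ι (not (dot ξ t′))) _) (sum-*ʳ G (ι (dot ξ t′)) _))))) ⟩
    sum G (λ t′ → ι (T t′) * (v * ι (not (dot ξ t′)) + u * ι (dot ξ t′)))
      ≡⟨ trans (sum-cong G (λ t′ → lem (ι (T t′)) v u (ι (not (dot ξ t′))) (ι (dot ξ t′))))
           (trans (sum-+ G _ _) (cong₂ _+_ (sum-*ˡ G v _) (sum-*ˡ G u _))) ⟩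
    v * u + u * v
      ≡⟨ lem₂ u v ⟩
    2 * (u * v)  ∎
    where
    open ≡-Reasoning
    u = agree T ξ
    v = disagree T ξ
    bits : ∀ p b c → p * ι (b xor c) ≡ p * ι b * ι (not c) + p * ι (not b) * ι c
    bits p true  true  = trans (*-zeroʳ p) (sym (cong₂ _+_ (*-zeroʳ (p * 1)) (cong (_* 1) (*-zeroʳ p))))
    bits p true  false = sym (trans (cong₂ _+_ (*-identityʳ (p * 1)) (*-zeroʳ (p * 0))) (+-identityʳ _))
    bits p false true  = sym (cong₂ _+_ (*-zeroʳ (p * 0)) (*-identityʳ (p * 1)))
    bits p false false = trans (*-zeroʳ p) (sym (cong₂ _+_ (cong (_* 1) (*-zeroʳ p)) (*-zeroʳ (p * 1))))
    lem : ∀ i v u a b → i * (v * a + u * b) ≡ v * (i * a) + u * (i * b)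
    lem = solve-∀
    lem₂ : ∀ u v → v * u + u * v ≡ 2 * (u * v)
    lem₂ = solve-∀

  -- Energy at least 3/4 of the maximum leaves at most a quarter for
  -- `4 * (agree T ξ * disagree T ξ)`, so a random ordered pair disagrees with probability at most
  -- 1/8.
  rarely : ∀ ξ → (3 * (c * c) ≤ᵇ 4 * energy T ξ) ≡ true → 8 * (2 * (agree T ξ * disagree T ξ)) ≤ c * c
  rarely ξ b = +-cancelˡ-≤ (3 * (c * c)) _ _ (begin
    3 * (c * c) + 8 * (2 * uv)  ≤⟨ +-monoˡ-≤ (8 * (2 * uv)) (≤ᵇ⇒≤ (3 * (c * c)) _ (Equivalence.from 𝔹ₚ.T-≡ b)) ⟩
    4 * energy T ξ + 8 * (2 * uv)  ≡⟨ lem (energy T ξ) uv ⟩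
    4 * (energy T ξ + 4 * uv)  ≡⟨ cong (4 *_) (energy-agree T ξ) ⟩
    4 * (c * c)  ≡⟨ *-distribʳ-+ (c * c) 3 1 ⟩
    3 * (c * c) + 1 * (c * c)  ≡⟨ cong (3 * (c * c) +_) (*-identityˡ _) ⟩
    3 * (c * c) + c * c  ∎)
    where
    open ≤-Reasoning
    uv = agree T ξ * disagree T ξ
    lem : ∀ e u → 4 * e + 8 * (2 * u) ≡ 4 * (e + 4 * u)
    lem = solve-∀

  total-defects : ∀ {k} (Ξ : Vec (𝔽₂^ n) k) → AllTrue (λ ξ → 3 * (c * c) ≤ᵇ 4 * energy T ξ) Ξ →
    8 * sum G (λ t′ → ι (T t′) * sum G (λ t → ι (T t) * defects Ξ (t ⊕ t′))) ≤ k * (c * c)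
  total-defects []      []        = ≤-reflexive (cong (8 *_) (trans (sum-cong G (λ t′ → trans (cong (ι (T t′) *_) (trans (sum-cong G (λ t → *-zeroʳ (ι (T t)))) (sum-zero G))) (*-zeroʳ (ι (T t′))))) (sum-zero G)))
  total-defects (ξ ∷ Ξ) (b ∷ bs) = begin
    8 * sum G (λ t′ → ι (T t′) * sum G (λ t → ι (T t) * (ι (dot ξ (t ⊕ t′)) + defects Ξ (t ⊕ t′))))
      ≡⟨ cong (8 *_) (trans (sum-cong G (λ t′ → trans (cong (ι (T t′) *_) (trans (sum-cong G (λ t → *-distribˡ-+ (ι (T t)) _ _)) (sum-+ G _ _))) (*-distribˡ-+ (ι (T t′)) _ _))) (sum-+ G _ _)) ⟩
    8 * (sum G (λ t′ → ι (T t′) * sum G (λ t → ι (T t) * ι (dot ξ (t ⊕ t′)))) + X)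
      ≡⟨ trans (cong (λ s → 8 * (s + X)) (disagreement ξ)) (*-distribˡ-+ 8 (2 * (agree T ξ * disagree T ξ)) X) ⟩
    8 * (2 * (agree T ξ * disagree T ξ)) + 8 * X
      ≤⟨ +-mono-≤ (rarely ξ b) (total-defects Ξ bs) ⟩
    c * c + _ ∎
    where
    open ≤-Reasoning
    X = sum G (λ t′ → ι (T t′) * sum G (λ t → ι (T t) * defects Ξ (t ⊕ t′)))

  base-point : ∃ λ t′ → T t′ ≡ true × 8 * sum G (λ t → ι (T t) * defects Ξ (t ⊕ t′)) ≤ d * c
  base-point = proj₁ found , proj₁ cond , ≤-pred (proj₂ cond)
    where
    open ≤-Reasoning
    F : 𝔽₂^ n → ℕ
    F t′ = 8 * sum G (λ t → ι (T t) * defects Ξ (t ⊕ t′))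
    found : ∃ λ t′ → ι (T t′) * F t′ < ι (T t′) * suc (d * c)
    found = sum<⇒∃ G (begin-strict
      sum G (λ t′ → ι (T t′) * F t′)  ≡⟨ trans (sum-cong G (λ t′ → *-swap (ι (T t′)) 8 _)) (sum-*ˡ G 8 _) ⟩
      _  ≤⟨ total-defects Ξ big ⟩
      d * (c * c)  ≡⟨ *-swap d c c ⟩
      c * (d * c)  <⟨ *-monoʳ-< c {{>-nonZero T>0}} (n<1+n (d * c)) ⟩
      c * suc (d * c)  ≡⟨ sum-*ʳ G (suc (d * c)) _ ⟨
      sum G (λ t′ → ι (T t′) * suc (d * c)) ∎)
    cond = ι*-true (T (proj₁ found)) (proj₂ found)

  private
    t₀ = proj₁ base-point

  typical : 𝔽₂^ n → Bool
  typical t = T t ∧ (4 * defects Ξ (t ⊕ t₀) ≤ᵇ d)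

  -- Relative to `t₀` the average number of defects is at most `d / 8`, and Markov's inequality at
  -- `d / 4` keeps half of `T`.
  many-typical : 0 < d → c ≤ 2 * count typical
  many-typical d>0 = *-cancelˡ-≤′ d>0 (+-cancelʳ-≤ (d * c) _ _ (begin
    d * c + d * c  ≡⟨ lem₀ d c ⟩
    2 * (d * c)  ≡⟨ cong (2 *_) (trans (*-comm d c) (sym (sum-*ʳ G d (ι ∘ T)))) ⟩
    2 * sum G (λ t → ι (T t) * d)  ≤⟨ *-monoʳ-≤ 2 (sum-mono G term) ⟩
    2 * sum G (λ t → ι (typical t) * d + 4 * (ι (T t) * defects Ξ (t ⊕ t₀)))
      ≡⟨ cong (2 *_) (trans (sum-+ G _ _) (cong₂ _+_ (sum-*ʳ G d _) (sum-*ˡ G 4 _))) ⟩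
    2 * (count typical * d + 4 * X)  ≡⟨ lem (count typical) d X ⟩
    d * (2 * count typical) + 8 * X  ≤⟨ +-monoʳ-≤ (d * (2 * count typical)) (proj₂ (proj₂ base-point)) ⟩
    d * (2 * count typical) + d * c  ∎))
    where
    open ≤-Reasoning
    X = sum G (λ t → ι (T t) * defects Ξ (t ⊕ t₀))
    lem₀ : ∀ d c → d * c + d * c ≡ 2 * (d * c)
    lem₀ = solve-∀
    lem : ∀ y d x → 2 * (y * d + 4 * x) ≡ d * (2 * y) + 8 * x
    lem = solve-∀
    cases : ∀ p b {u} → (b ≡ false → d ≤ 4 * u) → ι p * d ≤ ι (p ∧ b) * d + 4 * (ι p * u)
    cases false b     f = z≤n
    cases true  true  f = m≤m+n _ _
    cases true  false {u} f = ≤-trans (≤-reflexive (+-identityʳ d)) (≤-trans (f refl) (≤-reflexive (cong (4 *_) (sym (+-identityʳ u)))))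
    atypical : ∀ u → (4 * u ≤ᵇ d) ≡ false → d ≤ 4 * u
    atypical u eq with 4 * u ≤? d
    ... | no ¬p = <⇒≤ (≰⇒> ¬p)
    ... | yes p = contradiction (trans (sym eq) (Equivalence.to 𝔹ₚ.T-≡ (≤⇒≤ᵇ p))) λ ()
    term : ∀ t → ι (T t) * d ≤ ι (typical t) * d + 4 * (ι (T t) * defects Ξ (t ⊕ t₀))
    term t = cases (T t) (4 * defects Ξ (t ⊕ t₀) ≤ᵇ d) (atypical (defects Ξ (t ⊕ t₀)))

  riesz-defects : ∀ {k} (Ξ : Vec (𝔽₂^ n) k) z → riesz Ξ z * 3 ^ defects Ξ z ≡ 3 ^ k
  riesz-defects []      z = refl
  riesz-defects (ξ ∷ Ξ) z with dot ξ z
  ... | true  = trans (lem (riesz Ξ z) (3 ^ defects Ξ z)) (cong (3 *_) (riesz-defects Ξ z))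
    where
    lem : ∀ r p → (1 * r) * (3 * p) ≡ 3 * (r * p)
    lem = solve-∀
  ... | false = trans (*-assoc 3 (riesz Ξ z) (3 ^ defects Ξ z)) (cong (3 *_) (riesz-defects Ξ z))

  small-riesz : 0 < d → ∃ λ t → typical t ≡ true × c * riesz Ξ (t ⊕ t₀) ≤ 2 * (q * 2 ^ d)
  small-riesz d>0 = proj₁ found , proj₁ cond , ≤-pred (proj₂ cond)
    where
    open ≤-Reasoning
    B = q * 2 ^ d
    found : ∃ λ t → ι (typical t) * (c * riesz Ξ (t ⊕ t₀)) < ι (typical t) * suc (2 * B)
    found = sum<⇒∃ G (*-cancelˡ-<′ 2 (begin-strict
      2 * sum G (λ t → ι (typical t) * (c * riesz Ξ (t ⊕ t₀)))
        ≤⟨ *-monoʳ-≤ 2 (sum-mono G (λ t → ≤-trans (*-monoˡ-≤ (c * riesz Ξ (t ⊕ t₀)) (ι≤1 (typical t))) (≤-reflexive (*-identityˡ _)))) ⟩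
      2 * sum G (λ t → c * riesz Ξ (t ⊕ t₀))
        ≡⟨ cong (2 *_) (trans (sum-*ˡ G c _) (cong (c *_) (trans (sum-shiftʳ t₀ (riesz Ξ)) riesz-sum))) ⟩
      2 * (c * B)  ≡⟨ *-swap 2 c B ⟩
      c * (2 * B)  <⟨ *-monoʳ-< c {{>-nonZero T>0}} (n<1+n (2 * B)) ⟩
      c * suc (2 * B)  ≤⟨ *-monoˡ-≤ (suc (2 * B)) (many-typical d>0) ⟩
      2 * count typical * suc (2 * B)  ≡⟨ trans (*-assoc 2 (count typical) _) (cong (2 *_) (sym (sum-*ʳ G (suc (2 * B)) _))) ⟩
      2 * sum G (λ t → ι (typical t) * suc (2 * B))  ∎))
    cond = ι*-true (typical (proj₁ found)) (proj₂ found)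

  -- A typical point has Riesz weight at least 3^(3d/4), while the average over typical points is at
  -- most 2^(d + 1) divided by the density of `T`. Hence 27^d is at most 16^(d + E + 1); cubing,
  -- with 27^3 above 4 times 16^3, gives a linear bound.
  dimension-bound : ∀ E → q ≤ c * 2 ^ E → d ≤ 6 + 6 * E
  dimension-bound E q≤ = by-dimension d refl
    where
    open ≤-Reasoning
    by-dimension : ∀ k → k ≡ d → k ≤ 6 + 6 * E
    by-dimension zero    eq = z≤n
    by-dimension (suc k) eq = 2^-cancel-≤ _ _ (square-cancel-≤ (begin
      2 ^ suc k * 2 ^ suc k  ≡⟨ *-^ 2 2 (suc k) ⟨
      4 ^ suc k  ≡⟨ cong (4 ^_) eq ⟩
      4 ^ d  ≤⟨ *-cancelˡ-≤′ (m^n>0 4096 d) (begin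
        4096 ^ d * 4 ^ d  ≡⟨ *-^ 4096 4 d ⟨
        16384 ^ d  ≤⟨ ^-monoˡ-≤ d (≤ᵇ⇒≤ 16384 19683 _) ⟩
        19683 ^ d  ≡⟨ trans (^-*-assoc 27 3 d) (trans (cong (27 ^_) (*-comm 3 d)) (sym (^-*-assoc 27 d 3))) ⟩
        (27 ^ d) ^ 3  ≤⟨ ^-monoˡ-≤ 3 twenty-seven ⟩
        (16 * 16 ^ E * 16 ^ d) ^ 3  ≡⟨ trans (*-^ (16 * 16 ^ E) (16 ^ d) 3) (trans (cong₂ _*_ (*-^ 16 (16 ^ E) 3) (trans (^-*-assoc 16 d 3) (trans (cong (16 ^_) (*-comm d 3)) (sym (^-*-assoc 16 3 d))))) (*-comm _ (4096 ^ d))) ⟩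
        4096 ^ d * (16 ^ 3 * (16 ^ E) ^ 3)  ∎) ⟩
      16 ^ 3 * (16 ^ E) ^ 3  ≡⟨ cong (16 ^ 3 *_) (trans (^-*-assoc 16 E 3) (cong (16 ^_) (*-comm E 3))) ⟩
      16 ^ 3 * 16 ^ (3 * E)  ≡⟨ ^-distribˡ-+-* 16 3 (3 * E) ⟨
      16 ^ (3 + 3 * E)  ≡⟨ trans (^-*-assoc 4 2 (3 + 3 * E)) (cong (4 ^_) (six E)) ⟩
      4 ^ (6 + 6 * E)  ≡⟨ *-^ 2 2 (6 + 6 * E) ⟩
      2 ^ (6 + 6 * E) * 2 ^ (6 + 6 * E) ∎))
      where
      six : ∀ E → 2 * (3 + 3 * E) ≡ 6 + 6 * E
      six = solve-∀
      found = small-riesz (subst (0 <_) eq (s≤s z≤n))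
      z = proj₁ found ⊕ t₀
      R = riesz Ξ z
      few : 4 * defects Ξ z ≤ d
      few = ≤ᵇ⇒≤ _ _ (Equivalence.from 𝔹ₚ.T-≡ (𝔹ₚ.∧-conicalʳ (T (proj₁ found)) _ (proj₁ (proj₂ found))))
      27^≤R⁴ : 27 ^ d ≤ R ^ 4
      27^≤R⁴ = *-cancelˡ-≤′ (m^n>0 3 d) (begin
        3 ^ d * 27 ^ d  ≡⟨ *-^ 3 27 d ⟨
        81 ^ d  ≡⟨ trans (^-*-assoc 3 4 d) (trans (cong (3 ^_) (*-comm 4 d)) (sym (^-*-assoc 3 d 4))) ⟩
        (3 ^ d) ^ 4  ≡⟨ cong (_^ 4) (riesz-defects Ξ z) ⟨
        (R * 3 ^ defects Ξ z) ^ 4  ≡⟨ trans (*-^ R (3 ^ defects Ξ z) 4) (trans (cong (R ^ 4 *_) (trans (^-*-assoc 3 (defects Ξ z) 4) (cong (3 ^_) (*-comm (defects Ξ z) 4)))) (*-comm (R ^ 4) _)) ⟩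
        3 ^ (4 * defects Ξ z) * R ^ 4  ≤⟨ *-monoˡ-≤ (R ^ 4) (^-monoʳ-≤ 3 few) ⟩
        3 ^ d * R ^ 4  ∎)
      twenty-seven : 27 ^ d ≤ 16 * 16 ^ E * 16 ^ d
      twenty-seven = *-cancelˡ-≤′ (^-pos 4 T>0) (begin
        c ^ 4 * 27 ^ d  ≤⟨ *-monoʳ-≤ (c ^ 4) 27^≤R⁴ ⟩
        c ^ 4 * R ^ 4  ≡⟨ *-^ c R 4 ⟨
        (c * R) ^ 4  ≤⟨ ^-monoˡ-≤ 4 (≤-trans (proj₂ (proj₂ found)) (*-monoʳ-≤ 2 (*-monoˡ-≤ (2 ^ d) q≤))) ⟩
        (2 * (c * 2 ^ E * 2 ^ d)) ^ 4  ≡⟨ trans (*-^ 2 (c * 2 ^ E * 2 ^ d) 4) (cong (16 *_) (trans (*-^ (c * 2 ^ E) (2 ^ d) 4) (cong₂ _*_ (trans (*-^ c (2 ^ E) 4) (cong (c ^ 4 *_) (p4 E))) (p4 d)))) ⟩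
        16 * (c ^ 4 * 16 ^ E * 16 ^ d)  ≡⟨ lem 16 (c ^ 4) (16 ^ E) (16 ^ d) ⟩
        c ^ 4 * (16 * 16 ^ E * 16 ^ d)  ∎)
        where
        p4 : ∀ k → (2 ^ k) ^ 4 ≡ 16 ^ k
        p4 k = trans (^-*-assoc 2 k 4) (trans (cong (2 ^_) (*-comm k 4)) (sym (^-*-assoc 2 4 k)))
        lem : ∀ s a b c → s * (a * b * c) ≡ a * (s * b * c)
        lem = solve-∀

≡-neg⇒≡0 : ∀ i → i ≡ -ᶻ i → i ≡ 0ℤ
≡-neg⇒≡0 (pos zero)    eq = refl
≡-neg⇒≡0 (pos (suc _)) ()
≡-neg⇒≡0 (ℤ.-[1+ _ ]) ()

trivialOn : Emb e n → 𝔽₂^ n → Bool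
trivialOn ψ ξ = ⌊ ∀? (λ y → dot ξ (fun ψ y) 𝔹ₚ.≟ false) ⌋

trivialOn-intro : (ψ : Emb e n) (ξ : 𝔽₂^ n) → (∀ y → dot ξ (fun ψ y) ≡ false) → trivialOn ψ ξ ≡ true
trivialOn-intro ψ ξ h with ∀? (λ y → dot ξ (fun ψ y) 𝔹ₚ.≟ false)
... | yes _ = refl
... | no ¬h = contradiction h ¬h

character-sum : (ψ : Emb e n) (ξ : 𝔽₂^ n) → pos (2 ^ e * ι (trivialOn ψ ξ)) ≤ᶻ sumᶻ (𝔾 e) (λ y → χ ξ (fun ψ y))
character-sum {e} ψ ξ with ∀? (λ y → dot ξ (fun ψ y) 𝔹ₚ.≟ false)
... | yes h = ℤₚ.≤-reflexive (sym (trans (ℤΣ.sum-cong (𝔾 e) (λ y → cong sgn (h y)))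
  (trans (sym (pos-sum (𝔾 e) (λ _ → 1))) (cong pos (sum-const-𝔾 e 1)))))
... | no ¬h = ℤₚ.≤-reflexive (trans (cong pos (*-zeroʳ (2 ^ e))) (sym vanishes))
  where
  w : ∃ λ y → ¬ dot ξ (fun ψ y) ≡ false
  w with ∀⊎∃¬ (λ y → dot ξ (fun ψ y) 𝔹ₚ.≟ false)
  ... | inj₁ h  = contradiction h ¬h
  ... | inj₂ w′ = w′
  S = sumᶻ (𝔾 e) (λ y → χ ξ (fun ψ y))
  flip : ∀ y → χ ξ (fun ψ (proj₁ w ⊕ y)) ≡ -ᶻ χ ξ (fun ψ y)
  flip y = trans (cong (χ ξ) (add ψ _ y)) (trans (χ-⊕ ξ _ _)
    (trans (cong (λ b → sgn b *ᶻ χ ξ (fun ψ y)) (𝔹ₚ.¬-not (proj₂ w))) (ℤₚ.-1*i≡-i _)))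
  vanishes : S ≡ 0ℤ
  vanishes = ≡-neg⇒≡0 S (trans (sym (ℤΣ.sum-shift (proj₁ w) (λ y → χ ξ (fun ψ y))))
    (trans (ℤΣ.sum-cong (𝔾 e) flip) (sumᶻ-neg (𝔾 e) _)))

module SubspaceEnergy {n : ℕ} (A : 𝔽₂^ n → Bool) where

  open Representation A
  private
    G = 𝔾 n

  r-conv : ∀ x → pos (r x) ≡ conv (indicator A) (indicator A) x
  r-conv x = trans (pos-sum G _) (ℤΣ.sum-cong G (λ y → ℤₚ.pos-* (ι (A y)) _))

  -- Poisson summation: summing characters over the subspace selects those that are trivial on it.
  energy-trivialOn : (ψ : Emb e n) →
    2 ^ e * sum G (λ ξ → ι (trivialOn ψ ξ) * energy A ξ) ≤ q * sum (𝔾 e) (λ y → r (fun ψ y))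
  energy-trivialOn {e} ψ = ℤ.drop‿+≤+ (begin
    pos (2 ^ e * sum G (λ ξ → ι (trivialOn ψ ξ) * energy A ξ))
      ≡⟨ cong pos (sym (sum-*ˡ G (2 ^ e) _)) ⟩
    pos (sum G (λ ξ → 2 ^ e * (ι (trivialOn ψ ξ) * energy A ξ)))
      ≡⟨ trans (pos-sum G _) (ℤΣ.sum-cong G (λ ξ → trans (cong pos (rot (2 ^ e) (ι (trivialOn ψ ξ)) (energy A ξ))) (ℤₚ.pos-* (energy A ξ) _))) ⟩
    sumᶻ G (λ ξ → pos (energy A ξ) *ᶻ pos (2 ^ e * ι (trivialOn ψ ξ)))
      ≤⟨ sumᶻ-mono G (λ ξ → ℤₚ.*-monoˡ-≤-nonNeg (pos (energy A ξ)) (character-sum ψ ξ)) ⟩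
    sumᶻ G (λ ξ → pos (energy A ξ) *ᶻ sumᶻ (𝔾 e) (λ y → χ ξ (fun ψ y)))
      ≡⟨ trans (ℤΣ.sum-cong G (λ ξ → trans (sym (ℤΣ.sum-*ˡ (𝔾 e) (pos (energy A ξ)) _)) (ℤΣ.sum-cong (𝔾 e) (λ y → cong (_*ᶻ χ ξ (fun ψ y)) (abs-square (hat (indicator A) ξ))))))
           (ℤΣ.sum-swap G (𝔾 e) _) ⟩
    sumᶻ (𝔾 e) (λ y → sumᶻ G (λ ξ → (hat (indicator A) ξ *ᶻ hat (indicator A) ξ) *ᶻ χ ξ (fun ψ y)))
      ≡⟨ trans (ℤΣ.sum-cong (𝔾 e) (λ y → trans (inversion (indicator A) (indicator A) (fun ψ y)) (cong (pos q *ᶻ_) (sym (r-conv (fun ψ y))))))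
           (ℤΣ.sum-*ˡ (𝔾 e) (pos q) _) ⟩
    pos q *ᶻ sumᶻ (𝔾 e) (λ y → pos (r (fun ψ y)))
      ≡⟨ trans (ℤₚ.pos-* q _) (cong (pos q *ᶻ_) (pos-sum (𝔾 e) _)) ⟨
    pos (q * sum (𝔾 e) (λ y → r (fun ψ y)))  ∎)
    where
    open ℤₚ.≤-Reasoning
    rot : ∀ a b c → a * (b * c) ≡ c * (a * b)
    rot = solve-∀

  -- Representations of elements of the subspace count, for each `x` in `A`, the points of `A` in
  -- the coset of `x`; some `x` reaches the average.
  dense-coset : (ψ : Emb e n) → 0 < a → 9 * (a * a) * 2 ^ e ≤ 8 * (q * sum (𝔾 e) (λ y → r (fun ψ y))) →
    ∃ λ x → 9 * (a * 2 ^ e) ≤ 8 * (q * count (λ y → A (x ⊕ fun ψ y)))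
  dense-coset {e} ψ a>0 le = proj₁ found , ≤-pred (proj₂ (ι*-true (A (proj₁ found)) (proj₂ found)))
    where
    open ≤-Reasoning
    cnt : 𝔽₂^ n → ℕ
    cnt x = count (λ y → A (x ⊕ fun ψ y))
    lem : ∀ c a e → a * (c * (a * e)) ≡ c * (a * a) * e
    lem = solve-∀
    rot : ∀ i c q x → i * (c * (q * x)) ≡ c * q * (i * x)
    rot = solve-∀
    total : sum (𝔾 e) (λ y → r (fun ψ y)) ≡ sum G (λ x → ι (A x) * cnt x)
    total = trans (sum-swap (𝔾 e) G _) (sum-cong G (λ x → sum-*ˡ (𝔾 e) (ι (A x)) _))
    found : ∃ λ x → ι (A x) * (9 * (a * 2 ^ e)) < ι (A x) * suc (8 * (q * cnt x))
    found = sum<⇒∃ G (begin-strict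
      sum G (λ x → ι (A x) * (9 * (a * 2 ^ e)))  ≡⟨ trans (sum-*ʳ G _ (ι ∘ A)) (lem 9 a (2 ^ e)) ⟩
      9 * (a * a) * 2 ^ e  ≤⟨ le ⟩
      8 * (q * sum (𝔾 e) (λ y → r (fun ψ y)))  ≡⟨ trans (cong (λ t → 8 * (q * t)) total) (sym (*-assoc 8 q (sum G (λ x → ι (A x) * cnt x)))) ⟩
      8 * q * sum G (λ x → ι (A x) * cnt x)  ≡⟨ trans (sym (sum-*ˡ G (8 * q) _)) (sum-cong G (λ x → sym (rot (ι (A x)) 8 q (cnt x)))) ⟩
      sum G (λ x → ι (A x) * (8 * (q * cnt x)))  <⟨ m<n+m _ a>0 ⟩
      a + sum G (λ x → ι (A x) * (8 * (q * cnt x)))  ≡⟨ trans (sum-cong G (λ x → *-suc (ι (A x)) (8 * (q * cnt x)))) (sum-+ G (ι ∘ A) _) ⟨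
      sum G (λ x → ι (A x) * suc (8 * (q * cnt x)))  ∎)

-- `folds` makes (3/4)^folds at most 2^-(T + 4); `accuracy` keeps the total smoothing loss at 3/128;
-- `blockSize` is what Chebyshev's inequality asks for; `blockCount` makes `4 ^ blockCount` at least
-- `4 * accuracy * 2 ^ logDensity`. Then `2 ^ logPeriods` bounds the inverse density of the periods,
-- and `stepCost` is Chang's bound for it.
module StepParameters (T : ℕ) where

  folds accuracy blockSize blockCount logDensity logPeriods stepCost : ℕ
  folds      = 3 * (T + 4)
  accuracy   = 128 * folds
  blockSize  = 64 * (accuracy * accuracy)
  logDensity = T * (8 * T)
  blockCount = 1 + accuracy + logDensity
  logPeriods = 1 + logDensity * blockSize * blockCount
  stepCost   = 6 + 6 * logPeriods

≤ᵇ-false : ∀ {k l} → (k ≤ᵇ l) ≡ false → l < k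
≤ᵇ-false {k} {l} eq with k ≤? l
... | no ¬p = ≰⇒> ¬p
... | yes p = contradiction (trans (sym eq) (Equivalence.to 𝔹ₚ.T-≡ (≤⇒≤ᵇ p))) λ ()

n<4^n : ∀ k → k < 4 ^ k
n<4^n zero    = s≤s z≤n
n<4^n (suc k) = begin-strict
  suc k  ≤⟨ n<4^n k ⟩
  4 ^ k  <⟨ m<m*n (4 ^ k) 4 {{>-nonZero (m^n>0 4 k)}} (s≤s (s≤s z≤n)) ⟩
  4 ^ k * 4  ≡⟨ *-comm (4 ^ k) 4 ⟩
  4 ^ suc k  ∎
  where open ≤-Reasoning

module DensityIncrement {n : ℕ} (A S : 𝔽₂^ n → Bool)
  (sum-free : ∀ y z → A y ≡ true → A z ≡ true → S (y ⊕ z) ≡ false)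
  (T : ℕ) (T≥20 : 20 ≤ T) (densS : 2 ^ n ≤ count S * 2 ^ T) (densA : 2 ^ n ≤ count A * 2 ^ T) where

  open Representation A
  open SubspaceEnergy A
  open StepParameters T

  private
    G = 𝔾 n
    ℓ = folds
    h = accuracy
    b = blockSize
    K = blockCount

  r≡0 : ∀ x → S x ≡ true → r x ≡ 0
  r≡0 x Sx = trans (sum-cong G (λ y → term y (A y) (A (y ⊕ x)) refl refl)) (sum-zero G)
    where
    term : ∀ y u v → A y ≡ u → A (y ⊕ x) ≡ v → ι u * ι v ≡ 0
    term y true  true  e₁ e₂ = contradiction (trans (sym Sx) (trans (cong S (sym (⊕-cancelˡ y x))) (sum-free y (y ⊕ x) e₁ e₂))) λ ()
    term y true  false _ _ = refl
    term y false _     _ _ = refl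

  opaque
    sifted : Sifted T
    sifted = sift S r≡0 T T≥20 densS densA

  open Sifted sifted using (C; large; mostly)

  μ : ℕ
  μ = count C

  positive : ∀ {c t} → q ≤ c * t → 0 < c
  positive {zero}  le = contradiction le (<⇒≱ q>0)
  positive {suc c} le = s≤s z≤n

  μ>0 : 0 < μ
  μ>0 = positive large

  a>0 : 0 < a
  a>0 = positive densA

  ℓ>0 : 0 < ℓ
  ℓ>0 = *-mono-≤ (s≤s {n = 2} z≤n) (≤-trans (s≤s z≤n) (m≤n+m 4 T))

  h>0 : 0 < h
  h>0 = *-mono-≤ (s≤s {n = 127} z≤n) ℓ>0

  module Samp = Sampling C popular h b K h>0 ≤-refl μ>0
  open Samp using (g; g≤μ; shift; bad; good; periods; many-periods; transfer)

  opaque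
    tuple : Vec (Vec (𝔽₂^ n) b) K
    tuple = proj₁ many-periods

    tuple-periods : q * (μ ^ b) ^ K ≤ 2 * ((q ^ b) ^ K * count (periods tuple))
    tuple-periods = proj₂ many-periods

  P : 𝔽₂^ n → Bool
  P = periods tuple

  P-large : q ≤ count P * 2 ^ logPeriods
  P-large = *-cancelˡ-≤′ (^-pos K (^-pos b μ>0)) (begin
    M * q  ≡⟨ *-comm M q ⟩
    q * M  ≤⟨ tuple-periods ⟩
    2 * ((q ^ b) ^ K * count P)  ≤⟨ *-monoʳ-≤ 2 (*-monoˡ-≤ (count P) (^-monoˡ-≤ K (^-monoˡ-≤ b large))) ⟩
    2 * (((μ * 2 ^ E) ^ b) ^ K * count P)
      ≡⟨ cong (λ t → 2 * (t * count P)) (trans (cong (_^ K) (trans (*-^ μ (2 ^ E) b) (cong (μ ^ b *_) (^-*-assoc 2 E b))))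
           (trans (*-^ (μ ^ b) (2 ^ (E * b)) K) (cong (M *_) (^-*-assoc 2 (E * b) K)))) ⟩
    2 * (M * 2 ^ (E * b * K) * count P)  ≡⟨ lem M (2 ^ (E * b * K)) (count P) ⟩
    M * (count P * 2 ^ logPeriods)  ∎)
    where
    open ≤-Reasoning
    E = logDensity
    M = (μ ^ b) ^ K
    lem : ∀ m t p → 2 * (m * t * p) ≡ m * (p * (2 * t))
    lem = solve-∀

  P>0 : 0 < count P
  P>0 = positive P-large

  Bad : 𝔽₂^ n → 𝔽₂^ n → Bool
  Bad t x = bad x (shift t tuple)

  size : 4 * (h * 2 ^ n) ≤ 4 ^ K * μ
  size = begin
    4 * (h * q)  ≤⟨ *-monoʳ-≤ 4 (*-mono-≤ (<⇒≤ (n<4^n h)) large) ⟩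
    4 * (4 ^ h * (μ * 2 ^ logDensity)) ≤⟨ *-monoʳ-≤ 4 (*-monoʳ-≤ (4 ^ h) (*-monoʳ-≤ μ (^-monoˡ-≤ logDensity (s≤s (s≤s (z≤n {2})))))) ⟩
    4 * (4 ^ h * (μ * 4 ^ logDensity)) ≡⟨ lem 4 (4 ^ h) μ (4 ^ logDensity) ⟩
    4 * (4 ^ h * 4 ^ logDensity) * μ  ≡⟨ cong (λ t → 4 * t * μ) (^-distribˡ-+-* 4 h logDensity) ⟨
    4 ^ K * μ  ∎
    where
    open ≤-Reasoning
    lem : ∀ c u m v → c * (u * (m * v)) ≡ c * (u * v) * m
    lem = solve-∀

  module Sm = Smoothing P C Bad g h K g≤μ
    (λ t Pt → ≤ᵇ⇒≤ _ _ (Equivalence.from 𝔹ₚ.T-≡ Pt))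
    (λ t t′ x _ _ → transfer tuple t t′ x) size
  open Sm using (τ; smoothen; smooth; smooth-loss)

  τ>0 : 0 < τ
  τ>0 = *-mono-< P>0 P>0

  popular-pairs : 63 * (μ * μ) ≤ 64 * sum G (λ x → ι (C x) * g x)
  popular-pairs = +-cancelʳ-≤ (μ * μ) _ _ (begin
    63 * (μ * μ) + μ * μ  ≡⟨ lem (μ * μ) 63 ⟩
    64 * (μ * μ)  ≡⟨ cong (64 *_) total ⟩
    64 * (Y + U)  ≡⟨ *-distribˡ-+ 64 Y U ⟩
    64 * Y + 64 * U  ≤⟨ +-monoʳ-≤ (64 * Y) mostly ⟩
    64 * Y + μ * μ  ∎)
    where
    open ≤-Reasoning
    Y = sum G (λ x → ι (C x) * g x)
    U = pairs C unpopularity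
    lem : ∀ m c → c * m + m ≡ suc c * m
    lem = solve-∀
    cases : ∀ u v b → 1 * (u * v) ≡ u * (v * ι b) + ι (not b) * (u * v)
    cases u v true  = trans (*-identityˡ _) (sym (trans (+-identityʳ _) (cong (u *_) (*-identityʳ v))))
    cases u v false = sym (cong (_+ 1 * (u * v)) (trans (cong (u *_) (*-zeroʳ v)) (*-zeroʳ u)))
    total : μ * μ ≡ Y + U
    total = begin-equality
      μ * μ  ≡⟨ pairs-1 C ⟨
      pairs C (λ _ → 1)  ≡⟨ sum-cong G (λ z → trans (sum-cong G (λ z′ → cases (ι (C z)) (ι (C z′)) (popular (z ⊕ z′)))) (trans (sum-+ G _ _) (cong (_+ sum G (λ z′ → unpopularity (z ⊕ z′) * (ι (C z) * ι (C z′)))) (sum-*ˡ G (ι (C z)) _)))) ⟩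
      sum G (λ z → ι (C z) * g z + sum G (λ z′ → unpopularity (z ⊕ z′) * (ι (C z) * ι (C z′))))
                                  ≡⟨ sum-+ G _ _ ⟩
      Y + U  ∎

  φ : 𝔽₂^ n → ℕ
  φ = smooth ℓ

  -- Sifting leaves 126/128, and `folds` rounds of smoothing cost `3 / accuracy` each, which is
  -- 3/128 in total.
  smoothed-popular : 123 * (τ ^ ℓ * (μ * μ)) ≤ 128 * sum G (λ x → φ x * g x)
  smoothed-popular = +-cancelʳ-≤ (3 * L) _ _ (*-cancelˡ-≤′ ℓ>0 (begin
    ℓ * (123 * L + 3 * L)  ≡⟨ cong (ℓ *_) (sym (*-distribʳ-+ L 123 3)) ⟩
    ℓ * (126 * (τ ^ ℓ * (μ * μ)))  ≡⟨ lem₁ ℓ 2 63 (τ ^ ℓ) (μ * μ) ⟩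
    ℓ * (2 * (τ ^ ℓ * (63 * (μ * μ))))  ≤⟨ *-monoʳ-≤ ℓ (*-monoʳ-≤ 2 (*-monoʳ-≤ (τ ^ ℓ) popular-pairs)) ⟩
    ℓ * (2 * (τ ^ ℓ * (64 * Y)))  ≡⟨ lem₂ ℓ 2 64 (τ ^ ℓ) Y ⟩
    τ ^ ℓ * (128 * ℓ * Y)  ≡⟨ cong (τ ^ ℓ *_) (trans (sym (sum-*ˡ G h _)) (sum-cong G (λ x → *-swap h (ι (C x)) (g x)))) ⟩
    τ ^ ℓ * sum G (λ x → ι (C x) * (h * g x))  ≤⟨ smooth-loss ℓ ⟩
    sum G (λ x → φ x * (h * g x)) + ℓ * (3 * L)  ≡⟨ cong (_+ ℓ * (3 * L)) (trans (sum-cong G (λ x → *-swap (φ x) h (g x))) (sum-*ˡ G h _)) ⟩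
    128 * ℓ * Z + ℓ * (3 * L)  ≡⟨ lem₃ 128 ℓ Z (3 * L) ⟩
    ℓ * (128 * Z + 3 * L)  ∎))
    where
    open ≤-Reasoning
    L = τ ^ ℓ * (μ * μ)
    Y = sum G (λ x → ι (C x) * g x)
    Z = sum G (λ x → φ x * g x)
    lem₁ : ∀ l c d t m → l * (c * d * (t * m)) ≡ l * (c * (t * (d * m)))
    lem₁ = solve-∀
    lem₂ : ∀ l c d t m → l * (c * (t * (d * m))) ≡ t * (c * d * l * m)
    lem₂ = solve-∀
    lem₃ : ∀ c l z m → c * l * z + l * m ≡ l * (c * z + m)
    lem₃ = solve-∀

  X : ℕ
  X = sum G (λ x → φ x * sum G (λ c → ι (C c) * r (c ⊕ x)))

  popular-mass : 5 * (a * a) * sum G (λ x → φ x * g x) ≤ 4 * (q * X)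
  popular-mass = begin
    5 * (a * a) * sum G (λ x → φ x * g x)
      ≡⟨ trans (sym (sum-*ˡ G (5 * (a * a)) _)) (sum-cong G (λ x → trans (*-swap (5 * (a * a)) (φ x) (g x)) (cong (φ x *_) (trans (sym (sum-*ˡ G (5 * (a * a)) _)) (sum-cong G (λ c → *-swap (5 * (a * a)) (ι (C c)) _)))))) ⟩
    sum G (λ x → φ x * sum G (λ c → ι (C c) * (5 * (a * a) * ι (popular (x ⊕ c)))))
      ≤⟨ sum-mono G (λ x → *-monoʳ-≤ (φ x) (sum-mono G (λ c → *-monoʳ-≤ (ι (C c)) (term x c)))) ⟩
    sum G (λ x → φ x * sum G (λ c → ι (C c) * (4 * (q * r (c ⊕ x)))))
      ≡⟨ sum-cong G (λ x → cong (φ x *_) (trans (sum-cong G (λ c → rot (ι (C c)) 4 q (r (c ⊕ x)))) (sum-*ˡ G (4 * q) _))) ⟩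
    sum G (λ x → φ x * (4 * q * sum G (λ c → ι (C c) * r (c ⊕ x))))
      ≡⟨ trans (sum-cong G (λ x → *-swap (φ x) (4 * q) _)) (trans (sum-*ˡ G (4 * q) _) (*-assoc 4 q X)) ⟩
    4 * (q * X)  ∎
    where
    open ≤-Reasoning
    rot : ∀ i c q x → i * (c * (q * x)) ≡ c * q * (i * x)
    rot = solve-∀
    cases : ∀ x b → popular x ≡ b → 5 * (a * a) * ι b ≤ 4 * (q * r x)
    cases x true  eq = ≤-trans (≤-reflexive (*-identityʳ _)) (popular-≥ x eq)
    cases x false eq = ≤-trans (≤-reflexive (*-zeroʳ (5 * (a * a)))) z≤n
    term : ∀ x c → 5 * (a * a) * ι (popular (x ⊕ c)) ≤ 4 * (q * r (c ⊕ x))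
    term x c = subst (λ z → 5 * (a * a) * ι (popular (x ⊕ c)) ≤ 4 * (q * r z)) (⊕-comm x c) (cases (x ⊕ c) (popular (x ⊕ c)) refl)

  hat-smooth : ∀ i ξ → hat (pos ∘ smooth i) ξ ≡ powᶻ (hat (indicator P) ξ *ᶻ hat (indicator P) ξ) i *ᶻ hat (indicator C) ξ
  hat-smooth zero    ξ = sym (ℤₚ.*-identityˡ _)
  hat-smooth (suc i) ξ = begin
    hat (pos ∘ smoothen (smooth i)) ξ  ≡⟨ ℤΣ.sum-cong G (λ x → cong (_*ᶻ χ ξ x) (as-conv x)) ⟩
    hat (conv (indicator P) (conv (indicator P) (pos ∘ smooth i))) ξ
      ≡⟨ trans (hat-conv (indicator P) (conv (indicator P) (pos ∘ smooth i)) ξ) (cong (p *ᶻ_) (trans (hat-conv (indicator P) (pos ∘ smooth i) ξ) (cong (p *ᶻ_) (hat-smooth i ξ)))) ⟩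
    p *ᶻ (p *ᶻ (powᶻ (p *ᶻ p) i *ᶻ hat (indicator C) ξ))  ≡⟨ lem p (powᶻ (p *ᶻ p) i) (hat (indicator C) ξ) ⟩
    powᶻ (p *ᶻ p) (suc i) *ᶻ hat (indicator C) ξ  ∎
    where
    open ≡-Reasoning
    p = hat (indicator P) ξ
    lem : ∀ p w c → p *ᶻ (p *ᶻ (w *ᶻ c)) ≡ ((p *ᶻ p) *ᶻ w) *ᶻ c
    lem = ℤ-Solver.solve-∀
    as-conv : ∀ x → pos (smoothen (smooth i) x) ≡ conv (indicator P) (conv (indicator P) (pos ∘ smooth i)) x
    as-conv x = trans (pos-sum G _) (ℤΣ.sum-cong G (λ t → trans (ℤₚ.pos-* (ι (P t)) _) (cong (indicator P t *ᶻ_)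
      (trans (pos-sum G _) (ℤΣ.sum-cong G (λ t′ → ℤₚ.pos-* (ι (P t′)) _))))))

  -- The transform of `C` occurs once in `φ` and once in the inner sum, so it is squared like the
  -- others and every term is nonnegative.
  spectral : q * X ≡ sum G (λ ξ → energy P ξ ^ ℓ * (energy C ξ * energy A ξ))
  spectral = ℤₚ.+-injective (begin
    pos (q * X)
      ≡⟨ trans (ℤₚ.pos-* q X) (cong (pos q *ᶻ_) (trans (pos-sum G _) (ℤΣ.sum-cong G (λ x → trans (ℤₚ.pos-* (φ x) _) (cong (pos (φ x) *ᶻ_) (as-conv x)))))) ⟩
    pos q *ᶻ sumᶻ G (λ x → pos (φ x) *ᶻ conv (indicator C) (conv (indicator A) (indicator A)) x)
      ≡⟨ parseval (pos ∘ φ) (conv (indicator C) (conv (indicator A) (indicator A))) ⟨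
    sumᶻ G (λ ξ → hat (pos ∘ φ) ξ *ᶻ hat (conv (indicator C) (conv (indicator A) (indicator A))) ξ)
      ≡⟨ ℤΣ.sum-cong G term ⟩
    sumᶻ G (λ ξ → pos (energy P ξ ^ ℓ * (energy C ξ * energy A ξ)))
      ≡⟨ pos-sum G _ ⟨
    pos (sum G (λ ξ → energy P ξ ^ ℓ * (energy C ξ * energy A ξ)))  ∎)
    where
    open ≡-Reasoning
    as-conv : ∀ x → pos (sum G (λ c → ι (C c) * r (c ⊕ x))) ≡ conv (indicator C) (conv (indicator A) (indicator A)) x
    as-conv x = trans (pos-sum G _) (ℤΣ.sum-cong G (λ c → trans (ℤₚ.pos-* (ι (C c)) _) (cong (indicator C c *ᶻ_) (r-conv (c ⊕ x)))))
    lem : ∀ w c a → (w *ᶻ c) *ᶻ (c *ᶻ (a *ᶻ a)) ≡ w *ᶻ ((c *ᶻ c) *ᶻ (a *ᶻ a))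
    lem = ℤ-Solver.solve-∀
    term : ∀ ξ → hat (pos ∘ φ) ξ *ᶻ hat (conv (indicator C) (conv (indicator A) (indicator A))) ξ ≡ pos (energy P ξ ^ ℓ * (energy C ξ * energy A ξ))
    term ξ = begin
      hat (pos ∘ φ) ξ *ᶻ hat (conv (indicator C) (conv (indicator A) (indicator A))) ξ
        ≡⟨ cong₂ _*ᶻ_ (hat-smooth ℓ ξ) (trans (hat-conv (indicator C) (conv (indicator A) (indicator A)) ξ) (cong (ĉ *ᶻ_) (hat-conv (indicator A) (indicator A) ξ))) ⟩
      (powᶻ (p̂ *ᶻ p̂) ℓ *ᶻ ĉ) *ᶻ (ĉ *ᶻ (â *ᶻ â))  ≡⟨ lem (powᶻ (p̂ *ᶻ p̂) ℓ) ĉ â ⟩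
      powᶻ (p̂ *ᶻ p̂) ℓ *ᶻ ((ĉ *ᶻ ĉ) *ᶻ (â *ᶻ â))  ≡⟨ cong₂ _*ᶻ_ (trans (cong (λ t → powᶻ t ℓ) (sym (abs-square p̂))) (powᶻ-pos (energy P ξ) ℓ))
                                                          (trans (cong₂ _*ᶻ_ (sym (abs-square ĉ)) (sym (abs-square â))) (sym (ℤₚ.pos-* (energy C ξ) (energy A ξ)))) ⟩
      pos (energy P ξ ^ ℓ) *ᶻ pos (energy C ξ * energy A ξ)  ≡⟨ ℤₚ.pos-* (energy P ξ ^ ℓ) _ ⟨
      pos (energy P ξ ^ ℓ * (energy C ξ * energy A ξ))  ∎
      where
      p̂ = hat (indicator P) ξ
      ĉ = hat (indicator C) ξ
      â = hat (indicator A) ξ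

  big : 𝔽₂^ n → Bool
  big ξ = 3 * (count P * count P) ≤ᵇ 4 * energy P ξ

  opaque
    ann : Annihilator big n idₑ
    ann = annihilator big n idₑ

  open Annihilator ann using (codim; dimension; dims; sub; annihilated; cuts; cuts-big; riesz-sum)

  codim-bound : codim ≤ stepCost
  codim-bound = Chang.dimension-bound P P>0 cuts cuts-big
    (trans (sym (sum-cong G (λ y → cong (riesz cuts) (⊕-identityˡ y)))) (riesz-sum 0v)) logPeriods P-large

  Z : ℕ
  Z = sum G (λ ξ → ι (trivialOn sub ξ) * energy A ξ)

  -- Characters trivial on `sub` get the trivial bound. Any other is not big, because `sub` is
  -- annihilated by all big ones, and smoothing shrinks it by (3/4)^ℓ.
  spectral-split : 4 ^ ℓ * (q * X) ≤ τ ^ ℓ * (μ * μ) * (4 ^ ℓ * Z + 3 ^ ℓ * (q * a))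
  spectral-split = begin
    4 ^ ℓ * (q * X)
      ≡⟨ trans (cong (4 ^ ℓ *_) spectral) (sym (sum-*ˡ G (4 ^ ℓ) _)) ⟩
    sum G (λ ξ → 4 ^ ℓ * (energy P ξ ^ ℓ * (energy C ξ * energy A ξ)))
      ≤⟨ sum-mono G (λ ξ → term ξ (trivialOn sub ξ) refl) ⟩
    sum G (λ ξ → τ ^ ℓ * (μ * μ) * (4 ^ ℓ * (ι (trivialOn sub ξ) * energy A ξ) + 3 ^ ℓ * energy A ξ))
      ≡⟨ trans (sum-*ˡ G (τ ^ ℓ * (μ * μ)) _) (cong (τ ^ ℓ * (μ * μ) *_) (trans (sum-+ G _ _) (cong₂ _+_ (sum-*ˡ G (4 ^ ℓ) _) (trans (sum-*ˡ G (3 ^ ℓ) _) (cong (3 ^ ℓ *_) (sum-energy A)))))) ⟩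
    τ ^ ℓ * (μ * μ) * (4 ^ ℓ * Z + 3 ^ ℓ * (q * a))  ∎
    where
    open ≤-Reasoning
    lem₁ : ∀ f t m a → f * (t * (m * a)) ≡ t * m * (f * (1 * a))
    lem₁ = solve-∀
    lem₂ : ∀ f t m a → f * t * (m * a) ≡ t * m * (f * a)
    lem₂ = solve-∀
    small-energy : ∀ ξ → trivialOn sub ξ ≡ false → 4 * energy P ξ ≤ 3 * τ
    small-energy ξ triv = <⇒≤ (≤ᵇ-false (𝔹ₚ.¬-not {big ξ} (λ bξ →
      contradiction (trans (sym triv) (trivialOn-intro sub ξ (annihilated ξ bξ))) λ ())))
    term : ∀ ξ b → trivialOn sub ξ ≡ b → 4 ^ ℓ * (energy P ξ ^ ℓ * (energy C ξ * energy A ξ)) ≤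
      τ ^ ℓ * (μ * μ) * (4 ^ ℓ * (ι b * energy A ξ) + 3 ^ ℓ * energy A ξ)
    term ξ true _ = begin
      4 ^ ℓ * (energy P ξ ^ ℓ * (energy C ξ * energy A ξ))  ≤⟨ *-monoʳ-≤ (4 ^ ℓ) (*-mono-≤ (^-monoˡ-≤ ℓ (energy-≤ P ξ)) (*-monoˡ-≤ (energy A ξ) (energy-≤ C ξ))) ⟩
      4 ^ ℓ * (τ ^ ℓ * (μ * μ * energy A ξ))  ≡⟨ lem₁ (4 ^ ℓ) (τ ^ ℓ) (μ * μ) (energy A ξ) ⟩
      τ ^ ℓ * (μ * μ) * (4 ^ ℓ * (1 * energy A ξ))  ≤⟨ *-monoʳ-≤ (τ ^ ℓ * (μ * μ)) (m≤m+n (4 ^ ℓ * (1 * energy A ξ)) (3 ^ ℓ * energy A ξ)) ⟩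
      _  ∎
    term ξ false triv = begin
      4 ^ ℓ * (energy P ξ ^ ℓ * (energy C ξ * energy A ξ))  ≡⟨ trans (sym (*-assoc (4 ^ ℓ) (energy P ξ ^ ℓ) _)) (cong (_* (energy C ξ * energy A ξ)) (sym (*-^ 4 (energy P ξ) ℓ))) ⟩
      (4 * energy P ξ) ^ ℓ * (energy C ξ * energy A ξ)  ≤⟨ *-mono-≤ (^-monoˡ-≤ ℓ (small-energy ξ triv)) (*-monoˡ-≤ (energy A ξ) (energy-≤ C ξ)) ⟩
      (3 * τ) ^ ℓ * (μ * μ * energy A ξ)  ≡⟨ cong (_* (μ * μ * energy A ξ)) (*-^ 3 τ ℓ) ⟩
      3 ^ ℓ * τ ^ ℓ * (μ * μ * energy A ξ)  ≡⟨ lem₂ (3 ^ ℓ) (τ ^ ℓ) (μ * μ) (energy A ξ) ⟩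
      τ ^ ℓ * (μ * μ) * (3 ^ ℓ * energy A ξ)  ≤⟨ *-monoʳ-≤ (τ ^ ℓ * (μ * μ)) (m≤n+m (3 ^ ℓ * energy A ξ) (4 ^ ℓ * 0)) ⟩
      _  ∎

  -- Parseval's identity leaves an inverse density of at most 2^T; with 27 times 2 below 64, `folds`
  -- beats it and a factor 16 remains.
  tail-energy : 16 * (3 ^ ℓ * (q * a)) ≤ 4 ^ ℓ * (a * a)
  tail-energy = begin
    16 * (3 ^ ℓ * (q * a))  ≤⟨ *-monoʳ-≤ 16 (*-monoʳ-≤ (3 ^ ℓ) (*-monoˡ-≤ a densA)) ⟩
    16 * (3 ^ ℓ * (a * 2 ^ T * a))  ≡⟨ lem 16 (3 ^ ℓ) a (2 ^ T) ⟩
    3 ^ ℓ * (2 ^ T * 16) * (a * a)  ≡⟨ cong (λ t → 3 ^ ℓ * t * (a * a)) (^-distribˡ-+-* 2 T 4) ⟨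
    3 ^ ℓ * 2 ^ (T + 4) * (a * a)  ≤⟨ *-monoˡ-≤ (a * a) (begin
      3 ^ ℓ * 2 ^ (T + 4)  ≡⟨ cong (_* 2 ^ (T + 4)) (^-*-assoc 3 3 (T + 4)) ⟨
      27 ^ (T + 4) * 2 ^ (T + 4)  ≡⟨ *-^ 27 2 (T + 4) ⟨
      54 ^ (T + 4)  ≤⟨ ^-monoˡ-≤ (T + 4) (≤ᵇ⇒≤ 54 64 _) ⟩
      64 ^ (T + 4)  ≡⟨ ^-*-assoc 4 3 (T + 4) ⟩
      4 ^ ℓ  ∎) ⟩
    4 ^ ℓ * (a * a)  ∎
    where
    open ≤-Reasoning
    lem : ∀ c t a p → c * (t * (a * p * a)) ≡ t * (p * c) * (a * a)
    lem = solve-∀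

  -- Popularity 5/4 times the share 123/128, minus 1/16 for the tail, is 583/512, just above 9/8 =
  -- 576/512.
  large-subspace-energy : 9 * (a * a) ≤ 8 * Z
  large-subspace-energy = combine (a * a) Z (4 ^ ℓ) (τ ^ ℓ * (μ * μ)) (3 ^ ℓ * (q * a)) (sum G (λ x → φ x * g x)) (q * X)
    (m^n>0 4 ℓ) (*-mono-< (^-pos ℓ τ>0) (*-mono-< μ>0 μ>0)) smoothed-popular popular-mass spectral-split tail-energy
    where
    open ≤-Reasoning
    combine : ∀ α z f L t s x → 0 < f → 0 < L → 123 * L ≤ 128 * s → 5 * α * s ≤ 4 * x → f * x ≤ L * (f * z + t) → 16 * t ≤ f * α → 9 * α ≤ 8 * z
    combine α z f L t s x f>0 L>0 h₁ h₂ h₃ h₄ = *-cancelˡ-≤′ {1024} (s≤s z≤n) (begin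
      1024 * (9 * α)  ≡⟨ *-assoc 1024 9 α ⟨
      9216 * α  ≤⟨ *-monoˡ-≤ α (≤ᵇ⇒≤ 9216 9328 _) ⟩
      9328 * α  ≤⟨ +-cancelʳ-≤ (512 * α) (9328 * α) (8192 * z) (*-cancelˡ-≤′ (*-mono-< f>0 L>0) (begin
        f * L * (9328 * α + 512 * α)  ≡⟨ cong (f * L *_) (*-distribʳ-+ α 9328 512) ⟨
        f * L * (9840 * α)  ≡⟨ e₁ f L 80 123 α ⟩
        f * 80 * (α * (123 * L))  ≤⟨ *-monoʳ-≤ (f * 80) (*-monoʳ-≤ α h₁) ⟩
        f * 80 * (α * (128 * s))  ≡⟨ e₂ f 16 5 α 128 s ⟩
        f * 2048 * (5 * α * s)  ≤⟨ *-monoʳ-≤ (f * 2048) h₂ ⟩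
        f * 2048 * (4 * x)  ≡⟨ e₃ f 2048 4 x ⟩
        8192 * (f * x)  ≤⟨ *-monoʳ-≤ 8192 h₃ ⟩
        8192 * (L * (f * z + t))  ≡⟨ e₄ 512 16 L f z t ⟩
        L * (8192 * (f * z) + 512 * (16 * t))  ≤⟨ *-monoʳ-≤ L (+-monoʳ-≤ (8192 * (f * z)) (*-monoʳ-≤ 512 h₄)) ⟩
        L * (8192 * (f * z) + 512 * (f * α))  ≡⟨ e₅ 8192 512 L f z α ⟩
        f * L * (8192 * z + 512 * α)  ∎)) ⟩
      8192 * z  ≡⟨ *-assoc 1024 8 z ⟩
      1024 * (8 * z)  ∎)
      where
      e₁ : ∀ f l c d a → f * l * (c * d * a) ≡ f * c * (a * (d * l))
      e₁ = solve-∀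
      e₂ : ∀ f c d a e s → f * (c * d) * (a * (e * s)) ≡ f * (c * e) * (d * a * s)
      e₂ = solve-∀
      e₃ : ∀ f c d x → f * c * (d * x) ≡ c * d * (f * x)
      e₃ = solve-∀
      e₄ : ∀ c d l f z t → c * d * (l * (f * z + t)) ≡ l * (c * d * (f * z) + c * (d * t))
      e₄ = solve-∀
      e₅ : ∀ c d l f z a → l * (c * (f * z) + d * (f * a)) ≡ f * l * (c * z + d * a)
      e₅ = solve-∀

  increment : ∃ λ x → 9 * (a * 2 ^ dimension) ≤ 8 * (q * count (λ y → A (x ⊕ fun sub y)))
  increment = dense-coset sub a>0 (begin
    9 * (a * a) * 2 ^ dimension  ≤⟨ *-monoˡ-≤ (2 ^ dimension) large-subspace-energy ⟩
    8 * Z * 2 ^ dimension  ≡⟨ lem 8 Z (2 ^ dimension) ⟩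
    8 * (2 ^ dimension * Z)  ≤⟨ *-monoʳ-≤ 8 (energy-trivialOn sub) ⟩
    8 * (q * sum (𝔾 dimension) (λ y → r (fun sub y)))  ∎)
    where
    open ≤-Reasoning
    lem : ∀ c z p → c * z * p ≡ c * (p * z)
    lem = solve-∀

  dimension-bound : n ≤ dimension + stepCost
  dimension-bound = ≤-trans (≤-reflexive (trans dims (+-comm codim dimension))) (+-monoʳ-≤ dimension codim-bound)

-- Flats avoiding triangle-free sets

Avoids : (𝔽₂^ n → Bool) → Emb k n → Set
Avoids B ψ = ∀ y → y ≢ 0v → B (fun ψ y) ≡ false

Flat : (𝔽₂^ n → Bool) → ℕ → Set
Flat {n} B k = Σ (Emb k n) (Avoids B)

Flat-≤ : {B : 𝔽₂^ n → Bool} {k l : ℕ} → k ≤ l → Flat B l → Flat B k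
Flat-≤ {k = k} k≤l (ψ , av) = ψ ∘ₑ inner , λ y y≢0 → av (fun inner y) (λ eq → y≢0 (ker inner y eq))
  where
  inner : Emb k _
  inner = newₑ (complement []ₑ k (≤-trans (≤-reflexive (+-identityʳ k)) k≤l))

∃-matrix? : ∀ k {P : Vec (𝔽₂^ n) k → Set} → (∀ V → Dec (P V)) → Dec (∃ P)
∃-matrix? zero    P? = map′ (λ p → [] , p) (λ { ([] , p) → p }) (P? [])
∃-matrix? (suc k) P? = map′ (λ { (x , V , p) → x ∷ V , p }) (λ { (x ∷ V , p) → x , V , p })
  (∃? (λ x → ∃-matrix? k (λ V → P? (x ∷ V))))

-- Embeddings are functions and cannot be listed, but each equals `lin` of a matrix, and matrices
-- can be searched.
flat? : (B : 𝔽₂^ n → Bool) (k : ℕ) → Dec (Flat B k)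
flat? {n} B k = map′ to from (∃-matrix? k (λ V → ∀? (λ y → ¬? (y ≟ᵥ 0v) →-dec
    (¬? (lin (lookup V) y ≟ᵥ 0v) ×-dec (B (lin (lookup V) y) 𝔹ₚ.≟ false)))))
  where
  Q : Vec (𝔽₂^ n) k → Set
  Q V = ∀ y → y ≢ 0v → lin (lookup V) y ≢ 0v × B (lin (lookup V) y) ≡ false
  to : ∃ Q → Flat B k
  to (V , h) = record
    { fun = lin (lookup V) ; add = lin-⊕ (lookup V)
    ; ker = λ y eq → decidable-stable (y ≟ᵥ 0v) (λ y≢0 → proj₁ (h y y≢0) eq) }
    , λ y y≢0 → proj₂ (h y y≢0)
  from : Flat B k → ∃ Q
  from (ψ , av) = V , λ y y≢0 → (λ eq → y≢0 (ker ψ y (trans (sym (lin≡ y)) eq))) , trans (cong B (lin≡ y)) (av y y≢0)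
    where
    V = Vec.tabulate (fun ψ ∘ unit)
    lin-cong : ∀ {k} {u v : Fin k → 𝔽₂^ n} → (∀ i → u i ≡ v i) → ∀ y → lin u y ≡ lin v y
    lin-cong h []      = refl
    lin-cong h (b ∷ y) = cong₂ _⊕_ (cong (b ·ᵥ_) (h zero)) (lin-cong (h ∘ suc) y)
    lin≡ : ∀ y → lin (lookup V) y ≡ fun ψ y
    lin≡ y = trans (lin-cong (Vecₚ.lookup∘tabulate (fun ψ ∘ unit)) y) (additive-≡lin (add ψ) y)

sum≡0⇒≡0 : (f : 𝔽₂^ n → ℕ) → sum (𝔾 n) f < 1 → ∀ x → f x ≡ 0
sum≡0⇒≡0 f lt x = n≤0⇒n≡0 (≤-trans (sum-ge-term x f) (≤-pred lt))

-- In a random coset of the flat built so far, the expected number of points that are zero or in `B`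
-- is below 1. Counting zero keeps the new vector outside the flat.
greedy-flat : (B : 𝔽₂^ n → Bool) (k : ℕ) → suc (count B) * 2 ^ k < 2 ^ n → Flat B (suc k)
greedy-flat {n} B k lt = snoc ψ x x∉ , avoids
  where
  shorter : ∀ k → suc (count B) * 2 ^ k < 2 ^ n → Flat B k
  shorter zero    _  = []ₑ , λ { [] y≢0 → contradiction refl y≢0 }
  shorter (suc k) lt = greedy-flat B k (≤-<-trans (*-monoʳ-≤ (suc (count B)) (^-monoʳ-≤ 2 (n≤1+n k))) lt)
  ψ  = proj₁ (shorter k lt)
  av = proj₂ (shorter k lt)
  weight : 𝔽₂^ n → ℕ
  weight z = δ₀ z + ι (B z)
  total : sum (𝔾 n) weight ≡ suc (count B)
  total = trans (sum-+ (𝔾 n) δ₀ (ι ∘ B)) (cong (_+ count B) (trans (sym (sum-shiftʳ {n} 0v δ₀)) (sum-δ {n} 0v)))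
  found : ∃ λ x → sum (𝔾 k) (λ y → weight (x ⊕ fun ψ y)) < 1
  found = sum<⇒∃ (𝔾 n) (begin-strict
    sum (𝔾 n) (λ x → sum (𝔾 k) (λ y → weight (x ⊕ fun ψ y)))  ≡⟨ sum-swap (𝔾 n) (𝔾 k) _ ⟩
    sum (𝔾 k) (λ y → sum (𝔾 n) (λ x → weight (x ⊕ fun ψ y)))  ≡⟨ sum-cong (𝔾 k) (λ y → trans (sum-shiftʳ (fun ψ y) weight) total) ⟩
    sum (𝔾 k) (λ _ → suc (count B))  ≡⟨ trans (sum-const-𝔾 k _) (*-comm (2 ^ k) _) ⟩
    suc (count B) * 2 ^ k  <⟨ lt ⟩
    2 ^ n  ≡⟨ count-all n ⟨
    sum (𝔾 n) (λ _ → 1)  ∎)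
    where open ≤-Reasoning
  x = proj₁ found
  free : ∀ y → weight (x ⊕ fun ψ y) ≡ 0
  free = sum≡0⇒≡0 _ (proj₂ found)
  x∉ : ∀ y → fun ψ y ≢ x
  x∉ y eq = contradiction (trans (sym (m+n≡0⇒m≡0 _ (free y))) (trans (cong (λ z → δ₀ (x ⊕ z)) eq) (δ₀-self x))) λ ()
  ι≡0 : ∀ b → ι b ≡ 0 → b ≡ false
  ι≡0 false _ = refl
  avoids : Avoids B (snoc ψ x x∉)
  avoids (true ∷ y)  _   = ι≡0 _ (m+n≡0⇒n≡0 (δ₀ (x ⊕ fun ψ y)) (free y))
  avoids (false ∷ y) y≢0 = trans (cong B (⊕-identityˡ _)) (av y (λ eq → y≢0 (cong (false ∷_) eq)))

no-flat⇒dense : (B : 𝔽₂^ n → Bool) (T : ℕ) → T ≤ n → ¬ Flat B T → 2 ^ n ≤ count B * 2 ^ T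
no-flat⇒dense {n} B zero    T≤n none = contradiction ([]ₑ , λ { [] y≢0 → contradiction refl y≢0 }) none
no-flat⇒dense {n} B (suc k) T≤n none = +-cancelʳ-≤ (2 ^ n) _ _ (begin
  -- Doubling pays for the 1 in `suc (count B)`, since `2 ^ T` is at most `2 ^ n`.
  2 ^ n + 2 ^ n  ≤⟨ +-mono-≤ dense dense ⟩
  suc (count B) * p + suc (count B) * p  ≡⟨ lem (count B) p ⟩
  count B * (2 * p) + 2 * p  ≤⟨ +-monoʳ-≤ (count B * (2 * p)) (^-monoʳ-≤ 2 T≤n) ⟩
  count B * (2 * p) + 2 ^ n  ∎)
  where
  open ≤-Reasoning
  p = 2 ^ k
  dense : 2 ^ n ≤ suc (count B) * 2 ^ k
  dense = ≮⇒≥ (λ lt → none (greedy-flat B k lt))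
  lem : ∀ c p → suc c * p + suc c * p ≡ c * (2 * p) + 2 * p
  lem = solve-∀

TriangleFree : (𝔽₂^ n → Bool) → Set
TriangleFree B = ∀ x y → B x ≡ true → B y ≡ true → B (x ⊕ y) ≡ false

density-step : ∀ E E′ c c′ t p r → 0 < E → E * p ≤ c * t * r → 9 * (c * E′) ≤ 8 * (E * c′) → E′ * (9 * p) ≤ c′ * t * (8 * r)
density-step E E′ c c′ t p r E>0 dens inc = *-cancelˡ-≤′ E>0 (begin
  E * (E′ * (9 * p))  ≡⟨ lem₁ E E′ 9 p ⟩
  9 * E′ * (E * p)  ≤⟨ *-monoʳ-≤ (9 * E′) dens ⟩
  9 * E′ * (c * t * r)  ≡⟨ lem₂ 9 E′ c t r ⟩
  9 * (c * E′) * (t * r)  ≤⟨ *-monoˡ-≤ (t * r) inc ⟩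
  8 * (E * c′) * (t * r)  ≡⟨ lem₃ 8 E c′ t r ⟩
  E * (c′ * t * (8 * r))  ∎)
  where
  open ≤-Reasoning
  lem₁ : ∀ e d c p → e * (d * (c * p)) ≡ c * d * (e * p)
  lem₁ = solve-∀
  lem₂ : ∀ c d a t p → c * d * (a * t * p) ≡ c * (a * d) * (t * p)
  lem₂ = solve-∀
  lem₃ : ∀ c e a t p → c * (e * a) * (t * p) ≡ e * (a * t * (c * p))
  lem₃ = solve-∀

module Iteration {n : ℕ} (B : 𝔽₂^ n → Bool) (tf : TriangleFree B) (T : ℕ) (T≥20 : 20 ≤ T) (none : ¬ Flat B T) where

  open StepParameters T using (stepCost)

  subspace-dense : (ψ : Emb e n) → T ≤ e → 2 ^ e ≤ count (B ∘ fun ψ) * 2 ^ T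
  subspace-dense ψ T≤e = no-flat⇒dense (B ∘ fun ψ) T T≤e (λ { (χ , av) → none (ψ ∘ₑ χ , av) })

  -- (9/8)^6 exceeds 2, so this many increments would raise a density 2^-T to 2.
  steps : ℕ
  steps = 6 * suc T

  -- `i` steps remain and `j` are done, so the density on the coset has grown by (9/8)^j. The
  -- reserved room keeps the dimension at least `T`, so `B` remains dense in the underlying subspace
  -- too.
  iterate : ∀ i j → i + j ≡ steps → (ψ : Emb e n) (x : 𝔽₂^ n) → T + i * stepCost ≤ e →
    2 ^ e * 9 ^ j ≤ count (λ y → B (x ⊕ fun ψ y)) * 2 ^ T * 8 ^ j → ⊥
  iterate {e} zero j refl ψ x _ dens = <⇒≱ (m<n+m (2 ^ e) (m^n>0 2 e)) (≤-trans (*-cancelˡ-≤′ (*-mono-< (m^n>0 2 T) (m^n>0 8 j)) (begin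
    2 ^ T * 8 ^ j * (2 ^ e + 2 ^ e)  ≡⟨ lem (2 ^ T) (8 ^ j) (2 ^ e) ⟩
    2 ^ e * (2 ^ suc T * 8 ^ j)  ≤⟨ *-monoʳ-≤ (2 ^ e) (begin
      2 ^ suc T * 8 ^ (6 * suc T)  ≡⟨ cong (2 ^ suc T *_) (^-*-assoc 8 6 (suc T)) ⟨
      2 ^ suc T * (8 ^ 6) ^ suc T  ≡⟨ *-^ 2 (8 ^ 6) (suc T) ⟨
      (2 * 8 ^ 6) ^ suc T  ≤⟨ ^-monoˡ-≤ (suc T) (≤ᵇ⇒≤ (2 * 8 ^ 6) (9 ^ 6) _) ⟩
      (9 ^ 6) ^ suc T  ≡⟨ ^-*-assoc 9 6 (suc T) ⟩
      9 ^ (6 * suc T)  ∎) ⟩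
    2 ^ e * 9 ^ j  ≤⟨ dens ⟩
    c * 2 ^ T * 8 ^ j  ≡⟨ trans (*-assoc c _ _) (*-comm c _) ⟩
    2 ^ T * 8 ^ j * c  ∎)) (count≤ (λ y → B (x ⊕ fun ψ y))))
    where
    open ≤-Reasoning
    c = count (λ y → B (x ⊕ fun ψ y))
    lem : ∀ t f e → t * f * (e + e) ≡ e * (2 * t * f)
    lem = solve-∀
  iterate {e} (suc i) j eq ψ x room dens =
    iterate i (suc j) (trans (+-suc i j) eq) (ψ ∘ₑ sub′) (x ⊕ fun ψ x′) room′ dens′
    where
    A : 𝔽₂^ e → Bool
    A y = B (x ⊕ fun ψ y)
    -- The translation cancels: two points of `B` in the coset add up to a point of the subspace,
    -- which triangle-freeness keeps out of `B`.
    sum-free : ∀ y z → A y ≡ true → A z ≡ true → B (fun ψ (y ⊕ z)) ≡ false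
    sum-free y z Ay Az = trans (cong B (trans (add ψ y z) (⊕-solve (x ∷ fun ψ y ∷ fun ψ z ∷ []) (𝕩₁ ⊹ 𝕩₂) ((𝕩₀ ⊹ 𝕩₁) ⊹ (𝕩₀ ⊹ 𝕩₂)) refl)))
      (tf _ _ Ay Az)
    T≤e : T ≤ e
    T≤e = ≤-trans (m≤m+n T (suc i * stepCost)) room
    densA : 2 ^ e ≤ count A * 2 ^ T
    densA = *-cancelˡ-≤′ (m^n>0 8 j) (≤-trans (*-monoˡ-≤ (2 ^ e) (^-monoˡ-≤ j (n≤1+n 8)))
      (≤-trans (≤-reflexive (*-comm (9 ^ j) (2 ^ e))) (≤-trans dens (≤-reflexive (*-comm (count A * 2 ^ T) (8 ^ j))))))
    module Inc = DensityIncrement A (B ∘ fun ψ) sum-free T T≥20 (subspace-dense ψ T≤e) densA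
    e′ = Annihilator.dimension Inc.ann
    sub′ = Annihilator.sub Inc.ann
    x′ = proj₁ Inc.increment
    room′ : T + i * stepCost ≤ e′
    room′ = +-cancelʳ-≤ stepCost _ _ (≤-trans (≤-reflexive (lem T i stepCost)) (≤-trans room Inc.dimension-bound))
      where
      lem : ∀ t i s → t + i * s + s ≡ t + suc i * s
      lem = solve-∀
    c′ = count (λ y → B ((x ⊕ fun ψ x′) ⊕ fun ψ (fun sub′ y)))
    same : count (λ y → A (x′ ⊕ fun sub′ y)) ≡ c′
    same = sum-cong (𝔾 e′) (λ y → cong (ι ∘ B) (trans (cong (x ⊕_) (add ψ x′ (fun sub′ y))) (sym (⊕-assoc x _ _))))
    dens′ : 2 ^ e′ * 9 ^ suc j ≤ c′ * 2 ^ T * 8 ^ suc j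
    dens′ = density-step (2 ^ e) (2 ^ e′) (count A) c′ (2 ^ T) (9 ^ j) (8 ^ j) (m^n>0 2 e) dens
      (≤-trans (proj₂ Inc.increment) (≤-reflexive (cong (λ t → 8 * (2 ^ e * t)) same)))

  few-dimensions : T + steps * stepCost ≤ n → ⊥
  few-dimensions le = iterate steps 0 (+-identityʳ steps) idₑ 0v le (≤-trans (≤-reflexive (*-identityʳ _))
    (≤-trans (subspace-dense idₑ (≤-trans (m≤m+n T _) le)) (≤-reflexive (trans (cong (_* 2 ^ T) (sum-cong (𝔾 n) (λ y → cong (ι ∘ B) (sym (⊕-identityˡ y))))) (sym (*-identityʳ _))))))

seventh-power : ∀ T → T * (T * T * (T * T) * (T * T)) ≡ T ^ 7
seventh-power = solve7
  where
  solve7 : ∀ T → T * (T * T * (T * T) * (T * T)) ≡ T * (T * (T * (T * (T * (T * (T * 1))))))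
  solve7 = solve-∀

-- `H` is the coefficient of `T` in the bound for `accuracy`, and `d` that of `T ^ 6` in the bound
-- for `logPeriods`; the equations let both stay symbolic.
iteration-bound : ∀ H d → H ≡ 128 * 4 → d ≡ 8 * (64 * (H * H)) * (1 + H + 8) →
  ∀ T → 20 ≤ T → T + 6 * suc T * StepParameters.stepCost T ≤ (1 + 12 * (12 + 6 * d)) * T ^ 7
iteration-bound H d H≡ d≡ T T≥20 = begin
    T + 6 * suc T * stepCost  ≤⟨ +-mono-≤ (≤-trans (≤-reflexive (sym (*-identityʳ T))) (*-monoʳ-≤ T s³≥1)) (*-mono-≤ (double T T≥1) cost) ⟩
    T * s³ + 12 * T * ((12 + 6 * d) * s³)  ≡⟨ collect 12 T (12 + 6 * d) s³ ⟩
    (1 + 12 * (12 + 6 * d)) * (T * s³)  ≡⟨ cong ((1 + 12 * (12 + 6 * d)) *_) (seventh-power T) ⟩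
    (1 + 12 * (12 + 6 * d)) * T ^ 7  ∎
    where
    open ≤-Reasoning
    open StepParameters T
    s  = T * T
    s³ = s * s * s
    T≥1 : 1 ≤ T
    T≥1 = ≤-trans (s≤s z≤n) T≥20
    s≥1 : 1 ≤ s
    s≥1 = *-mono-≤ T≥1 T≥1
    s³≥1 : 1 ≤ s³
    s³≥1 = *-mono-≤ (*-mono-≤ s≥1 s≥1) s≥1
    collect : ∀ c t d s → t * s + c * t * (d * s) ≡ (1 + c * d) * (t * s)
    collect = solve-∀
    double : ∀ T → 1 ≤ T → 6 * suc T ≤ 12 * T
    double T h = ≤-trans (*-monoʳ-≤ 6 (+-monoˡ-≤ T h)) (≤-reflexive (lem T))
      where
      lem : ∀ T → 6 * (T + T) ≡ 12 * T
      lem = solve-∀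
    folds≤ : folds ≤ 4 * T
    folds≤ = begin
      3 * (T + 4)  ≡⟨ *-distribˡ-+ 3 T 4 ⟩
      3 * T + 12  ≤⟨ +-monoʳ-≤ (3 * T) (≤-trans (≤ᵇ⇒≤ 12 20 _) T≥20) ⟩
      3 * T + T  ≡⟨ +-comm (3 * T) T ⟩
      4 * T  ∎
    accuracy≤ : accuracy ≤ H * T
    accuracy≤ = subst (λ t → accuracy ≤ t * T) (sym H≡) (≤-trans (*-monoʳ-≤ 128 folds≤) (≤-reflexive (sym (*-assoc 128 4 T))))
    block≤ : blockSize ≤ 64 * (H * H) * s
    block≤ = ≤-trans (*-monoʳ-≤ 64 (*-mono-≤ accuracy≤ accuracy≤)) (≤-reflexive (lem 64 H T))
      where
      lem : ∀ c h t → c * (h * t * (h * t)) ≡ c * (h * h) * (t * t)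
      lem = solve-∀
    density≡ : logDensity ≡ 8 * s
    density≡ = lem T 8
      where
      lem : ∀ t c → t * (c * t) ≡ c * (t * t)
      lem = solve-∀
    count≤′ : blockCount ≤ (1 + H + 8) * s
    count≤′ = ≤-trans (+-mono-≤ (+-mono-≤ s≥1 (≤-trans accuracy≤ (*-monoʳ-≤ H (m≤m*n T T {{>-nonZero T≥1}})))) (≤-reflexive density≡))
      (≤-reflexive (lem H 8 s))
      where
      lem : ∀ h c s → s + h * s + c * s ≡ (1 + h + c) * s
      lem = solve-∀
    periods≤ : logPeriods ≤ 1 + d * s³
    periods≤ = subst (λ t → logPeriods ≤ 1 + t * s³) (sym d≡) (+-monoʳ-≤ 1 (≤-trans (*-mono-≤ (*-mono-≤ (≤-reflexive density≡) block≤) count≤′) (≤-reflexive (lem 8 (64 * (H * H)) (1 + H + 8) s))))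
      where
      lem : ∀ a b c s → a * s * (b * s) * (c * s) ≡ a * b * c * (s * s * s)
      lem = solve-∀
    cost : stepCost ≤ (12 + 6 * d) * s³
    cost = begin
      6 + 6 * logPeriods  ≤⟨ +-monoʳ-≤ 6 (*-monoʳ-≤ 6 periods≤) ⟩
      6 + 6 * (1 + d * s³)  ≡⟨ lem₁ 6 d s³ ⟩
      12 * 1 + 6 * d * s³  ≤⟨ +-monoˡ-≤ (6 * d * s³) (*-monoʳ-≤ 12 s³≥1) ⟩
      12 * s³ + 6 * d * s³  ≡⟨ *-distribʳ-+ s³ 12 (6 * d) ⟨
      (12 + 6 * d) * s³  ∎
      where
      lem₁ : ∀ c d s → c + c * (1 + d * s) ≡ (c + c) * 1 + c * d * s
      lem₁ = solve-∀

opaque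
  iteration-cost : ∃ λ c → ∀ T → 20 ≤ T → T + 6 * suc T * StepParameters.stepCost T ≤ c * T ^ 7
  iteration-cost = 1 + 12 * (12 + 6 * d) , iteration-bound H d refl refl
    where
    H d : ℕ
    H = 128 * 4
    d = 8 * (64 * (H * H)) * (1 + H + 8)

^-mono-* : ∀ c T k → c * (20 * T) ^ k ≡ c * 20 ^ k * T ^ k
^-mono-* c T k = trans (cong (c *_) (*-^ 20 T k)) (sym (*-assoc c (20 ^ k) (T ^ k)))

-- Iteration with `20 * t` meets the threshold on `T` and costs only the factor 20^7 in the
-- constant.
triangle-free-flat : ∃ λ c → ∀ n (B : 𝔽₂^ n → Bool) → TriangleFree B → ∀ t → 1 ≤ t → c * t ^ 7 ≤ n → Flat B t
triangle-free-flat = proj₁ iteration-cost * 20 ^ 7 , proof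
  where
  c = proj₁ iteration-cost
  proof : ∀ n (B : 𝔽₂^ n → Bool) → TriangleFree B → ∀ t → 1 ≤ t → c * 20 ^ 7 * t ^ 7 ≤ n → Flat B t
  proof n B tf t t≥1 le with flat? B (20 * t)
  ... | yes F   = Flat-≤ {B = B} (m≤n*m t 20) F
  ... | no none = ⊥-elim (Iteration.few-dimensions B tf (20 * t) T≥20 none
    (≤-trans (proj₂ iteration-cost (20 * t) T≥20) (≤-trans (≤-reflexive (^-mono-* c t 7)) le)))
    where
    T≥20 : 20 ≤ 20 * t
    T≥20 = *-monoʳ-≤ 20 t≥1

-- Claw-free sets

sumₑ : ∀ {t t′ n} (G : Emb t′ n) (F : Emb t n) → (∀ z y → z ≢ 0v → fun G z ≢ fun F y) →
  Σ (Emb (t′ + t) n) λ H → ∀ z y → fun H (z ⧺ y) ≡ fun G z ⊕ fun F y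
sumₑ {t} {t′} {n} G F apart = record { fun = f ; add = f-add ; ker = f-ker } , f-⧺
  where
  f : 𝔽₂^ (t′ + t) → 𝔽₂^ n
  f v = fun G (proj₁ (⧺-surj t′ v)) ⊕ fun F (proj₁ (proj₂ (⧺-surj t′ v)))
  f-⧺ : ∀ z y → f (z ⧺ y) ≡ fun G z ⊕ fun F y
  f-⧺ z y with ⧺-surj t′ (z ⧺ y)
  ... | z′ , y′ , eq with ⧺-inj z z′ eq
  ...   | refl , refl = refl
  f-add : Additive f
  f-add u v with ⧺-surj t′ u | ⧺-surj t′ v
  ... | z , y , refl | z′ , y′ , refl = trans (cong f (⧺-⊕ z z′ y y′)) (trans (f-⧺ (z ⊕ z′) (y ⊕ y′))
    (trans (cong₂ _⊕_ (add G z z′) (add F y y′)) (⊕-interchange (fun G z) (fun G z′) (fun F y) (fun F y′))))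
  f-ker : ∀ v → f v ≡ 0v → v ≡ 0v
  f-ker v eq with ⧺-surj t′ v
  ... | z , y , refl with z ≟ᵥ 0v
  ...   | no z≢0   = contradiction (⊕≡0⇒≡ eq) (apart z y z≢0)
  ...   | yes refl = trans (cong (0v ⧺_) (ker F y (trans (sym (⊕-identityˡ _)) (trans (cong (_⊕ fun F y) (sym (0v-fun G))) eq)))) (0v⧺0v t′)

root : (c N : ℕ) → 0 < c → ∃ λ t → c * t ^ 7 ≤ N × N < c * suc t ^ 7
root c N c>0 = search N 0 (≤-trans (≤-reflexive (*-zeroʳ c)) z≤n) (≤-trans (m≤m*n (suc N) (suc N ^ 6) {{>-nonZero (m^n>0 (suc N) 6)}}) (m≤n*m (suc N ^ 7) c {{>-nonZero c>0}}))
  where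
  search : ∀ fuel t → c * t ^ 7 ≤ N → N < c * suc (t + fuel) ^ 7 → ∃ λ t → c * t ^ 7 ≤ N × N < c * suc t ^ 7
  search zero       t le lt = t , le , subst (λ s → N < c * suc s ^ 7) (+-identityʳ t) lt
  search (suc fuel) t le lt with c * suc t ^ 7 ≤? N
  ... | yes le′ = search fuel (suc t) le′ (subst (λ s → N < c * suc s ^ 7) (+-suc t fuel) lt)
  ... | no ¬le  = t , le , ≰⇒> ¬le

-- Turns the failure of `suc t` as a root into an upper bound by `t`; the summand 1 is there for
-- `t = 0`.
suc-^7 : ∀ t → suc t ^ 7 ≤ 128 * t ^ 7 + 1
suc-^7 zero    = ≤-refl
suc-^7 (suc t) = begin
  suc (suc t) ^ 7  ≤⟨ ^-monoˡ-≤ 7 (s≤s (≤-trans (m≤n+m (suc t) t) (+-monoʳ-≤ t (m≤m+n (suc t) 0)))) ⟩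
  (2 * suc t) ^ 7  ≡⟨ *-^ 2 (suc t) 7 ⟩
  128 * suc t ^ 7  ≤⟨ m≤m+n _ 1 ⟩
  128 * suc t ^ 7 + 1  ∎
  where open ≤-Reasoning

-- When two flats are added their dimensions add, and superadditivity preserves what each
-- contributes to the bound.
+-^7 : ∀ s t → s ^ 7 + t ^ 7 ≤ (s + t) ^ 7
+-^7 s t = begin
  s * s ^ 6 + t * t ^ 6  ≤⟨ +-mono-≤ (*-monoʳ-≤ s (^-monoˡ-≤ 6 (m≤m+n s t))) (*-monoʳ-≤ t (^-monoˡ-≤ 6 (m≤n+m t s))) ⟩
  s * (s + t) ^ 6 + t * (s + t) ^ 6  ≡⟨ *-distribʳ-+ ((s + t) ^ 6) s t ⟨
  (s + t) ^ 7  ∎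
  where open ≤-Reasoning

opaque
  flatConstant : ℕ
  flatConstant = suc (proj₁ triangle-free-flat)

  triangle-free-root : ∀ w (B : 𝔽₂^ w → Bool) → TriangleFree B → ∃ λ t → w ≤ flatConstant * (128 * t ^ 7 + 1) × Flat B t
  triangle-free-root w B tf with root flatConstant w (s≤s z≤n)
  ... | t , le , lt = t , ≤-trans (<⇒≤ lt) (*-monoʳ-≤ flatConstant (suc-^7 t)) , flat t le
    where
    flat : ∀ t → flatConstant * t ^ 7 ≤ w → Flat B t
    flat zero    _  = []ₑ , λ { [] y≢0 → contradiction refl y≢0 }
    flat (suc t) le = proj₂ triangle-free-flat w B tf (suc t) (s≤s z≤n) (≤-trans (*-monoˡ-≤ (suc t ^ 7) (n≤1+n (proj₁ triangle-free-flat))) le)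

-- Subspaces of small index

true≢false : ∀ {b} {P : Set} → b ≡ true → b ≡ false → P
true≢false refl ()

bool-ext : ∀ {b c} → (b ≡ true → c ≡ true) → (c ≡ true → b ≡ true) → b ≡ c
bool-ext {true}  {c}     f g = sym (f refl)
bool-ext {false} {true}  f g = g refl
bool-ext {false} {false} f g = refl

true? : ∀ b → b ≡ true ⊎ b ≡ false
true? true  = inj₁ refl
true? false = inj₂ refl

⊆⇒count≤ : {P Q : 𝔽₂^ n → Bool} → (∀ u → P u ≡ true → Q u ≡ true) → count P ≤ count Q
⊆⇒count≤ {P = P} {Q} sub = count-inj {P = P} {R = Q} id sub (λ _ _ _ _ eq → eq)

count-split : (P Q : 𝔽₂^ n → Bool) → count Q ≡ count (λ u → Q u ∧ P u) + count (λ u → Q u ∧ not (P u))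
count-split {n} P Q = trans (sum-cong (𝔾 n) (λ u → lem (Q u) (P u))) (sum-+ (𝔾 n) _ _)
  where
  lem : ∀ b c → ι b ≡ ι (b ∧ c) + ι (b ∧ not c)
  lem true  true  = refl
  lem true  false = refl
  lem false c     = refl

∧-true : ∀ {b c} → b ≡ true → c ≡ true → b ∧ c ≡ true
∧-true refl refl = refl

not-true : ∀ {b} → b ≡ false → not b ≡ true
not-true refl = refl

not-true⁻ : ∀ {b} → not b ≡ true → b ≡ false
not-true⁻ {false} _ = refl

translate-inj : (t : 𝔽₂^ n) {u v : 𝔽₂^ n} → u ⊕ t ≡ v ⊕ t → u ≡ v
translate-inj t {u} {v} eq = trans (sym (⊕-cancelʳ u t)) (trans (cong (_⊕ t) eq) (⊕-cancelʳ v t))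

doubling : {P Q : 𝔽₂^ n → Bool} (t : 𝔽₂^ n) → (∀ u → P u ≡ true → Q u ≡ true) →
  (∀ u → P u ≡ true → Q (u ⊕ t) ≡ true) → (∀ u → P u ≡ true → P (u ⊕ t) ≡ false) → 2 * count P ≤ count Q
doubling {P = P} {Q} t sub moved out = begin
  2 * count P  ≡⟨ cong (count P +_) (+-identityʳ _) ⟩
  count P + count P  ≤⟨ +-mono-≤ (⊆⇒count≤ {P = P} {λ u → Q u ∧ P u} (λ u p → ∧-true (sub u p) p))
                          (count-inj {P = P} {λ u → Q u ∧ not (P u)} (_⊕ t) (λ u p → ∧-true (moved u p) (not-true (out u p)))
                            (λ u v _ _ → translate-inj t)) ⟩
  count (λ u → Q u ∧ P u) + count (λ u → Q u ∧ not (P u))  ≡⟨ count-split P Q ⟨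
  count Q  ∎
  where open ≤-Reasoning

halving : {P Q : 𝔽₂^ n → Bool} (t : 𝔽₂^ n) → Q t ≡ true → P t ≡ false →
  (∀ u v → Q u ≡ true → P u ≡ false → Q v ≡ true → P v ≡ false → P (u ⊕ v) ≡ true) → count Q ≤ 2 * count P
halving {P = P} {Q} t Qt ¬Pt index = begin
  count Q  ≡⟨ count-split P Q ⟩
  count (λ u → Q u ∧ P u) + count (λ u → Q u ∧ not (P u))
    ≤⟨ +-mono-≤ (⊆⇒count≤ {P = λ u → Q u ∧ P u} {P} (λ u p → 𝔹ₚ.∧-conicalʳ (Q u) _ p))
         (count-inj {P = λ u → Q u ∧ not (P u)} {P} (_⊕ t)
           (λ u p → index u t (𝔹ₚ.∧-conicalˡ (Q u) _ p) (not-true⁻ (𝔹ₚ.∧-conicalʳ (Q u) _ p)) Qt ¬Pt)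
           (λ u v _ _ → translate-inj t)) ⟩
  count P + count P  ≡⟨ cong (count P +_) (+-identityʳ _) ⟨
  2 * count P  ∎
  where open ≤-Reasoning

proper-subspace : {P Q : 𝔽₂^ n → Bool} → IsSubspace P → IsSubspace Q → (∀ u → P u ≡ true → Q u ≡ true) →
  ∀ t → Q t ≡ true → P t ≡ false → 2 * count P ≤ count Q
proper-subspace {P = P} subP subQ P⊆Q t Qt ¬Pt = doubling t P⊆Q (λ u p → closed subQ u t (P⊆Q u p) Qt)
  (λ u p → subst (λ v → P v ≡ false) (⊕-comm t u) (closed-∉ subP t u ¬Pt p))

-- If the sum were also outside `P`, then `P` and its translates by the two elements and by their
-- sum would be four disjoint cosets inside `Q`. `doubling` counts them in two rounds, the second
-- for the union `P₁` of two cosets.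
index-two : {P Q : 𝔽₂^ n → Bool} → IsSubspace P → IsSubspace Q → (∀ u → P u ≡ true → Q u ≡ true) →
  count Q < 4 * count P → ∀ u v → Q u ≡ true → P u ≡ false → Q v ≡ true → P v ≡ false → P (u ⊕ v) ≡ true
index-two {n} {P} {Q} subP subQ P⊆Q small t t′ Qt ¬Pt Qt′ ¬Pt′ with true? (P (t ⊕ t′))
... | inj₁ yes′  = yes′
... | inj₂ ¬Ptt′ = ⊥-elim (<⇒≱ small (begin
  4 * count P  ≡⟨ *-assoc 2 2 (count P) ⟩
  2 * (2 * count P)  ≤⟨ *-monoʳ-≤ 2 (doubling {P = P} {P₁} t (λ u p → ∨-left (P u) p)
                          (λ u p → ∨-right (P (u ⊕ t)) (trans (cong P (⊕-cancelʳ u t)) p))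
                          (λ u p → subst (λ v → P v ≡ false) (⊕-comm t u) (closed-∉ subP t u ¬Pt p))) ⟩
  2 * count P₁  ≤⟨ doubling {P = P₁} {Q} t′ P₁⊆Q (λ u p → closed subQ u t′ (P₁⊆Q u p) Qt′) out ⟩
  count Q  ∎))
  where
  open ≤-Reasoning
  _∨′_ : Bool → Bool → Bool
  b ∨′ c = not (not b ∧ not c)
  ∨-left : ∀ b {c} → b ≡ true → b ∨′ c ≡ true
  ∨-left true _ = refl
  ∨-right : ∀ b {c} → c ≡ true → b ∨′ c ≡ true
  ∨-right true  refl = refl
  ∨-right false refl = refl
  ∨-elim : ∀ b c → b ∨′ c ≡ true → b ≡ true ⊎ c ≡ true
  ∨-elim true  c    _ = inj₁ refl
  ∨-elim false true _ = inj₂ refl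
  ∨-false : ∀ {b c} → b ≡ false → c ≡ false → b ∨′ c ≡ false
  ∨-false refl refl = refl
  P₁ : 𝔽₂^ n → Bool
  P₁ u = P u ∨′ P (u ⊕ t)
  P₁⊆Q : ∀ u → P₁ u ≡ true → Q u ≡ true
  P₁⊆Q u p with ∨-elim (P u) (P (u ⊕ t)) p
  ... | inj₁ q = P⊆Q u q
  ... | inj₂ q = subst (λ v → Q v ≡ true) (⊕-cancelʳ u t) (closed subQ (u ⊕ t) t (P⊆Q _ q) Qt)
  out : ∀ u → P₁ u ≡ true → P₁ (u ⊕ t′) ≡ false
  out u p with ∨-elim (P u) (P (u ⊕ t)) p
  ... | inj₁ q = ∨-false (subst (λ v → P v ≡ false) (⊕-comm t′ u) (closed-∉ subP t′ u ¬Pt′ q))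
    (subst (λ v → P v ≡ false) (⊕-solve (t ∷ t′ ∷ u ∷ []) ((𝕩₀ ⊹ 𝕩₁) ⊹ 𝕩₂) ((𝕩₂ ⊹ 𝕩₁) ⊹ 𝕩₀) refl) (closed-∉ subP (t ⊕ t′) u ¬Ptt′ q))
  ... | inj₂ q = ∨-false
    (subst (λ v → P v ≡ false) (⊕-solve (t ∷ t′ ∷ u ∷ []) ((𝕩₀ ⊹ 𝕩₁) ⊹ (𝕩₂ ⊹ 𝕩₀)) (𝕩₂ ⊹ 𝕩₁) refl) (closed-∉ subP (t ⊕ t′) (u ⊕ t) ¬Ptt′ q))
    (subst (λ v → P v ≡ false) (⊕-solve (t ∷ t′ ∷ u ∷ []) (𝕩₁ ⊹ (𝕩₂ ⊹ 𝕩₀)) ((𝕩₂ ⊹ 𝕩₁) ⊹ 𝕩₀) refl) (closed-∉ subP t′ (u ⊕ t) ¬Pt′ q))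

kernel-embedding : (φ : 𝔽₂^ n → Bool) → AdditiveB φ → (x : 𝔽₂^ n) → φ x ≡ true →
  Σ ℕ λ k → suc k ≡ n × Σ (Emb k n) λ E → ∀ y → φ (fun E y) ≡ false
kernel-embedding {zero}  φ φ-add [] φx = true≢false φx (additiveB-0v φ φ-add)
kernel-embedding {suc k} φ φ-add x φx = k , refl , chart L , κ-chart L
  where L = kernelChart φ φ-add (x , φx)

ClawFreeSet : (𝔽₂^ n → Bool) → Set
ClawFreeSet A = ∀ x y z → A x ≡ true → A y ≡ true → A z ≡ true → x ≢ y → x ≢ z → y ≢ z → x ⊕ y ≢ z →
  A (x ⊕ y) ≡ true ⊎ A (x ⊕ z) ≡ true ⊎ A (y ⊕ z) ≡ true ⊎ A ((x ⊕ y) ⊕ z) ≡ true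

-- U = im ψ is a maximal flat avoiding A.  For x outside U the fibre of A over
-- the coset x ⊕ U is {s | x ∋ s}; it is a coset of the subspace stab x.
module ClawFree {n a : ℕ} (A : 𝔽₂^ n → Bool) (A0 : A 0v ≡ false)
  (claw-free : ClawFreeSet A)
  (ψ : Emb a n) (ψ-avoids : Avoids A ψ) (maximal : ¬ Flat A (suc a)) where

  U-avoids : ∀ u → A (fun ψ u) ≡ false
  U-avoids u with u ≟ᵥ 0v
  ... | yes refl = trans (cong A (0v-fun ψ)) A0
  ... | no u≢0   = ψ-avoids u u≢0

  Out : 𝔽₂^ n → Set
  Out x = ¬ x ∈im ψ

  infix 4 _∋_
  _∋_ : 𝔽₂^ n → 𝔽₂^ a → Set
  x ∋ s = A (x ⊕ fun ψ s) ≡ true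

  opaque
    stab-dec : (x : 𝔽₂^ n) (u : 𝔽₂^ a) → Dec (∀ s → A (x ⊕ fun ψ (s ⊕ u)) ≡ A (x ⊕ fun ψ s))
    stab-dec x u = ∀? (λ s → A (x ⊕ fun ψ (s ⊕ u)) 𝔹ₚ.≟ A (x ⊕ fun ψ s))

    -- Defined as the periods of the fibre, not as differences of its points, so that it is a
    -- subspace from the start.
    stab : 𝔽₂^ n → 𝔽₂^ a → Bool
    stab x u = ⌊ stab-dec x u ⌋

    stab⇒ : ∀ {x u} → stab x u ≡ true → ∀ s → A (x ⊕ fun ψ (s ⊕ u)) ≡ A (x ⊕ fun ψ s)
    stab⇒ {x} {u} eq with stab-dec x u
    ... | yes h = h

    stab⇐ : ∀ {x u} → (∀ s → A (x ⊕ fun ψ (s ⊕ u)) ≡ A (x ⊕ fun ψ s)) → stab x u ≡ true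
    stab⇐ {x} {u} h with stab-dec x u
    ... | yes _ = refl
    ... | no ¬h = contradiction h ¬h

  stab-subspace : ∀ x → IsSubspace (stab x)
  stab-subspace x = record
    { has-0  = stab⇐ (λ s → cong (λ t → A (x ⊕ fun ψ t)) (⊕-identityʳ s))
    ; closed = λ u v p q → stab⇐ (λ s → trans (cong (λ t → A (x ⊕ fun ψ t)) (sym (⊕-assoc s u v))) (trans (stab⇒ {x} q (s ⊕ u)) (stab⇒ {x} p s)))
    }

  ∋-stab : ∀ {x s u} → x ∋ s → stab x u ≡ true → x ∋ (s ⊕ u)
  ∋-stab {x} {s} xs st = trans (stab⇒ {x} st s) xs

  infix 4 _≈_
  _≈_ : 𝔽₂^ n → 𝔽₂^ n → Set
  x ≈ y = ∀ u → stab x u ≡ stab y u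

  _≈?_ : ∀ x y → Dec (x ≈ y)
  x ≈? y = ∀? (λ u → stab x u 𝔹ₚ.≟ stab y u)

  ≈-sym : ∀ {x y} → x ≈ y → y ≈ x
  ≈-sym h u = sym (h u)

  ≈-trans : ∀ {x y z} → x ≈ y → y ≈ z → x ≈ z
  ≈-trans h h′ u = trans (h u) (h′ u)

  ≈-size : ∀ {x y} → x ≈ y → count (stab x) ≡ count (stab y)
  ≈-size h = sum-cong (𝔾 a) (λ u → cong ι (h u))

  ≈-translate : ∀ x v → (x ⊕ fun ψ v) ≈ x
  ≈-translate x v u = bool-ext
    (λ p → stab⇐ (λ s → trans (cong A (regroup s)) (trans (stab⇒ {x ⊕ fun ψ v} p (s ⊕ v)) (cong A (regroup₀ s)))))
    (λ p → stab⇐ (λ s → trans (cong A (regroup₁ s)) (trans (stab⇒ {x} p (v ⊕ s)) (cong A (regroup₂ s)))))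
    where
    φ₂ : ∀ s t → fun ψ (s ⊕ t) ≡ fun ψ s ⊕ fun ψ t
    φ₂ = add ψ
    regroup : ∀ s → x ⊕ fun ψ (s ⊕ u) ≡ (x ⊕ fun ψ v) ⊕ fun ψ ((s ⊕ v) ⊕ u)
    regroup s = trans (cong (λ t → x ⊕ fun ψ t) (⊕-solve (s ∷ u ∷ v ∷ []) (𝕩₀ ⊹ 𝕩₁) (𝕩₂ ⊹ ((𝕩₀ ⊹ 𝕩₂) ⊹ 𝕩₁)) refl))
      (trans (cong (x ⊕_) (φ₂ v ((s ⊕ v) ⊕ u))) (sym (⊕-assoc x _ _)))
    regroup₀ : ∀ s → (x ⊕ fun ψ v) ⊕ fun ψ (s ⊕ v) ≡ x ⊕ fun ψ s
    regroup₀ s = trans (⊕-assoc x _ _) (cong (x ⊕_) (trans (sym (φ₂ v (s ⊕ v))) (cong (fun ψ) (⊕-solve (s ∷ v ∷ []) (𝕩₁ ⊹ (𝕩₀ ⊹ 𝕩₁)) 𝕩₀ refl))))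
    regroup₁ : ∀ s → (x ⊕ fun ψ v) ⊕ fun ψ (s ⊕ u) ≡ x ⊕ fun ψ ((v ⊕ s) ⊕ u)
    regroup₁ s = trans (⊕-assoc x _ _) (cong (x ⊕_) (trans (sym (φ₂ v (s ⊕ u))) (cong (fun ψ) (sym (⊕-assoc v s u)))))
    regroup₂ : ∀ s → x ⊕ fun ψ (v ⊕ s) ≡ (x ⊕ fun ψ v) ⊕ fun ψ s
    regroup₂ s = trans (cong (x ⊕_) (φ₂ v s)) (sym (⊕-assoc x _ _))

  out-fibre : ∀ {x} s → Out x → x ⊕ fun ψ s ≢ 0v
  out-fibre s x∉ eq = x∉ (s , sym (⊕≡0⇒≡ eq))

  -- A coset disjoint from `A` would enlarge `U` by one dimension.
  nonempty : ∀ x → Out x → ∃ λ s → x ∋ s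
  nonempty x x∉ with ∃? (λ s → A (x ⊕ fun ψ s) 𝔹ₚ.≟ true)
  ... | yes w = w
  ... | no ¬w = ⊥-elim (maximal (snoc ψ x (λ y eq → x∉ (y , eq)) , avoids))
    where
    avoids : ∀ y → y ≢ 0v → _
    avoids (true ∷ y)  _   = 𝔹ₚ.¬-not (λ p → ¬w (y , p))
    avoids (false ∷ y) _   = trans (cong A (⊕-identityˡ _)) (U-avoids y)

  private
    in-U : ∀ {x y} → (∃ λ u → x ⊕ y ≡ fun ψ u) → A (x ⊕ y) ≡ false
    in-U (u , eq) = trans (cong A eq) (U-avoids u)

    same-coset : ∀ x s t → (x ⊕ fun ψ s) ⊕ (x ⊕ fun ψ t) ≡ fun ψ (s ⊕ t)
    same-coset x s t = trans (⊕-solve (x ∷ fun ψ s ∷ fun ψ t ∷ []) ((𝕩₀ ⊹ 𝕩₁) ⊹ (𝕩₀ ⊹ 𝕩₂)) (𝕩₁ ⊹ 𝕩₂) refl) (sym (add ψ s t))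

  -- Points of `A` in one coset have pairwise sums in `U`, hence outside `A`; claw-freeness leaves
  -- only the sum of all three.
  affine : ∀ {x s t u} → Out x → x ∋ s → x ∋ t → x ∋ u → x ∋ ((s ⊕ t) ⊕ u)
  affine {x} {s} {t} {u} x∉ xs xt xu with s ≟ᵥ t | s ≟ᵥ u | t ≟ᵥ u
  ... | yes refl | _ | _ = trans (cong (λ v → A (x ⊕ fun ψ v)) (⊕-solve (s ∷ u ∷ []) ((𝕩₀ ⊹ 𝕩₀) ⊹ 𝕩₁) 𝕩₁ refl)) xu
  ... | no _ | yes refl | _ = trans (cong (λ v → A (x ⊕ fun ψ v)) (⊕-solve (s ∷ t ∷ []) ((𝕩₀ ⊹ 𝕩₁) ⊹ 𝕩₀) 𝕩₁ refl)) xt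
  ... | no _ | no _ | yes refl = trans (cong (λ v → A (x ⊕ fun ψ v)) (⊕-solve (s ∷ t ∷ []) ((𝕩₀ ⊹ 𝕩₁) ⊹ 𝕩₁) 𝕩₀ refl)) xs
  ... | no s≢t | no s≢u | no t≢u with claw-free (x ⊕ fun ψ s) (x ⊕ fun ψ t) (x ⊕ fun ψ u) xs xt xu (distinct s≢t) (distinct s≢u) (distinct t≢u) indep
    where
    distinct : ∀ {s t} → s ≢ t → x ⊕ fun ψ s ≢ x ⊕ fun ψ t
    distinct {s} {t} s≢t eq = s≢t (inj ψ s t (trans (sym (⊕-cancelˡ x _)) (trans (cong (x ⊕_) eq) (⊕-cancelˡ x _))))
    indep : (x ⊕ fun ψ s) ⊕ (x ⊕ fun ψ t) ≢ x ⊕ fun ψ u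
    indep eq = x∉ ((s ⊕ t) ⊕ u , trans (add ψ (s ⊕ t) u) (trans (cong (_⊕ fun ψ u) (trans (sym (same-coset x s t)) eq)) (⊕-cancelʳ x _)))
  ... | inj₁ p               = true≢false p (in-U (s ⊕ t , same-coset x s t))
  ... | inj₂ (inj₁ p)        = true≢false p (in-U (s ⊕ u , same-coset x s u))
  ... | inj₂ (inj₂ (inj₁ p)) = true≢false p (in-U (t ⊕ u , same-coset x t u))
  ... | inj₂ (inj₂ (inj₂ p)) = trans (cong A (sym (trans (cong (_⊕ (x ⊕ fun ψ u)) (same-coset x s t))
    (trans (⊕-solve (fun ψ (s ⊕ t) ∷ x ∷ fun ψ u ∷ []) (𝕩₀ ⊹ (𝕩₁ ⊹ 𝕩₂)) (𝕩₁ ⊹ (𝕩₀ ⊹ 𝕩₂)) refl) (cong (x ⊕_) (sym (add ψ (s ⊕ t) u))))))) p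

  stab-difference : ∀ {x s t} → Out x → x ∋ s → x ∋ t → stab x (s ⊕ t) ≡ true
  stab-difference {x} {s} {t} x∉ xs xt = stab⇐ {x} (λ v → bool-ext
    (λ p → trans (cong (λ w → A (x ⊕ fun ψ w)) (⊕-solve (v ∷ s ∷ t ∷ []) 𝕩₀ (((𝕩₀ ⊹ (𝕩₁ ⊹ 𝕩₂)) ⊹ 𝕩₁) ⊹ 𝕩₂) refl)) (affine x∉ p xs xt))
    (λ p → trans (cong (λ w → A (x ⊕ fun ψ w)) (sym (⊕-assoc v s t))) (affine x∉ p xs xt)))

  -- A line of the quotient by `U`, given by representatives.
  record Line (x y z : 𝔽₂^ n) : Set where
    constructor line
    field
      x∉ : Out x
      y∉ : Out y
      z∉ : Out z
      total : x ⊕ y ≡ z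

  swapL : ∀ {x y z} → Line x y z → Line y x z
  swapL {x} {y} (line x∉ y∉ z∉ eq) = line y∉ x∉ z∉ (trans (⊕-comm y x) eq)

  rotL : ∀ {x y z} → Line x y z → Line z x y
  rotL {x} {y} (line x∉ y∉ z∉ refl) = line z∉ x∉ y∉ (⊕-solve (x ∷ y ∷ []) ((𝕩₀ ⊹ 𝕩₁) ⊹ 𝕩₀) 𝕩₁ refl)

  fibre-sum : ∀ {x y z} → x ⊕ y ≡ z → ∀ s t → (x ⊕ fun ψ s) ⊕ (y ⊕ fun ψ t) ≡ z ⊕ fun ψ (s ⊕ t)
  fibre-sum {x} {y} refl s t = trans (⊕-interchange x (fun ψ s) y (fun ψ t)) (cong ((x ⊕ y) ⊕_) (sym (add ψ s t)))

  -- Applies claw-freeness to two points over `x` that differ by `t` and one point over `y`. The sum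
  -- of all three lies over `y` and would make `t` a period there, so one of the two sums over `z`
  -- must be in `A`.
  line-claw : ∀ {x y z s s′ t} → Line x y z → stab x t ≡ true → stab y t ≡ false → x ∋ s → y ∋ s′ →
    z ∋ (s ⊕ s′) ⊎ z ∋ ((s ⊕ s′) ⊕ t)
  line-claw {x} {y} {z} {s} {s′} {t} (line x∉ y∉ z∉ eq) Pt ¬Qt xs ys
    with claw-free (x ⊕ fun ψ s) (x ⊕ fun ψ (s ⊕ t)) (y ⊕ fun ψ s′) xs (∋-stab xs Pt) ys p₁≢p₂ (apart s) (apart (s ⊕ t)) indep
    where
    t≢0 : t ≢ 0v
    t≢0 refl = true≢false (has-0 (stab-subspace y)) ¬Qt
    p₁≢p₂ : x ⊕ fun ψ s ≢ x ⊕ fun ψ (s ⊕ t)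
    p₁≢p₂ e = t≢0 (ker ψ t (trans (⊕-solve (x ∷ fun ψ s ∷ fun ψ t ∷ []) 𝕩₂ ((𝕩₀ ⊹ 𝕩₁) ⊹ (𝕩₀ ⊹ (𝕩₁ ⊹ 𝕩₂))) refl)
      (trans (cong (λ w → (x ⊕ fun ψ s) ⊕ (x ⊕ w)) (sym (add ψ s t))) (trans (cong ((x ⊕ fun ψ s) ⊕_) (sym e)) (⊕-self _)))))
    apart : ∀ s → x ⊕ fun ψ s ≢ y ⊕ fun ψ s′
    apart s e = out-fibre (s ⊕ s′) z∉ (trans (sym (fibre-sum eq s s′)) (trans (cong (_⊕ (y ⊕ fun ψ s′)) e) (⊕-self _)))
    indep : (x ⊕ fun ψ s) ⊕ (x ⊕ fun ψ (s ⊕ t)) ≢ y ⊕ fun ψ s′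
    indep e = y∉ ((s ⊕ (s ⊕ t)) ⊕ s′ , trans (add ψ _ s′) (trans (cong (_⊕ fun ψ s′) (trans (sym (same-coset x s (s ⊕ t))) e)) (⊕-cancelʳ y _)))
  ... | inj₁ p               = true≢false p (in-U (s ⊕ (s ⊕ t) , same-coset x s (s ⊕ t)))
  ... | inj₂ (inj₁ p)        = inj₁ (trans (cong A (sym (fibre-sum eq s s′))) p)
  ... | inj₂ (inj₂ (inj₁ p)) = inj₂ (trans (cong A (sym (trans (fibre-sum eq (s ⊕ t) s′) (cong (λ w → z ⊕ fun ψ w) (⊕-solve (s ∷ t ∷ s′ ∷ []) ((𝕩₀ ⊹ 𝕩₁) ⊹ 𝕩₂) ((𝕩₀ ⊹ 𝕩₂) ⊹ 𝕩₁) refl))))) p)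
  ... | inj₂ (inj₂ (inj₂ p)) = true≢false (subst (λ w → stab y w ≡ true) (⊕-cancelˡ s′ t) (stab-difference y∉ ys y∋)) ¬Qt
    where
    y∋ : y ∋ (s′ ⊕ t)
    y∋ = trans (cong A (sym (trans (cong (_⊕ (y ⊕ fun ψ s′)) (trans (same-coset x s (s ⊕ t)) (cong (fun ψ) (⊕-cancelˡ s t))))
      (trans (⊕-solve (fun ψ t ∷ y ∷ fun ψ s′ ∷ []) (𝕩₀ ⊹ (𝕩₁ ⊹ 𝕩₂)) (𝕩₁ ⊹ (𝕩₂ ⊹ 𝕩₀)) refl) (cong (y ⊕_) (sym (add ψ s′ t))))))) p

  _⊑_ : 𝔽₂^ n → 𝔽₂^ n → Set
  x ⊑ y = ∀ u → stab x u ≡ true → stab y u ≡ true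

  _∖_ : 𝔽₂^ n → 𝔽₂^ n → 𝔽₂^ a → Set
  (x ∖ y) t = stab x t ≡ true × stab y t ≡ false

  ⊑⊎∖ : ∀ x y → x ⊑ y ⊎ ∃ (x ∖ y)
  ⊑⊎∖ x y with ∃? (λ t → (stab x t 𝔹ₚ.≟ true) ×-dec (stab y t 𝔹ₚ.≟ false))
  ... | yes w = inj₂ w
  ... | no ¬w = inj₁ (λ u p → 𝔹ₚ.¬-not (λ q → ¬w (u , p , q)))

  ⊑-antisym : ∀ {x y} → x ⊑ y → y ⊑ x → x ≈ y
  ⊑-antisym f g u = bool-ext (f u) (g u)

  Full : (x y z : 𝔽₂^ n) → Set
  Full x y z = ∀ s s′ → x ∋ s → y ∋ s′ → z ∋ (s ⊕ s′)

  -- The alternative to `Full`: one sum of fibre points is missing over `z`, and `line-claw` then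
  -- puts every translate of it by an element of `x ∖ y` into the fibre.
  record Half (x y z : 𝔽₂^ n) : Set where
    field
      meet   : ∀ u → stab x u ≡ true → stab y u ≡ true → stab z u ≡ true
      apart  : ∀ t → (x ∖ y) t → stab z t ≡ false
      index  : ∀ t t′ → (x ∖ y) t → (x ∖ y) t′ → stab y (t ⊕ t′) ≡ true
      s₀ s₁  : 𝔽₂^ a
      fibre  : ∀ t → (x ∖ y) t → z ∋ ((s₀ ⊕ s₁) ⊕ t)
      x∋s₀   : x ∋ s₀
      y∋s₁   : y ∋ s₁
      z∌     : A (z ⊕ fun ψ (s₀ ⊕ s₁)) ≡ false

  full-⊑ : ∀ {x y z} → Line x y z → Full x y z → x ⊑ z × y ⊑ z
  full-⊑ {x} {y} {z} (line x∉ y∉ z∉ eq) full = in-z , in-z′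
    where
    s  = proj₁ (nonempty x x∉)
    xs = proj₂ (nonempty x x∉)
    t  = proj₁ (nonempty y y∉)
    yt = proj₂ (nonempty y y∉)
    in-z : x ⊑ z
    in-z u p = subst (λ w → stab z w ≡ true) (⊕-solve (s ∷ t ∷ u ∷ []) ((𝕩₀ ⊹ 𝕩₁) ⊹ ((𝕩₀ ⊹ 𝕩₂) ⊹ 𝕩₁)) 𝕩₂ refl)
      (stab-difference z∉ (full s t xs yt) (full (s ⊕ u) t (∋-stab xs p) yt))
    in-z′ : y ⊑ z
    in-z′ u p = subst (λ w → stab z w ≡ true) (⊕-solve (s ∷ t ∷ u ∷ []) ((𝕩₀ ⊹ 𝕩₁) ⊹ (𝕩₀ ⊹ (𝕩₁ ⊹ 𝕩₂))) 𝕩₂ refl)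
      (stab-difference z∉ (full s t xs yt) (full s (t ⊕ u) xs (∋-stab yt p)))

  half-from : ∀ {x y z} → Line x y z → ∃ (x ∖ y) → ∀ s s′ → x ∋ s → y ∋ s′ → A (z ⊕ fun ψ (s ⊕ s′)) ≡ false → Half x y z
  half-from {x} {y} {z} L (t₀ , Pt₀ , ¬Qt₀) s s′ xs ys z∌ = record
    { meet = meet ; apart = apart ; index = index ; s₀ = s ; s₁ = s′ ; fibre = fibre ; x∋s₀ = xs ; y∋s₁ = ys ; z∌ = z∌ }
    where
    open Line L
    fibre : ∀ t → (x ∖ y) t → z ∋ ((s ⊕ s′) ⊕ t)
    fibre t (Pt , ¬Qt) with line-claw L Pt ¬Qt xs ys
    ... | inj₁ p = true≢false p z∌
    ... | inj₂ p = p
    apart : ∀ t → (x ∖ y) t → stab z t ≡ false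
    apart t d = 𝔹ₚ.¬-not (λ Rt → true≢false (trans (cong (λ w → A (z ⊕ fun ψ w)) (sym (⊕-cancelʳ (s ⊕ s′) t))) (∋-stab (fibre t d) Rt)) z∌)
    meet : ∀ u → stab x u ≡ true → stab y u ≡ true → stab z u ≡ true
    meet u Pu Qu = subst (λ w → stab z w ≡ true) (⊕-solve ((s ⊕ s′) ∷ t₀ ∷ u ∷ []) ((𝕩₀ ⊹ 𝕩₁) ⊹ (𝕩₀ ⊹ (𝕩₁ ⊹ 𝕩₂))) 𝕩₂ refl)
      (stab-difference z∉ (fibre t₀ (Pt₀ , ¬Qt₀)) (fibre (t₀ ⊕ u) (closed (stab-subspace x) t₀ u Pt₀ Pu , closed-∉ (stab-subspace y) t₀ u ¬Qt₀ Qu)))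
    -- If `t ⊕ t′` were in `x ∖ y` as well, three points of the affine fibre over `z` would add up
    -- to the missing one.
    index : ∀ t t′ → (x ∖ y) t → (x ∖ y) t′ → stab y (t ⊕ t′) ≡ true
    index t t′ d d′ with true? (stab y (t ⊕ t′))
    ... | inj₁ p = p
    ... | inj₂ ¬p = true≢false (trans (cong (λ w → A (z ⊕ fun ψ w)) (⊕-solve ((s ⊕ s′) ∷ t ∷ t′ ∷ []) 𝕩₀ (((𝕩₀ ⊹ 𝕩₁) ⊹ (𝕩₀ ⊹ 𝕩₂)) ⊹ (𝕩₀ ⊹ (𝕩₁ ⊹ 𝕩₂))) refl))
      (affine z∉ (fibre t d) (fibre t′ d′) (fibre (t ⊕ t′) (closed (stab-subspace x) t t′ (proj₁ d) (proj₁ d′) , ¬p)))) z∌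

  full⊎half : ∀ {x y z} → Line x y z → ∃ (x ∖ y) → Full x y z ⊎ Half x y z
  full⊎half {x} {y} {z} L d with ∃? (λ s → ∃? (λ s′ → (A (x ⊕ fun ψ s) 𝔹ₚ.≟ true) ×-dec ((A (y ⊕ fun ψ s′) 𝔹ₚ.≟ true) ×-dec (A (z ⊕ fun ψ (s ⊕ s′)) 𝔹ₚ.≟ false))))
  ... | yes (s , s′ , xs , ys , z∌) = inj₂ (half-from L d s s′ xs ys z∌)
  ... | no ¬w = inj₁ (λ s s′ xs ys → 𝔹ₚ.¬-not (λ z∌ → ¬w (s , s′ , xs , ys , z∌)))

  -- The stabiliser of the third point of a line whose first two stabilisers are incomparable.
  Third : (P Q : 𝔽₂^ a → Bool) → 𝔽₂^ a → Set
  Third P Q ρ = (P ρ ≡ true × Q ρ ≡ true) ⊎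
    ∃ λ t → ∃ λ t′ → (P t ≡ true × Q t ≡ false) × (Q t′ ≡ true × P t′ ≡ false) × ρ ≡ t ⊕ t′

  record Incomparable (x y z : 𝔽₂^ n) : Set where
    field
      third⇒ : ∀ ρ → stab z ρ ≡ true → Third (stab x) (stab y) ρ
      third⇐ : ∀ ρ → Third (stab x) (stab y) ρ → stab z ρ ≡ true
      z∖x    : ∃ (z ∖ x)
      z∖y    : ∃ (z ∖ y)
      x∖z    : ∃ (x ∖ z)
      y∖z    : ∃ (y ∖ z)
      size   : count (stab x) ≤ count (stab z)

  -- The full case would put both stabilisers into that of `z`, and the same line read from `z` and
  -- `x` would then force `t₀` into `stab y`. So both halves hold around one missing point, and
  -- comparing their fibres yields the mixed sums.
  incomparable : ∀ {x y z} → Line x y z → ∃ (x ∖ y) → ∃ (y ∖ x) → Incomparable x y z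
  incomparable {x} {y} {z} L (t₀ , Pt₀ , ¬Qt₀) (t₁ , Qt₁ , ¬Pt₁) with full⊎half L (t₀ , Pt₀ , ¬Qt₀)
  ... | inj₁ full = ⊥-elim (impossible (full⊎half (rotL L) (t₁ , Q⊑R t₁ Qt₁ , ¬Pt₁)))
    where
    P⊑R = proj₁ (full-⊑ L full)
    Q⊑R = proj₂ (full-⊑ L full)
    impossible : Full z x y ⊎ Half z x y → ⊥
    impossible (inj₁ f) = true≢false (proj₂ (full-⊑ (rotL L) f) t₀ Pt₀) ¬Qt₀
    impossible (inj₂ h) = true≢false (Half.meet h t₀ (P⊑R t₀ Pt₀) Pt₀) ¬Qt₀
  ... | inj₂ half = record
    { third⇒ = third⇒ ; third⇐ = third⇐
    ; z∖x = ρ₀ , Rρ₀ , ¬Pρ₀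
    ; z∖y = ρ₀ , Rρ₀ , closed-∉ (stab-subspace y) t₀ t₁ ¬Qt₀ Qt₁
    ; x∖z = t₀ , Pt₀ , Half.apart half t₀ (Pt₀ , ¬Qt₀)
    ; y∖z = t₁ , Qt₁ , Half.apart half′ t₁ (Qt₁ , ¬Pt₁)
    ; size = size
    }
    where
    open Line L
    open Half half using (s₀; s₁; x∋s₀; y∋s₁; z∌)
    half′ : Half y x z
    half′ = half-from (swapL L) (t₁ , Qt₁ , ¬Pt₁) s₁ s₀ y∋s₁ x∋s₀ (trans (cong (λ w → A (z ⊕ fun ψ w)) (⊕-comm s₁ s₀)) z∌)
    cross : ∀ t t′ → (x ∖ y) t → (y ∖ x) t′ → stab z (t ⊕ t′) ≡ true
    cross t t′ d d′ = subst (λ w → stab z w ≡ true) (⊕-solve (s₀ ∷ s₁ ∷ t ∷ t′ ∷ []) (((𝕩₀ ⊹ 𝕩₁) ⊹ 𝕩₂) ⊹ ((𝕩₁ ⊹ 𝕩₀) ⊹ 𝕩₃)) (𝕩₂ ⊹ 𝕩₃) refl)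
      (stab-difference z∉ (Half.fibre half t d) (Half.fibre half′ t′ d′))
    ρ₀ = t₀ ⊕ t₁
    Rρ₀ : stab z ρ₀ ≡ true
    Rρ₀ = cross t₀ t₁ (Pt₀ , ¬Qt₀) (Qt₁ , ¬Pt₁)
    ¬Pρ₀ : stab x ρ₀ ≡ false
    ¬Pρ₀ = subst (λ w → stab x w ≡ false) (⊕-comm t₁ t₀) (closed-∉ (stab-subspace x) t₁ t₀ ¬Pt₁ Pt₀)
    third⇐ : ∀ ρ → Third (stab x) (stab y) ρ → stab z ρ ≡ true
    third⇐ ρ (inj₁ (p , q)) = Half.meet half ρ p q
    third⇐ ρ (inj₂ (t , t′ , d , d′ , refl)) = cross t t′ d d′
    third⇒ : ∀ ρ → stab z ρ ≡ true → Third (stab x) (stab y) ρ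
    third⇒ ρ Rρ = from (full⊎half (rotL L) (ρ₀ , Rρ₀ , ¬Pρ₀))
      where
      δ = ρ ⊕ ρ₀
      outside-P : Half z x y → stab x ρ ≡ false → Third (stab x) (stab y) ρ
      outside-P h ¬Pρ = inj₂ (t₀ ⊕ δ , t₁ , (closed (stab-subspace x) t₀ δ Pt₀ Pδ , closed-∉ (stab-subspace y) t₀ δ ¬Qt₀ Qδ) , (Qt₁ , ¬Pt₁)
        , ⊕-solve (ρ ∷ t₀ ∷ t₁ ∷ []) 𝕩₀ ((𝕩₁ ⊹ (𝕩₀ ⊹ (𝕩₁ ⊹ 𝕩₂))) ⊹ 𝕩₂) refl)
        where
        Pδ : stab x δ ≡ true
        Pδ = Half.index h ρ ρ₀ (Rρ , ¬Pρ) (Rρ₀ , ¬Pρ₀)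
        Qδ : stab y δ ≡ true
        Qδ = Half.meet h δ (closed (stab-subspace z) ρ ρ₀ Rρ Rρ₀) Pδ
      by-side : Half z x y → stab x ρ ≡ true ⊎ stab x ρ ≡ false → Third (stab x) (stab y) ρ
      by-side h (inj₁ Pρ)  = inj₁ (Pρ , Half.meet h ρ Rρ Pρ)
      by-side h (inj₂ ¬Pρ) = outside-P h ¬Pρ
      from : Full z x y ⊎ Half z x y → Third (stab x) (stab y) ρ
      from (inj₁ f) = true≢false (proj₂ (full-⊑ (rotL L) f) t₀ Pt₀) ¬Qt₀
      from (inj₂ h) = by-side h (true? (stab x ρ))
    -- Shifting the elements of `x ∖ y` by one element `t₁` of `y ∖ x` injects `stab x` into
    -- `stab z`.
    slide : ∀ u b → stab y u ≡ b → 𝔽₂^ a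
    slide u true  _ = u
    slide u false _ = u ⊕ t₁
    size : count (stab x) ≤ count (stab z)
    size = count-inj {P = stab x} {stab z} (λ u → slide u (stab y u) refl) (λ u p → maps u p (stab y u) refl)
      (λ u v p p′ → injective u v p p′ (stab y u) (stab y v) refl refl)
      where
      maps : ∀ u → stab x u ≡ true → ∀ b (e : stab y u ≡ b) → stab z (slide u b e) ≡ true
      maps u p true  e = Half.meet half u p e
      maps u p false e = cross u t₁ (p , e) (Qt₁ , ¬Pt₁)
      mixed : ∀ u v → stab x u ≡ true → stab x v ≡ true → u ≢ v ⊕ t₁
      mixed u v p p′ refl = true≢false (subst (λ w → stab x w ≡ true) (⊕-solve (v ∷ t₁ ∷ []) ((𝕩₀ ⊹ 𝕩₁) ⊹ 𝕩₀) 𝕩₁ refl) (closed (stab-subspace x) _ _ p p′)) ¬Pt₁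
      injective : ∀ u v → stab x u ≡ true → stab x v ≡ true → ∀ b c (e : stab y u ≡ b) (e′ : stab y v ≡ c) → slide u b e ≡ slide v c e′ → u ≡ v
      injective u v p p′ true  true  _ _ eq = eq
      injective u v p p′ true  false _ _ eq = ⊥-elim (mixed u v p p′ eq)
      injective u v p p′ false true  _ _ eq = ⊥-elim (mixed v u p′ p (sym eq))
      injective u v p p′ false false _ _ eq = translate-inj t₁ eq

  -- Every pair on the line is again incomparable, so the injection exists in all directions.
  incomparable-size : ∀ {x y z} → Line x y z → ∃ (x ∖ y) → ∃ (y ∖ x) → count (stab z) ≡ count (stab x) × count (stab y) ≡ count (stab x)
  incomparable-size {x} {y} {z} L d d′ = ≤-antisym R≤P (size I) , ≤-antisym (≤-trans Q≤R R≤P) (≤-trans (size I) R≤Q)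
    where
    open Incomparable
    I = incomparable L d d′
    R≤Q : count (stab z) ≤ count (stab y)
    R≤Q = size (incomparable (rotL L) (z∖x I) (x∖z I))
    R≤P : count (stab z) ≤ count (stab x)
    R≤P = size (incomparable (rotL (swapL L)) (z∖y I) (y∖z I))
    Q≤R : count (stab y) ≤ count (stab z)
    Q≤R = size (incomparable (swapL L) d′ d)

  -- Any other stabiliser at `z` is excluded by reading the line from another pair of points: it
  -- would place an element outside `stab x` inside it, or contradict the inclusion in `stab y`.
  comparable : ∀ {x y z} → Line x y z → x ⊑ y → ∃ (y ∖ x) → (Full x y z × z ≈ y) ⊎ (Half y x z × z ≈ x)
  comparable {x} {y} {z} L P⊑Q (t₁ , Qt₁ , ¬Pt₁) with full⊎half (swapL L) (t₁ , Qt₁ , ¬Pt₁)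
  ... | inj₁ full = inj₁ ((λ s s′ xs ys → subst (λ w → z ∋ w) (⊕-comm s′ s) (full s′ s ys xs)) , ⊑-antisym R⊑Q Q⊑R)
    where
    Q⊑R = proj₁ (full-⊑ (swapL L) full)
    L′ = rotL (swapL L)
    R⊑Q : z ⊑ y
    R⊑Q with ⊑⊎∖ z y
    ... | inj₁ h = h
    ... | inj₂ d with full⊎half L′ d
    ...   | inj₁ f = true≢false (proj₂ (full-⊑ L′ f) t₁ Qt₁) ¬Pt₁
    ...   | inj₂ h = true≢false (Half.meet h t₁ (Q⊑R t₁ Qt₁) Qt₁) ¬Pt₁
  ... | inj₂ half = inj₂ (half , ⊑-antisym R⊑P (λ u p → Half.meet half u (P⊑Q u p) p))
    where
    R⊑Q : z ⊑ y
    R⊑Q with ⊑⊎∖ z y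
    ... | inj₁ h = h
    ... | inj₂ d with Incomparable.z∖x (incomparable (rotL (rotL L)) (t₁ , Qt₁ , Half.apart half t₁ (Qt₁ , ¬Pt₁)) d)
    ...   | ρ , Pρ , ¬Qρ = true≢false (P⊑Q ρ Pρ) ¬Qρ
    R⊑P : z ⊑ x
    R⊑P u Ru with true? (stab x u)
    ... | inj₁ p = p
    ... | inj₂ ¬p = true≢false Ru (Half.apart half u (R⊑Q u Ru , ¬p))

  -- The half case would give `z` the stabiliser of `x`, which is too small. Full lines are what
  -- allows flats of distant layers to be added.
  sum-of-smaller : ∀ {x y z} → Line x y z → count (stab x) < count (stab y) → count (stab x) < count (stab z) → Full x y z
  sum-of-smaller {x} {y} {z} L P<Q P<R with ⊑⊎∖ x y | ⊑⊎∖ y x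
  ... | inj₂ d | inj₂ d′ = ⊥-elim (<⇒≢ P<Q (sym (proj₂ (incomparable-size L d d′))))
  ... | _      | inj₁ h  = ⊥-elim (<⇒≱ P<Q (⊆⇒count≤ h))
  ... | inj₁ h | inj₂ d′ with comparable L h d′
  ...   | inj₁ (full , _) = full
  ...   | inj₂ (_ , eq)   = ⊥-elim (<⇒≢ P<R (sym (≈-size eq)))

  -- Read from `x` and `z`, the third point `y` does not share the stabiliser of `z`, so the half
  -- case holds, and its `index` bounds the index of `stab x` in `stab z` by two.
  larger-third : ∀ {x y z} → Line x y z → count (stab x) < count (stab z) → count (stab y) < count (stab z) →
    count (stab z) ≤ 2 * count (stab x)
  larger-third {x} {y} {z} L P<R Q<R with ⊑⊎∖ x z | ⊑⊎∖ z x
  ... | inj₂ d | inj₂ d′ = ⊥-elim (<⇒≢ P<R (sym (proj₂ (incomparable-size (swapL (rotL L)) d d′))))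
  ... | _      | inj₁ h  = ⊥-elim (<⇒≱ P<R (⊆⇒count≤ h))
  ... | inj₁ h | inj₂ (t , Rt , ¬Pt) with comparable (swapL (rotL L)) h (t , Rt , ¬Pt)
  ...   | inj₁ (_ , eq)    = ⊥-elim (<⇒≢ Q<R (≈-size eq))
  ...   | inj₂ (half , _)  = halving t Rt ¬Pt (λ u v Ru ¬Pu Rv ¬Pv → Half.index half u v (Ru , ¬Pu) (Rv , ¬Pv))

  -- Otherwise a functional φ vanishing on X and not at the defect produces, from
  -- ker φ and shifted lifts of x and y, a flat avoiding A of dimension a + 1.
  fibre-defect : ∀ {x y z} → Line x y z → {X : 𝔽₂^ a → Bool} → IsSubspace X →
    (∀ u → stab x u ≡ true → X u ≡ true) → (∀ u → stab y u ≡ true → X u ≡ true) → (∀ u → stab z u ≡ true → X u ≡ true) →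
    ∀ {s s′ s″} → x ∋ s → y ∋ s′ → z ∋ s″ → X ((s ⊕ s′) ⊕ s″) ≡ true
  fibre-defect {x} {y} {z} (line x∉ y∉ z∉ eq) {X} subX P⊆X Q⊆X R⊆X {s} {s′} {s″} xs ys zs with true? (X ((s ⊕ s′) ⊕ s″))
  ... | inj₁ p = p
  ... | inj₂ ¬p = ⊥-elim (maximal (subst (Flat A) (cong suc (proj₁ (proj₂ kerE))) (snoc E₁ x₁ x₁∉ , avoids)))
    where
    d = (s ⊕ s′) ⊕ s″
    sep = separate subX d ¬p
    φ = proj₁ sep
    φ-add = proj₁ (proj₂ sep)
    φX = proj₁ (proj₂ (proj₂ sep))
    φd = proj₂ (proj₂ (proj₂ sep))
    kerE = kernel-embedding φ φ-add d φd
    E = proj₁ (proj₂ (proj₂ kerE))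
    φE = proj₂ (proj₂ (proj₂ kerE))
    x₁ = x ⊕ fun ψ (s ⊕ d)
    y₁ = y ⊕ fun ψ (s′ ⊕ d)
    y₁∉ : ∀ h → fun (ψ ∘ₑ E) h ≢ y₁
    y₁∉ h e = y∉ (fun E h ⊕ (s′ ⊕ d) , trans (add ψ _ _) (trans (cong (_⊕ fun ψ (s′ ⊕ d)) e) (⊕-cancelʳ y _)))
    E₁ = snoc (ψ ∘ₑ E) y₁ y₁∉
    x₁∉ : ∀ h → fun E₁ h ≢ x₁
    x₁∉ (false ∷ h) e = x∉ (fun E h ⊕ (s ⊕ d) , trans (add ψ _ _) (trans (cong (_⊕ fun ψ (s ⊕ d)) (trans (sym (⊕-identityˡ _)) e)) (⊕-cancelʳ x _)))
    x₁∉ (true ∷ h)  e = z∉ ((fun E h ⊕ (s′ ⊕ d)) ⊕ (s ⊕ d) , trans (trans (add ψ _ _) (cong (_⊕ fun ψ (s ⊕ d)) (add ψ _ _)))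
      (trans (⊕-solve (fun ψ (fun E h) ∷ fun ψ (s′ ⊕ d) ∷ fun ψ (s ⊕ d) ∷ x ∷ y ∷ []) ((𝕩₀ ⊹ 𝕩₁) ⊹ 𝕩₂) ((((𝕩₄ ⊹ 𝕩₁) ⊹ 𝕩₀) ⊹ (𝕩₃ ⊹ 𝕩₂)) ⊹ (𝕩₃ ⊹ 𝕩₄)) refl)
        (trans (cong (λ w → (w ⊕ x₁) ⊕ (x ⊕ y)) e) (trans (cong (_⊕ (x ⊕ y)) (⊕-self x₁)) (trans (⊕-identityˡ _) eq)))))
    off-kernel : ∀ v h → stab v (d ⊕ fun E h) ≡ true → (∀ u → stab v u ≡ true → X u ≡ true) → ⊥
    off-kernel v h st sub = true≢false (trans (φ-add d (fun E h)) (cong₂ _xor_ φd (φE h))) (φX _ (sub _ st))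
    avoids : Avoids A (snoc E₁ x₁ x₁∉)
    avoids (false ∷ false ∷ h) _ = trans (cong A (trans (⊕-identityˡ _) (⊕-identityˡ _))) (U-avoids (fun E h))
    avoids (true ∷ false ∷ h)  _ = 𝔹ₚ.¬-not (λ p → off-kernel x h (subst (λ w → stab x w ≡ true) (⊕-solve (s ∷ d ∷ fun E h ∷ []) (𝕩₀ ⊹ ((𝕩₀ ⊹ 𝕩₁) ⊹ 𝕩₂)) (𝕩₁ ⊹ 𝕩₂) refl)
      (stab-difference x∉ xs (trans (cong A (trans (cong (x ⊕_) (add ψ (s ⊕ d) (fun E h))) (trans (sym (⊕-assoc x _ _)) (cong (x₁ ⊕_) (sym (⊕-identityˡ _)))))) p))) P⊆X)
    avoids (false ∷ true ∷ h)  _ = 𝔹ₚ.¬-not (λ p → off-kernel y h (subst (λ w → stab y w ≡ true) (⊕-solve (s′ ∷ d ∷ fun E h ∷ []) (𝕩₀ ⊹ ((𝕩₀ ⊹ 𝕩₁) ⊹ 𝕩₂)) (𝕩₁ ⊹ 𝕩₂) refl)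
      (stab-difference y∉ ys (trans (cong A (trans (cong (y ⊕_) (add ψ (s′ ⊕ d) (fun E h))) (trans (sym (⊕-assoc y _ _)) (sym (⊕-identityˡ _))))) p))) Q⊆X)
    avoids (true ∷ true ∷ h)   _ = 𝔹ₚ.¬-not (λ p → off-kernel z h (subst (λ w → stab z w ≡ true)
      (⊕-solve (s ∷ s′ ∷ s″ ∷ fun E h ∷ []) (𝕩₂ ⊹ ((𝕩₀ ⊹ 𝕩₁) ⊹ 𝕩₃)) (((𝕩₀ ⊹ 𝕩₁) ⊹ 𝕩₂) ⊹ 𝕩₃) refl)
      (stab-difference z∉ zs (trans (cong A (in-z h)) p))) R⊆X)
      where
      in-z : ∀ h → z ⊕ fun ψ ((s ⊕ s′) ⊕ fun E h) ≡ x₁ ⊕ (y₁ ⊕ fun ψ (fun E h))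
      in-z h = begin
        z ⊕ fun ψ ((s ⊕ s′) ⊕ fun E h)  ≡⟨ cong (z ⊕_) (trans (add ψ _ _) (cong (_⊕ fun ψ (fun E h)) (add ψ s s′))) ⟩
        z ⊕ ((fun ψ s ⊕ fun ψ s′) ⊕ fun ψ (fun E h))  ≡⟨ cong (_⊕ ((fun ψ s ⊕ fun ψ s′) ⊕ fun ψ (fun E h))) (sym eq) ⟩
        (x ⊕ y) ⊕ ((fun ψ s ⊕ fun ψ s′) ⊕ fun ψ (fun E h))
          ≡⟨ ⊕-solve (x ∷ y ∷ fun ψ s ∷ fun ψ s′ ∷ fun ψ (fun E h) ∷ fun ψ d ∷ []) ((𝕩₀ ⊹ 𝕩₁) ⊹ ((𝕩₂ ⊹ 𝕩₃) ⊹ 𝕩₄)) ((𝕩₀ ⊹ (𝕩₂ ⊹ 𝕩₅)) ⊹ ((𝕩₁ ⊹ (𝕩₃ ⊹ 𝕩₅)) ⊹ 𝕩₄)) refl ⟩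
        (x ⊕ (fun ψ s ⊕ fun ψ d)) ⊕ ((y ⊕ (fun ψ s′ ⊕ fun ψ d)) ⊕ fun ψ (fun E h))
          ≡⟨ cong₂ (λ u v → (x ⊕ u) ⊕ ((y ⊕ v) ⊕ fun ψ (fun E h))) (sym (add ψ s d)) (sym (add ψ s′ d)) ⟩
        x₁ ⊕ (y₁ ⊕ fun ψ (fun E h))  ∎
        where open ≡-Reasoning

  -- Layers by stabiliser size

  size : 𝔽₂^ n → ℕ
  size x = 2 * count (stab x)

  -- The factor 2 in `size` makes level 0 exactly `U`. As `size` is at most `2 ^ suc a`, level
  -- `suc a` is the whole space.
  Low : ℕ → 𝔽₂^ n → Set
  Low i x = x ∈im ψ ⊎ size x ≤ 2 ^ i

  low? : ∀ i x → Dec (Low i x)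
  low? i x = (x ∈im? ψ) ⊎-dec (size x ≤? 2 ^ i)

  Low-suc : ∀ i {x} → Low i x → Low (suc i) x
  Low-suc i (inj₁ p) = inj₁ p
  Low-suc i (inj₂ p) = inj₂ (≤-trans p (^-monoʳ-≤ 2 (n≤1+n i)))

  ≈-∈im : ∀ {x y} → x ∈im ψ → (x ⊕ y) ≈ y
  ≈-∈im {y = y} (u , refl) v = trans (cong (λ w → stab w v) (⊕-comm (fun ψ u) y)) (≈-translate y u v)

  low-size : ∀ i {x} → Out x → Low i x → size x ≤ 2 ^ i
  low-size i x∉ (inj₁ x∈) = contradiction x∈ x∉
  low-size i x∉ (inj₂ le) = le

  -- A level need not be closed under addition, but by `larger-third` a sum larger than both
  -- summands at most doubles the one from level `i`.
  Low-⊕ : ∀ i {x y} → Low i x → Low (suc i) y → Low (suc i) (x ⊕ y)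
  Low-⊕ i {x} {y} lx ly with (x ⊕ y) ∈im? ψ
  ... | yes p = inj₁ p
  ... | no z∉ with x ∈im? ψ | y ∈im? ψ
  ...   | yes x∈ | yes y∈ = inj₁ (∈im-⊕ ψ x∈ y∈)
  ...   | yes x∈ | no y∉ = inj₂ (≤-trans (≤-reflexive (cong (2 *_) (≈-size (≈-∈im x∈)))) (low-size (suc i) y∉ ly))
  ...   | no x∉ | yes y∈ = inj₂ (≤-trans (≤-reflexive (cong (2 *_) (≈-size (λ u → trans (cong (λ w → stab w u) (⊕-comm x y)) (≈-∈im y∈ u)))))
            (low-size (suc i) x∉ (Low-suc i lx)))
  ...   | no x∉ | no y∉ with size (x ⊕ y) ≤? 2 ^ suc i
  ...     | yes p = inj₂ p
  ...     | no ¬p = ⊥-elim (¬p (≤-trans (*-monoʳ-≤ 2 (larger-third (line x∉ y∉ z∉ refl)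
            (*-cancelˡ-<′ 2 (≤-<-trans (low-size (suc i) x∉ (Low-suc i lx)) (≰⇒> ¬p)))
            (*-cancelˡ-<′ 2 (≤-<-trans (low-size (suc i) y∉ ly) (≰⇒> ¬p))))) (*-monoʳ-≤ 2 (low-size i x∉ lx))))

  -- A subspace squeezed between two consecutive levels. It exists because adding a point of the
  -- lower level never leads out of the upper one.
  record Layer (i : ℕ) {y : ℕ} (Ψ : Emb y n) : Set where
    field
      width : ℕ
      ext   : Extension width Ψ
      upper : ∀ x → x ∈im whole ext → Low (suc (suc i)) x
      lower : ∀ x → Low (suc i) x → x ∈im whole ext

  grow : ∀ i {y} {Ψ : Emb y n} fuel {w} (E : Extension w Ψ) → n ≤ fuel + (w + y) →
    (∀ x → x ∈im whole E → Low (suc (suc i)) x) → Layer i Ψ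
  grow i fuel E room upper with ∃? (λ x → low? (suc i) x ×-dec ¬? (x ∈im? whole E))
  ... | no ¬w = record { width = _ ; ext = E ; upper = upper ; lower = λ x lx → decidable-stable (x ∈im? whole E) (λ x∉ → ¬w (x , lx , x∉)) }
  grow i zero       E room upper | yes (x , lx , x∉) = ⊥-elim (<⇒≱ (dim≤ (whole (snocExt E x x∉))) room)
  grow i {y} {Ψ} (suc fuel) {w} E room upper | yes (x , lx , x∉) =
    grow i fuel (snocExt E x x∉) (≤-trans room (≤-reflexive (sym (+-suc fuel (w + y))))) upper′
    where
    upper′ : ∀ v → v ∈im whole (snocExt E x x∉) → Low (suc (suc i)) v
    upper′ v ((true ∷ u)  , refl) = Low-⊕ (suc i) lx (upper _ (u , refl))
    upper′ v ((false ∷ u) , refl) = upper v (u , sym (⊕-identityˡ _))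

  layer : ∀ i {y} (Ψ : Emb y n) → (∀ x → x ∈im Ψ → Low (suc i) x) → Layer i Ψ
  layer i Ψ upper = grow i n (trivialExt Ψ) (m≤m+n n _) (λ x x∈ → Low-suc (suc i) (upper x x∈))

  -- Stabiliser classes within a factor of two in size

  margin : ℕ
  margin = suc (suc (codeLength a))

  module Window (lo : ℕ) where

    Win : 𝔽₂^ n → Set
    Win x = Out x × lo < size x × size x ≤ 2 * lo

    win? : ∀ x → Dec (Win x)
    win? x = ¬? (x ∈im? ψ) ×-dec ((lo <? size x) ×-dec (size x ≤? 2 * lo))

    -- A proper inclusion at least doubles the size, which the window excludes.
    ⊑⇒≈ : ∀ {x y} → Win x → Win y → x ⊑ y → x ≈ y
    ⊑⇒≈ {x} {y} (_ , lo<x , _) (_ , _ , y≤) h with ⊑⊎∖ y x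
    ... | inj₁ h′ = ⊑-antisym h h′
    ... | inj₂ (t , Qt , ¬Pt) = ⊥-elim (<⇒≱ (*-monoʳ-< 2 lo<x)
      (≤-trans (*-monoʳ-≤ 2 (proper-subspace (stab-subspace x) (stab-subspace y) h t Qt ¬Pt)) y≤))

    ∖-of-≉ : ∀ {x y} → Win x → Win y → ¬ x ≈ y → ∃ (x ∖ y)
    ∖-of-≉ {x} {y} wx wy ≉ with ⊑⊎∖ x y
    ... | inj₁ h = contradiction (⊑⇒≈ wx wy h) ≉
    ... | inj₂ d = d

    third-out : ∀ {x y} → ¬ x ≈ y → Out (x ⊕ y)
    third-out {x} {y} ≉ z∈ = ≉ (λ u → trans (cong (λ w → stab w u) (⊕-solve (x ∷ y ∷ []) 𝕩₀ ((𝕩₀ ⊹ 𝕩₁) ⊹ 𝕩₁) refl)) (≈-∈im z∈ u))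

    third : ∀ {x y} (wx : Win x) (wy : Win y) (≉ : ¬ x ≈ y) → Incomparable x y (x ⊕ y)
    third wx wy ≉ = incomparable (line (proj₁ wx) (proj₁ wy) (third-out ≉) refl) (∖-of-≉ wx wy ≉) (∖-of-≉ wy wx (≉ ∘ ≈-sym))

    win-⊕ : ∀ {x y} → Win x → Win y → ¬ x ≈ y → Win (x ⊕ y)
    win-⊕ {x} {y} wx wy ≉ = third-out ≉ , subst (lo <_) eq (proj₁ (proj₂ wx)) , subst (_≤ 2 * lo) eq (proj₂ (proj₂ wx))
      where
      eq : size x ≡ size (x ⊕ y)
      eq = cong (2 *_) (sym (proj₁ (incomparable-size (line (proj₁ wx) (proj₁ wy) (third-out ≉) refl) (∖-of-≉ wx wy ≉) (∖-of-≉ wy wx (≉ ∘ ≈-sym)))))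

    ⊕-≉ˡ : ∀ {x y} → Win x → Win y → ¬ x ≈ y → ¬ (x ⊕ y) ≈ x
    ⊕-≉ˡ wx wy ≉ eq with Incomparable.z∖x (third wx wy ≉)
    ... | t , p , ¬p = true≢false (trans (sym (eq t)) p) ¬p

    ⊕-≉ʳ : ∀ {x y} → Win x → Win y → ¬ x ≈ y → ¬ (x ⊕ y) ≈ y
    ⊕-≉ʳ wx wy ≉ eq with Incomparable.z∖y (third wx wy ≉)
    ... | t , p , ¬p = true≢false (trans (sym (eq t)) p) ¬p

    -- By `Third`, the stabiliser of the sum is determined by the two stabilisers alone.
    ⊕-≈ : ∀ {x y x′ y′} → Win x → Win y → Win x′ → Win y′ → ¬ x ≈ y → x ≈ x′ → y ≈ y′ → (x ⊕ y) ≈ (x′ ⊕ y′)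
    ⊕-≈ {x} {y} {x′} {y′} wx wy wx′ wy′ ≉ ex ey u = bool-ext
      (λ p → third⇐ I′ u (transport ex ey (third⇒ I u p)))
      (λ p → third⇐ I u (transport (≈-sym ex) (≈-sym ey) (third⇒ I′ u p)))
      where
      open Incomparable
      I = third wx wy ≉
      I′ = third wx′ wy′ (λ eq → ≉ (≈-trans ex (≈-trans eq (≈-sym ey))))
      transport : ∀ {x y x′ y′} → x ≈ x′ → y ≈ y′ → Third (stab x) (stab y) u → Third (stab x′) (stab y′) u
      transport ex ey (inj₁ (p , q)) = inj₁ (trans (sym (ex u)) p , trans (sym (ey u)) q)
      transport ex ey (inj₂ (t , t′ , (p , ¬q) , (q′ , ¬p′) , eq)) =
        inj₂ (t , t′ , (trans (sym (ex t)) p , trans (sym (ey t)) ¬q) , (trans (sym (ey t′)) q′ , trans (sym (ex t′)) ¬p′) , eq)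

    -- If there are two classes, then sums of two elements of one class act on the window:
    -- an element of the class of l₁ and l₂ is moved by way of an element y of another class.
    win-translate : ∀ {y₀ y₁ l₁ l₂ x} → Win y₀ → Win y₁ → ¬ y₀ ≈ y₁ → Win l₁ → Win l₂ → l₁ ≈ l₂ → Win x → Win ((x ⊕ l₁) ⊕ l₂)
    win-translate {y₀} {y₁} {l₁} {l₂} {x} wy₀ wy₁ y≉ w₁ w₂ eq wx with x ≈? l₁
    ... | no ≉ = win-⊕ (win-⊕ wx w₁ ≉) w₂ (λ e → ⊕-≉ʳ wx w₁ ≉ (≈-trans e (≈-sym eq)))
    ... | yes x≈ = via (proj₁ other) (proj₁ (proj₂ other)) (proj₂ (proj₂ other))
      where
      other : ∃ λ y → Win y × ¬ y ≈ l₁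
      other with y₀ ≈? l₁
      ... | no ≉  = y₀ , wy₀ , ≉
      ... | yes e = y₁ , wy₁ , λ e′ → y≉ (≈-trans e (≈-sym e′))
      via : ∀ y → Win y → ¬ y ≈ l₁ → Win ((x ⊕ l₁) ⊕ l₂)
      via y wy y≉l = subst Win (⊕-solve (x ∷ y ∷ l₁ ∷ l₂ ∷ []) ((((𝕩₁ ⊹ 𝕩₀) ⊹ 𝕩₂) ⊹ 𝕩₃) ⊹ 𝕩₁) ((𝕩₀ ⊹ 𝕩₂) ⊹ 𝕩₃) refl)
        (win-⊕ wd wy (λ e → ⊕-≉ˡ wc w₂ c≉l₂ (≈-trans e (≈-sym c≈y))))
        where
        y≉x : ¬ y ≈ x
        y≉x e = y≉l (≈-trans e x≈)
        wb : Win (y ⊕ x)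
        wb = win-⊕ wy wx y≉x
        b≉x : ¬ (y ⊕ x) ≈ x
        b≉x = ⊕-≉ʳ wy wx y≉x
        b≉l : ¬ (y ⊕ x) ≈ l₁
        b≉l e = b≉x (≈-trans e (≈-sym x≈))
        wc : Win ((y ⊕ x) ⊕ l₁)
        wc = win-⊕ wb w₁ b≉l
        c≈y : ((y ⊕ x) ⊕ l₁) ≈ y
        c≈y = ≈-trans (⊕-≈ wb w₁ wb wx b≉l (λ _ → refl) (≈-sym x≈)) (λ u → cong (λ w → stab w u) (⊕-cancelʳ y x))
        c≉l₂ : ¬ ((y ⊕ x) ⊕ l₁) ≈ l₂
        c≉l₂ e = y≉l (≈-trans (≈-sym c≈y) (≈-trans e (≈-sym eq)))
        wd : Win (((y ⊕ x) ⊕ l₁) ⊕ l₂)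
        wd = win-⊕ wc w₂ c≉l₂

    module _ {w : ℕ} (W : Emb w n) where

      Avoiding : ℕ → Set
      Avoiding k = Σ (Emb k w) λ κ → ∀ z → ¬ Win (fun W (fun κ z))

      SingleClass : {k : ℕ} → Emb k w → Set
      SingleClass κ = ∀ z z′ → Win (fun W (fun κ z)) → Win (fun W (fun κ z′)) → fun W (fun κ z) ≈ fun W (fun κ z′)

      0∉Win : ¬ Win (fun W 0v)
      0∉Win (out , _) = out (0v , trans (0v-fun ψ) (sym (0v-fun W)))

      module _ {x₀ x₁ : 𝔽₂^ n} (w₀ : Win x₀) (w₁ : Win x₁) (x₀≉x₁ : ¬ x₀ ≈ x₁) where

        -- New directions come from a complement of dimension `margin`. Either one of its cosets
        -- misses the window, or every nonzero `z` hits some class. Codes have one bit fewer than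
        -- `margin`, so two hits have equal classes; translation by their sum preserves the window
        -- and can be adjoined.
        extend : ∀ {k} → Avoiding k → margin + k ≤ w → Avoiding (suc k)
        extend {k} (κ , avoid) le = search
          where
          E = complement κ margin le
          hit : 𝔽₂^ margin → 𝔽₂^ k → 𝔽₂^ n
          hit z y = fun W (new E z ⊕ fun κ y)
          Hit : 𝔽₂^ margin → Set
          Hit z = ∃ λ y → Win (hit z y)
          hit? : ∀ z → Dec (Hit z)
          hit? z = ∃? (λ y → win? (hit z y))
          fresh : ∀ z → z ≢ 0v → ¬ Hit z → Avoiding (suc k)
          fresh z z≢0 ¬h = snoc κ (new E z) (λ y eq → new∉im E z z≢0 (y , eq)) , λ
            { (true ∷ y)  p → ¬h (y , p)
            ; (false ∷ y) p → avoid y (subst (Win ∘ fun W) (⊕-identityˡ _) p) }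
          -- The leading bit keeps zero, which has no hit, apart from all codes of classes.
          coded : (∀ z → z ≢ 0v → Hit z) → ∀ z → Dec (z ≡ 0v) → 𝔽₂^ (suc (codeLength a))
          coded hits z (yes _)  = 0v
          coded hits z (no z≢0) = true ∷ code (stab (hit z (proj₁ (hits z z≢0))))
          clash : (hits : ∀ z → z ≢ 0v → Hit z) → ∀ z z′ (d : Dec (z ≡ 0v)) (d′ : Dec (z′ ≡ 0v)) → z ≢ z′ → coded hits z d ≡ coded hits z′ d′ →
            Σ (Hit z) λ h → Σ (Hit z′) λ h′ → hit z (proj₁ h) ≈ hit z′ (proj₁ h′)
          clash hits z z′ (yes p) (yes p′) z≢ eq = contradiction (trans p (sym p′)) z≢
          clash hits z z′ (yes p) (no _)   z≢ ()
          clash hits z z′ (no _)  (yes _)  z≢ ()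
          clash hits z z′ (no p)  (no p′)  z≢ eq = hits z p , hits z′ p′ , code-injective (stab-subspace (hit z (proj₁ (hits z p)))) (stab-subspace (hit z′ (proj₁ (hits z′ p′)))) (cong tail eq)
          merge : ∀ z z′ → z ≢ z′ → (h : Hit z) (h′ : Hit z′) → hit z (proj₁ h) ≈ hit z′ (proj₁ h′) → Avoiding (suc k)
          merge z z′ z≢ (y , wy) (y′ , wy′) eq = snoc κ p p∉ , λ
            { (true ∷ v)  q → avoid v (subst Win (shuffle v) (win-translate w₀ w₁ x₀≉x₁ wy wy′ eq q))
            ; (false ∷ v) q → avoid v (subst (Win ∘ fun W) (⊕-identityˡ _) q) }
            where
            p = (new E z ⊕ fun κ y) ⊕ (new E z′ ⊕ fun κ y′)
            p≡ : p ≡ new E (z ⊕ z′) ⊕ fun κ (y ⊕ y′)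
            p≡ = trans (⊕-interchange _ _ _ _) (sym (cong₂ _⊕_ (new-add E z z′) (add κ y y′)))
            p∉ : ∀ v → fun κ v ≢ p
            p∉ v e = new∉im E (z ⊕ z′) (λ q → z≢ (⊕≡0⇒≡ q)) (v ⊕ (y ⊕ y′) , trans (add κ v _) (trans (cong (_⊕ fun κ (y ⊕ y′)) (trans e p≡)) (⊕-cancelʳ _ _)))
            shuffle : ∀ v → (fun W (p ⊕ fun κ v) ⊕ hit z y) ⊕ hit z′ y′ ≡ fun W (fun κ v)
            shuffle v = trans (cong (_⊕ hit z′ y′) (sym (add W _ _))) (trans (sym (add W _ _)) (cong (fun W)
              (⊕-solve ((new E z ⊕ fun κ y) ∷ (new E z′ ⊕ fun κ y′) ∷ fun κ v ∷ []) ((((𝕩₀ ⊹ 𝕩₁) ⊹ 𝕩₂) ⊹ 𝕩₀) ⊹ 𝕩₁) 𝕩₂ refl)))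
          from-hits : (∀ z → z ≢ 0v → Hit z) → Avoiding (suc k)
          from-hits hits = merge z z′ z≢ (proj₁ c) (proj₁ (proj₂ c)) (proj₂ (proj₂ c))
            where
            w₂ : ∃ λ z → ∃ λ z′ → z ≢ z′ × coded hits z (z ≟ᵥ 0v) ≡ coded hits z′ (z′ ≟ᵥ 0v)
            w₂ = collision (n<1+n (suc (codeLength a))) (λ z → coded hits z (z ≟ᵥ 0v))
            z = proj₁ w₂
            z′ = proj₁ (proj₂ w₂)
            z≢ = proj₁ (proj₂ (proj₂ w₂))
            c = clash hits z z′ (z ≟ᵥ 0v) (z′ ≟ᵥ 0v) z≢ (proj₂ (proj₂ (proj₂ w₂)))
          go : (Dec (∃ λ z → z ≢ 0v × ¬ Hit z)) → Avoiding (suc k)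
          go (yes (z , z≢0 , ¬h)) = fresh z z≢0 ¬h
          go (no ¬w) = from-hits (λ z z≢0 → decidable-stable (hit? z) (λ ¬h → ¬w (z , z≢0 , ¬h)))
          search : Avoiding (suc k)
          search = go (∃? (λ z → ¬? (z ≟ᵥ 0v) ×-dec ¬? (hit? z)))

        avoiding : ∀ k → k ≡ 0 ⊎ margin + k ≤ suc w → Avoiding k
        avoiding zero    _         = []ₑ , λ { [] → 0∉Win }
        avoiding (suc k) (inj₂ le) = extend (avoiding k (inj₂ (≤-trans le′ (n≤1+n w)))) le′
          where
          le′ : margin + k ≤ w
          le′ = ≤-pred (subst (_≤ suc w) (+-suc margin k) le)

      -- Two classes make `win-translate` available, and a large subspace can then avoid the window
      -- altogether; with at most one class the whole of `W` serves.
      single-class : ∃ λ k → Σ (Emb k w) λ κ → w ≤ margin + k × SingleClass κ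
      single-class with ∃? (λ z → ∃? (λ z′ → win? (fun W z) ×-dec (win? (fun W z′) ×-dec ¬? (fun W z ≈? fun W z′))))
      ... | no ¬w = w , idₑ , m≤n+m w margin , λ z z′ p p′ → decidable-stable (fun W z ≈? fun W z′) (λ ≉ → ¬w (z , z′ , p , p′ , ≉))
      ... | yes (z , z′ , p , p′ , ≉) with avoiding p p′ ≉ (w ∸ margin) bound
        where
        bound : w ∸ margin ≡ 0 ⊎ margin + (w ∸ margin) ≤ suc w
        bound with margin ≤? w
        ... | yes le = inj₂ (≤-trans (≤-reflexive (m+[n∸m]≡n le)) (n≤1+n w))
        ... | no ¬le = inj₁ (m≤n⇒m∸n≡0 (<⇒≤ (≰⇒> ¬le)))
      ...   | κ , avoid = w ∸ margin , κ , m≤n+m∸n w margin , λ z z′ p _ → contradiction p (avoid z)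

  -- Modulo `R` the position of a fibre is additive, because `fibre-defect` puts the sum of three
  -- positions on a line into `R`. Positions chosen on a basis therefore extend to all of the
  -- subspace.
  lift : ∀ k (f : 𝔽₂^ k → 𝔽₂^ n) → Additive f → (∀ z → z ≢ 0v → Out (f z)) →
    {R : 𝔽₂^ a → Bool} → IsSubspace R → (∀ z → z ≢ 0v → ∀ u → stab (f z) u ≡ true → R u ≡ true) →
    ∃ λ ℓ → Additive ℓ × (∀ z → z ≢ 0v → ∀ s → f z ∋ s → R (ℓ z ⊕ s) ≡ true)
  lift zero    f f-add out subR ⊆R = (λ _ → 0v) , (λ _ _ → sym (⊕-self 0v)) , λ { [] z≢0 → contradiction refl z≢0 }
  lift (suc k) f f-add out {R} subR ⊆R = ℓ , ℓ-add , good
    where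
    f₁ : 𝔽₂^ k → 𝔽₂^ n
    f₁ z = f (false ∷ z)
    nz : ∀ {z : 𝔽₂^ k} → z ≢ 0v → false ∷ z ≢ 0v
    nz z≢0 eq = z≢0 (cong tail eq)
    ih = lift k f₁ (λ z z′ → f-add (false ∷ z) (false ∷ z′)) (λ z z≢0 → out _ (nz z≢0)) subR (λ z z≢0 → ⊆R _ (nz z≢0))
    ℓ₁ = proj₁ ih
    e₀ : 𝔽₂^ (suc k)
    e₀ = true ∷ 0v
    e₀≢0 : e₀ ≢ 0v
    e₀≢0 ()
    s₀ = proj₁ (nonempty (f e₀) (out e₀ e₀≢0))
    e₀∋s₀ = proj₂ (nonempty (f e₀) (out e₀ e₀≢0))
    ℓ : 𝔽₂^ (suc k) → 𝔽₂^ a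
    ℓ (b ∷ z) = (b ·ᵥ s₀) ⊕ ℓ₁ z
    ℓ-add : Additive ℓ
    ℓ-add (b ∷ z) (c ∷ z′) = trans (cong₂ _⊕_ (·ᵥ-xor b c s₀) (proj₁ (proj₂ ih) z z′)) (⊕-interchange _ _ _ _)
    good : ∀ z → z ≢ 0v → ∀ s → f z ∋ s → R (ℓ z ⊕ s) ≡ true
    good (false ∷ z) z≢0 s p = trans (cong (λ t → R (t ⊕ s)) (⊕-identityˡ (ℓ₁ z))) (proj₂ (proj₂ ih) z (λ eq → z≢0 (cong (false ∷_) eq)) s p)
    good (true ∷ z)  z≢0 s p with z ≟ᵥ 0v
    ... | yes refl = trans (cong (λ t → R (t ⊕ s)) (trans (cong (s₀ ⊕_) (additive-0v (proj₁ (proj₂ ih)))) (⊕-identityʳ s₀)))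
      (⊆R e₀ e₀≢0 _ (stab-difference (out e₀ e₀≢0) e₀∋s₀ p))
    ... | no z≢0′ = trans (cong R (⊕-solve (s₀ ∷ ℓ₁ z ∷ s ∷ s₁ ∷ []) ((𝕩₀ ⊹ 𝕩₁) ⊹ 𝕩₂) (((𝕩₀ ⊹ 𝕩₃) ⊹ 𝕩₂) ⊹ (𝕩₁ ⊹ 𝕩₃)) refl))
      (closed subR _ _ (fibre-defect (line (out e₀ e₀≢0) (out _ (nz z≢0′)) (out (true ∷ z) z≢0) sum≡) subR (⊆R e₀ e₀≢0) (⊆R _ (nz z≢0′)) (⊆R _ z≢0) e₀∋s₀ (proj₂ w₁) p)
        (proj₂ (proj₂ ih) z z≢0′ s₁ (proj₂ w₁)))
      where
      w₁ = nonempty (f₁ z) (out _ (nz z≢0′))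
      s₁ = proj₁ w₁
      sum≡ : f e₀ ⊕ f₁ z ≡ f (true ∷ z)
      sum≡ = trans (sym (f-add e₀ (false ∷ z))) (cong (λ t → f (true ∷ t)) (⊕-identityˡ z))

  -- All stabilisers are `R`, up to one smaller class. Indices are powers of two, so the bound by 4
  -- means that this class has index at most two.
  record Uniform (i : ℕ) {w : ℕ} (W : Emb w n) : Set where
    open Window (2 ^ i)
    field
      R       : 𝔽₂^ a → Bool
      R-sub   : IsSubspace R
      classes : ∀ z → z ≢ 0v → (∀ u → stab (fun W z) u ≡ R u) ⊎
        (Win (fun W z) × (∀ u → stab (fun W z) u ≡ true → R u ≡ true) × count R < 4 * count (stab (fun W z)))
      single  : ∀ z z′ → Win (fun W z) → Win (fun W z′) → fun W z ≈ fun W z′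

  module _ (i : ℕ) {w : ℕ} (W : Emb w n) (out : ∀ z → z ≢ 0v → Out (fun W z))
    (above : ∀ z → z ≢ 0v → 2 ^ i < size (fun W z)) (below : ∀ z → z ≢ 0v → size (fun W z) ≤ 2 ^ suc (suc i)) where

    private
      module Lo = Window (2 ^ i)
      module Hi = Window (2 ^ suc i)

    low⊎high : ∀ z → z ≢ 0v → Lo.Win (fun W z) ⊎ Hi.Win (fun W z)
    low⊎high z z≢0 with size (fun W z) ≤? 2 ^ suc i
    ... | yes le = inj₁ (out z z≢0 , above z z≢0 , le)
    ... | no ¬le = inj₂ (out z z≢0 , ≰⇒> ¬le , below z z≢0)

    -- `R` is the class of the upper window if that is met. Points of the lower window then have
    -- smaller stabilisers, comparable to `R` by `incomparable-size`, and the total range of sizes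
    -- keeps the index below 4.
    uniform : (∀ z z′ → Lo.Win (fun W z) → Lo.Win (fun W z′) → fun W z ≈ fun W z′) →
      (∀ z z′ → Hi.Win (fun W z) → Hi.Win (fun W z′) → fun W z ≈ fun W z′) → Uniform i W
    uniform low-single high-single with ∃? (λ z → Hi.win? (fun W z))
    ... | yes (h , wh) = record { R = stab (fun W h) ; R-sub = stab-subspace _ ; classes = classes ; single = low-single }
      where
      classes : ∀ z → z ≢ 0v → (∀ u → stab (fun W z) u ≡ stab (fun W h) u) ⊎
        (Lo.Win (fun W z) × (∀ u → stab (fun W z) u ≡ true → stab (fun W h) u ≡ true) × count (stab (fun W h)) < 4 * count (stab (fun W z)))
      classes z z≢0 with low⊎high z z≢0
      ... | inj₂ wz = inj₁ (high-single z h wz wh)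
      ... | inj₁ wz = inj₂ (wz , below-high , *-cancelˡ-<′ 2 (begin-strict
        size (fun W h)  ≤⟨ proj₂ (proj₂ wh) ⟩
        2 * (2 * 2 ^ i)  ≡⟨ *-assoc 2 2 (2 ^ i) ⟨
        4 * 2 ^ i  <⟨ *-monoʳ-< 4 (proj₁ (proj₂ wz)) ⟩
        4 * (2 * count (stab (fun W z)))  ≡⟨ *-swap 4 2 (count (stab (fun W z))) ⟩
        2 * (4 * count (stab (fun W z)))  ∎))
        where
        open ≤-Reasoning
        smaller : count (stab (fun W z)) < count (stab (fun W h))
        smaller = *-cancelˡ-<′ 2 (≤-<-trans (proj₂ (proj₂ wz)) (proj₁ (proj₂ wh)))
        z≢h : z ≢ h
        z≢h refl = <-irrefl refl smaller
        below-high : fun W z ⊑ fun W h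
        below-high with ⊑⊎∖ (fun W z) (fun W h) | ⊑⊎∖ (fun W h) (fun W z)
        ... | inj₁ p | _      = p
        ... | inj₂ _ | inj₁ p = ⊥-elim (<⇒≱ smaller (⊆⇒count≤ p))
        ... | inj₂ d | inj₂ d′ = ⊥-elim (<⇒≢ smaller (sym (proj₂ (incomparable-size
          (line (proj₁ wz) (proj₁ wh) (subst Out (add W z h) (out (z ⊕ h) (λ eq → z≢h (⊕≡0⇒≡ eq)))) refl) d d′))))
    ... | no ¬high with ∃? (λ z → Lo.win? (fun W z))
    ...   | yes (l , wl) = record { R = stab (fun W l) ; R-sub = stab-subspace _ ; classes = classes ; single = low-single }
      where
      classes : ∀ z → z ≢ 0v → (∀ u → stab (fun W z) u ≡ stab (fun W l) u) ⊎ _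
      classes z z≢0 with low⊎high z z≢0
      ... | inj₁ wz = inj₁ (low-single z l wz wl)
      ... | inj₂ wz = contradiction (z , wz) ¬high
    -- Every nonzero vector would lie in one of the windows, so `W` has dimension 0 and `stab 0v` is
    -- a default value.
    ...   | no ¬low = record { R = stab 0v ; R-sub = stab-subspace _ ; classes = classes ; single = low-single }
      where
      classes : ∀ z → z ≢ 0v → (∀ u → stab (fun W z) u ≡ stab 0v u) ⊎ _
      classes z z≢0 with low⊎high z z≢0
      ... | inj₁ wz = contradiction (z , wz) ¬low
      ... | inj₂ wz = contradiction (z , wz) ¬high

  InFlat : Emb k n → Set
  InFlat F = ∀ y → y ≢ 0v → A (fun F y) ≡ true

  record LiftedFlat {w : ℕ} (W : Emb w n) : Set where
    field
      dim   : ℕ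
      flat  : Emb dim n
      in-A  : InFlat flat
      over  : ∀ y → ∃ λ z → ∃ λ u → (y ≢ 0v → z ≢ 0v) × fun flat y ≡ fun W z ⊕ fun ψ u
      bound : w ≤ flatConstant * (128 * dim ^ 7 + 1)

  -- Lift W along ℓ with ℓ z in (fibre over W z) ⊕ R.  A triangle of the complement of A
  -- consists of points with the smaller stabiliser P; there the lifts differ from the
  -- fibres by the nonzero class of R / P, and three such classes do not sum to zero.
  uniform-flat : ∀ i {w} (W : Emb w n) → (∀ z → z ≢ 0v → Out (fun W z)) → Uniform i W → LiftedFlat W
  uniform-flat i {w} W out unif = record
    { dim = proj₁ found ; flat = θ ∘ₑ κ ; in-A = in-A
    ; over = λ y → fun κ y , ℓ (fun κ y) , (λ y≢0 eq → y≢0 (ker κ y eq)) , refl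
    ; bound = proj₁ (proj₂ found) }
    where
    open Window (2 ^ i)
    open Uniform unif
    St⊆R : ∀ z → z ≢ 0v → ∀ u → stab (fun W z) u ≡ true → R u ≡ true
    St⊆R z z≢0 u p with classes z z≢0
    ... | inj₁ eq            = trans (sym (eq u)) p
    ... | inj₂ (_ , sub , _) = sub u p
    lifted = lift w (fun W) (add W) out R-sub St⊆R
    ℓ = proj₁ lifted
    ℓ-add = proj₁ (proj₂ lifted)
    ℓ-R = proj₂ (proj₂ lifted)
    θ : Emb w n
    θ = record
      { fun = λ z → fun W z ⊕ fun ψ (ℓ z)
      ; add = λ z z′ → trans (cong₂ _⊕_ (add W z z′) (trans (cong (fun ψ) (ℓ-add z z′)) (add ψ _ _))) (⊕-interchange _ _ _ _)
      ; ker = λ z eq → decidable-stable (z ≟ᵥ 0v) (λ z≢0 → out z z≢0 (ℓ z , sym (⊕≡0⇒≡ eq)))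
      }
    B : 𝔽₂^ w → Bool
    B z = not ⌊ z ≟ᵥ 0v ⌋ ∧ not (A (fun θ z))
    B⇒ : ∀ z → B z ≡ true → z ≢ 0v × A (fun θ z) ≡ false
    B⇒ z p with z ≟ᵥ 0v
    ... | no z≢0 = z≢0 , not-true⁻ p
    ¬B⇒ : ∀ z → z ≢ 0v → B z ≡ false → A (fun θ z) ≡ true
    ¬B⇒ z z≢0 p with z ≟ᵥ 0v
    ... | yes eq = contradiction eq z≢0
    ... | no _   = not-false⁻ p
      where
      not-false⁻ : ∀ {b} → not b ≡ false → b ≡ true
      not-false⁻ {true} _ = refl
    record Off (z : 𝔽₂^ w) : Set where
      field
        s    : 𝔽₂^ a
        W∋s  : fun W z ∋ s
        win  : Win (fun W z)
        sub  : ∀ u → stab (fun W z) u ≡ true → R u ≡ true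
        few  : count R < 4 * count (stab (fun W z))
        in-R : R (ℓ z ⊕ s) ≡ true
        off  : stab (fun W z) (ℓ z ⊕ s) ≡ false
    -- The lift is correct modulo `R`, so it can miss the fibre only where the stabiliser is smaller
    -- than `R`.
    off : ∀ z → z ≢ 0v → A (fun θ z) ≡ false → Off z
    off z z≢0 A≡f = by-class (classes z z≢0)
      where
      s = proj₁ (nonempty (fun W z) (out z z≢0))
      W∋s = proj₂ (nonempty (fun W z) (out z z≢0))
      in-R : R (ℓ z ⊕ s) ≡ true
      in-R = ℓ-R z z≢0 s W∋s
      ¬st : stab (fun W z) (ℓ z ⊕ s) ≡ false
      ¬st = 𝔹ₚ.¬-not (λ p → true≢false (trans (cong (λ w → A (fun W z ⊕ fun ψ w)) (⊕-solve (ℓ z ∷ s ∷ []) 𝕩₀ (𝕩₁ ⊹ (𝕩₀ ⊹ 𝕩₁)) refl)) (∋-stab W∋s p)) A≡f)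
      by-class : _ → Off z
      by-class (inj₁ eq) = true≢false (trans (eq (ℓ z ⊕ s)) in-R) ¬st
      by-class (inj₂ (win , sub , few)) = record { s = s ; W∋s = W∋s ; win = win ; sub = sub ; few = few ; in-R = in-R ; off = ¬st }
    tf : TriangleFree B
    tf z z′ Bz Bz′ = 𝔹ₚ.¬-not no-triangle
      where
      no-triangle : B (z ⊕ z′) ≢ true
      no-triangle Bz″ = true≢false P-last (Off.off o″)
        where
        o = off z (proj₁ (B⇒ z Bz)) (proj₂ (B⇒ z Bz))
        o′ = off z′ (proj₁ (B⇒ z′ Bz′)) (proj₂ (B⇒ z′ Bz′))
        o″ = off (z ⊕ z′) (proj₁ (B⇒ _ Bz″)) (proj₂ (B⇒ _ Bz″))
        P = stab (fun W (z ⊕ z′))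
        P≡ : ∀ u → stab (fun W z) u ≡ P u
        P≡ = single z (z ⊕ z′) (Off.win o) (Off.win o″)
        P≡′ : ∀ u → stab (fun W z′) u ≡ P u
        P≡′ = single z′ (z ⊕ z′) (Off.win o′) (Off.win o″)
        defect : P ((Off.s o ⊕ Off.s o′) ⊕ Off.s o″) ≡ true
        defect = fibre-defect (line (out z (proj₁ (B⇒ z Bz))) (out z′ (proj₁ (B⇒ z′ Bz′))) (out _ (proj₁ (B⇒ _ Bz″))) (sym (add W z z′)))
          {P} (stab-subspace (fun W (z ⊕ z′))) (λ u p → trans (sym (P≡ u)) p) (λ u p → trans (sym (P≡′ u)) p) (λ _ p → p) (Off.W∋s o) (Off.W∋s o′) (Off.W∋s o″)
        pair : P ((ℓ z ⊕ Off.s o) ⊕ (ℓ z′ ⊕ Off.s o′)) ≡ true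
        pair = index-two {P = P} {R} (stab-subspace (fun W (z ⊕ z′))) R-sub (Off.sub o″) (Off.few o″) (ℓ z ⊕ Off.s o) (ℓ z′ ⊕ Off.s o′)
          (Off.in-R o) (trans (sym (P≡ (ℓ z ⊕ Off.s o))) (Off.off o)) (Off.in-R o′) (trans (sym (P≡′ (ℓ z′ ⊕ Off.s o′))) (Off.off o′))
        P-last : P (ℓ (z ⊕ z′) ⊕ Off.s o″) ≡ true
        P-last = subst (λ v → P v ≡ true)
          (trans (⊕-solve (ℓ z ∷ ℓ z′ ∷ Off.s o ∷ Off.s o′ ∷ Off.s o″ ∷ []) (((𝕩₀ ⊹ 𝕩₂) ⊹ (𝕩₁ ⊹ 𝕩₃)) ⊹ ((𝕩₂ ⊹ 𝕩₃) ⊹ 𝕩₄)) ((𝕩₀ ⊹ 𝕩₁) ⊹ 𝕩₄) refl)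
            (cong (_⊕ Off.s o″) (sym (ℓ-add z z′))))
          (closed (stab-subspace (fun W (z ⊕ z′))) _ _ pair defect)
    found = triangle-free-root w B tf
    κ = proj₁ (proj₂ (proj₂ found))
    in-A : InFlat (θ ∘ₑ κ)
    in-A y y≢0 = ¬B⇒ (fun κ y) (λ eq → y≢0 (ker κ y eq)) (proj₂ (proj₂ (proj₂ found)) y y≢0)

  record LayerFlat (i : ℕ) {y : ℕ} {Ψ : Emb y n} (L : Layer i Ψ) : Set where
    open Layer L
    field
      dim   : ℕ
      flat  : Emb dim n
      in-A  : InFlat flat
      above : ∀ u → u ≢ 0v → ¬ fun flat u ∈im Ψ
      below : ∀ u → fun flat u ∈im whole ext
      bound : width ≤ flatConstant * (128 * dim ^ 7 + 1) + 2 * margin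

  -- Two windows cover the sizes occurring in a layer. Reducing each to one class costs `margin`
  -- dimensions, and what remains is uniform.
  layer-flat : ∀ i {y} {Ψ : Emb y n} (L : Layer i Ψ) → (∀ x → Low i x → x ∈im Ψ) → LayerFlat i L
  layer-flat i {y} {Ψ} L low = record
    { dim = dim ; flat = flat ; in-A = in-A
    ; above = λ u u≢0 u∈ → new∉im ext _ (λ eq → proj₁ (proj₂ (proj₂ (over u))) u≢0 (ker κ _ eq))
        (subst (_∈im Ψ) (trans (cong (_⊕ fun ψ (proj₁ (proj₂ (over u)))) (proj₂ (proj₂ (proj₂ (over u))))) (⊕-cancelʳ _ _)) (∈im-⊕ Ψ u∈ (U∈ (proj₁ (proj₂ (over u))))))
    ; below = λ u → subst (_∈im whole ext) (sym (proj₂ (proj₂ (proj₂ (over u))))) (∈im-⊕ (whole ext) (_ , refl) (lower _ (inj₁ (_ , refl))))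
    ; bound = begin
        width  ≤⟨ w≤₁ ⟩
        margin + k₁  ≤⟨ +-monoʳ-≤ margin (≤-trans w≤₂ (+-monoʳ-≤ margin bound)) ⟩
        margin + (margin + flatConstant * (128 * dim ^ 7 + 1))  ≡⟨ lem margin (flatConstant * (128 * dim ^ 7 + 1)) ⟩
        flatConstant * (128 * dim ^ 7 + 1) + 2 * margin  ∎
    }
    where
    open ≤-Reasoning
    lem : ∀ m f → m + (m + f) ≡ f + 2 * m
    lem = solve-∀
    open Layer L
    W : Emb width n
    W = newₑ ext
    U∈ : ∀ u → fun ψ u ∈im Ψ
    U∈ u = low _ (inj₁ (u , refl))
    ¬low : ∀ z → z ≢ 0v → ¬ Low i (fun W z)
    ¬low z z≢0 p = new∉im ext z z≢0 (low _ p)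
    out : ∀ z → z ≢ 0v → Out (fun W z)
    out z z≢0 p = ¬low z z≢0 (inj₁ p)
    first = Window.single-class (2 ^ i) W
    k₁ = proj₁ first
    κ₁ = proj₁ (proj₂ first)
    w≤₁ = proj₁ (proj₂ (proj₂ first))
    second = Window.single-class (2 ^ suc i) (W ∘ₑ κ₁)
    κ₂ = proj₁ (proj₂ second)
    w≤₂ = proj₁ (proj₂ (proj₂ second))
    κ = κ₁ ∘ₑ κ₂
    W″ = W ∘ₑ κ
    κ≢0 : ∀ z → z ≢ 0v → fun κ z ≢ 0v
    κ≢0 z z≢0 eq = z≢0 (ker κ z eq)
    unif : Uniform i W″
    unif = uniform i W″ (λ z z≢0 → out _ (κ≢0 z z≢0))
      (λ z z≢0 → ≰⇒> (λ le → ¬low _ (κ≢0 z z≢0) (inj₂ le)))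
      (λ z z≢0 → low-size (suc (suc i)) (out _ (κ≢0 z z≢0)) (upper _ (_ , refl)))
      (λ z z′ → proj₂ (proj₂ (proj₂ first)) (fun κ₂ z) (fun κ₂ z′))
      (proj₂ (proj₂ (proj₂ second)))
    open LiftedFlat (uniform-flat i W″ (λ z z≢0 → out _ (κ≢0 z z≢0)) unif)

  -- Accumulating flats over the layers

  slack : ℕ
  slack = flatConstant + 2 * margin

  -- Consecutive layers overlap in size, so a new flat can join only the flat from two layers back.
  -- That is `F₁`, whose points are at level `i`, strictly below everything outside `Ψ`; `F₂`
  -- contains the latest layer and waits one turn.
  record State (i : ℕ) : Set where
    field
      {dimΨ t₁ t₂} : ℕ
      Ψ      : Emb dimΨ n
      lower  : ∀ x → Low i x → x ∈im Ψ
      upper  : ∀ x → x ∈im Ψ → Low (suc i) x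
      F₁     : Emb t₁ n
      F₁-A   : InFlat F₁
      F₁-Ψ   : ∀ u → fun F₁ u ∈im Ψ
      F₁-low : ∀ u → Low i (fun F₁ u)
      F₂     : Emb t₂ n
      F₂-A   : InFlat F₂
      F₂-Ψ   : ∀ u → fun F₂ u ∈im Ψ
      bound  : dimΨ ≤ a + (flatConstant * 128) * (t₁ ^ 7 + t₂ ^ 7) + i * slack

  initial : State 0
  initial = record
    { Ψ = ψ
    ; lower = λ { x (inj₁ p) → p ; x (inj₂ p) → ⊥-elim (<⇒≱ (positive x) p) }
    ; upper = λ x p → inj₁ p
    ; F₁ = []ₑ ; F₁-A = trivial ; F₁-Ψ = λ _ → 0v , 0v-fun ψ ; F₁-low = λ _ → inj₁ (0v , 0v-fun ψ)
    ; F₂ = []ₑ ; F₂-A = trivial ; F₂-Ψ = λ _ → 0v , 0v-fun ψ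
    ; bound = ≤-trans (m≤m+n a _) (m≤m+n _ _)
    }
    where
    trivial : InFlat []ₑ
    trivial [] y≢0 = contradiction refl y≢0
    positive : ∀ x → 1 < size x
    positive x = *-monoʳ-≤ 2 (≤-trans (≤-reflexive (cong ι (sym (has-0 (stab-subspace x))))) (sum-ge-term 0v (ι ∘ stab x)))

  step-with : ∀ i (st : State i) (L : Layer i (State.Ψ st)) → LayerFlat i L → State (suc i)
  step-with i st L G = record
    { Ψ = whole ext ; lower = Layer.lower L ; upper = Layer.upper L
    ; F₁ = F₂ ; F₁-A = F₂-A ; F₁-Ψ = λ u → extend∈ (F₂-Ψ u) ; F₁-low = λ u → upper (fun F₂ u) (F₂-Ψ u)
    ; F₂ = proj₁ H ; F₂-A = H-A ; F₂-Ψ = H-Ψ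
    ; bound = begin
        width + dimΨ
          ≤⟨ +-mono-≤ (LayerFlat.bound G) bound ⟩
        c * (128 * t ^ 7 + 1) + 2 * margin + (a + c * 128 * (t₁ ^ 7 + t₂ ^ 7) + i * slack)
          ≡⟨ lem₁ c 128 (t ^ 7) (2 * margin) a (t₁ ^ 7) (t₂ ^ 7) (i * slack) ⟩
        a + c * 128 * (t₂ ^ 7 + (t ^ 7 + t₁ ^ 7)) + (slack + i * slack)
          ≤⟨ +-monoˡ-≤ (slack + i * slack) (+-monoʳ-≤ a (*-monoʳ-≤ (c * 128) (+-monoʳ-≤ (t₂ ^ 7) (+-^7 t t₁)))) ⟩
        a + c * 128 * (t₂ ^ 7 + (t + t₁) ^ 7) + suc i * slack  ∎
    }
    where
    open ≤-Reasoning
    open State st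
    c = flatConstant
    lem₁ : ∀ c d t m a u v s → c * (d * t + 1) + m + (a + c * d * (u + v) + s) ≡ a + c * d * (v + (t + u)) + (c + m + s)
    lem₁ = solve-∀
    open Layer L using (width; ext)
    open LayerFlat G using (flat; in-A; above; below) renaming (dim to t)
    extend∈ : ∀ {x} → x ∈im Ψ → x ∈im whole ext
    extend∈ (u , refl) = _ , restrict ext u
    H = sumₑ flat F₁ (λ z y z≢0 eq → above z z≢0 (subst (_∈im Ψ) (sym eq) (F₁-Ψ y)))
    H-Ψ : ∀ v → fun (proj₁ H) v ∈im whole ext
    H-Ψ v = subst (λ v → fun (proj₁ H) v ∈im whole ext) (sym v≡) (subst (_∈im whole ext) (sym (proj₂ H z y)) (∈im-⊕ (whole ext) (below z) (extend∈ (F₁-Ψ y))))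
      where
      z = proj₁ (⧺-surj t v)
      y = proj₁ (proj₂ (⧺-surj t v))
      v≡ : v ≡ z ⧺ y
      v≡ = proj₂ (proj₂ (⧺-surj t v))
    not-in-U : ∀ {x} → A x ≡ true → Out x
    not-in-U Ax (u , refl) = true≢false Ax (U-avoids u)
    -- Both points sit in `A` at fibre position zero. The one from `F₁` has the strictly smallest
    -- stabiliser on the line, so the line is full and the sum is again in `A` at position zero.
    sum-in-A : ∀ z y → z ≢ 0v → y ≢ 0v → A (fun flat z ⊕ fun F₁ y) ≡ true
    sum-in-A z y z≢0 y≢0 = trans (cong A (sym (trans (cong (λ w → (x ⊕ f) ⊕ w) (trans (cong (fun ψ) (⊕-self 0v)) (0v-fun ψ))) (trans (⊕-identityʳ _) (⊕-comm x f)))))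
      (sum-of-smaller (line x-out (λ p → ¬low f∉ (inj₁ p)) (λ p → ¬low xf∉ (inj₁ p)) refl) (smaller f∉) (smaller xf∉) 0v 0v (at-0 (F₁-A y y≢0)) (at-0 (in-A z z≢0)))
      where
      x = fun F₁ y
      f = fun flat z
      x-out : Out x
      x-out = not-in-U (F₁-A y y≢0)
      f∉ : ¬ f ∈im Ψ
      f∉ = above z z≢0
      xf∉ : ¬ (x ⊕ f) ∈im Ψ
      xf∉ p = f∉ (subst (_∈im Ψ) (⊕-cancelˡ x f) (∈im-⊕ Ψ (F₁-Ψ y) p))
      ¬low : ∀ {v} → ¬ v ∈im Ψ → ¬ Low i v
      ¬low v∉ p = v∉ (lower _ p)
      smaller : ∀ {v} → ¬ v ∈im Ψ → count (stab x) < count (stab v)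
      smaller v∉ = *-cancelˡ-<′ 2 (≤-<-trans (low-size i x-out (F₁-low y)) (≰⇒> (λ le → ¬low v∉ (inj₂ le))))
      at-0 : ∀ {v} → A v ≡ true → v ∋ 0v
      at-0 {v} p = trans (cong A (trans (cong (v ⊕_) (0v-fun ψ)) (⊕-identityʳ v))) p
    H-⧺ : ∀ z y → z ⧺ y ≢ 0v → A (fun flat z ⊕ fun F₁ y) ≡ true
    H-⧺ z y zy≢0 with z ≟ᵥ 0v | y ≟ᵥ 0v
    ... | yes refl | yes refl = contradiction (0v⧺0v t) zy≢0
    ... | yes refl | no y≢0   = trans (cong A (trans (cong (_⊕ fun F₁ y) (0v-fun flat)) (⊕-identityˡ _))) (F₁-A y y≢0)
    ... | no z≢0   | yes refl = trans (cong A (trans (cong (fun flat z ⊕_) (0v-fun F₁)) (⊕-identityʳ _))) (in-A z z≢0)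
    ... | no z≢0   | no y≢0   = sum-in-A z y z≢0 y≢0
    H-A : InFlat (proj₁ H)
    H-A v v≢0 = subst (λ v → A (fun (proj₁ H) v) ≡ true) (sym v≡) (trans (cong A (proj₂ H z y)) (H-⧺ z y (λ eq → v≢0 (trans v≡ eq))))
      where
      z = proj₁ (⧺-surj t v)
      y = proj₁ (proj₂ (⧺-surj t v))
      v≡ : v ≡ z ⧺ y
      v≡ = proj₂ (proj₂ (⧺-surj t v))

  step : ∀ i → State i → State (suc i)
  step i st = step-with i st L (layer-flat i L (State.lower st))
    where L = layer i (State.Ψ st) (State.upper st)

  states : ∀ i → State i
  states zero    = initial
  states (suc i) = step i (states i)

  conclusion : ∃ λ t₁ → ∃ λ t₂ → Σ (Emb t₁ n) InFlat × Σ (Emb t₂ n) InFlat ×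
    n ≤ a + (flatConstant * 128) * (t₁ ^ 7 + t₂ ^ 7) + suc a * slack
  conclusion = t₁ , t₂ , (F₁ , F₁-A) , (F₂ , F₂-A) , ≤-trans (surjective⇒≤ Ψ (λ x → lower x (inj₂ (*-monoʳ-≤ 2 (count≤ (stab x)))))) bound
    where open State (states (suc a))

-- Colourings

isZero : Fin 2 → Bool
isZero zero       = true
isZero (suc zero) = false

isZero-true : ∀ f → isZero f ≡ true → f ≡ zero
isZero-true zero       _ = refl
isZero-true (suc zero) ()

isZero-false : ∀ f → isZero f ≡ false → f ≡ suc zero
isZero-false (suc zero) _ = refl

≢zero : ∀ (f : Fin 2) → f ≢ zero → f ≡ suc zero
≢zero zero       h = contradiction refl h
≢zero (suc zero) h = refl

-- The value of a colouring at 0v is junk, so 0v is excluded explicitly.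
colourOne : Colouring n → 𝔽₂^ n → Bool
colourOne c x = not ⌊ x ≟ᵥ 0v ⌋ ∧ isZero (c x)

colourOne-0v : (c : Colouring n) → colourOne c 0v ≡ false
colourOne-0v {n} c with 0v {n} ≟ᵥ 0v
... | yes _ = refl
... | no h  = contradiction refl h

colourOne⇒ : (c : Colouring n) {x : 𝔽₂^ n} → colourOne c x ≡ true → x ≢ 0v × c x ≡ zero
colourOne⇒ c {x} p with x ≟ᵥ 0v
... | no x≢0 = x≢0 , isZero-true (c x) p

colourOne-false : (c : Colouring n) {x : 𝔽₂^ n} → x ≢ 0v → colourOne c x ≡ false → c x ≡ suc zero
colourOne-false c {x} x≢0 p with x ≟ᵥ 0v
... | yes eq = contradiction eq x≢0
... | no _   = isZero-false (c x) p

linₑ : (v : Fin k → 𝔽₂^ n) → InjLin v → Emb k n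
linₑ v inj-v = record { fun = lin v ; add = lin-⊕ v ; ker = λ x eq → inj-v (trans eq (sym (lin-0v v))) }

emb-mono : (c : Colouring n) (ψ : Emb k n) (col : Fin 2) → (∀ y → y ≢ 0v → c (fun ψ y) ≡ col) → HasMonoFlat c k
emb-mono c ψ col mono = fun ψ ∘ unit
  , (λ {x} {y} eq → inj ψ x y (trans (sym (additive-≡lin (add ψ) x)) (trans eq (additive-≡lin (add ψ) y))))
  , col , λ x x≢0 → trans (cong c (additive-≡lin (add ψ) x)) (mono x x≢0)

columns : 𝔽₂^ n → 𝔽₂^ n → 𝔽₂^ n → Fin 3 → 𝔽₂^ n
columns x y z zero             = x
columns x y z (suc zero)       = y
columns x y z (suc (suc zero)) = z

module Claw (c : Colouring n) (x y z : 𝔽₂^ n)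
  (Ax : colourOne c x ≡ true) (Ay : colourOne c y ≡ true) (Az : colourOne c z ≡ true)
  (x≢y : x ≢ y) (x≢z : x ≢ z) (y≢z : y ≢ z) (xy≢z : x ⊕ y ≢ z)
  (¬xy : colourOne c (x ⊕ y) ≡ false) (¬xz : colourOne c (x ⊕ z) ≡ false)
  (¬yz : colourOne c (y ⊕ z) ≡ false) (¬xyz : colourOne c ((x ⊕ y) ⊕ z) ≡ false) where

  p : Fin 3 → 𝔽₂^ n
  p = columns x y z

  -- Nonvanishing is recorded with the colour, so that the injectivity of the columns comes out of
  -- the same case analysis.
  Colour : 𝔽₂^ 3 → Set
  Colour w = lin p w ≢ 0v ×
    ((∃ λ i → w ≡ unit i × c (lin p w) ≡ zero) ⊎ ((∀ i → w ≢ unit i) × c (lin p w) ≡ suc zero))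

  private
    point : ∀ {v w} i → w ≡ unit i → lin p w ≡ v → colourOne c v ≡ true → Colour w
    point {v} i w≡ eq Av = (λ e → proj₁ (colourOne⇒ c Av) (trans (sym eq) e)) , inj₁ (i , w≡ , trans (cong c eq) (proj₂ (colourOne⇒ c Av)))
    other : ∀ {v w} → (∀ i → w ≢ unit i) → lin p w ≡ v → v ≢ 0v → colourOne c v ≡ false → Colour w
    other {v} w≢ eq v≢0 Av = (λ e → v≢0 (trans (sym eq) e)) , inj₂ (w≢ , trans (cong c eq) (colourOne-false c v≢0 Av))

  colour : ∀ w → w ≢ 0v → Colour w
  colour (false ∷ false ∷ false ∷ []) w≢0 = contradiction refl w≢0
  colour (true ∷ false ∷ false ∷ []) _ = point zero refl (lin-unit p zero) Ax
  colour (false ∷ true ∷ false ∷ []) _ = point (suc zero) refl (lin-unit p (suc zero)) Ay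
  colour (false ∷ false ∷ true ∷ []) _ = point (suc (suc zero)) refl (lin-unit p (suc (suc zero))) Az
  colour (true ∷ true ∷ false ∷ []) _ = other (λ { zero () ; (suc zero) () ; (suc (suc zero)) () })
    (⊕-solve (x ∷ y ∷ z ∷ []) (𝕩₀ ⊹ (𝕩₁ ⊹ (‵0 ⊹ ‵0))) (𝕩₀ ⊹ 𝕩₁) refl) (λ e → x≢y (⊕≡0⇒≡ e)) ¬xy
  colour (true ∷ false ∷ true ∷ []) _ = other (λ { zero () ; (suc zero) () ; (suc (suc zero)) () })
    (⊕-solve (x ∷ y ∷ z ∷ []) (𝕩₀ ⊹ (‵0 ⊹ (𝕩₂ ⊹ ‵0))) (𝕩₀ ⊹ 𝕩₂) refl) (λ e → x≢z (⊕≡0⇒≡ e)) ¬xz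
  colour (false ∷ true ∷ true ∷ []) _ = other (λ { zero () ; (suc zero) () ; (suc (suc zero)) () })
    (⊕-solve (x ∷ y ∷ z ∷ []) (‵0 ⊹ (𝕩₁ ⊹ (𝕩₂ ⊹ ‵0))) (𝕩₁ ⊹ 𝕩₂) refl) (λ e → y≢z (⊕≡0⇒≡ e)) ¬yz
  colour (true ∷ true ∷ true ∷ []) _ = other (λ { zero () ; (suc zero) () ; (suc (suc zero)) () })
    (⊕-solve (x ∷ y ∷ z ∷ []) (𝕩₀ ⊹ (𝕩₁ ⊹ (𝕩₂ ⊹ ‵0))) ((𝕩₀ ⊹ 𝕩₁) ⊹ 𝕩₂) refl) (λ e → xy≢z (⊕≡0⇒≡ e)) ¬xyz

  pₑ : Emb 3 n
  pₑ = record { fun = lin p ; add = lin-⊕ p ; ker = λ w eq → decidable-stable (w ≟ᵥ 0v) (λ w≢0 → proj₁ (colour w w≢0) eq) }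

  -- The basis of `ĉ` is arbitrary; composing with the inverse of its matrix carries it to the three
  -- columns.
  contains : (ĉ : Colouring 3) → IsBasisColouring ĉ → Contains c ĉ
  contains ĉ (b , inj-b , iff) = fun ψ ∘ unit
    , (λ {u} {v} eq → inj ψ u v (trans (sym (ψ≡ u)) (trans eq (ψ≡ v))))
    , λ v v≢0 → trans (cong c (ψ≡ v)) (matches v v≢0)
    where
    bₑ : Emb 3 3
    bₑ = linₑ b inj-b
    g : 𝔽₂^ 3 → 𝔽₂^ 3
    g v = proj₁ (square-surjective bₑ v)
    bg : ∀ v → lin b (g v) ≡ v
    bg v = proj₂ (square-surjective bₑ v)
    gₑ : Emb 3 3
    gₑ = record
      { fun = g
      ; add = λ u v → inj-b (trans (bg (u ⊕ v)) (sym (trans (lin-⊕ b (g u) (g v)) (cong₂ _⊕_ (bg u) (bg v)))))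
      ; ker = λ v eq → trans (sym (bg v)) (trans (cong (lin b) eq) (lin-0v b))
      }
    ψ : Emb 3 n
    ψ = pₑ ∘ₑ gₑ
    ψ≡ : ∀ v → lin (fun ψ ∘ unit) v ≡ fun ψ v
    ψ≡ = additive-≡lin (add ψ)
    matches : ∀ v → v ≢ 0v → c (lin p (g v)) ≡ ĉ v
    matches v v≢0 with proj₂ (colour (g v) (λ eq → v≢0 (ker gₑ v eq)))
    ... | inj₁ (i , gv≡ , c≡) = trans c≡ (sym (Equivalence.from (iff v v≢0) (i , trans (sym (bg v)) (trans (cong (lin b) gv≡) (lin-unit b i)))))
    ... | inj₂ (gv≢ , c≡) = trans c≡ (sym (≢zero (ĉ v) (λ ĉ≡ → not-basis (Equivalence.to (iff v v≢0) ĉ≡))))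
      where
      not-basis : (∃ λ i → v ≡ b i) → ⊥
      not-basis (i , v≡) = gv≢ i (inj-b (trans (bg v) (trans v≡ (sym (lin-unit b i)))))

maximal-flat : (A : 𝔽₂^ n → Bool) → ∃ λ a → Flat A a × ¬ Flat A (suc a)
maximal-flat {n} A = search n 0 (≤-reflexive (sym (+-identityʳ n))) ([]ₑ , λ { [] y≢0 → contradiction refl y≢0 })
  where
  search : ∀ fuel a → n ≤ fuel + a → Flat A a → ∃ λ a → Flat A a × ¬ Flat A (suc a)
  search fuel a room F with flat? A (suc a)
  ... | no ¬F = a , F , ¬F
  search zero       a room F | yes F′ = ⊥-elim (<⇒≱ (dim≤ (proj₁ F′)) room)
  search (suc fuel) a room F | yes F′ = search fuel (suc a) (≤-trans room (≤-reflexive (sym (+-suc fuel a)))) F′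

HasMonoFlat-⊔ : (c : Colouring n) (i j : ℕ) → HasMonoFlat c i → HasMonoFlat c j → HasMonoFlat c (i ⊔ j)
HasMonoFlat-⊔ c i j F G with ⊔-sel i j
... | inj₁ eq = subst (HasMonoFlat c) (sym eq) F
... | inj₂ eq = subst (HasMonoFlat c) (sym eq) G

-- Guarantees a flat of dimension 1, so that additive constants can be absorbed into `k ^ 7`.
point-flat : (c : Colouring (suc n)) → HasMonoFlat c 1
point-flat c = emb-mono c ψ (c (fun ψ (true ∷ []))) λ { (true ∷ []) _ → refl ; (false ∷ []) y≢0 → contradiction refl y≢0 }
  where
  ψ : Emb 1 (suc _)
  ψ = snoc []ₑ (true ∷ 0v) (λ { [] () })

codeLength≤ : ∀ a → codeLength a ≤ a * a
codeLength≤ zero    = z≤n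
codeLength≤ (suc a) = ≤-trans (+-monoʳ-≤ (suc a) (codeLength≤ a)) (≤-trans (m≤m+n _ a) (≤-reflexive (lem a)))
  where
  lem : ∀ a → suc a + a * a + a ≡ suc a * suc a
  lem = solve-∀

-- The loss over all layers is of order a³, and `a` is at most `k`, so it is dominated by `k ^ 7`.
final-bound : ∀ F n k a t₁ t₂ → 1 ≤ k → a ≤ k → t₁ ≤ k → t₂ ≤ k →
  n ≤ a + (F * 128) * (t₁ ^ 7 + t₂ ^ 7) + suc a * (F + 2 * (2 + codeLength a)) →
  n ≤ (1 + F * 128 * 2 + 2 * (F + 6)) * k ^ 7
final-bound F n k a t₁ t₂ k≥1 a≤k t₁≤k t₂≤k le = begin
  n  ≤⟨ le ⟩
  a + (F * 128) * (t₁ ^ 7 + t₂ ^ 7) + suc a * (F + 2 * (2 + codeLength a))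
    ≤⟨ +-mono-≤ (+-mono-≤ (≤-trans a≤k k≤K) (*-monoʳ-≤ (F * 128) (+-mono-≤ (^-monoˡ-≤ 7 t₁≤k) (^-monoˡ-≤ 7 t₂≤k)))) last ⟩
  K + (F * 128) * (K + K) + 2 * (F + 6) * K
    ≡⟨ lem (F * 128) K (2 * (F + 6)) ⟩
  (1 + F * 128 * 2 + 2 * (F + 6)) * K  ∎
  where
  open ≤-Reasoning
  K = k ^ 7
  lem : ∀ f k g → k + f * (k + k) + g * k ≡ (1 + f * 2 + g) * k
  lem = solve-∀
  k≤K : k ≤ K
  k≤K = m≤m*n k (k ^ 6) {{>-nonZero (^-pos 6 k≥1)}}
  kk≥1 : 1 ≤ k * k
  kk≥1 = *-mono-≤ k≥1 k≥1
  inner : F + 2 * (2 + codeLength a) ≤ (F + 6) * (k * k)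
  inner = begin
    F + 2 * (2 + codeLength a)  ≤⟨ +-monoʳ-≤ F (*-monoʳ-≤ 2 (+-monoʳ-≤ 2 (≤-trans (codeLength≤ a) (*-mono-≤ a≤k a≤k)))) ⟩
    F + 2 * (2 + k * k)  ≡⟨ lem₁ F (k * k) ⟩
    (F + 4) * 1 + 2 * (k * k)  ≤⟨ +-monoˡ-≤ (2 * (k * k)) (*-monoʳ-≤ (F + 4) kk≥1) ⟩
    (F + 4) * (k * k) + 2 * (k * k) ≡⟨ lem₂ F (k * k) ⟩
    (F + 6) * (k * k)  ∎
    where
    lem₁ : ∀ f s → f + 2 * (2 + s) ≡ (f + 4) * 1 + 2 * s
    lem₁ = solve-∀
    lem₂ : ∀ f s → (f + 4) * s + 2 * s ≡ (f + 6) * s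
    lem₂ = solve-∀
  cube : k * (k * k) ≤ K
  cube = ≤-trans (≤-reflexive (cong (λ t → k * (k * t)) (sym (*-identityʳ k)))) (^-monoʳ-≤ k {{>-nonZero k≥1}} {3} {7} (s≤s (s≤s (s≤s z≤n))))
  last : suc a * (F + 2 * (2 + codeLength a)) ≤ 2 * (F + 6) * K
  last = begin
    suc a * (F + 2 * (2 + codeLength a))  ≤⟨ *-mono-≤ (+-mono-≤ k≥1 a≤k) inner ⟩
    (k + k) * ((F + 6) * (k * k))  ≡⟨ lem₃ k (F + 6) ⟩
    2 * (F + 6) * (k * (k * k))  ≤⟨ *-monoʳ-≤ (2 * (F + 6)) cube ⟩
    2 * (F + 6) * K  ∎
    where
    lem₃ : ∀ k f → (k + k) * (f * (k * k)) ≡ 2 * f * (k * (k * k))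
    lem₃ = solve-∀

constant : ℕ
constant = 1 + flatConstant * 128 * 2 + 2 * (flatConstant + 6)

largest-flat : (c : Colouring n) (a t₁ t₂ : ℕ) →
  HasMonoFlat c 1 → HasMonoFlat c a → HasMonoFlat c t₁ → HasMonoFlat c t₂ →
  n ≤ a + (flatConstant * 128) * (t₁ ^ 7 + t₂ ^ 7) + suc a * (flatConstant + 2 * (2 + codeLength a)) →
  ∃ λ k → n ≤ constant * k ^ 7 × HasMonoFlat c k
largest-flat {n} c a t₁ t₂ G₀ G G₁ G₂ le = d , final-bound flatConstant n d a t₁ t₂ (m≤m⊔n 1 t₀)
    (≤-trans (m≤m⊔n a (t₁ ⊔ t₂)) (m≤n⊔m 1 t₀))
    (≤-trans (≤-trans (m≤m⊔n t₁ t₂) (m≤n⊔m a (t₁ ⊔ t₂))) (m≤n⊔m 1 t₀))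
    (≤-trans (≤-trans (m≤n⊔m t₁ t₂) (m≤n⊔m a (t₁ ⊔ t₂))) (m≤n⊔m 1 t₀)) le
  , HasMonoFlat-⊔ c 1 t₀ G₀ (HasMonoFlat-⊔ c a (t₁ ⊔ t₂) G (HasMonoFlat-⊔ c t₁ t₂ G₁ G₂))
  where
  t₀ = a ⊔ (t₁ ⊔ t₂)
  d = 1 ⊔ t₀

colourOne-claw-free : (ĉ : Colouring 3) → IsBasisColouring ĉ → (c : Colouring n) → ¬ Contains c ĉ → ClawFreeSet (colourOne c)
colourOne-claw-free ĉ basis c free x y z Ax Ay Az x≢y x≢z y≢z xy≢z =
  by-colour (true? (A (x ⊕ y))) (true? (A (x ⊕ z))) (true? (A (y ⊕ z))) (true? (A ((x ⊕ y) ⊕ z)))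
  where
  A = colourOne c
  by-colour : A (x ⊕ y) ≡ true ⊎ A (x ⊕ y) ≡ false → A (x ⊕ z) ≡ true ⊎ A (x ⊕ z) ≡ false →
    A (y ⊕ z) ≡ true ⊎ A (y ⊕ z) ≡ false → A ((x ⊕ y) ⊕ z) ≡ true ⊎ A ((x ⊕ y) ⊕ z) ≡ false →
    A (x ⊕ y) ≡ true ⊎ A (x ⊕ z) ≡ true ⊎ A (y ⊕ z) ≡ true ⊎ A ((x ⊕ y) ⊕ z) ≡ true
  by-colour (inj₁ p) _ _ _ = inj₁ p
  by-colour (inj₂ _) (inj₁ p) _ _ = inj₂ (inj₁ p)
  by-colour (inj₂ _) (inj₂ _) (inj₁ p) _ = inj₂ (inj₂ (inj₁ p))
  by-colour (inj₂ _) (inj₂ _) (inj₂ _) (inj₁ p) = inj₂ (inj₂ (inj₂ p))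
  by-colour (inj₂ ¬xy) (inj₂ ¬xz) (inj₂ ¬yz) (inj₂ ¬xyz) =
    ⊥-elim (free (Claw.contains c x y z Ax Ay Az x≢y x≢z y≢z xy≢z ¬xy ¬xz ¬yz ¬xyz ĉ basis))

mono-flat-from : (c : Colouring (suc n)) → ClawFreeSet (colourOne c) → ∀ {a} (F : Flat (colourOne c) a) → ¬ Flat (colourOne c) (suc a) →
  ∃ λ k → suc n ≤ constant * k ^ 7 × HasMonoFlat c k
mono-flat-from {n} c claw-free {a} (ψ , ψ-avoids) maximal = finish Ch.conclusion
  where
  module Ch = ClawFree (colourOne c) (colourOne-0v c) claw-free ψ ψ-avoids maximal
  flat-two : HasMonoFlat c a
  flat-two = emb-mono c ψ (suc zero) (λ y y≢0 → colourOne-false c (λ eq → y≢0 (ker ψ y eq)) (ψ-avoids y y≢0))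
  flat-one : ∀ {t} → Σ (Emb t (suc n)) Ch.InFlat → HasMonoFlat c t
  flat-one (F , in-A) = emb-mono c F zero (λ y y≢0 → proj₂ (colourOne⇒ c (in-A y y≢0)))
  finish : (∃ λ t₁ → ∃ λ t₂ → Σ (Emb t₁ (suc n)) Ch.InFlat × Σ (Emb t₂ (suc n)) Ch.InFlat ×
    suc n ≤ a + (flatConstant * 128) * (t₁ ^ 7 + t₂ ^ 7) + suc a * Ch.slack) → ∃ λ k → suc n ≤ constant * k ^ 7 × HasMonoFlat c k
  finish (t₁ , t₂ , F₁ , F₂ , le) = largest-flat c a t₁ t₂ (point-flat c) flat-two (flat-one F₁) (flat-one F₂) le

claw-free-mono-flat : (ĉ : Colouring 3) → IsBasisColouring ĉ → (n : ℕ) (c : Colouring n) → ¬ Contains c ĉ →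
  ∃ λ k → n ≤ constant * k ^ 7 × HasMonoFlat c k
claw-free-mono-flat ĉ basis zero    c free = 0 , z≤n , emb-mono c []ₑ zero (λ { [] y≢0 → contradiction refl y≢0 })
claw-free-mono-flat ĉ basis (suc n) c free =
  mono-flat-from c (colourOne-claw-free ĉ basis c free) (proj₁ (proj₂ (maximal-flat (colourOne c)))) (proj₂ (proj₂ (maximal-flat (colourOne c))))

theorem11p4 : (ĉ : Colouring 3) → IsBasisColouring ĉ →
    Σ ℕ λ p → Σ ℕ λ q → 1 ≤ p × 1 ≤ q ×
    ((n : ℕ) (c : Colouring n) → ¬ Contains c ĉ →
    ∃ λ k → p * n ≤ q * k ^ 7 × HasMonoFlat c k)
-- `p` and `q` encode C = (p / q)^(1/7); the values chosen do not depend on `ĉ`.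
theorem11p4 ĉ basis = 1 , constant , s≤s z≤n , s≤s z≤n , λ n c free → rescale n c (claw-free-mono-flat ĉ basis n c free)
  where
  rescale : ∀ n c → (∃ λ k → n ≤ constant * k ^ 7 × HasMonoFlat c k) → ∃ λ k → 1 * n ≤ constant * k ^ 7 × HasMonoFlat c k
  rescale n c (k , le , F) = k , ≤-trans (≤-reflexive (*-identityˡ n)) le , F
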